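{- Let $\epsilon>0$, let $a$ be a positive integer, and let $G$ be a finite abelian group whose exponent divides $a$. There exist constants $K,c>0$, depending only on $a$, $\epsilon$ and $G$, such that for every $n$ and every $\epsilon$-balanced random digraph $\Gamma(n)$ on $[n]$, \[\Big|\mathbb{E}\big(\#\mathrm{Sur}(S(\Gamma(n)),G)\big)-\frac{1}{|G|}\Big|\le K e^{ -cn}.\]
   Context: Digraphs may have multiple edges (and loops). $\deg(i,j)$ is the number of edges from $i$ to $j$, and $\mathrm{outdeg}(i)$ is the number of edges leaving $i$. A random variable $y$ in a ring $T$ is $\epsilon$-balanced if for every maximal ideal $\mathfrak p$ of $T$ and every $r\in T/\mathfrak p$, $\mathbb{P}(y\equiv r\bmod\mathfrak p)\le1-\epsilon$. A random digraph on $[n]$ is $\epsilon$-balanced if the $\deg(i,j)$ for ordered pairs $i\ne j$ are independent $\epsilon$-balanced random variables in $\mathbb{Z}$. The Laplacian $L$ has entries $L_{ij}=-\deg(j,i)$ for $i\ne j$ and $L_{jj}=\mathrm{outdeg}(j)-\deg(j,j)$, so its columns sum to $0$. The total sandpile group is $S(\Gamma)=\mathbb{Z}^n_0/L\mathbb{Z}^n$, where $\mathbb{Z}^n_0$ is the subgroup of $\mathbb{Z}^n$ of vectors with entry sum $0$. $\mathrm{Sur}(A,B)$ denotes the set of surjective homomorphisms $A\to B$. -}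

module Defs where

open import Algebra.Bundles using (AbelianGroup; CommutativeRing)
open import Algebra.Morphism.Structures using (module GroupMorphisms)
import Algebra.Properties.CommutativeMonoid.Sum as CMSum
open import Data.Bool.Base using (Bool; true; false; if_then_else_)
open import Data.Fin.Base using (Fin; zero; suc)
import Data.Fin.Properties as Fin
open import Data.Integer.Base as ℤ using (ℤ; +_)
import Data.Integer.Properties as ℤ
open import Data.Integer.Tactic.RingSolver using (solve-∀)
open import Data.List.Base using (List; map; foldr; filter; cartesianProduct; allFin)
open import Data.Bool.ListAction using (all)
open import Data.Nat.Base as ℕ using (ℕ; zero; suc; NonZero; _!)
import Data.Nat.Properties as ℕ

open import Data.Product using (∃-syntax; _×_; _,_; proj₁; proj₂)
open import Data.Rational.Base as ℚ using (ℚ; 0ℚ; 1ℚ; ½)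
import Data.Rational.Properties as ℚ
import Data.Rational.Unnormalised.Base as ℚᵘ
import Data.Rational.Unnormalised.Properties as ℚᵘ
open import Data.Rational.Solver using (module +-*-Solver)
open import Data.Sum.Base using (_⊎_; inj₁; inj₂)
open import Data.Vec.Functional using (Vector)
open import Function.Base using (_∘_; const)
open import Function.Bundles using (Inverse)
open import Function.Definitions using (Surjective)
open import Level using (Level; _⊔_; 0ℓ) renaming (suc to lsuc)
open import Relation.Binary.Bundles using (Setoid)
open import Relation.Binary.PropositionalEquality as ≡
  using (_≡_; _≢_; refl; sym; trans; cong; cong₂; subst)
open import Relation.Nullary using (¬_; yes; no; does; ¬?)
open import Relation.Unary using (Pred; Decidable)

private
  variable
    a b c ℓ ℓ₁ ℓ₂ : Level
    n : ℕ

IsCauchy : (ℕ → ℚ) → Set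
IsCauchy s = ∀ ε → 0ℚ ℚ.< ε →
  ∃[ N ] (∀ m n → N ℕ.≤ m → N ℕ.≤ n → ℚ.∣ s m ℚ.- s n ∣ ℚ.≤ ε)

record ℝ : Set where
  constructor mkℝ
  field
    seq    : ℕ → ℚ
    cauchy : IsCauchy seq

open ℝ public

infix  4 _≤ᴿ_ _<ᴿ_ _≈ᴿ_
infixl 6 _+ᴿ_ _-ᴿ_
infixl 7 _*ᴿ_
infixr 8 _^ᴿ_
infix  8 -ᴿ_

_≤ᴿ_ : ℝ → ℝ → Set
x ≤ᴿ y = ∀ ε → 0ℚ ℚ.< ε → ∃[ N ] (∀ n → N ℕ.≤ n → seq x n ℚ.≤ seq y n ℚ.+ ε)

_<ᴿ_ : ℝ → ℝ → Set
x <ᴿ y = ∃[ ε ] 0ℚ ℚ.< ε × ∃[ N ] (∀ n → N ℕ.≤ n → seq x n ℚ.+ ε ℚ.≤ seq y n)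

_≈ᴿ_ : ℝ → ℝ → Set
x ≈ᴿ y = x ≤ᴿ y × y ≤ᴿ x

module QS = +-*-Solver

half : ℚ → ℚ
half ε = ½ ℚ.* ε

half>0 : ∀ {ε} → 0ℚ ℚ.< ε → 0ℚ ℚ.< half ε
half>0 {ε} ε>0 = ℚ.*-monoʳ-<-pos ½ ε>0

half+half : ∀ ε → half ε ℚ.+ half ε ≡ ε
half+half = QS.solve 1 (λ e → QS.con ½ QS.:* e QS.:+ QS.con ½ QS.:* e QS.:= e) refl

+-mono-half : ∀ {p q} ε → p ℚ.≤ half ε → q ℚ.≤ half ε → p ℚ.+ q ℚ.≤ ε
+-mono-half ε p≤ q≤ = ℚ.≤-trans (ℚ.+-mono-≤ p≤ q≤) (ℚ.≤-reflexive (half+half ε))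

∣-∣-flip : ∀ p q → ℚ.∣ p ℚ.- q ∣ ≡ ℚ.∣ q ℚ.- p ∣
∣-∣-flip p q = trans (sym (ℚ.∣-p∣≡∣p∣ (p ℚ.- q))) (cong ℚ.∣_∣
  (QS.solve 2 (λ x y → QS.:- (x QS.:- y) QS.:= y QS.:- x) refl p q))

p≤∣p∣ : ∀ p → p ℚ.≤ ℚ.∣ p ∣
p≤∣p∣ p with ℚ.≤-total 0ℚ p
... | inj₁ 0≤p = ℚ.≤-reflexive (sym (ℚ.0≤p⇒∣p∣≡p 0≤p))
... | inj₂ p≤0 = ℚ.≤-trans p≤0 (ℚ.0≤∣p∣ p)

∣p∣≤ : ∀ {p q} → p ℚ.≤ q → ℚ.- p ℚ.≤ q → ℚ.∣ p ∣ ℚ.≤ q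
∣p∣≤ {p} p≤q -p≤q with ℚ.∣p∣≡p∨∣p∣≡-p p
... | inj₁ eq = ℚ.≤-trans (ℚ.≤-reflexive eq) p≤q
... | inj₂ eq = ℚ.≤-trans (ℚ.≤-reflexive eq) -p≤q

triangle : ∀ p q r → ℚ.∣ p ℚ.- r ∣ ℚ.≤ ℚ.∣ p ℚ.- q ∣ ℚ.+ ℚ.∣ q ℚ.- r ∣
triangle p q r = ℚ.≤-trans (ℚ.≤-reflexive (cong ℚ.∣_∣
    (QS.solve 3 (λ x y z → x QS.:- z QS.:= (x QS.:- y) QS.:+ (y QS.:- z)) refl p q r)))
  (ℚ.∣p+q∣≤∣p∣+∣q∣ (p ℚ.- q) (q ℚ.- r))

∣∣p∣-∣q∣∣≤ : ∀ p q → ℚ.∣ ℚ.∣ p ∣ ℚ.- ℚ.∣ q ∣ ∣ ℚ.≤ ℚ.∣ p ℚ.- q ∣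
∣∣p∣-∣q∣∣≤ p q = ∣p∣≤ (lem p q)
  (ℚ.≤-trans (ℚ.≤-reflexive (QS.solve 2 (λ x y → QS.:- (x QS.:- y) QS.:= y QS.:- x) refl ℚ.∣ p ∣ ℚ.∣ q ∣))
    (ℚ.≤-trans (lem q p) (ℚ.≤-reflexive (∣-∣-flip q p))))
  where
  lem : ∀ p q → ℚ.∣ p ∣ ℚ.- ℚ.∣ q ∣ ℚ.≤ ℚ.∣ p ℚ.- q ∣
  lem p q = ℚ.≤-trans
    (ℚ.+-monoˡ-≤ (ℚ.- ℚ.∣ q ∣)
      (ℚ.≤-trans (ℚ.≤-reflexive (cong ℚ.∣_∣
          (QS.solve 2 (λ x y → x QS.:= (x QS.:- y) QS.:+ y) refl p q)))
        (ℚ.∣p+q∣≤∣p∣+∣q∣ (p ℚ.- q) q)))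
    (ℚ.≤-reflexive (QS.solve 2 (λ x y → (x QS.:+ y) QS.:- y QS.:= x) refl ℚ.∣ p ℚ.- q ∣ ℚ.∣ q ∣))

fromℚ : ℚ → ℝ
fromℚ q = mkℝ (const q) λ ε ε>0 → 0 , λ _ _ _ _ →
  ℚ.≤-trans (ℚ.≤-reflexive (cong ℚ.∣_∣ (ℚ.+-inverseʳ q))) (ℚ.<⇒≤ ε>0)

fromℕ : ℕ → ℝ
fromℕ k = fromℚ (+ k ℚ./ 1)

0ᴿ 1ᴿ : ℝ
0ᴿ = fromℚ 0ℚ
1ᴿ = fromℚ 1ℚ

abstract
  +-cauchy : ∀ x y → IsCauchy (λ n → seq x n ℚ.+ seq y n)
  +-cauchy x y ε ε>0 =
    let (M , hx) = cauchy x (half ε) (half>0 ε>0)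
        (N , hy) = cauchy y (half ε) (half>0 ε>0)
    in M ℕ.⊔ N , λ m n ≤m ≤n → ℚ.≤-trans
      (ℚ.≤-trans
        (ℚ.≤-reflexive (cong ℚ.∣_∣ (QS.solve 4
          (λ a b c d → (a QS.:+ b) QS.:- (c QS.:+ d) QS.:= (a QS.:- c) QS.:+ (b QS.:- d))
          refl (seq x m) (seq y m) (seq x n) (seq y n))))
        (ℚ.∣p+q∣≤∣p∣+∣q∣ (seq x m ℚ.- seq x n) (seq y m ℚ.- seq y n)))
      (+-mono-half ε
        (hx m n (ℕ.m⊔n≤o⇒m≤o M N ≤m) (ℕ.m⊔n≤o⇒m≤o M N ≤n))
        (hy m n (ℕ.m⊔n≤o⇒n≤o M N ≤m) (ℕ.m⊔n≤o⇒n≤o M N ≤n)))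

_+ᴿ_ : ℝ → ℝ → ℝ
x +ᴿ y = mkℝ (λ n → seq x n ℚ.+ seq y n) (+-cauchy x y)

abstract
  neg-cauchy : ∀ x → IsCauchy (λ n → ℚ.- seq x n)
  neg-cauchy x ε ε>0 =
    let (N , h) = cauchy x ε ε>0
    in N , λ m n ≤m ≤n → ℚ.≤-trans
      (ℚ.≤-reflexive (trans
        (cong ℚ.∣_∣ (QS.solve 2 (λ a b → QS.:- a QS.:- (QS.:- b) QS.:= b QS.:- a)
          refl (seq x m) (seq x n)))
        (∣-∣-flip (seq x n) (seq x m))))
      (h m n ≤m ≤n)

-ᴿ_ : ℝ → ℝ
-ᴿ x = mkℝ (λ n → ℚ.- seq x n) (neg-cauchy x)

_-ᴿ_ : ℝ → ℝ → ℝ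
x -ᴿ y = x +ᴿ (-ᴿ y)

abstract
  ∣∣-cauchy : ∀ x → IsCauchy (λ n → ℚ.∣ seq x n ∣)
  ∣∣-cauchy x ε ε>0 =
    let (N , h) = cauchy x ε ε>0
    in N , λ m n ≤m ≤n → ℚ.≤-trans (∣∣p∣-∣q∣∣≤ (seq x m) (seq x n)) (h m n ≤m ≤n)

∣_∣ᴿ : ℝ → ℝ
∣ x ∣ᴿ = mkℝ (λ n → ℚ.∣ seq x n ∣) (∣∣-cauchy x)

eventuallyBounded : ∀ x → ∃[ B ] ℚ.Positive B × ∃[ N ] (∀ n → N ℕ.≤ n → ℚ.∣ seq x n ∣ ℚ.≤ B)
eventuallyBounded x =
  let (N , h) = cauchy x 1ℚ (ℚ.positive⁻¹ 1ℚ)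
      B = ℚ.∣ seq x N ∣ ℚ.+ 1ℚ
  in B , ℚ.nonNeg+pos⇒pos ℚ.∣ seq x N ∣ {{ℚ.∣-∣-nonNeg (seq x N)}} 1ℚ , N , λ n N≤n →
    ℚ.≤-trans
      (ℚ.≤-trans
        (ℚ.≤-reflexive (cong ℚ.∣_∣ (QS.solve 2 (λ a b → a QS.:= b QS.:+ (a QS.:- b))
          refl (seq x n) (seq x N))))
        (ℚ.∣p+q∣≤∣p∣+∣q∣ (seq x N) (seq x n ℚ.- seq x N)))
      (ℚ.+-monoʳ-≤ ℚ.∣ seq x N ∣ (h n N N≤n ℕ.≤-refl))

scaled : ∀ {ε} → 0ℚ ℚ.< ε → ∀ B → ℚ.Positive B → ∃[ δ ] 0ℚ ℚ.< δ × (B ℚ.* δ ≡ ε)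
scaled {ε} ε>0 B B>0 = 1/B ℚ.* ε
    , subst (ℚ._< 1/B ℚ.* ε) (ℚ.*-zeroʳ 1/B) (ℚ.*-monoʳ-<-pos 1/B {{ℚ.1/pos⇒pos B {{B>0}}}} ε>0)
    , trans (sym (ℚ.*-assoc B 1/B ε))
        (trans (cong (ℚ._* ε) (ℚ.*-inverseʳ B {{nz}})) (ℚ.*-identityˡ ε))
  where
  nz = ℚ.pos⇒nonZero B {{B>0}}
  1/B = (ℚ.1/ B) {{nz}}

*-mono-∣∣ : ∀ {p q B δ} → ℚ.Positive B → ℚ.∣ p ∣ ℚ.≤ B → ℚ.∣ q ∣ ℚ.≤ δ → ℚ.∣ p ℚ.* q ∣ ℚ.≤ B ℚ.* δ
*-mono-∣∣ {p} {q} {B} B>0 p≤ q≤ = ℚ.≤-trans (ℚ.≤-reflexive (ℚ.∣p*q∣≡∣p∣*∣q∣ p q))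
  (ℚ.≤-trans (ℚ.*-monoʳ-≤-nonNeg ℚ.∣ q ∣ {{ℚ.∣-∣-nonNeg q}} p≤)
    (ℚ.*-monoˡ-≤-nonNeg B {{ℚ.pos⇒nonNeg B {{B>0}}}} q≤))

abstract
  *-cauchy : ∀ x y → IsCauchy (λ n → seq x n ℚ.* seq y n)
  *-cauchy x y ε ε>0 =
    let (A , A>0 , M₁ , hA) = eventuallyBounded x
        (B , B>0 , N₁ , hB) = eventuallyBounded y
        (δ , δ>0 , Aδ) = scaled (half>0 ε>0) A A>0
        (η , η>0 , Bη) = scaled (half>0 ε>0) B B>0
        (M₂ , hx) = cauchy x η η>0
        (N₂ , hy) = cauchy y δ δ>0
        M = M₁ ℕ.⊔ M₂
        N = N₁ ℕ.⊔ N₂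
    in M ℕ.⊔ N , λ m n ≤m ≤n →
      let M≤m = ℕ.m⊔n≤o⇒m≤o M N ≤m
          N≤m = ℕ.m⊔n≤o⇒n≤o M N ≤m
          M≤n = ℕ.m⊔n≤o⇒m≤o M N ≤n
          N≤n = ℕ.m⊔n≤o⇒n≤o M N ≤n
      in ℚ.≤-trans
        (ℚ.≤-trans
          (ℚ.≤-reflexive (cong ℚ.∣_∣ (QS.solve 4
            (λ a b c d → (a QS.:* b) QS.:- (c QS.:* d)
                         QS.:= a QS.:* (b QS.:- d) QS.:+ d QS.:* (a QS.:- c))
            refl (seq x m) (seq y m) (seq x n) (seq y n))))
          (ℚ.∣p+q∣≤∣p∣+∣q∣ (seq x m ℚ.* (seq y m ℚ.- seq y n)) (seq y n ℚ.* (seq x m ℚ.- seq x n))))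
        (+-mono-half ε
          (ℚ.≤-trans (*-mono-∣∣ A>0 (hA m (ℕ.m⊔n≤o⇒m≤o M₁ M₂ M≤m))
              (hy m n (ℕ.m⊔n≤o⇒n≤o N₁ N₂ N≤m) (ℕ.m⊔n≤o⇒n≤o N₁ N₂ N≤n)))
            (ℚ.≤-reflexive Aδ))
          (ℚ.≤-trans (*-mono-∣∣ B>0 (hB n (ℕ.m⊔n≤o⇒m≤o N₁ N₂ N≤n))
              (hx m n (ℕ.m⊔n≤o⇒n≤o M₁ M₂ M≤m) (ℕ.m⊔n≤o⇒n≤o M₁ M₂ M≤n)))
            (ℚ.≤-reflexive Bη)))

_*ᴿ_ : ℝ → ℝ → ℝ
x *ᴿ y = mkℝ (λ n → seq x n ℚ.* seq y n) (*-cauchy x y)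

_^ᴿ_ : ℝ → ℕ → ℝ
x ^ᴿ zero  = 1ᴿ
x ^ᴿ suc k = x *ᴿ x ^ᴿ k

pointwise⇒≤ᴿ : ∀ {x y} → (∀ n → seq x n ℚ.≤ seq y n) → x ≤ᴿ y
pointwise⇒≤ᴿ {x} {y} h ε ε>0 = 0 , λ n _ → ℚ.≤-trans (h n)
  (ℚ.≤-trans (ℚ.≤-reflexive (sym (ℚ.+-identityʳ (seq y n)))) (ℚ.+-monoʳ-≤ (seq y n) (ℚ.<⇒≤ ε>0)))

≤ᴿ-trans : ∀ {x y z} → x ≤ᴿ y → y ≤ᴿ z → x ≤ᴿ z
≤ᴿ-trans {x} {y} {z} x≤y y≤z ε ε>0 =
  let (M , hx) = x≤y (half ε) (half>0 ε>0)
      (N , hy) = y≤z (half ε) (half>0 ε>0)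
  in M ℕ.⊔ N , λ n ≤n → ℚ.≤-trans (hx n (ℕ.m⊔n≤o⇒m≤o M N ≤n))
       (ℚ.≤-trans (ℚ.+-monoˡ-≤ (half ε) (hy n (ℕ.m⊔n≤o⇒n≤o M N ≤n)))
         (ℚ.≤-reflexive (trans (ℚ.+-assoc (seq z n) (half ε) (half ε)) (cong (seq z n ℚ.+_) (half+half ε)))))

+ᴿ-mono-≤ : ∀ {x y u v} → x ≤ᴿ y → u ≤ᴿ v → x +ᴿ u ≤ᴿ y +ᴿ v
+ᴿ-mono-≤ {x} {y} {u} {v} x≤y u≤v ε ε>0 =
  let (M , hx) = x≤y (half ε) (half>0 ε>0)
      (N , hu) = u≤v (half ε) (half>0 ε>0)
  in M ℕ.⊔ N , λ n ≤n → ℚ.≤-trans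
       (ℚ.+-mono-≤ (hx n (ℕ.m⊔n≤o⇒m≤o M N ≤n)) (hu n (ℕ.m⊔n≤o⇒n≤o M N ≤n)))
       (ℚ.≤-reflexive (trans
         (QS.solve 3 (λ a b e → (a QS.:+ e) QS.:+ (b QS.:+ e) QS.:= (a QS.:+ b) QS.:+ (e QS.:+ e))
           refl (seq y n) (seq v n) (half ε))
         (cong ((seq y n ℚ.+ seq v n) ℚ.+_) (half+half ε))))

∣∣ᴿ-of-nonNeg : ∀ {x} → 0ᴿ ≤ᴿ x → ∣ x ∣ᴿ ≤ᴿ x
∣∣ᴿ-of-nonNeg {x} 0≤x ε ε>0 =
  let (N , h) = 0≤x (half ε) (half>0 ε>0)
  in N , λ n N≤n →
    let s = seq x n
        0≤s+½ε = h n N≤n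
    in ∣p∣≤
      (ℚ.≤-trans (ℚ.≤-reflexive (sym (ℚ.+-identityʳ s))) (ℚ.+-monoʳ-≤ s (ℚ.<⇒≤ ε>0)))
      (ℚ.≤-trans (ℚ.≤-reflexive (sym (ℚ.+-identityʳ (ℚ.- s))))
        (ℚ.≤-trans (ℚ.+-monoʳ-≤ (ℚ.- s) (ℚ.+-mono-≤ 0≤s+½ε 0≤s+½ε))
          (ℚ.≤-reflexive (QS.solve 2
            (λ a e → QS.:- a QS.:+ ((a QS.:+ QS.con ½ QS.:* e) QS.:+ (a QS.:+ QS.con ½ QS.:* e))
                     QS.:= a QS.:+ e) refl s ε))))

ConvergesTo : (ℕ → ℝ) → ℝ → Set
ConvergesTo x l = ∀ ε → 0ℚ ℚ.< ε → ∃[ N ] (∀ n → N ℕ.≤ n → ∣ x n -ᴿ l ∣ᴿ ≤ᴿ fromℚ ε)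

IsCauchyᴿ : (ℕ → ℝ) → Set
IsCauchyᴿ x = ∀ ε → 0ℚ ℚ.< ε →
  ∃[ N ] (∀ m n → N ℕ.≤ m → N ℕ.≤ n → ∣ x m -ᴿ x n ∣ᴿ ≤ᴿ fromℚ ε)

triangleᴿ : ∀ x y z → ∣ x -ᴿ z ∣ᴿ ≤ᴿ ∣ x -ᴿ y ∣ᴿ +ᴿ ∣ y -ᴿ z ∣ᴿ
triangleᴿ x y z = pointwise⇒≤ᴿ {∣ x -ᴿ z ∣ᴿ} {∣ x -ᴿ y ∣ᴿ +ᴿ ∣ y -ᴿ z ∣ᴿ}
  λ n → triangle (seq x n) (seq y n) (seq z n)

∣∣ᴿ-flip : ∀ x y → ∣ x -ᴿ y ∣ᴿ ≤ᴿ ∣ y -ᴿ x ∣ᴿ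
∣∣ᴿ-flip x y = pointwise⇒≤ᴿ {∣ x -ᴿ y ∣ᴿ} {∣ y -ᴿ x ∣ᴿ}
  λ n → ℚ.≤-reflexive (∣-∣-flip (seq x n) (seq y n))

converges⇒cauchy : ∀ {x l} → ConvergesTo x l → IsCauchyᴿ x
converges⇒cauchy {x} {l} conv ε ε>0 =
  let (N , h) = conv (half ε) (half>0 ε>0)
  in N , λ m n N≤m N≤n →
    ≤ᴿ-trans {∣ x m -ᴿ x n ∣ᴿ} {∣ x m -ᴿ l ∣ᴿ +ᴿ ∣ l -ᴿ x n ∣ᴿ} {fromℚ ε} (triangleᴿ (x m) l (x n))
      (≤ᴿ-trans {∣ x m -ᴿ l ∣ᴿ +ᴿ ∣ l -ᴿ x n ∣ᴿ} {fromℚ (half ε) +ᴿ fromℚ (half ε)} {fromℚ ε}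
        (+ᴿ-mono-≤ {∣ x m -ᴿ l ∣ᴿ} {fromℚ (half ε)} {∣ l -ᴿ x n ∣ᴿ} {fromℚ (half ε)} (h m N≤m)
          (≤ᴿ-trans {∣ l -ᴿ x n ∣ᴿ} {∣ x n -ᴿ l ∣ᴿ} {fromℚ (half ε)} (∣∣ᴿ-flip l (x n)) (h n N≤n)))
        (pointwise⇒≤ᴿ {fromℚ (half ε) +ᴿ fromℚ (half ε)} {fromℚ ε} λ _ → ℚ.≤-reflexive (half+half ε)))

/1-mono : ∀ i j m n .{{_ : NonZero m}} .{{_ : NonZero n}} →
          i ℤ.* + n ℤ.≤ j ℤ.* + m → i ℚ./ m ℚ.≤ j ℚ./ n
/1-mono i j (suc m) (suc n) h = ℚ.toℚᵘ-cancel-≤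
  (ℚᵘ.≤-respˡ-≃ (ℚᵘ.≃-sym (ℚ.toℚᵘ-fromℚᵘ (ℚᵘ.mkℚᵘ i m)))
    (ℚᵘ.≤-respʳ-≃ (ℚᵘ.≃-sym (ℚ.toℚᵘ-fromℚᵘ (ℚᵘ.mkℚᵘ j n))) (ℚᵘ.*≤* h)))

1/suc : ℕ → ℚ
1/suc k = + 1 ℚ./ suc k

1/suc>0 : ∀ k → 0ℚ ℚ.< 1/suc k
1/suc>0 k = ℚ.positive⁻¹ (1/suc k) {{ℚ.normalize-pos 1 (suc k)}}

1/suc-archimedean : ∀ {ε} → 0ℚ ℚ.< ε → ∃[ N ] (∀ n → N ℕ.≤ n → 1/suc n ℚ.≤ ε)
1/suc-archimedean {ε@(ℚ.mkℚ (+ suc p) d _)} _ = d , λ n d≤n →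
  subst (1/suc n ℚ.≤_) (ℚ.↥p/↧p≡p ε)
    (/1-mono (+ 1) (+ suc p) (suc n) (suc d)
      (ℤ.+≤+ (ℕ.≤-trans (ℕ.≤-reflexive (ℕ.*-identityˡ (suc d)))
        (ℕ.≤-trans (ℕ.s≤s d≤n) (ℕ.m≤m+n (suc n) (p ℕ.* suc n))))))
1/suc-archimedean {ℚ.mkℚ (+ zero) _ _} (ℚ.*<* (ℤ.+<+ ()))
1/suc-archimedean {ℚ.mkℚ ℤ.-[1+ _ ] _ _} (ℚ.*<* ())

-- The k-th term of the limit is an entry of x k that lies within 1/(k+1) of
-- all later entries of x k.
module Diagonal (x : ℕ → ℝ) where

  index : ℕ → ℕ
  index k = proj₁ (cauchy (x k) (1/suc k) (1/suc>0 k))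

  index-close : ∀ k m n → index k ℕ.≤ m → index k ℕ.≤ n →
                ℚ.∣ seq (x k) m ℚ.- seq (x k) n ∣ ℚ.≤ 1/suc k
  index-close k = proj₂ (cauchy (x k) (1/suc k) (1/suc>0 k))

  diag : ℕ → ℚ
  diag k = seq (x k) (index k)

  abstract
    diag-cauchy : IsCauchyᴿ x → IsCauchy diag
    diag-cauchy x-cauchy ε ε>0 =
      let η   = half (half ε)
          η>0 = half>0 (half>0 ε>0)
          (A , 1/≤η)  = 1/suc-archimedean η>0
          (B , close) = x-cauchy η η>0
      in A ℕ.⊔ B , λ m n ≤m ≤n →
        let (L , hL) = close m n (ℕ.m⊔n≤o⇒n≤o A B ≤m) (ℕ.m⊔n≤o⇒n≤o A B ≤n) η η>0
            l = (index m ℕ.⊔ index n) ℕ.⊔ L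
            m≤l = ℕ.≤-trans (ℕ.m≤m⊔n (index m) (index n)) (ℕ.m≤m⊔n (index m ℕ.⊔ index n) L)
            n≤l = ℕ.≤-trans (ℕ.m≤n⊔m (index m) (index n)) (ℕ.m≤m⊔n (index m ℕ.⊔ index n) L)
        in begin
          ℚ.∣ diag m ℚ.- diag n ∣
            ≤⟨ triangle (diag m) (seq (x m) l) (diag n) ⟩
          ℚ.∣ diag m ℚ.- seq (x m) l ∣ ℚ.+ ℚ.∣ seq (x m) l ℚ.- diag n ∣
            ≤⟨ ℚ.+-monoʳ-≤ (ℚ.∣ diag m ℚ.- seq (x m) l ∣) (triangle (seq (x m) l) (seq (x n) l) (diag n)) ⟩
          ℚ.∣ diag m ℚ.- seq (x m) l ∣ ℚ.+ (ℚ.∣ seq (x m) l ℚ.- seq (x n) l ∣ ℚ.+ ℚ.∣ seq (x n) l ℚ.- diag n ∣)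
            ≤⟨ ℚ.+-mono-≤
                 (ℚ.≤-trans (index-close m (index m) l ℕ.≤-refl m≤l) (1/≤η m (ℕ.m⊔n≤o⇒m≤o A B ≤m)))
                 (ℚ.+-mono-≤ (hL l (ℕ.m≤n⊔m (index m ℕ.⊔ index n) L))
                   (ℚ.≤-trans (index-close n l (index n) n≤l ℕ.≤-refl) (1/≤η n (ℕ.m⊔n≤o⇒m≤o A B ≤n)))) ⟩
          η ℚ.+ ((η ℚ.+ η) ℚ.+ η)
            ≡⟨ QS.solve 1 (λ e → let h = QS.con ½ QS.:* (QS.con ½ QS.:* e) in
                 h QS.:+ ((h QS.:+ h) QS.:+ h) QS.:= e) refl ε ⟩
          ε ∎
      where open ℚ.≤-Reasoning

lim : (x : ℕ → ℝ) → IsCauchyᴿ x → ℝ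
lim x x-cauchy = mkℝ (Diagonal.diag x) (Diagonal.diag-cauchy x x-cauchy)

partialSum : (ℕ → ℝ) → ℕ → ℝ
partialSum f zero    = 0ᴿ
partialSum f (suc n) = partialSum f n +ᴿ f n

HasSum : (ℕ → ℝ) → ℝ → Set
HasSum f s = ConvergesTo (partialSum f) s

Summable : (ℕ → ℝ) → Set
Summable f = IsCauchyᴿ (partialSum f)

∑∞ : (f : ℕ → ℝ) → Summable f → ℝ
∑∞ f = lim (partialSum f)

comparison : ∀ {f g} → (∀ k → ∣ f k ∣ᴿ ≤ᴿ g k) → Summable g → Summable f
comparison {f} {g} f≤g g-sum ε ε>0 =
  let (N , h) = g-sum ε ε>0
  in N , λ m n N≤m N≤n → [ m , n ] (ℕ.≤-total m n) (h n m N≤n N≤m) (h m n N≤m N≤n)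
  where
  F = partialSum f
  G = partialSum g

  step : ∀ m d → ∣ F (d ℕ.+ m) -ᴿ F m ∣ᴿ ≤ᴿ G (d ℕ.+ m) -ᴿ G m
  step m zero = pointwise⇒≤ᴿ {∣ F m -ᴿ F m ∣ᴿ} {G m -ᴿ G m} λ n → ℚ.≤-reflexive
    (trans (cong ℚ.∣_∣ (ℚ.+-inverseʳ (seq (F m) n))) (sym (ℚ.+-inverseʳ (seq (G m) n))))
  step m (suc d) =
    ≤ᴿ-trans {∣ (F k +ᴿ f k) -ᴿ F m ∣ᴿ} {∣ F k -ᴿ F m ∣ᴿ +ᴿ ∣ f k ∣ᴿ} {(G k +ᴿ g k) -ᴿ G m}
      (pointwise⇒≤ᴿ {∣ (F k +ᴿ f k) -ᴿ F m ∣ᴿ} {∣ F k -ᴿ F m ∣ᴿ +ᴿ ∣ f k ∣ᴿ} λ n → ℚ.≤-trans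
        (ℚ.≤-reflexive (cong ℚ.∣_∣ (swap (seq (F k) n) (seq (f k) n) (seq (F m) n))))
        (ℚ.∣p+q∣≤∣p∣+∣q∣ (seq (F k) n ℚ.- seq (F m) n) (seq (f k) n)))
      (≤ᴿ-trans {∣ F k -ᴿ F m ∣ᴿ +ᴿ ∣ f k ∣ᴿ} {(G k -ᴿ G m) +ᴿ g k} {(G k +ᴿ g k) -ᴿ G m}
        (+ᴿ-mono-≤ {∣ F k -ᴿ F m ∣ᴿ} {G k -ᴿ G m} {∣ f k ∣ᴿ} {g k} (step m d) (f≤g k))
        (pointwise⇒≤ᴿ {(G k -ᴿ G m) +ᴿ g k} {(G k +ᴿ g k) -ᴿ G m}
          λ n → ℚ.≤-reflexive (sym (swap (seq (G k) n) (seq (g k) n) (seq (G m) n)))))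
    where
    k = d ℕ.+ m
    swap : ∀ p q r → (p ℚ.+ q) ℚ.- r ≡ (p ℚ.- r) ℚ.+ q
    swap = QS.solve 3 (λ x y z → (x QS.:+ y) QS.:- z QS.:= (x QS.:- z) QS.:+ y) refl

  ordered : ∀ m n → m ℕ.≤ n → ∣ G n -ᴿ G m ∣ᴿ ≤ᴿ fromℚ ε → ∣ F n -ᴿ F m ∣ᴿ ≤ᴿ fromℚ ε
  ordered m n m≤n h =
    ≤ᴿ-trans {∣ F n -ᴿ F m ∣ᴿ} {G n -ᴿ G m} {fromℚ ε}
      (subst (λ k → ∣ F k -ᴿ F m ∣ᴿ ≤ᴿ G k -ᴿ G m) (ℕ.m∸n+n≡m m≤n) (step m (n ℕ.∸ m)))
      (≤ᴿ-trans {G n -ᴿ G m} {∣ G n -ᴿ G m ∣ᴿ} {fromℚ ε}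
        (pointwise⇒≤ᴿ {G n -ᴿ G m} {∣ G n -ᴿ G m ∣ᴿ} λ i → p≤∣p∣ (seq (G n -ᴿ G m) i)) h)

  [_,_] : ∀ m n → m ℕ.≤ n ⊎ n ℕ.≤ m → ∣ G n -ᴿ G m ∣ᴿ ≤ᴿ fromℚ ε → ∣ G m -ᴿ G n ∣ᴿ ≤ᴿ fromℚ ε →
          ∣ F m -ᴿ F n ∣ᴿ ≤ᴿ fromℚ ε
  [ m , n ] (inj₁ m≤n) h _ =
    ≤ᴿ-trans {∣ F m -ᴿ F n ∣ᴿ} {∣ F n -ᴿ F m ∣ᴿ} {fromℚ ε} (∣∣ᴿ-flip (F m) (F n)) (ordered m n m≤n h)
  [ m , n ] (inj₂ n≤m) _ h = ordered n m n≤m h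

expTerm : ℝ → ℕ → ℝ
expTerm x k = x ^ᴿ k *ᴿ fromℚ ((+ 1 ℚ./ (k !)) {{ℕ._!≢0 k}})

-- With |x| ≤ B and C = (2B)^(2B), the k-th term is at most C/2ᵏ.
module ExpSummable where

  fromℕℚ : ℕ → ℚ
  fromℕℚ k = + k ℚ./ 1

  fromℕℚ-* : ∀ m n → fromℕℚ m ℚ.* fromℕℚ n ≡ fromℕℚ (m ℕ.* n)
  fromℕℚ-* m n = ℚ.toℚᵘ-injective (ℚᵘ.≃-trans (ℚ.toℚᵘ-homo-* (fromℕℚ m) (fromℕℚ n))
    (ℚᵘ.≃-trans (ℚᵘ.*-cong (ℚ.toℚᵘ-fromℚᵘ (ℚᵘ.mkℚᵘ (+ m) 0)) (ℚ.toℚᵘ-fromℚᵘ (ℚᵘ.mkℚᵘ (+ n) 0)))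
      (ℚᵘ.≃-trans (ℚᵘ.≃-reflexive (cong (λ i → ℚᵘ.mkℚᵘ i 0) (sym (ℤ.pos-* m n))))
        (ℚᵘ.≃-sym (ℚ.toℚᵘ-fromℚᵘ (ℚᵘ.mkℚᵘ (+ (m ℕ.* n)) 0))))))

  fromℕℚ-inv : ∀ n .{{_ : NonZero n}} → fromℕℚ n ℚ.* (+ 1 ℚ./ n) ≡ 1ℚ
  fromℕℚ-inv (suc n) = ℚ.toℚᵘ-injective (ℚᵘ.≃-trans (ℚ.toℚᵘ-homo-* (fromℕℚ (suc n)) (1/suc n))
    (ℚᵘ.≃-trans (ℚᵘ.*-cong (ℚ.toℚᵘ-fromℚᵘ (ℚᵘ.mkℚᵘ (+ suc n) 0)) (ℚ.toℚᵘ-fromℚᵘ (ℚᵘ.mkℚᵘ (+ 1) n)))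
      (ℚᵘ.*≡* (cong +_ (trans (ℕ.*-identityʳ (suc n ℕ.* 1))
        (trans (ℕ.*-identityʳ (suc n)) (sym (trans (ℕ.*-identityˡ (1 ℕ.* suc n)) (ℕ.*-identityˡ (suc n))))))))))

  fromℕℚ-mono : ∀ {m n} → m ℕ.≤ n → fromℕℚ m ℚ.≤ fromℕℚ n
  fromℕℚ-mono {m} {n} m≤n = /1-mono (+ m) (+ n) 1 1 (ℤ.*-monoʳ-≤-nonNeg (+ 1) (ℤ.+≤+ m≤n))

  fromℕℚ-nonNeg : ∀ n → ℚ.NonNegative (fromℕℚ n)
  fromℕℚ-nonNeg n = ℚ.normalize-nonNeg n 1

  ceiling : ∀ q → ∃[ B ] q ℚ.≤ fromℕℚ B
  ceiling q@(ℚ.mkℚ (+ p) d _) = p , subst (ℚ._≤ fromℕℚ p) (ℚ.↥p/↧p≡p q)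
    (/1-mono (+ p) (+ p) (suc d) 1 (ℤ.*-monoˡ-≤-nonNeg (+ p) (ℤ.+≤+ (ℕ.s≤s ℕ.z≤n))))
  ceiling q@(ℚ.mkℚ ℤ.-[1+ p ] d _) = 0 , subst (ℚ._≤ fromℕℚ 0) (ℚ.↥p/↧p≡p q)
    (/1-mono ℤ.-[1+ p ] (+ 0) (suc d) 1 ℤ.-≤+)

  pow : ℚ → ℕ → ℚ
  pow q zero    = 1ℚ
  pow q (suc k) = q ℚ.* pow q k

  seq-^ : ∀ x k n → seq (x ^ᴿ k) n ≡ pow (seq x n) k
  seq-^ x zero    n = refl
  seq-^ x (suc k) n = cong (seq x n ℚ.*_) (seq-^ x k n)

  pow-nonNeg : ∀ q → ℚ.NonNegative q → ∀ k → ℚ.NonNegative (pow q k)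
  pow-nonNeg q q≥0 zero    = _
  pow-nonNeg q q≥0 (suc k) = ℚ.nonNeg*nonNeg⇒nonNeg q {{q≥0}} (pow q k) {{pow-nonNeg q q≥0 k}}

  pow-bound : ∀ p q → ℚ.NonNegative q → ℚ.∣ p ∣ ℚ.≤ q → ∀ k → ℚ.∣ pow p k ∣ ℚ.≤ pow q k
  pow-bound p q q≥0 p≤q zero    = ℚ.≤-refl
  pow-bound p q q≥0 p≤q (suc k) = ℚ.≤-trans (ℚ.≤-reflexive (ℚ.∣p*q∣≡∣p∣*∣q∣ p (pow p k)))
    (ℚ.≤-trans (ℚ.*-monoʳ-≤-nonNeg ℚ.∣ pow p k ∣ {{ℚ.∣-∣-nonNeg (pow p k)}} p≤q)
      (ℚ.*-monoˡ-≤-nonNeg q {{q≥0}} (pow-bound p q q≥0 p≤q k)))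

  pow-* : ∀ p q k → pow (p ℚ.* q) k ≡ pow p k ℚ.* pow q k
  pow-* p q zero    = refl
  pow-* p q (suc k) = trans (cong ((p ℚ.* q) ℚ.*_) (pow-* p q k))
    (QS.solve 4 (λ a b c d → (a QS.:* b) QS.:* (c QS.:* d) QS.:= (a QS.:* c) QS.:* (b QS.:* d))
      refl p q (pow p k) (pow q k))

  pow-fromℕℚ : ∀ m k → pow (fromℕℚ m) k ≡ fromℕℚ (m ℕ.^ k)
  pow-fromℕℚ m zero    = refl
  pow-fromℕℚ m (suc k) = trans (cong (fromℕℚ m ℚ.*_) (pow-fromℕℚ m k)) (fromℕℚ-* m (m ℕ.^ k))

  ^≤^*! : ∀ Q .{{_ : NonZero Q}} k → Q ℕ.^ k ℕ.≤ Q ℕ.^ Q ℕ.* k !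
  ^≤^*! Q zero = ℕ.≤-trans (ℕ.m^n>0 Q Q) (ℕ.≤-reflexive (sym (ℕ.*-identityʳ (Q ℕ.^ Q))))
  ^≤^*! Q (suc k) with ℕ.≤-total Q (suc k)
  ... | inj₁ Q≤k = ℕ.≤-trans (ℕ.*-mono-≤ Q≤k (^≤^*! Q k)) (ℕ.≤-reflexive
    (trans (sym (ℕ.*-assoc (suc k) (Q ℕ.^ Q) (k !)))
      (trans (cong (ℕ._* k !) (ℕ.*-comm (suc k) (Q ℕ.^ Q))) (ℕ.*-assoc (Q ℕ.^ Q) (suc k) (k !)))))
  ... | inj₂ k≤Q = ℕ.≤-trans (ℕ.^-monoʳ-≤ Q k≤Q)
    (ℕ.≤-trans (ℕ.≤-reflexive (sym (ℕ.*-identityʳ (Q ℕ.^ Q)))) (ℕ.*-monoʳ-≤ (Q ℕ.^ Q) (ℕ.1≤n! (suc k))))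

  suc*½^≤1 : ∀ k → fromℕℚ (suc k) ℚ.* pow ½ k ℚ.≤ 1ℚ
  suc*½^≤1 zero    = ℚ.≤-refl
  suc*½^≤1 (suc k) = begin
    fromℕℚ (suc (suc k)) ℚ.* (½ ℚ.* pow ½ k)
      ≤⟨ ℚ.*-monoʳ-≤-nonNeg (½ ℚ.* pow ½ k) {{pow-nonNeg ½ _ (suc k)}}
           (fromℕℚ-mono (ℕ.s≤s (ℕ.≤-trans (ℕ.s≤s (ℕ.m≤m+n k (k ℕ.+ 0)))
             (ℕ.≤-reflexive (sym (ℕ.+-suc k (k ℕ.+ 0))))))) ⟩
    fromℕℚ (2 ℕ.* suc k) ℚ.* (½ ℚ.* pow ½ k)
      ≡⟨ cong (ℚ._* (½ ℚ.* pow ½ k)) (fromℕℚ-* 2 (suc k)) ⟨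
    (fromℕℚ 2 ℚ.* fromℕℚ (suc k)) ℚ.* (½ ℚ.* pow ½ k)
      ≡⟨ QS.solve 2 (λ a b → (QS.con (fromℕℚ 2) QS.:* a) QS.:* (QS.con ½ QS.:* b) QS.:= a QS.:* b)
           refl (fromℕℚ (suc k)) (pow ½ k) ⟩
    fromℕℚ (suc k) ℚ.* pow ½ k
      ≤⟨ suc*½^≤1 k ⟩
    1ℚ ∎
    where open ℚ.≤-Reasoning

  geometric→0 : ∀ C {ε} → 0ℚ ℚ.< ε → ∃[ N ] (∀ n → N ℕ.≤ n → fromℕℚ C ℚ.* pow ½ n ℚ.≤ ε)
  geometric→0 C {ε} ε>0 = let (N , hN) = ceiling (fromℕℚ C ℚ.* 1/ε) in N , λ n N≤n → begin
    fromℕℚ C ℚ.* pow ½ n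
      ≡⟨ cong (ℚ._* pow ½ n) (trans (sym (ℚ.*-identityʳ (fromℕℚ C)))
           (trans (cong (fromℕℚ C ℚ.*_) (sym (ℚ.*-inverseˡ ε {{nz}}))) (sym (ℚ.*-assoc (fromℕℚ C) 1/ε ε)))) ⟩
    ((fromℕℚ C ℚ.* 1/ε) ℚ.* ε) ℚ.* pow ½ n
      ≤⟨ ℚ.*-monoʳ-≤-nonNeg (pow ½ n) {{pow-nonNeg ½ _ n}}
           (ℚ.*-monoʳ-≤-nonNeg ε {{ε≥0}}
             (ℚ.≤-trans hN (fromℕℚ-mono (ℕ.m≤n⇒m≤1+n N≤n)))) ⟩
    (fromℕℚ (suc n) ℚ.* ε) ℚ.* pow ½ n
      ≡⟨ QS.solve 3 (λ a e b → (a QS.:* e) QS.:* b QS.:= e QS.:* (a QS.:* b)) refl (fromℕℚ (suc n)) ε (pow ½ n) ⟩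
    ε ℚ.* (fromℕℚ (suc n) ℚ.* pow ½ n)
      ≤⟨ ℚ.*-monoˡ-≤-nonNeg ε {{ε≥0}} (suc*½^≤1 n) ⟩
    ε ℚ.* 1ℚ
      ≡⟨ ℚ.*-identityʳ ε ⟩
    ε ∎
    where
    open ℚ.≤-Reasoning
    ε⁺ = ℚ.positive ε>0
    ε≥0 = ℚ.pos⇒nonNeg ε {{ε⁺}}
    nz = ℚ.pos⇒nonZero ε {{ε⁺}}
    1/ε = (ℚ.1/ ε) {{nz}}

  geometric : ℕ → ℕ → ℝ
  geometric C k = fromℚ (fromℕℚ C ℚ.* pow ½ k)

  geometric-partialSum : ∀ C n i → seq (partialSum (geometric C) n) i
                       ≡ fromℕℚ (2 ℕ.* C) ℚ.- fromℕℚ (2 ℕ.* C) ℚ.* pow ½ n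
  geometric-partialSum C zero i = sym (trans
    (cong (λ q → fromℕℚ (2 ℕ.* C) ℚ.- q) (ℚ.*-identityʳ (fromℕℚ (2 ℕ.* C)))) (ℚ.+-inverseʳ (fromℕℚ (2 ℕ.* C))))
  geometric-partialSum C (suc n) i = trans
    (cong (ℚ._+ fromℕℚ C ℚ.* pow ½ n) (geometric-partialSum C n i))
    (subst (λ D → (D ℚ.- D ℚ.* pow ½ n) ℚ.+ fromℕℚ C ℚ.* pow ½ n ≡ D ℚ.- D ℚ.* (½ ℚ.* pow ½ n))
      (fromℕℚ-* 2 C)
      (QS.solve 2 (λ c h → let D = QS.con (fromℕℚ 2) QS.:* c in
        (D QS.:- D QS.:* h) QS.:+ c QS.:* h QS.:= D QS.:- D QS.:* (QS.con ½ QS.:* h))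
        refl (fromℕℚ C) (pow ½ n)))

  geometric-summable : ∀ C → Summable (geometric C)
  geometric-summable C ε ε>0 =
    let (N , h) = geometric→0 (2 ℕ.* C) (half>0 ε>0)
    in N , λ m n N≤m N≤n →
      pointwise⇒≤ᴿ {∣ partialSum (geometric C) m -ᴿ partialSum (geometric C) n ∣ᴿ} {fromℚ ε} λ i → begin
        ℚ.∣ seq (partialSum (geometric C) m) i ℚ.- seq (partialSum (geometric C) n) i ∣
          ≡⟨ cong₂ (λ p q → ℚ.∣ p ℚ.- q ∣) (geometric-partialSum C m i) (geometric-partialSum C n i) ⟩
        ℚ.∣ (D ℚ.- t m) ℚ.- (D ℚ.- t n) ∣
          ≡⟨ cong ℚ.∣_∣ (QS.solve 3 (λ d a b → (d QS.:- a) QS.:- (d QS.:- b) QS.:= b QS.:- a) refl D (t m) (t n)) ⟩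
        ℚ.∣ t n ℚ.- t m ∣
          ≤⟨ ℚ.∣p-q∣≤∣p∣+∣q∣ (t n) (t m) ⟩
        ℚ.∣ t n ∣ ℚ.+ ℚ.∣ t m ∣
          ≡⟨ cong₂ ℚ._+_ (ℚ.0≤p⇒∣p∣≡p (t≥0 n)) (ℚ.0≤p⇒∣p∣≡p (t≥0 m)) ⟩
        t n ℚ.+ t m
          ≤⟨ +-mono-half ε (h n N≤n) (h m N≤m) ⟩
        ε ∎
    where
    open ℚ.≤-Reasoning
    D = fromℕℚ (2 ℕ.* C)
    t : ℕ → ℚ
    t n = D ℚ.* pow ½ n
    t≥0 : ∀ n → 0ℚ ℚ.≤ t n
    t≥0 n = ℚ.nonNegative⁻¹ (t n)
      {{ℚ.nonNeg*nonNeg⇒nonNeg D {{fromℕℚ-nonNeg (2 ℕ.* C)}} (pow ½ n) {{pow-nonNeg ½ _ n}}}}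

  expTerm-bound : ∀ x → ∃[ C ] (∀ k → ∣ expTerm x k ∣ᴿ ≤ᴿ geometric C k)
  expTerm-bound x = C , λ k ε ε>0 → N , λ n N≤n → begin
    ℚ.∣ seq (x ^ᴿ k) n ℚ.* 1/! k ∣
      ≡⟨ trans (ℚ.∣p*q∣≡∣p∣*∣q∣ (seq (x ^ᴿ k) n) (1/! k))
           (cong₂ ℚ._*_ (cong ℚ.∣_∣ (seq-^ x k n)) (ℚ.0≤p⇒∣p∣≡p (ℚ.nonNegative⁻¹ (1/! k) {{1/!≥0 k}}))) ⟩
    ℚ.∣ pow (seq x n) k ∣ ℚ.* 1/! k
      ≤⟨ ℚ.*-monoʳ-≤-nonNeg (1/! k) {{1/!≥0 k}} (ℚ.≤-trans
           (pow-bound (seq x n) (fromℕℚ B) (fromℕℚ-nonNeg B) (ℚ.≤-trans (hb n N≤n) b≤B) k) (Bᵏ≤ k)) ⟩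
    ((fromℕℚ C ℚ.* pow ½ k) ℚ.* fromℕℚ (k !)) ℚ.* 1/! k
      ≡⟨ trans (ℚ.*-assoc (fromℕℚ C ℚ.* pow ½ k) (fromℕℚ (k !)) (1/! k))
           (trans (cong ((fromℕℚ C ℚ.* pow ½ k) ℚ.*_) (fromℕℚ-inv (k !) {{ℕ._!≢0 k}}))
             (ℚ.*-identityʳ (fromℕℚ C ℚ.* pow ½ k))) ⟩
    fromℕℚ C ℚ.* pow ½ k
      ≡⟨ ℚ.+-identityʳ (fromℕℚ C ℚ.* pow ½ k) ⟨
    fromℕℚ C ℚ.* pow ½ k ℚ.+ 0ℚ
      ≤⟨ ℚ.+-monoʳ-≤ (fromℕℚ C ℚ.* pow ½ k) (ℚ.<⇒≤ ε>0) ⟩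
    fromℕℚ C ℚ.* pow ½ k ℚ.+ ε ∎
    where
    open ℚ.≤-Reasoning
    bounded = eventuallyBounded x
    N = proj₁ (proj₂ (proj₂ bounded))
    hb = proj₂ (proj₂ (proj₂ bounded))
    B₀ = proj₁ (ceiling (proj₁ bounded))
    B = suc B₀
    b≤B : proj₁ bounded ℚ.≤ fromℕℚ B
    b≤B = ℚ.≤-trans (proj₂ (ceiling (proj₁ bounded))) (fromℕℚ-mono (ℕ.n≤1+n B₀))
    Q = 2 ℕ.* B
    C = Q ℕ.^ Q
    1/! : ℕ → ℚ
    1/! k = (+ 1 ℚ./ (k !)) {{ℕ._!≢0 k}}
    1/!≥0 : ∀ k → ℚ.NonNegative (1/! k)
    1/!≥0 k = ℚ.normalize-nonNeg 1 (k !) {{ℕ._!≢0 k}}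
    Bᵏ≤ : ∀ k → pow (fromℕℚ B) k ℚ.≤ (fromℕℚ C ℚ.* pow ½ k) ℚ.* fromℕℚ (k !)
    Bᵏ≤ k = begin
      pow (fromℕℚ B) k
        ≡⟨ cong (λ q → pow q k) (trans
             (QS.solve 1 (λ b → b QS.:= QS.con ½ QS.:* (QS.con (fromℕℚ 2) QS.:* b)) refl (fromℕℚ B))
             (cong (½ ℚ.*_) (fromℕℚ-* 2 B))) ⟩
      pow (½ ℚ.* fromℕℚ Q) k
        ≡⟨ trans (pow-* ½ (fromℕℚ Q) k) (cong (pow ½ k ℚ.*_) (pow-fromℕℚ Q k)) ⟩
      pow ½ k ℚ.* fromℕℚ (Q ℕ.^ k)
        ≤⟨ ℚ.*-monoˡ-≤-nonNeg (pow ½ k) {{pow-nonNeg ½ _ k}} (fromℕℚ-mono (^≤^*! Q k)) ⟩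
      pow ½ k ℚ.* fromℕℚ (C ℕ.* k !)
        ≡⟨ cong (pow ½ k ℚ.*_) (fromℕℚ-* C (k !)) ⟨
      pow ½ k ℚ.* (fromℕℚ C ℚ.* fromℕℚ (k !))
        ≡⟨ QS.solve 3 (λ h c f → h QS.:* (c QS.:* f) QS.:= (c QS.:* h) QS.:* f)
             refl (pow ½ k) (fromℕℚ C) (fromℕℚ (k !)) ⟩
      (fromℕℚ C ℚ.* pow ½ k) ℚ.* fromℕℚ (k !) ∎

  abstract
    expTerm-summable : ∀ x → Summable (expTerm x)
    expTerm-summable x = let (C , h) = expTerm-bound x in
      comparison {expTerm x} {geometric C} h (geometric-summable C)

exp : ℝ → ℝ
exp x = ∑∞ (expTerm x) (ExpSummable.expTerm-summable x)

-- Outcomes are natural numbers.  A random element of a countable set has a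
-- countably supported law, so its law is realised by a function on such a space.
Ω : Set
Ω = ℕ

record ProbabilitySpace : Set where
  field
    mass   : Ω → ℝ
    mass≥0 : ∀ ω → 0ᴿ ≤ᴿ mass ω
    total  : HasSum mass 1ᴿ

open ProbabilitySpace public

module _ (P : ProbabilitySpace) where

  restrict : (Ω → Bool) → Ω → ℝ
  restrict A ω = if A ω then mass P ω else 0ᴿ

  abstract
    restrict-summable : ∀ A → Summable (restrict A)
    restrict-summable A = comparison {restrict A} {mass P} bound
      (converges⇒cauchy {partialSum (mass P)} {1ᴿ} (total P))
      where
      bound : ∀ ω → ∣ restrict A ω ∣ᴿ ≤ᴿ mass P ω
      bound ω with A ω
      ... | true  = ∣∣ᴿ-of-nonNeg {mass P ω} (mass≥0 P ω)
      ... | false = mass≥0 P ω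

  ℙ : (Ω → Bool) → ℝ
  ℙ A = ∑∞ (restrict A) (restrict-summable A)

  HasExpectation : (Ω → ℕ) → ℝ → Set
  HasExpectation X E = HasSum (λ ω → mass P ω *ᴿ fromℕ (X ω)) E

  -- Independence of the finite family (X i), i ranging over the list is.
  -- Taking A i constantly true drops the index i, so subfamilies are covered.
  Independent : {I : Set a} {V : Set b} → List I → (I → Ω → V) → Set (a ⊔ b)
  Independent {I = I} {V} is X = (A : I → V → Bool) →
    ℙ (λ ω → all (λ i → A i (X i ω)) is)
      ≈ᴿ foldr _*ᴿ_ 1ᴿ (map (λ i → ℙ (λ ω → A i (X i ω))) is)

record Ideal (R : CommutativeRing c ℓ) : Set (lsuc (c ⊔ ℓ)) where
  open CommutativeRing R
  field
    Mem      : Pred Carrier (c ⊔ ℓ)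
    resp     : ∀ {x y} → x ≈ y → Mem x → Mem y
    0∈       : Mem 0#
    +-closed : ∀ {x y} → Mem x → Mem y → Mem (x + y)
    *-closed : ∀ r {x} → Mem x → Mem (r * x)

module _ {R : CommutativeRing c ℓ} where
  open CommutativeRing R using (1#)
  open Ideal

  Proper : Ideal R → Set (c ⊔ ℓ)
  Proper I = ¬ Mem I 1#

  IsMaximal : Ideal R → Set (lsuc (c ⊔ ℓ))
  IsMaximal I = Proper I ×
    (∀ (J : Ideal R) → Proper J → (∀ {x} → Mem I x → Mem J x) → (∀ {x} → Mem J x → Mem I x))

-- The residue class in R/I is given by a representative r.  Decidability of I
-- makes {y ≡ r mod I} an event.
IsBalanced : ProbabilitySpace → (R : CommutativeRing c ℓ) → ℝ →
             (Ω → CommutativeRing.Carrier R) → Set (lsuc (c ⊔ ℓ))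
IsBalanced P R ε y =
  ∀ (I : Ideal R) (I? : Decidable (Ideal.Mem I)) → IsMaximal I →
  ∀ (r : Carrier) → ℙ P (λ ω → does (I? (y ω - r))) ≤ᴿ 1ᴿ -ᴿ ε
  where open CommutativeRing R using (Carrier; _-_)

-- deg Γ i j is the number of edges from i to j.
record Digraph (n : ℕ) : Set where
  constructor mkDigraph
  field
    deg : Fin n → Fin n → ℕ

open Digraph public

module Σℕ = CMSum ℕ.+-0-commutativeMonoid
module Σℤ = CMSum ℤ.+-0-commutativeMonoid

outdeg : Digraph n → Fin n → ℕ
outdeg Γ i = Σℕ.sum (λ j → deg Γ i j)

RandomDigraph : ℕ → Set
RandomDigraph n = Ω → Digraph n

offDiagonal : ∀ n → List (Fin n × Fin n)
offDiagonal n = filter (λ (i , j) → ¬? (i Fin.≟ j)) (cartesianProduct (allFin n) (allFin n))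

degree : RandomDigraph n → Fin n × Fin n → Ω → ℤ
degree Γ (i , j) ω = + deg (Γ ω) i j

IsBalancedDigraph : ProbabilitySpace → ℝ → RandomDigraph n → Set₁
IsBalancedDigraph {n} P ε Γ =
  Independent P (offDiagonal n) (degree Γ) ×
  (∀ i j → i ≢ j → IsBalanced P ℤ.+-*-commutativeRing ε (degree Γ (i , j)))

laplacian : Digraph n → Fin n → Fin n → ℤ
laplacian Γ i j with i Fin.≟ j
... | yes _ = + outdeg Γ j ℤ.- + deg Γ j j
... | no  _ = ℤ.- (+ deg Γ j i)

mulVec : (Fin n → Fin n → ℤ) → Vector ℤ n → Vector ℤ n
mulVec M w i = Σℤ.sum (λ j → M i j ℤ.* w j)

record ℤ₀^ (n : ℕ) : Set where
  constructor mkℤ₀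
  field
    vec   : Vector ℤ n
    sum≡0 : Σℤ.sum vec ≡ ℤ.0ℤ

open ℤ₀^ public

sum-neg : (v : Vector ℤ n) → Σℤ.sum (λ i → ℤ.- v i) ≡ ℤ.- Σℤ.sum v
sum-neg {zero}  v = refl
sum-neg {suc n} v = trans (cong (λ s → ℤ.- v zero ℤ.+ s) (sum-neg (v ∘ suc)))
  (sym (ℤ.neg-distrib-+ (v zero) (Σℤ.sum (v ∘ suc))))

mulVec-0 : (M : Fin n → Fin n → ℤ) → ∀ i → mulVec M (λ _ → ℤ.0ℤ) i ≡ ℤ.0ℤ
mulVec-0 {n} M i = trans (Σℤ.sum-cong-≗ (λ j → ℤ.*-zeroʳ (M i j))) (Σℤ.sum-replicate-zero n)

mulVec-neg : (M : Fin n → Fin n → ℤ) (w : Vector ℤ n) → ∀ i →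
             mulVec M (λ j → ℤ.- w j) i ≡ ℤ.- mulVec M w i
mulVec-neg M w i = trans (Σℤ.sum-cong-≗ (λ j → sym (ℤ.neg-distribʳ-* (M i j) (w j))))
  (sum-neg (λ j → M i j ℤ.* w j))

mulVec-+ : (M : Fin n → Fin n → ℤ) (v w : Vector ℤ n) → ∀ i →
           mulVec M (λ j → v j ℤ.+ w j) i ≡ mulVec M v i ℤ.+ mulVec M w i
mulVec-+ M v w i = trans (Σℤ.sum-cong-≗ (λ j → ℤ.*-distribˡ-+ (M i j) (v j) (w j)))
  (Σℤ.∑-distrib-+ (λ j → M i j ℤ.* v j) (λ j → M i j ℤ.* w j))

-- The quotient of ℤⁿ₀ by Lℤⁿ, as a setoid: u ≈ v iff u - v ∈ Lℤⁿ.
sandpileGroup : Digraph n → AbelianGroup 0ℓ 0ℓ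
sandpileGroup {n} Γ = record
  { Carrier = ℤ₀^ n
  ; _≈_ = _~_
  ; _∙_ = _⊕_
  ; ε = 𝟘
  ; _⁻¹ = ⊖_
  ; isAbelianGroup = record
    { isGroup = record
      { isMonoid = record
        { isSemigroup = record
          { isMagma = record
            { isEquivalence = record
              { refl = λ {u} → pointwise u u (λ _ → refl)
              ; sym = λ {u} {v} (w , h) → (λ j → ℤ.- w j) , λ i →
                  trans (flip-minus (vec v i) (vec u i))
                    (trans (cong ℤ.-_ (h i)) (sym (mulVec-neg L w i)))
              ; trans = λ {u} {v} {x} (w , h) (w′ , h′) → (λ j → w j ℤ.+ w′ j) , λ i →
                  trans (telescope (vec u i) (vec v i) (vec x i))
                    (trans (cong₂ ℤ._+_ (h i) (h′ i)) (sym (mulVec-+ L w w′ i)))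
              }
            ; ∙-cong = λ {u} {u′} {v} {v′} (w , h) (w′ , h′) → (λ j → w j ℤ.+ w′ j) , λ i →
                trans (interchange (vec u i) (vec v i) (vec u′ i) (vec v′ i))
                  (trans (cong₂ ℤ._+_ (h i) (h′ i)) (sym (mulVec-+ L w w′ i)))
            }
          ; assoc = λ u v x → pointwise ((u ⊕ v) ⊕ x) (u ⊕ (v ⊕ x)) (λ i → ℤ.+-assoc (vec u i) (vec v i) (vec x i))
          }
        ; identity = (λ u → pointwise (𝟘 ⊕ u) u (λ i → ℤ.+-identityˡ (vec u i)))
                   , (λ u → pointwise (u ⊕ 𝟘) u (λ i → ℤ.+-identityʳ (vec u i)))
        }
      ; inverse = (λ u → pointwise ((⊖ u) ⊕ u) 𝟘 (λ i → ℤ.+-inverseˡ (vec u i)))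
                , (λ u → pointwise (u ⊕ (⊖ u)) 𝟘 (λ i → ℤ.+-inverseʳ (vec u i)))
      ; ⁻¹-cong = λ {u} {v} (w , h) → (λ j → ℤ.- w j) , λ i →
          trans (neg-minus (vec u i) (vec v i))
            (trans (cong ℤ.-_ (h i)) (sym (mulVec-neg L w i)))
      }
    ; comm = λ u v → pointwise (u ⊕ v) (v ⊕ u) (λ i → ℤ.+-comm (vec u i) (vec v i))
    }
  }
  where
  L = laplacian Γ

  _⊕_ : ℤ₀^ n → ℤ₀^ n → ℤ₀^ n
  u ⊕ v = mkℤ₀ (λ i → vec u i ℤ.+ vec v i)
    (trans (Σℤ.∑-distrib-+ (vec u) (vec v)) (cong₂ ℤ._+_ (sum≡0 u) (sum≡0 v)))

  ⊖_ : ℤ₀^ n → ℤ₀^ n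
  ⊖ u = mkℤ₀ (λ i → ℤ.- vec u i) (trans (sum-neg (vec u)) (cong ℤ.-_ (sum≡0 u)))

  𝟘 : ℤ₀^ n
  𝟘 = mkℤ₀ (λ _ → ℤ.0ℤ) (Σℤ.sum-replicate-zero n)

  _~_ : ℤ₀^ n → ℤ₀^ n → Set
  u ~ v = ∃[ w ] (∀ i → vec u i ℤ.- vec v i ≡ mulVec L w i)

  pointwise : ∀ u v → (∀ i → vec u i ≡ vec v i) → u ~ v
  pointwise u v h = (λ _ → ℤ.0ℤ) , λ i →
    trans (ℤ.i≡j⇒i-j≡0 (h i)) (sym (mulVec-0 L i))

  flip-minus : ∀ x y → x ℤ.- y ≡ ℤ.- (y ℤ.- x)
  flip-minus = solve-∀

  neg-minus : ∀ x y → ℤ.- x ℤ.- (ℤ.- y) ≡ ℤ.- (x ℤ.- y)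
  neg-minus = solve-∀

  telescope : ∀ x y z → x ℤ.- z ≡ (x ℤ.- y) ℤ.+ (y ℤ.- z)
  telescope = solve-∀

  interchange : ∀ x y z w → (x ℤ.+ y) ℤ.- (z ℤ.+ w) ≡ (x ℤ.- z) ℤ.+ (y ℤ.- w)
  interchange = solve-∀

HasCardinality : Setoid c ℓ → ℕ → Set (c ⊔ ℓ)
HasCardinality S k = Inverse S (≡.setoid (Fin k))

record FiniteAbelianGroup c ℓ : Set (lsuc (c ⊔ ℓ)) where
  field
    group       : AbelianGroup c ℓ
    order       : ℕ
    enumeration : HasCardinality (AbelianGroup.setoid group) order

  order≢0 : NonZero order
  order≢0 = Fin.nonZeroIndex (Inverse.to enumeration (AbelianGroup.ε group))

open FiniteAbelianGroup public using (group; order; order≢0)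

1/∣_∣ : FiniteAbelianGroup c ℓ → ℝ
1/∣ G ∣ = fromℚ ((+ 1 ℚ./ order G) {{order≢0 G}})

IsExponent : AbelianGroup c ℓ → ℕ → Set (c ⊔ ℓ)
IsExponent G e = 0 ℕ.< e × Kills e × (∀ k → 0 ℕ.< k → Kills k → e ℕ.≤ k)
  where
  open AbelianGroup G
  open import Algebra.Definitions.RawMonoid rawMonoid using () renaming (_×_ to _·_)
  Kills : ℕ → Set _
  Kills k = ∀ x → k · x ≈ ε

module _ (A : AbelianGroup a ℓ₁) (B : AbelianGroup b ℓ₂) where
  private
    module A = AbelianGroup A
    module B = AbelianGroup B

  record SurjectiveHom : Set (a ⊔ b ⊔ ℓ₁ ⊔ ℓ₂) where
    open GroupMorphisms A.rawGroup B.rawGroup using (IsGroupHomomorphism)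
    field
      ⟦_⟧                 : A.Carrier → B.Carrier
      isGroupHomomorphism : IsGroupHomomorphism ⟦_⟧
      surjective          : Surjective A._≈_ B._≈_ ⟦_⟧

  Sur : Setoid (a ⊔ b ⊔ ℓ₁ ⊔ ℓ₂) (a ⊔ ℓ₂)
  Sur = record
    { Carrier = SurjectiveHom
    ; _≈_ = λ f g → ∀ x → ⟦ f ⟧ x B.≈ ⟦ g ⟧ x
    ; isEquivalence = record
      { refl  = λ _ → B.refl
      ; sym   = λ f≈g x → B.sym (f≈g x)
      ; trans = λ f≈g g≈h x → B.trans (f≈g x) (g≈h x)
      }
    }
    where open SurjectiveHom

-- A homomorphism from ℤⁿ₀ to G is a function f from the vertices to G, up to translation.  It factors
-- through the sandpile group iff Σᵢ deg(j,i) (f j - f i) = 0 for every vertex j; these n conditions are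
-- independent, and only the residues of the degrees modulo a matter.
--
-- Instead of characters, the law μ of one such sum is controlled by D(s) = ‖μ - τ_s μ‖², where τ_s is
-- translation by s.  Adding a summand t v with t balanced multiplies D(v) by some ρ < 1 and does not
-- increase D(s) for any other s.  If S is the set of values that f takes at least δn times, D is
-- therefore exponentially small on the subgroup H spanned by the elements f j - s with s ∈ S.
--
-- If H = G, each condition holds with probability exponentially close to 1/|G|; as there are |G|ⁿ⁻¹
-- such f (up to exponentially few), they contribute 1/|G|.  If H ≠ G, then |S| < |G|, and surjectivity
-- provides some f j - f i outside H.  For f j ∈ S the condition then holds with probability at most
-- (1 - ε)/|S| plus a small error.  Giving the few vertices with f j ∉ S a small weight 1/Y, at the cost
-- of a factor Y^(δn|G|), the sum over all such f is dominated by the n-th power of a number below 1.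

module Submission where

open import Defs
open import Algebra.Bundles using (AbelianGroup; CommutativeMonoid; CommutativeRing; CommutativeSemiring)
open import Algebra.Core using (Op₁; Op₂)
import Algebra.Properties.AbelianGroup as AbelianGroupProperties
import Algebra.Properties.CommutativeMonoid.Mult as CMMult
import Algebra.Properties.CommutativeMonoid.Sum as CMSum
import Algebra.Properties.Group as GroupProperties
import Algebra.Properties.Semiring.Exp as Exp
import Algebra.Properties.CommutativeSemiring.Exp as CExp
open import Algebra.Morphism.Structures using (module GroupMorphisms)
import Algebra.Solver.Ring as RingSolver
import Algebra.Solver.Ring.AlmostCommutativeRing as ACR
open import Algebra.Structures using (IsCommutativeRing; IsAbelianGroup)
open import Data.Bool.Base as Bool using (Bool; true; false; if_then_else_; not; _∧_)
open import Data.Bool.ListAction using (all)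
import Data.Bool.Properties as Bool
open import Data.Fin.Base as Fin using (Fin; zero; suc; toℕ)
import Data.Fin.Properties as Fin
open import Data.Integer.Base as ℤ using (ℤ; +_; -[1+_])
import Data.Integer.DivMod as ℤ
import Data.Integer.Divisibility.Signed as ℤ∣
import Data.Integer.Properties as ℤ
open import Data.List.Base using (List; []; _∷_; map; foldr; filter; length; _++_; cartesianProduct; cartesianProductWith; allFin; tabulate)
import Data.List.Properties as List
open import Data.List.Membership.Propositional using (_∈_)
import Data.List.Membership.Propositional.Properties as ∈
open import Data.List.Relation.Unary.All as All using (All; []; _∷_)
import Data.List.Relation.Unary.All.Properties as All
open import Data.List.Relation.Unary.AllPairs using ([]; _∷_)
open import Data.List.Relation.Unary.Any as Any using (here; there)
import Data.List.Relation.Unary.Any.Properties as Any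
open import Data.List.Relation.Unary.Unique.Propositional using (Unique)
import Data.List.Relation.Unary.Unique.Propositional.Properties as Unique
import Data.Maybe.Base as Maybe
open import Data.Nat.Base as ℕ using (ℕ; zero; suc; NonZero; _!)
open import Data.Nat.Divisibility as ℕ∣ using (_∣_; _∣?_; divides)
open import Data.Nat.DivMod as ℕ/ using ()
open import Data.Nat.GCD as GCD using (gcd)
open import Data.Nat.Primality using (Prime; prime?; ¬prime[1]; prime⇒irreducible)
open import Data.Nat.Primality.Factorisation using (factorise)
import Data.Nat.Properties as ℕ
open import Data.Nat.Tactic.RingSolver using () renaming (solve-∀ to solveℕ-∀)
open import Data.Product using (∃-syntax; _×_; _,_; proj₁; proj₂)
open import Data.Rational.Base as ℚ using (ℚ; 0ℚ; 1ℚ; ½)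
import Data.Rational.Properties as ℚ
import Data.Rational.Unnormalised.Base as ℚᵘ
import Data.Rational.Unnormalised.Properties as ℚᵘ
open import Data.Sum.Base using (_⊎_; inj₁; inj₂; [_,_]′)
open import Data.Vec.Base as Vec using (Vec; []; _∷_; lookup)
import Data.Vec.Properties as Vec
open import Function.Base using (_∘_; id)
open import Function.Bundles using (Inverse; mk⇔)
open import Level using (Level; 0ℓ)
open import Relation.Binary.Bundles using (Setoid; Poset)
open import Relation.Binary.Core using (Rel)
open import Relation.Binary.Definitions using (DecidableEquality)
import Relation.Binary.Reasoning.PartialOrder as PosetReasoning
import Relation.Binary.Reasoning.Setoid as SetoidReasoning
open import Relation.Binary.PropositionalEquality as ≡ using (_≡_; _≢_; refl; sym; trans; cong; cong₂; subst; subst₂)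
open import Relation.Binary.Structures using (IsDecTotalOrder)
open import Relation.Nullary using (¬_; Dec; yes; no; does; ¬?; contradiction)
open import Relation.Nullary.Decidable using (decidable-stable; dec⇒maybe; does-⇔; dec-true; dec-false; map′; _×-dec_)
open import Relation.Unary using (Decidable)

-- The estimates need a decidable order (is a residue likely, is a total positive, does x² ≤ y² give
-- x ≤ y), which the reals lack. They are therefore made for rational laws. A real law is
-- represented by a sequence of exact rational laws; the moment is a polynomial in the laws, so a
-- rational bound at every late index bounds the real expectation.
--
-- Squared differences spare both characters and square roots. The price is the 2 in D(s + t) ≤ 2
-- (D(s) + D(t)), which does no harm because coefficients reduce modulo a. The contraction rests on
-- an exact identity: twice the squared norm lost in a step is the mean of D over differences of two
-- independent residues. Balance enters through Bézout: a prime dividing a and all differences of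
-- likely residues would collect too much mass in one class.
--
-- Popularity starts at 4k occurrences, where k is about n/B for a fixed block length B: enough for
-- an error ρ^(2k) that survives a factor n, yet few enough for the unpopular vertices to stay
-- cheap. For H ≠ G, the probability of f is not compared with its main term directly: both lie
-- below the same envelope.

record Enumeration (A : Set) : Set where
  infix 4 _≟_
  field
    elements : List A
    unique   : Unique elements
    complete : ∀ x → x ∈ elements
    _≟_      : DecidableEquality A

open Enumeration using (elements)

fins : ∀ n → Enumeration (Fin n)
fins n = record
  { elements = allFin n
  ; unique   = Unique.allFin⁺ n
  ; complete = ∈.∈-allFin
  ; _≟_      = Fin._≟_
  }

bools : Enumeration Bool
bools = record
  { elements = true ∷ false ∷ []
  ; unique   = ((λ ()) ∷ []) ∷ [] ∷ []
  ; complete = λ { true → here refl ; false → there (here refl) }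
  ; _≟_      = Bool._≟_
  }

vecs : ∀ {A} → Enumeration A → ∀ n → Enumeration (Vec A n)
vecs {A} E n = record
  { elements = els n
  ; unique   = unique n
  ; complete = complete
  ; _≟_      = Vec.≡-dec (Enumeration._≟_ E)
  }
  where
  els : ∀ n → List (Vec A n)
  els zero    = [] ∷ []
  els (suc n) = cartesianProductWith _∷_ (elements E) (els n)

  unique : ∀ n → Unique (els n)
  unique zero    = [] ∷ []
  unique (suc n) = Unique.cartesianProductWith⁺ _∷_ Vec.∷-injective (Enumeration.unique E) (unique n)

  complete : ∀ {n} (v : Vec A n) → v ∈ els n
  complete []      = here refl
  complete (x ∷ v) = ∈.∈-cartesianProductWith⁺ _∷_ (Enumeration.complete E x) (complete v)

does⇒ : ∀ {p} {P : Set p} (P? : Dec P) → does P? ≡ true → P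
does⇒ (yes p) _ = p

does⇒¬ : ∀ {p} {P : Set p} (P? : Dec P) → does P? ≡ false → ¬ P
does⇒¬ (no ¬p) _ = ¬p

if-yes : ∀ {p b} {P : Set p} {B : Set b} (P? : Dec P) {x y : B} → P → (if does P? then x else y) ≡ x
if-yes P? {x} {y} p = cong (λ b → if b then x else y) (dec-true P? p)

if-no : ∀ {p b} {P : Set p} {B : Set b} (P? : Dec P) {x y : B} → ¬ P → (if does P? then x else y) ≡ y
if-no P? {x} {y} ¬p = cong (λ b → if b then x else y) (dec-false P? ¬p)

-- Finite sums and products in a commutative semiring.

module Sums (R : CommutativeSemiring 0ℓ 0ℓ) where
  open CommutativeSemiring R hiding (zero) renaming (Carrier to C; refl to ≈-refl; sym to ≈-sym; trans to ≈-trans)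
  open SetoidReasoning setoid

  private
    variable
      A B : Set
      f g : A → C

  ∑ : List A → (A → C) → C
  ∑ []       f = 0#
  ∑ (x ∷ xs) f = f x + ∑ xs f

  ∏ : ∀ {n} → (Fin n → C) → C
  ∏ {zero}  f = 1#
  ∏ {suc n} f = f zero * ∏ (f ∘ suc)

  [_] : Bool → C
  [ b ] = if b then 1# else 0#

  ∑-cong : ∀ xs → (∀ x → f x ≈ g x) → ∑ xs f ≈ ∑ xs g
  ∑-cong []       h = ≈-refl
  ∑-cong (x ∷ xs) h = +-cong (h x) (∑-cong xs h)

  ∏-cong : ∀ {n} {f g : Fin n → C} → (∀ i → f i ≈ g i) → ∏ f ≈ ∏ g
  ∏-cong {zero}  h = ≈-refl
  ∏-cong {suc n} h = *-cong (h zero) (∏-cong (h ∘ suc))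

  ∏-1 : ∀ n → ∏ {n} (λ _ → 1#) ≈ 1#
  ∏-1 zero    = ≈-refl
  ∏-1 (suc n) = ≈-trans (*-identityˡ _) (∏-1 n)

  ∏-* : ∀ {n} (f g : Fin n → C) → ∏ (λ i → f i * g i) ≈ ∏ f * ∏ g
  ∏-* {zero}  f g = ≈-sym (*-identityˡ 1#)
  ∏-* {suc n} f g = begin
    (f zero * g zero) * ∏ (λ i → f (suc i) * g (suc i)) ≈⟨ *-congˡ (∏-* (f ∘ suc) (g ∘ suc)) ⟩
    (f zero * g zero) * (∏ (f ∘ suc) * ∏ (g ∘ suc))     ≈⟨ *-assoc _ _ _ ⟩
    f zero * (g zero * (∏ (f ∘ suc) * ∏ (g ∘ suc)))     ≈⟨ *-congˡ (*-assoc _ _ _) ⟨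
    f zero * ((g zero * ∏ (f ∘ suc)) * ∏ (g ∘ suc))     ≈⟨ *-congˡ (*-congʳ (*-comm _ _)) ⟩
    f zero * ((∏ (f ∘ suc) * g zero) * ∏ (g ∘ suc))     ≈⟨ *-congˡ (*-assoc _ _ _) ⟩
    f zero * (∏ (f ∘ suc) * (g zero * ∏ (g ∘ suc)))     ≈⟨ *-assoc _ _ _ ⟨
    ∏ f * ∏ g                                           ∎

  ∑-0 : ∀ (xs : List A) → ∑ xs (λ _ → 0#) ≈ 0#
  ∑-0 []       = ≈-refl
  ∑-0 (x ∷ xs) = ≈-trans (+-identityˡ _) (∑-0 xs)

  +-interchange : ∀ a b c d → (a + b) + (c + d) ≈ (a + c) + (b + d)
  +-interchange a b c d = begin
    (a + b) + (c + d) ≈⟨ +-assoc a b (c + d) ⟩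
    a + (b + (c + d)) ≈⟨ +-congˡ (+-assoc b c d) ⟨
    a + ((b + c) + d) ≈⟨ +-congˡ (+-congʳ (+-comm b c)) ⟩
    a + ((c + b) + d) ≈⟨ +-congˡ (+-assoc c b d) ⟩
    a + (c + (b + d)) ≈⟨ +-assoc a c (b + d) ⟨
    (a + c) + (b + d) ∎

  ∑-+ : ∀ xs (f g : A → C) → ∑ xs (λ x → f x + g x) ≈ ∑ xs f + ∑ xs g
  ∑-+ []       f g = ≈-sym (+-identityˡ 0#)
  ∑-+ (x ∷ xs) f g = ≈-trans (+-congˡ (∑-+ xs f g)) (+-interchange _ _ _ _)

  ∑-*ˡ : ∀ xs c (f : A → C) → c * ∑ xs f ≈ ∑ xs (λ x → c * f x)
  ∑-*ˡ []       c f = zeroʳ c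
  ∑-*ˡ (x ∷ xs) c f = ≈-trans (distribˡ c _ _) (+-congˡ (∑-*ˡ xs c f))

  ∑-*ʳ : ∀ xs c (f : A → C) → ∑ xs f * c ≈ ∑ xs (λ x → f x * c)
  ∑-*ʳ xs c f = ≈-trans (*-comm _ c) (≈-trans (∑-*ˡ xs c f) (∑-cong xs λ x → *-comm c (f x)))

  ∑-swap : ∀ xs ys (f : A → B → C) → ∑ xs (λ x → ∑ ys (f x)) ≈ ∑ ys (λ y → ∑ xs (λ x → f x y))
  ∑-swap []       ys f = ≈-sym (∑-0 ys)
  ∑-swap (x ∷ xs) ys f = ≈-trans (+-congˡ (∑-swap xs ys f)) (≈-sym (∑-+ ys (f x) _))

  ∑-++ : ∀ xs ys (f : A → C) → ∑ (xs ++ ys) f ≈ ∑ xs f + ∑ ys f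
  ∑-++ []       ys f = ≈-sym (+-identityˡ _)
  ∑-++ (x ∷ xs) ys f = ≈-trans (+-congˡ (∑-++ xs ys f)) (≈-sym (+-assoc _ _ _))

  ∑-map : ∀ (h : B → A) xs (f : A → C) → ∑ (map h xs) f ≡ ∑ xs (f ∘ h)
  ∑-map h []       f = refl
  ∑-map h (x ∷ xs) f = cong (_+_ _) (∑-map h xs f)

  ∑-cartesianProductWith : ∀ {D : Set} (h : A → B → D) xs ys (f : D → C) →
    ∑ (cartesianProductWith h xs ys) f ≈ ∑ xs (λ x → ∑ ys (λ y → f (h x y)))
  ∑-cartesianProductWith h []       ys f = ≈-refl
  ∑-cartesianProductWith h (x ∷ xs) ys f = ≈-trans (∑-++ (map (h x) ys) _ f)
    (+-cong (reflexive (∑-map (h x) ys f)) (∑-cartesianProductWith h xs ys f))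

  -- Generalised distributivity. It splits a sum over all vertex labellings into one factor per
  -- vertex, and a sum over matrices into one factor per row.
  ∑-∏ : ∀ (E : Enumeration A) {n} (F : Fin n → A → C) →
    ∑ (elements (vecs E n)) (λ v → ∏ (λ i → F i (lookup v i))) ≈ ∏ (λ i → ∑ (elements E) (F i))
  ∑-∏ E {zero}  F = +-identityʳ 1#
  ∑-∏ E {suc n} F = begin
    ∑ (elements (vecs E (suc n))) (λ v → ∏ (λ i → F i (lookup v i)))
      ≈⟨ ∑-cartesianProductWith _∷_ (elements E) (elements (vecs E n)) _ ⟩
    ∑ (elements E) (λ x → ∑ (elements (vecs E n)) (λ v → F zero x * ∏ (λ i → F (suc i) (lookup v i))))
      ≈⟨ ∑-cong (elements E) (λ x → ≈-sym (∑-*ˡ (elements (vecs E n)) (F zero x) _)) ⟩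
    ∑ (elements E) (λ x → F zero x * ∑ (elements (vecs E n)) (λ v → ∏ (λ i → F (suc i) (lookup v i))))
      ≈⟨ ∑-*ʳ (elements E) _ (F zero) ⟨
    ∑ (elements E) (F zero) * ∑ (elements (vecs E n)) (λ v → ∏ (λ i → F (suc i) (lookup v i)))
      ≈⟨ *-congˡ (∑-∏ E (F ∘ suc)) ⟩
    ∏ (λ i → ∑ (elements E) (F i)) ∎

  module _ (E : Enumeration A) where
    open Enumeration E using (_≟_; unique; complete)

    private
      δ-∉ : ∀ {x₀ xs} (f : A → C) → All (x₀ ≢_) xs → ∑ xs (λ x → [ does (x ≟ x₀) ] * f x) ≈ 0#
      δ-∉ f []                       = ≈-refl
      δ-∉ {x₀} f (_∷_ {x} x₀≢x rest) with x ≟ x₀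
      ... | yes x≡x₀ = contradiction (sym x≡x₀) x₀≢x
      ... | no  _    = ≈-trans (+-cong (zeroˡ _) (δ-∉ f rest)) (+-identityˡ 0#)

      δ-∈ : ∀ {x₀ xs} (f : A → C) → Unique xs → x₀ ∈ xs → ∑ xs (λ x → [ does (x ≟ x₀) ] * f x) ≈ f x₀
      δ-∈ {x₀} f (x∉xs ∷ u) (here refl) with x₀ ≟ x₀
      ... | yes _   = ≈-trans (+-cong (*-identityˡ _) (δ-∉ f x∉xs)) (+-identityʳ _)
      ... | no  x≢x = contradiction refl x≢x
      δ-∈ {x₀} f (_∷_ {x} x∉xs u) (there x₀∈xs) with x ≟ x₀
      ... | yes refl = contradiction refl (All.lookup x∉xs x₀∈xs)
      ... | no  _    = ≈-trans (+-cong (zeroˡ _) (δ-∈ f u x₀∈xs)) (+-identityˡ _)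

    ∑-δ : ∀ x₀ (f : A → C) → ∑ (elements E) (λ x → [ does (x ≟ x₀) ] * f x) ≈ f x₀
    ∑-δ x₀ f = δ-∈ f unique (complete x₀)

    ∑-δ₁ : ∀ x₀ → ∑ (elements E) (λ x → [ does (x ≟ x₀) ]) ≈ 1#
    ∑-δ₁ x₀ = ≈-trans (∑-cong (elements E) (λ x → ≈-sym (*-identityʳ _))) (∑-δ x₀ (λ _ → 1#))

    -- Instead of permuting the list, `f (π x)` is expanded as a Kronecker sum over y and the two
    -- sums are swapped; each y is then hit exactly once, at `π⁻¹ y`.
    ∑-reindex : (π π⁻¹ : A → A) → (∀ x → π⁻¹ (π x) ≡ x) → (∀ x → π (π⁻¹ x) ≡ x) → ∀ f →
                ∑ (elements E) (f ∘ π) ≈ ∑ (elements E) f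
    ∑-reindex π π⁻¹ left right f = begin
      ∑ es (λ x → f (π x))
        ≈⟨ ∑-cong es (λ x → ≈-sym (∑-δ (π x) f)) ⟩
      ∑ es (λ x → ∑ es (λ y → [ does (y ≟ π x) ] * f y))
        ≈⟨ ∑-swap es es _ ⟩
      ∑ es (λ y → ∑ es (λ x → [ does (y ≟ π x) ] * f y))
        ≈⟨ ∑-cong es (λ y → ≈-sym (∑-*ʳ es (f y) _)) ⟩
      ∑ es (λ y → ∑ es (λ x → [ does (y ≟ π x) ]) * f y)
        ≈⟨ ∑-cong es (λ y → *-congʳ (≈-trans (∑-cong es (λ x → reflexive (cong [_] (flip x y)))) (∑-δ₁ (π⁻¹ y)))) ⟩
      ∑ es (λ y → 1# * f y)
        ≈⟨ ∑-cong es (λ y → *-identityˡ (f y)) ⟩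
      ∑ es f ∎
      where
      es = elements E
      flip : ∀ x y → does (y ≟ π x) ≡ does (x ≟ π⁻¹ y)
      flip x y with x ≟ π⁻¹ y
      ... | yes refl = dec-true (y ≟ π (π⁻¹ y)) (sym (right y))
      ... | no  x≢   = dec-false (y ≟ π x) (λ { refl → x≢ (sym (left x)) })

-- Ordered rings with decidable order, and elementary inequalities in them.

record OrderedRing : Set₁ where
  infix  4 _≤_
  infixl 6 _+_
  infixl 7 _*_
  infix  8 -_
  field
    Carrier           : Set
    _+_ _*_           : Op₂ Carrier
    -_                : Op₁ Carrier
    0# 1#             : Carrier
    isCommutativeRing : IsCommutativeRing _≡_ _+_ _*_ -_ 0# 1#
    _≤_               : Rel Carrier 0ℓ
    isDecTotalOrder   : IsDecTotalOrder _≡_ _≤_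
    +-mono-≤          : ∀ {x y u v} → x ≤ y → u ≤ v → x + u ≤ y + v
    *-nonNeg          : ∀ {x y} → 0# ≤ x → 0# ≤ y → 0# ≤ x * y
    -- `¬ z ≤ 0#` is the form in which strict positivity is used.
    *-cancelˡ-≤       : ∀ {x y} z → ¬ z ≤ 0# → z * x ≤ z * y → x ≤ y
    0≤1               : 0# ≤ 1#
    1≰0               : ¬ 1# ≤ 0#
    fromℤ             : ℤ → Carrier
    fromℤ-+           : ∀ i j → fromℤ (i ℤ.+ j) ≡ fromℤ i + fromℤ j
    fromℤ-*           : ∀ i j → fromℤ (i ℤ.* j) ≡ fromℤ i * fromℤ j
    fromℤ-neg         : ∀ i → fromℤ (ℤ.- i) ≡ - fromℤ i
    fromℤ-0           : fromℤ ℤ.0ℤ ≡ 0#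
    fromℤ-1           : fromℤ ℤ.1ℤ ≡ 1#
    -- recip k is 1/(k + 1).
    recip             : ℕ → Carrier
    suc*recip         : ∀ k → fromℤ (+ suc k) * (recip k) ≡ 1#

  commutativeRing : CommutativeRing 0ℓ 0ℓ
  commutativeRing = record { isCommutativeRing = isCommutativeRing }

module OrderedRingProperties (F : OrderedRing) where
  open OrderedRing F public renaming (Carrier to C)
  open CommutativeRing commutativeRing public
    using ( +-identityˡ; +-identityʳ; +-assoc; +-comm; *-identityˡ; *-identityʳ; *-assoc; *-comm
          ; zeroˡ; zeroʳ; distribˡ; distribʳ; -‿inverseʳ; commutativeSemiring; semiring)
  open IsDecTotalOrder isDecTotalOrder public
    using () renaming (refl to ≤-refl; trans to ≤-trans; antisym to ≤-antisym; total to ≤-total; _≤?_ to _≤?_; reflexive to ≤-reflexive)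
  open Sums commutativeSemiring public
  open Exp semiring public using (_^_; ^-homo-*; ^-assocʳ)
  open CExp commutativeSemiring public using (^-distrib-*)

  poset : Poset 0ℓ 0ℓ 0ℓ
  poset = record { isPartialOrder = IsDecTotalOrder.isPartialOrder isDecTotalOrder }

  module ≤-Reasoning = PosetReasoning poset

  infixl 6 _-_
  _-_ : C → C → C
  x - y = x + (- y)

  private
    R : ACR.AlmostCommutativeRing 0ℓ 0ℓ
    R = ACR.fromCommutativeRing commutativeRing

    -- Agrees with fromℤ, but makes the solver's constants 0 and 1 compute to 0# and 1#.
    numeral : ℤ → C
    numeral (+ 0) = 0#
    numeral (+ 1) = 1#
    numeral i     = fromℤ i

    numeral≡ : ∀ i → numeral i ≡ fromℤ i
    numeral≡ (+ 0)           = sym fromℤ-0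
    numeral≡ (+ 1)           = sym fromℤ-1
    numeral≡ (+ suc (suc _)) = refl
    numeral≡ -[1+ _ ]        = refl

    morphism : CommutativeRing.rawRing ℤ.+-*-commutativeRing ACR.-Raw-AlmostCommutative⟶ R
    morphism = record
      { ⟦_⟧    = numeral
      ; +-homo = λ i j → trans (numeral≡ (i ℤ.+ j)) (trans (fromℤ-+ i j) (sym (cong₂ _+_ (numeral≡ i) (numeral≡ j))))
      ; *-homo = λ i j → trans (numeral≡ (i ℤ.* j)) (trans (fromℤ-* i j) (sym (cong₂ _*_ (numeral≡ i) (numeral≡ j))))
      ; -‿homo = λ i → trans (numeral≡ (ℤ.- i)) (trans (fromℤ-neg i) (sym (cong -_ (numeral≡ i))))
      ; 0-homo = refl
      ; 1-homo = refl
      }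

  module S = RingSolver _ R morphism (λ i j → Maybe.map (cong numeral) (dec⇒maybe (i ℤ.≟ j)))
  open S public using (solve; _:=_; _:+_; _:*_; _:-_; :-_; con)

  private
    variable
      A : Set
      x y z u v : C

  fromℕ# : ℕ → C
  fromℕ# n = fromℤ (+ n)

  fromℕ#-suc : ∀ n → fromℕ# (suc n) ≡ 1# + fromℕ# n
  fromℕ#-suc n = trans (fromℤ-+ (+ 1) (+ n)) (cong (_+ fromℕ# n) fromℤ-1)

  fromℕ#-+ : ∀ m n → fromℕ# (m ℕ.+ n) ≡ fromℕ# m + fromℕ# n
  fromℕ#-+ m n = fromℤ-+ (+ m) (+ n)

  fromℕ#-* : ∀ m n → fromℕ# (m ℕ.* n) ≡ fromℕ# m * fromℕ# n
  fromℕ#-* m n = trans (cong fromℤ (ℤ.pos-* m n)) (fromℤ-* (+ m) (+ n))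

  fromℕ#-^ : ∀ m n → fromℕ# (m ℕ.^ n) ≡ fromℕ# m ^ n
  fromℕ#-^ m zero    = fromℤ-1
  fromℕ#-^ m (suc n) = trans (fromℕ#-* m (m ℕ.^ n)) (cong (fromℕ# m *_) (fromℕ#-^ m n))

  +-monoˡ : ∀ z → x ≤ y → x + z ≤ y + z
  +-monoˡ z p = +-mono-≤ p ≤-refl

  +-monoʳ : ∀ z → x ≤ y → z + x ≤ z + y
  +-monoʳ z p = +-mono-≤ ≤-refl p

  0≤y-x : x ≤ y → 0# ≤ y - x
  0≤y-x {x} {y} p = subst (_≤ y - x) (-‿inverseʳ x) (+-monoˡ (- x) p)

  0≤y-x⇒x≤y : 0# ≤ y - x → x ≤ y
  0≤y-x⇒x≤y {y} {x} p = subst₂ _≤_ (+-identityʳ x) (solve 2 (λ x y → x :+ (y :- x) := y) refl x y) (+-monoʳ x p)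

  0≤+ : 0# ≤ x → 0# ≤ y → 0# ≤ x + y
  0≤+ {x} {y} p q = subst (_≤ x + y) (+-identityˡ 0#) (+-mono-≤ p q)

  x≤x+y : 0# ≤ y → x ≤ x + y
  x≤x+y {y} {x} p = subst (_≤ x + y) (+-identityʳ x) (+-monoʳ x p)

  x≤y+x : 0# ≤ y → x ≤ y + x
  x≤y+x {y} {x} p = subst (_≤ y + x) (+-identityˡ x) (+-monoˡ x p)

  x-y≤x : 0# ≤ y → x - y ≤ x
  x-y≤x {y} {x} p = 0≤y-x⇒x≤y (subst (0# ≤_) (solve 2 (λ x y → y := x :- (x :- y)) refl x y) p)

  *-monoˡ : 0# ≤ z → x ≤ y → z * x ≤ z * y
  *-monoˡ {z} {x} {y} p q = 0≤y-x⇒x≤y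
    (subst (0# ≤_) (solve 3 (λ x y z → z :* (y :- x) := z :* y :- z :* x) refl x y z) (*-nonNeg p (0≤y-x q)))

  *-monoʳ : 0# ≤ z → x ≤ y → x * z ≤ y * z
  *-monoʳ {z} {x} {y} p q = subst₂ _≤_ (*-comm z x) (*-comm z y) (*-monoˡ p q)

  *-mono : 0# ≤ x → 0# ≤ v → x ≤ y → u ≤ v → x * u ≤ y * v
  *-mono p q r s = ≤-trans (*-monoˡ p s) (*-monoʳ q r)

  0≤x² : ∀ x → 0# ≤ x * x
  0≤x² x with ≤-total 0# x
  ... | inj₁ p = *-nonNeg p p
  ... | inj₂ p = subst (0# ≤_) (solve 1 (λ x → (:- x) :* (:- x) := x :* x) refl x) (*-nonNeg q q)
    where
    q : 0# ≤ - x
    q = subst (0# ≤_) (+-identityˡ (- x)) (0≤y-x p)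

  -- Decidability of the order replaces the square root: otherwise x is positive and y ≤ x, and x
  -- cancels from x x ≤ y y ≤ x y.
  x²≤y²⇒x≤y : 0# ≤ y → x * x ≤ y * y → x ≤ y
  x²≤y²⇒x≤y {y} {x} 0≤y x²≤y² with x ≤? y
  ... | yes x≤y = x≤y
  ... | no  x≰y = *-cancelˡ-≤ x (λ x≤0 → x≰y (≤-trans x≤0 0≤y)) (≤-trans x²≤y² (*-monoʳ 0≤y y≤x))
    where
    y≤x : y ≤ x
    y≤x = [ (λ x≤y → contradiction x≤y x≰y) , id ]′ (≤-total x y)

  0≤fromℕ : ∀ n → 0# ≤ fromℕ# n
  0≤fromℕ zero    = ≤-reflexive (sym fromℤ-0)
  0≤fromℕ (suc n) = subst (0# ≤_) (sym (fromℕ#-suc n)) (0≤+ 0≤1 (0≤fromℕ n))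

  fromℕ-mono : ∀ {m n} → m ℕ.≤ n → fromℕ# m ≤ fromℕ# n
  fromℕ-mono {n = n} ℕ.z≤n = subst (_≤ fromℕ# n) (sym fromℤ-0) (0≤fromℕ n)
  fromℕ-mono (ℕ.s≤s {m} {n} p) = subst₂ _≤_ (sym (fromℕ#-suc m)) (sym (fromℕ#-suc n)) (+-monoʳ 1# (fromℕ-mono p))

  1≤suc : ∀ k → 1# ≤ fromℕ# (suc k)
  1≤suc k = subst (_≤ fromℕ# (suc k)) fromℤ-1 (fromℕ-mono {1} (ℕ.s≤s ℕ.z≤n))

  suc≰0 : ∀ k → ¬ fromℕ# (suc k) ≤ 0#
  suc≰0 k p = 1≰0 (≤-trans (1≤suc k) p)

  0≤recip : ∀ k → 0# ≤ recip k
  0≤recip k = *-cancelˡ-≤ (fromℕ# (suc k)) (suc≰0 k)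
    (subst₂ _≤_ (sym (zeroʳ _)) (sym (suc*recip k)) 0≤1)

  recip≤1 : ∀ k → recip k ≤ 1#
  recip≤1 k = *-cancelˡ-≤ (fromℕ# (suc k)) (suc≰0 k)
    (subst₂ _≤_ (sym (suc*recip k)) (sym (*-identityʳ _)) (1≤suc k))

  recip*suc : ∀ k → recip k * fromℕ# (suc k) ≡ 1#
  recip*suc k = trans (*-comm _ _) (suc*recip k)

  recip-unscale : ∀ k → fromℕ# (suc k) * x ≤ y → x ≤ recip k * y
  recip-unscale {x} {y} k p = subst (_≤ recip k * y)
    (trans (sym (*-assoc _ _ _)) (trans (cong (_* x) (recip*suc k)) (*-identityˡ x)))
    (*-monoˡ (0≤recip k) p)

  0≤^ : 0# ≤ x → ∀ n → 0# ≤ x ^ n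
  0≤^ p zero    = 0≤1
  0≤^ p (suc n) = *-nonNeg p (0≤^ p n)

  ^-mono : 0# ≤ x → x ≤ y → ∀ n → x ^ n ≤ y ^ n
  ^-mono p q zero    = ≤-refl
  ^-mono p q (suc n) = *-mono p (0≤^ (≤-trans p q) n) q (^-mono p q n)

  1≤^ : 1# ≤ x → ∀ n → 1# ≤ x ^ n
  1≤^ p zero    = ≤-refl
  1≤^ {x} p (suc n) = subst (_≤ x * x ^ n) (*-identityˡ 1#) (*-mono 0≤1 (≤-trans 0≤1 (1≤^ p n)) p (1≤^ p n))

  ^≤1 : 0# ≤ x → x ≤ 1# → ∀ n → x ^ n ≤ 1#
  ^≤1 p q zero    = ≤-refl
  ^≤1 {x} p q (suc n) = subst (x * x ^ n ≤_) (*-identityˡ 1#) (*-mono p 0≤1 q (^≤1 p q n))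

  ^-antitone : 0# ≤ x → x ≤ 1# → ∀ {m n} → m ℕ.≤ n → x ^ n ≤ x ^ m
  ^-antitone p q {n = n} ℕ.z≤n = ^≤1 p q n
  ^-antitone p q (ℕ.s≤s r)     = *-monoˡ p (^-antitone p q r)

  ^-monotone : 1# ≤ x → ∀ {m n} → m ℕ.≤ n → x ^ m ≤ x ^ n
  ^-monotone p {n = n} ℕ.z≤n = 1≤^ p n
  ^-monotone p (ℕ.s≤s r)     = *-monoˡ (≤-trans 0≤1 p) (^-monotone p r)

  ∑-mono : ∀ (xs : List A) {f g : A → C} → (∀ x → f x ≤ g x) → ∑ xs f ≤ ∑ xs g
  ∑-mono []       h = ≤-refl
  ∑-mono (x ∷ xs) h = +-mono-≤ (h x) (∑-mono xs h)

  ∑-nonNeg : ∀ (xs : List A) {f : A → C} → (∀ x → 0# ≤ f x) → 0# ≤ ∑ xs f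
  ∑-nonNeg []       h = ≤-refl
  ∑-nonNeg (x ∷ xs) h = 0≤+ (h x) (∑-nonNeg xs h)

  term≤∑ : ∀ {xs : List A} {f : A → C} → (∀ x → 0# ≤ f x) → ∀ {x} → x ∈ xs → f x ≤ ∑ xs f
  term≤∑ {xs = _ ∷ xs} h (here refl)  = x≤x+y (∑-nonNeg xs h)
  term≤∑               h (there x∈xs) = ≤-trans (term≤∑ h x∈xs) (x≤y+x (h _))

  ∑-const : ∀ (xs : List A) c → ∑ xs (λ _ → c) ≡ fromℕ# (length xs) * c
  ∑-const []       c = sym (trans (cong (_* c) fromℤ-0) (zeroˡ c))
  ∑-const (x ∷ xs) c = trans (cong (_+_ c) (∑-const xs c))
    (trans (solve 2 (λ c n → c :+ n :* c := (con (+ 1) :+ n) :* c) refl c (fromℕ# (length xs)))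
      (cong (_* c) (sym (fromℕ#-suc (length xs)))))

  ∏-nonNeg : ∀ {n} {f : Fin n → C} → (∀ i → 0# ≤ f i) → 0# ≤ ∏ f
  ∏-nonNeg {zero}  h = 0≤1
  ∏-nonNeg {suc n} h = *-nonNeg (h zero) (∏-nonNeg (h ∘ suc))

  ∏-mono : ∀ {n} {f g : Fin n → C} → (∀ i → 0# ≤ f i) → (∀ i → f i ≤ g i) → ∏ f ≤ ∏ g
  ∏-mono {zero}  p q = ≤-refl
  ∏-mono {suc n} p q = *-mono (p zero) (≤-trans (∏-nonNeg (p ∘ suc)) (∏-mono (p ∘ suc) (q ∘ suc)))
    (q zero) (∏-mono (p ∘ suc) (q ∘ suc))

  ∏-const : ∀ n c → ∏ {n} (λ _ → c) ≡ c ^ n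
  ∏-const zero    c = refl
  ∏-const (suc n) c = cong (c *_) (∏-const n c)

  0≤[] : ∀ b → 0# ≤ [ b ]
  0≤[] true  = 0≤1
  0≤[] false = ≤-refl

  []≤1 : ∀ b → [ b ] ≤ 1#
  []≤1 true  = ≤-refl
  []≤1 false = 0≤1

  -- (1 - x) ^ k ≤ 1 / (1 + x) ^ k ≤ 1 / (1 + k x)
  bernoulli : 0# ≤ x → x ≤ 1# → ∀ k → (1# - x) ^ k * (1# + fromℕ# k * x) ≤ 1#
  bernoulli {x} p q zero = ≤-reflexive (trans (*-identityˡ _)
    (trans (cong (λ z → 1# + z * x) fromℤ-0) (trans (cong (_+_ 1#) (zeroˡ x)) (+-identityʳ 1#))))
  bernoulli {x} p q (suc k) = begin
    ((1# - x) * (1# - x) ^ k) * (1# + fromℕ# (suc k) * x)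
      ≡⟨ cong (λ z → ((1# - x) * (1# - x) ^ k) * (1# + z * x)) (fromℕ#-suc k) ⟩
    ((1# - x) * (1# - x) ^ k) * (1# + (1# + fromℕ# k) * x)
      ≡⟨ solve 3 (λ x r n → ((con (+ 1) :- x) :* r) :* (con (+ 1) :+ (con (+ 1) :+ n) :* x)
                         := r :* ((con (+ 1) :+ n :* x) :- (con (+ 1) :+ n) :* (x :* x)))
           refl x ((1# - x) ^ k) (fromℕ# k) ⟩
    (1# - x) ^ k * ((1# + fromℕ# k * x) - (1# + fromℕ# k) * (x * x))
      ≤⟨ *-monoˡ (0≤^ (0≤y-x q) k) (x-y≤x (*-nonNeg (0≤+ 0≤1 (0≤fromℕ k)) (0≤x² x))) ⟩
    (1# - x) ^ k * (1# + fromℕ# k * x)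
      ≤⟨ bernoulli p q k ⟩
    1# ∎
    where open ≤-Reasoning

  rate : ℕ → C
  rate k = 1# - recip k

  0≤rate : ∀ k → 0# ≤ rate k
  0≤rate k = 0≤y-x (recip≤1 k)

  rate≤1 : ∀ k → rate k ≤ 1#
  rate≤1 k = x-y≤x (0≤recip k)

  -- j + 1 ≤ (k + 1) + j = (k + 1)(1 + j/(k + 1)), and `bernoulli` bounds the last factor times
  -- `rate k ^ j` by 1. The thresholds `blockLength` and `k₁` come from this crude 1/j decay.
  suc*rate^≤ : ∀ k j → fromℕ# (suc j) * rate k ^ j ≤ fromℕ# (suc k)
  suc*rate^≤ k j = begin
    fromℕ# (suc j) * r ^ j
      ≤⟨ *-monoʳ (0≤^ (0≤rate k) j) (fromℕ-mono (ℕ.s≤s (ℕ.m≤n+m j k))) ⟩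
    fromℕ# (suc k ℕ.+ j) * r ^ j
      ≡⟨ cong (_* r ^ j) (fromℕ#-+ (suc k) j) ⟩
    (fromℕ# (suc k) + fromℕ# j) * r ^ j
      ≡⟨ cong (λ z → (fromℕ# (suc k) + z) * r ^ j) (*-identityʳ (fromℕ# j)) ⟨
    (fromℕ# (suc k) + fromℕ# j * 1#) * r ^ j
      ≡⟨ cong (λ o → (fromℕ# (suc k) + fromℕ# j * o) * r ^ j) (suc*recip k) ⟨
    (fromℕ# (suc k) + fromℕ# j * (fromℕ# (suc k) * recip k)) * r ^ j
      ≡⟨ solve 4 (λ a b t r → (a :+ b :* (a :* t)) :* r := a :* (r :* (con (+ 1) :+ b :* t)))
           refl (fromℕ# (suc k)) (fromℕ# j) (recip k) (r ^ j) ⟩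
    fromℕ# (suc k) * (r ^ j * (1# + fromℕ# j * recip k))
      ≤⟨ *-monoˡ (0≤fromℕ (suc k)) (bernoulli (0≤recip k) (recip≤1 k) j) ⟩
    fromℕ# (suc k) * 1#
      ≡⟨ *-identityʳ _ ⟩
    fromℕ# (suc k) ∎
    where
    open ≤-Reasoning
    r = rate k

  rate^-small : ∀ k Z j → suc k ℕ.* Z ℕ.≤ suc j → fromℕ# Z * rate k ^ j ≤ 1#
  rate^-small k Z j h = *-cancelˡ-≤ (fromℕ# (suc k)) (suc≰0 k) (begin
    fromℕ# (suc k) * (fromℕ# Z * rate k ^ j) ≡⟨ *-assoc _ _ _ ⟨
    (fromℕ# (suc k) * fromℕ# Z) * rate k ^ j ≡⟨ cong (_* rate k ^ j) (fromℕ#-* (suc k) Z) ⟨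
    fromℕ# (suc k ℕ.* Z) * rate k ^ j        ≤⟨ *-monoʳ (0≤^ (0≤rate k) j) (fromℕ-mono h) ⟩
    fromℕ# (suc j) * rate k ^ j              ≤⟨ suc*rate^≤ k j ⟩
    fromℕ# (suc k)                           ≡⟨ *-identityʳ _ ⟨
    fromℕ# (suc k) * 1#                      ∎)
    where open ≤-Reasoning

  -- The index is 2k + 1, written so that its successor is definitionally `2 ℕ.* suc k`.
  recip-double : ∀ k → recip (k ℕ.+ suc (k ℕ.+ 0)) + recip (k ℕ.+ suc (k ℕ.+ 0)) ≡ recip k
  recip-double k = begin
    r + r                                  ≡⟨ trans (cong (_* (r + r)) (suc*recip k)) (*-identityˡ _) ⟨
    (fromℕ# (suc k) * recip k) * (r + r)   ≡⟨ solve 3 (λ n i r → (n :* i) :* (r :+ r) := i :* ((con (+ 2) :* n) :* r)) refl (fromℕ# (suc k)) (recip k) r ⟩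
    recip k * ((fromℕ# 2 * fromℕ# (suc k)) * r)
      ≡⟨ cong (λ z → recip k * (z * r)) (fromℕ#-* 2 (suc k)) ⟨
    recip k * (fromℕ# (suc (k ℕ.+ suc (k ℕ.+ 0))) * r)
      ≡⟨ trans (cong (recip k *_) (suc*recip _)) (*-identityʳ _) ⟩
    recip k                                ∎
    where
    open ≡.≡-Reasoning
    r = recip (k ℕ.+ suc (k ℕ.+ 0))

  recip-antitone : ∀ {j k} → j ℕ.≤ k → recip k ≤ recip j
  recip-antitone {j} {k} j≤k = begin
    recip k                                   ≡⟨ *-identityʳ (recip k) ⟨
    recip k * 1#                              ≡⟨ cong (recip k *_) (recip*suc j) ⟨
    recip k * (recip j * fromℕ# (suc j))      ≤⟨ *-monoˡ (0≤recip k) (*-monoˡ (0≤recip j) (fromℕ-mono (ℕ.s≤s j≤k))) ⟩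
    recip k * (recip j * fromℕ# (suc k))      ≡⟨ solve 3 (λ i j n → i :* (j :* n) := j :* (n :* i)) refl (recip k) (recip j) (fromℕ# (suc k)) ⟩
    recip j * (fromℕ# (suc k) * recip k)      ≡⟨ trans (cong (recip j *_) (suc*recip k)) (*-identityʳ _) ⟩
    recip j                                   ∎
    where open ≤-Reasoning

  negate-≤ : ∀ {x y} → x ≤ y → 1# - y ≤ 1# - x
  negate-≤ {x} {y} h = 0≤y-x⇒x≤y (subst (0# ≤_) (solve 2 (λ x y → y :- x := (con (+ 1) :- x) :- (con (+ 1) :- y)) refl x y) (0≤y-x h))

  -- The cross term σ · 2nσ of the induction step is at most σ; the factor 2 in the bound pays for
  -- it.
  [1+σ]^≤ : ∀ {σ} → 0# ≤ σ → ∀ n → fromℕ# 2 * (fromℕ# n * σ) ≤ 1# → (1# + σ) ^ n ≤ 1# + fromℕ# 2 * (fromℕ# n * σ)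
  [1+σ]^≤ {σ} 0≤σ zero    _ = x≤x+y (*-nonNeg (0≤fromℕ 2) (*-nonNeg (0≤fromℕ 0) 0≤σ))
  [1+σ]^≤ {σ} 0≤σ (suc n) h = begin
    (1# + σ) * (1# + σ) ^ n
      ≤⟨ *-monoˡ (0≤+ 0≤1 0≤σ) ([1+σ]^≤ 0≤σ n 2nσ≤1) ⟩
    (1# + σ) * (1# + fromℕ# 2 * (fromℕ# n * σ))
      ≡⟨ solve 2 (λ s x → (con (+ 1) :+ s) :* (con (+ 1) :+ x) := (con (+ 1) :+ (x :+ s)) :+ s :* x) refl σ (fromℕ# 2 * (fromℕ# n * σ)) ⟩
    (1# + (fromℕ# 2 * (fromℕ# n * σ) + σ)) + σ * (fromℕ# 2 * (fromℕ# n * σ))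
      ≤⟨ +-monoʳ _ (≤-trans (*-monoˡ 0≤σ 2nσ≤1) (≤-reflexive (*-identityʳ σ))) ⟩
    (1# + (fromℕ# 2 * (fromℕ# n * σ) + σ)) + σ
      ≡⟨ solve 2 (λ s n → (con (+ 1) :+ (con (+ 2) :* (n :* s) :+ s)) :+ s := con (+ 1) :+ con (+ 2) :* ((con (+ 1) :+ n) :* s)) refl σ (fromℕ# n) ⟩
    1# + fromℕ# 2 * ((1# + fromℕ# n) * σ)
      ≡⟨ cong (λ z → 1# + fromℕ# 2 * (z * σ)) (fromℕ#-suc n) ⟨
    1# + fromℕ# 2 * (fromℕ# (suc n) * σ) ∎
    where
    open ≤-Reasoning
    2nσ≤1 : fromℕ# 2 * (fromℕ# n * σ) ≤ 1#
    2nσ≤1 = ≤-trans (*-monoˡ (0≤fromℕ 2) (*-monoʳ 0≤σ (fromℕ-mono (ℕ.n≤1+n n)))) h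

  ≤[1-σ]^ : ∀ {σ} → 0# ≤ σ → σ ≤ 1# → ∀ n → 1# - fromℕ# n * σ ≤ (1# - σ) ^ n
  ≤[1-σ]^ {σ} 0≤σ σ≤1 zero    = x-y≤x (*-nonNeg (0≤fromℕ 0) 0≤σ)
  ≤[1-σ]^ {σ} 0≤σ σ≤1 (suc n) = begin
    1# - fromℕ# (suc n) * σ
      ≡⟨ cong (λ z → 1# - z * σ) (fromℕ#-suc n) ⟩
    1# - (1# + fromℕ# n) * σ
      ≤⟨ x≤x+y (*-nonNeg (0≤fromℕ n) (0≤x² σ)) ⟩
    (1# - (1# + fromℕ# n) * σ) + fromℕ# n * (σ * σ)
      ≡⟨ solve 2 (λ s n → (con (+ 1) :- (con (+ 1) :+ n) :* s) :+ n :* (s :* s) := (con (+ 1) :- s) :* (con (+ 1) :- n :* s)) refl σ (fromℕ# n) ⟩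
    (1# - σ) * (1# - fromℕ# n * σ)
      ≤⟨ *-monoˡ (0≤y-x σ≤1) (≤[1-σ]^ 0≤σ σ≤1 n) ⟩
    (1# - σ) * (1# - σ) ^ n ∎
    where open ≤-Reasoning

-- Common prime divisors, and finite abelian groups killed by a.

prime-divisor : ∀ g .{{_ : NonZero g}} → g ≢ 1 → ∃[ p ] Prime p × p ∣ g
prime-divisor g g≢1 with factorise g
... | record { factors = [] ; isFactorisation = g≡1 } = contradiction g≡1 g≢1
... | record { factors = p ∷ ps ; isFactorisation = g≡ ; factorsPrime = p-prime ∷ _ } =
  p , p-prime , subst (p ∣_) (sym g≡) (ℕ∣.m∣m*n _)

gcds : ℕ → List ℕ → ℕ
gcds = foldr gcd

gcds-∣ : ∀ a us → gcds a us ∣ a × All (gcds a us ∣_) us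
gcds-∣ a []       = ℕ∣.∣-refl , []
gcds-∣ a (u ∷ us) = let (∣a , ∣us) = gcds-∣ a us in
    ℕ∣.∣-trans (GCD.gcd[m,n]∣n u (gcds a us)) ∣a
  , GCD.gcd[m,n]∣m u (gcds a us) ∷ All.map (ℕ∣.∣-trans (GCD.gcd[m,n]∣n u (gcds a us))) ∣us

-- A divisor of the nonzero a is nonzero, so it has a prime factor unless it is 1. Both uses of
-- balance, in `likely-gcd` and in `coset-mass`, go through this.
common-prime : ∀ a .{{_ : NonZero a}} us → gcds a us ≢ 1 → ∃[ p ] Prime p × p ∣ a × All (p ∣_) us
common-prime a us g≢1 = let (p , p-prime , p∣g) = prime-divisor (gcds a us) g≢1 in
  p , p-prime , ℕ∣.∣-trans p∣g ∣a , All.map (ℕ∣.∣-trans p∣g) (proj₂ (gcds-∣ a us))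
  where
  ∣a = proj₁ (gcds-∣ a us)
  instance
    g≢0 : NonZero (gcds a us)
    g≢0 = ℕ.≢-nonZero λ g≡0 → ℕ.≢-nonZero⁻¹ a (ℕ∣.0∣⇒≡0 (subst (_∣ a) g≡0 ∣a))

-- Carried by Fin size, so that its equality is propositional.
record TorsionGroup (a : ℕ) : Set where
  infixl 6 _⊕_
  infix  8 ⊖_
  field
    size           : ℕ
    _⊕_            : Op₂ (Fin size)
    0̂              : Fin size
    ⊖_             : Op₁ (Fin size)
    isAbelianGroup : IsAbelianGroup _≡_ _⊕_ 0̂ ⊖_

  X : Set
  X = Fin size

  abelianGroup : AbelianGroup 0ℓ 0ℓ
  abelianGroup = record { isAbelianGroup = isAbelianGroup }

  open CMMult (AbelianGroup.commutativeMonoid abelianGroup) public using () renaming (_×_ to infixr 8 _·_)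

  field
    torsion : ∀ x → a · x ≡ 0̂

module TorsionGroupProperties (a : ℕ) .{{_ : NonZero a}} (G : TorsionGroup a) where
  open TorsionGroup G public
  open AbelianGroup abelianGroup public
    using () renaming (assoc to ⊕-assoc; comm to ⊕-comm; identityˡ to ⊕-identityˡ; identityʳ to ⊕-identityʳ; inverseˡ to ⊕-inverseˡ; inverseʳ to ⊕-inverseʳ)
  private
    module CM = CMMult (AbelianGroup.commutativeMonoid abelianGroup)
    module G = GroupProperties (AbelianGroup.group abelianGroup)
    module AG = AbelianGroupProperties abelianGroup
  open ≡.≡-Reasoning

  infixl 6 _⊝_
  _⊝_ : Op₂ X
  x ⊝ y = x ⊕ ⊖ y

  ⊝-⊕ : ∀ x y z → x ⊝ (y ⊕ z) ≡ (x ⊝ y) ⊝ z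
  ⊝-⊕ x y z = trans (cong (x ⊕_) (sym (AG.⁻¹-∙-comm y z))) (sym (⊕-assoc x (⊖ y) (⊖ z)))

  ⊝-comm : ∀ x y z → (x ⊝ y) ⊝ z ≡ (x ⊝ z) ⊝ y
  ⊝-comm x y z = trans (sym (⊝-⊕ x y z)) (trans (cong (x ⊝_) (⊕-comm y z)) (⊝-⊕ x z y))

  ⊕-⊝ : ∀ x y → (x ⊕ y) ⊝ y ≡ x
  ⊕-⊝ x y = G.//-rightDividesʳ y x

  ⊝-⊕-cancel : ∀ x y → (x ⊝ y) ⊕ y ≡ x
  ⊝-⊕-cancel x y = G.//-rightDividesˡ y x

  ⊖-⊝ : ∀ x y → ⊖ (x ⊝ y) ≡ y ⊝ x
  ⊖-⊝ = AG.⁻¹-anti-homo‿-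

  ⊖-⊖ : ∀ x → ⊖ ⊖ x ≡ x
  ⊖-⊖ = G.⁻¹-involutive

  ⊝-0 : ∀ x → x ⊝ 0̂ ≡ x
  ⊝-0 x = trans (cong (x ⊕_) G.ε⁻¹≈ε) (⊕-identityʳ x)

  ⊝≡0⇒≡ : ∀ {x y} → x ⊝ y ≡ 0̂ → x ≡ y
  ⊝≡0⇒≡ {x} {y} = G.x∙y⁻¹≈ε⇒x≈y x y

  ⊝-⊝ : ∀ c x → c ⊝ (c ⊝ x) ≡ x
  ⊝-⊝ c x = begin
    c ⊕ ⊖ (c ⊝ x) ≡⟨ cong (c ⊕_) (⊖-⊝ c x) ⟩
    c ⊕ (x ⊝ c)   ≡⟨ ⊕-comm c (x ⊝ c) ⟩
    (x ⊝ c) ⊕ c   ≡⟨ ⊝-⊕-cancel x c ⟩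
    x             ∎

  ⊝-⊝-⊝ : ∀ x y z → (x ⊝ z) ⊝ (y ⊝ z) ≡ x ⊝ y
  ⊝-⊝-⊝ x y z = begin
    (x ⊝ z) ⊝ (y ⊝ z)   ≡⟨ ⊝-comm x z (y ⊝ z) ⟩
    (x ⊝ (y ⊝ z)) ⊝ z   ≡⟨ ⊝-⊕ x (y ⊝ z) z ⟨
    x ⊝ ((y ⊝ z) ⊕ z)   ≡⟨ cong (x ⊝_) (⊝-⊕-cancel y z) ⟩
    x ⊝ y               ∎

  ·-+ : ∀ m n x → (m ℕ.+ n) · x ≡ m · x ⊕ n · x
  ·-+ m n x = CM.×-homo-+ x m n

  ·-* : ∀ m n x → m · n · x ≡ (m ℕ.* n) · x
  ·-* m n x = CM.×-assocˡ x m n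

  ·-0̂ : ∀ k → k · 0̂ ≡ 0̂
  ·-0̂ zero    = refl
  ·-0̂ (suc k) = trans (⊕-identityˡ _) (·-0̂ k)

  ·-⊕ : ∀ k x y → k · (x ⊕ y) ≡ k · x ⊕ k · y
  ·-⊕ k x y = CM.×-distrib-+ x y k

  ·-⊖ : ∀ k x → k · (⊖ x) ≡ ⊖ (k · x)
  ·-⊖ k x = G.inverseʳ-unique (k · x) (k · (⊖ x))
    (trans (sym (·-⊕ k x (⊖ x))) (trans (cong (k ·_) (⊕-inverseʳ x)) (·-0̂ k)))

  ·-⊝ : ∀ k x y → k · (x ⊝ y) ≡ k · x ⊝ k · y
  ·-⊝ k x y = trans (·-⊕ k x (⊖ y)) (cong (k · x ⊕_) (·-⊖ k y))

  a∣⇒·≡0 : ∀ {k} → a ∣ k → ∀ x → k · x ≡ 0̂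
  a∣⇒·≡0 {k} (divides q refl) x = begin
    (q ℕ.* a) · x ≡⟨ ·-* q a x ⟨
    q · a · x     ≡⟨ cong (q ·_) (torsion x) ⟩
    q · 0̂         ≡⟨ ·-0̂ q ⟩
    0̂             ∎

  ·-% : ∀ k x → (k ℕ/.% a) · x ≡ k · x
  ·-% k x = sym (begin
    k · x                                              ≡⟨ cong (_· x) (ℕ/.m≡m%n+[m/n]*n k a) ⟩
    (k ℕ/.% a ℕ.+ (k ℕ/./ a) ℕ.* a) · x                ≡⟨ ·-+ (k ℕ/.% a) _ x ⟩
    (k ℕ/.% a) · x ⊕ ((k ℕ/./ a) ℕ.* a) · x            ≡⟨ cong ((k ℕ/.% a) · x ⊕_) (a∣⇒·≡0 (divides (k ℕ/./ a) refl) x) ⟩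
    (k ℕ/.% a) · x ⊕ 0̂                                 ≡⟨ ⊕-identityʳ _ ⟩
    (k ℕ/.% a) · x                                     ∎)

  -- The difference t - t₀ modulo a, kept a natural number because `_·_` takes natural multiples.
  offset : Fin a → Fin a → ℕ
  offset t₀ t = toℕ t ℕ.+ (a ℕ.∸ toℕ t₀)

  offset-· : ∀ t₀ t v → offset t₀ t · v ≡ toℕ t · v ⊝ toℕ t₀ · v
  offset-· t₀ t v = trans (·-+ (toℕ t) _ v) (cong (toℕ t · v ⊕_) (G.inverseˡ-unique _ _
    (trans (sym (·-+ (a ℕ.∸ toℕ t₀) (toℕ t₀) v))
      (trans (cong (_· v) (ℕ.m∸n+n≡m (ℕ.<⇒≤ (Fin.toℕ<n t₀)))) (torsion v)))))

  bezout-· : ∀ i j u w {d} x → d ℕ.+ j ℕ.* w ≡ i ℕ.* u → d · x ≡ i · u · x ⊝ j · w · x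
  bezout-· i j u w {d} x eq = sym (begin
    i · u · x ⊝ j · w · x                     ≡⟨ cong₂ _⊝_ (·-* i u x) (·-* j w x) ⟩
    (i ℕ.* u) · x ⊝ (j ℕ.* w) · x             ≡⟨ cong (λ e → e · x ⊝ (j ℕ.* w) · x) eq ⟨
    (d ℕ.+ j ℕ.* w) · x ⊝ (j ℕ.* w) · x       ≡⟨ cong (_⊝ (j ℕ.* w) · x) (·-+ d _ x) ⟩
    (d · x ⊕ (j ℕ.* w) · x) ⊝ (j ℕ.* w) · x   ≡⟨ ⊕-⊝ _ _ ⟩
    d · x                                     ∎)

  -- With natural coefficients, Bézout's identity is a subtraction in one order or the other; hence
  -- the two alternatives.
  gcd-· : ∀ u w x → ∃[ i ] ∃[ j ] (gcd u w · x ≡ i · u · x ⊝ j · w · x ⊎ gcd u w · x ≡ j · w · x ⊝ i · u · x)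
  gcd-· u w x with GCD.Bézout.identity (GCD.gcd-GCD u w)
  ... | GCD.Bézout.+- i j eq = i , j , inj₁ (bezout-· i j u w x eq)
  ... | GCD.Bézout.-+ i j eq = i , j , inj₂ (bezout-· j i w u x eq)

  record IsSubgroup (H : X → Set) : Set where
    field
      0∈ : H 0̂
      ⊕∈ : ∀ {x y} → H x → H y → H (x ⊕ y)
      ⊖∈ : ∀ {x} → H x → H (⊖ x)

    ⊝∈ : ∀ {x y} → H x → H y → H (x ⊝ y)
    ⊝∈ x∈ y∈ = ⊕∈ x∈ (⊖∈ y∈)

    ·∈ : ∀ k {x} → H x → H (k · x)
    ·∈ zero    x∈ = 0∈
    ·∈ (suc k) x∈ = ⊕∈ x∈ (·∈ k x∈)

    ⊝∈⁻ : ∀ {x y} → H (x ⊝ y) → H y → H x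
    ⊝∈⁻ {x} {y} x-y∈ y∈ = subst H (⊝-⊕-cancel x y) (⊕∈ x-y∈ y∈)

    gcd∈ : ∀ u w {x} → H (u · x) → H (w · x) → H (gcd u w · x)
    gcd∈ u w {x} u∈ w∈ with gcd-· u w x
    ... | i , j , inj₁ eq = subst H (sym eq) (⊝∈ (·∈ i u∈) (·∈ j w∈))
    ... | i , j , inj₂ eq = subst H (sym eq) (⊝∈ (·∈ j w∈) (·∈ i u∈))

    -- Bézout along the list. The gcd also involves a, and `a · x` is `0̂`, so it lies in H.
    gcds∈ : ∀ us {x} → All (λ u → H (u · x)) us → H (gcds a us · x)
    gcds∈ []       {x} []         = subst H (sym (torsion x)) 0∈
    gcds∈ (u ∷ us) {x} (u∈ ∷ us∈) = gcd∈ u (gcds a us) u∈ (gcds∈ us us∈)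

  -- Coefficients below a suffice because a kills the group; being finite in number, they make
  -- membership decidable by search.
  span : List X → X → Set
  span []       x = x ≡ 0̂
  span (v ∷ vs) x = ∃[ c ] span vs (x ⊝ toℕ {a} c · v)

  span? : ∀ vs → Decidable (span vs)
  span? []       x = x Fin.≟ 0̂
  span? (v ∷ vs) x = Fin.any? (λ c → span? vs (x ⊝ toℕ c · v))

  span-∷ : ∀ {v vs x} k → span vs (x ⊝ k · v) → span (v ∷ vs) x
  span-∷ {v} {vs} {x} k h = Fin.fromℕ< (ℕ/.m%n<n k a) ,
    subst (λ y → span vs (x ⊝ y)) (sym (trans (cong (_· v) (Fin.toℕ-fromℕ< (ℕ/.m%n<n k a))) (·-% k v))) h

  span-isSubgroup : ∀ vs → IsSubgroup (span vs)
  span-isSubgroup [] = record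
    { 0∈ = refl
    ; ⊕∈ = λ { refl refl → ⊕-identityˡ 0̂ }
    ; ⊖∈ = λ { refl → G.ε⁻¹≈ε }
    }
  span-isSubgroup (v ∷ vs) = record
    { 0∈ = span-∷ 0 (subst (span vs) (sym (⊝-0 0̂)) 0∈)
    ; ⊕∈ = λ {x} {y} (c , x∈) (d , y∈) → span-∷ (toℕ c ℕ.+ toℕ d) (subst (span vs) (split x y c d) (⊕∈ x∈ y∈))
    ; ⊖∈ = λ {x} (c , x∈) → span-∷ (a ℕ.∸ toℕ c) (subst (span vs) (negate x c) (⊖∈ x∈))
    }
    where
    open IsSubgroup (span-isSubgroup vs)

    split : ∀ x y (c d : Fin a) → (x ⊝ toℕ c · v) ⊕ (y ⊝ toℕ d · v) ≡ (x ⊕ y) ⊝ (toℕ c ℕ.+ toℕ d) · v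
    split x y c d = begin
      (x ⊝ p) ⊕ (y ⊝ q)             ≡⟨ ⊕-assoc x (⊖ p) (y ⊝ q) ⟩
      x ⊕ (⊖ p ⊕ (y ⊝ q))           ≡⟨ cong (x ⊕_) (⊕-comm (⊖ p) (y ⊝ q)) ⟩
      x ⊕ ((y ⊝ q) ⊝ p)             ≡⟨ cong (x ⊕_) (⊝-comm y q p) ⟩
      x ⊕ ((y ⊝ p) ⊝ q)             ≡⟨ cong (x ⊕_) (⊝-⊕ y p q) ⟨
      x ⊕ (y ⊝ (p ⊕ q))             ≡⟨ ⊕-assoc x y _ ⟨
      (x ⊕ y) ⊝ (p ⊕ q)             ≡⟨ cong (x ⊕ y ⊝_) (·-+ (toℕ c) (toℕ d) v) ⟨
      (x ⊕ y) ⊝ (toℕ c ℕ.+ toℕ d) · v ∎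
      where
      p = toℕ c · v
      q = toℕ d · v

    negate : ∀ x (c : Fin a) → ⊖ (x ⊝ toℕ c · v) ≡ ⊖ x ⊝ (a ℕ.∸ toℕ c) · v
    negate x c = begin
      ⊖ (x ⊝ toℕ c · v)               ≡⟨ AG.⁻¹-∙-comm x (⊖ (toℕ c · v)) ⟨
      ⊖ x ⊕ ⊖ ⊖ (toℕ c · v)           ≡⟨ cong (λ y → ⊖ x ⊕ ⊖ y) (G.inverseʳ-unique _ _
        (trans (⊕-comm _ _) (trans (sym (·-+ (a ℕ.∸ toℕ c) (toℕ c) v))
          (trans (cong (_· v) (ℕ.m∸n+n≡m (ℕ.<⇒≤ (Fin.toℕ<n c)))) (torsion v))))) ⟨
      ⊖ x ⊝ (a ℕ.∸ toℕ c) · v         ∎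

  span-∈ : ∀ {v vs} → v ∈ vs → span vs v
  span-∈ {v} {_ ∷ vs} (here refl) =
    span-∷ 1 (subst (span vs) (sym (trans (cong (v ⊝_) (⊕-identityʳ v)) (⊕-inverseʳ v))) (IsSubgroup.0∈ (span-isSubgroup vs)))
  span-∈ {v} {_ ∷ vs} (there v∈) = span-∷ 0 (subst (span vs) (sym (⊝-0 v)) (span-∈ v∈))

  span-least : ∀ {H} → IsSubgroup H → ∀ {vs} → (∀ {v} → v ∈ vs → H v) → ∀ {x} → span vs x → H x
  span-least {H} sub {[]}     vs⊆H refl     = IsSubgroup.0∈ sub
  span-least {H} sub {v ∷ vs} vs⊆H (c , x∈) =
    IsSubgroup.⊝∈⁻ sub (span-least sub (vs⊆H ∘ there) x∈) (IsSubgroup.·∈ sub (toℕ c) (vs⊆H (here refl)))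

  Generates : ∀ {n} → (Fin n → X) → Set
  Generates f = ∀ x → span (tabulate f) x

  generates? : ∀ {n} (f : Fin n → X) → Dec (Generates f)
  generates? f = Fin.all? (span? (tabulate f))

  -- The base point is normalised to 0̂: a homomorphism on ℤⁿ₀ is a function on vertices up to translation.
  extend : ∀ {n} → Vec X n → Fin (suc n) → X
  extend f = lookup (0̂ ∷ f)

  combination : ∀ {n} → (Fin n → ℕ) → (Fin n → X) → X
  combination {zero}  d v = 0̂
  combination {suc n} d v = d zero · v zero ⊕ combination (d ∘ suc) (v ∘ suc)

  -- d holds the multiplicities of the edges leaving j; Kills says that f sends column j of the Laplacian to 0̂.
  Kills : ∀ {n} → (Fin n → X) → Fin n → (Fin n → ℕ) → Set
  Kills f j d = combination d (λ i → f j ⊝ f i) ≡ 0̂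

  kills? : ∀ {n} (f : Fin n → X) j d → Dec (Kills f j d)
  kills? f j d = combination d (λ i → f j ⊝ f i) Fin.≟ 0̂

  Solution : ∀ {n} → (Fin (suc n) → Fin (suc n) → ℕ) → Vec X n → Set
  Solution D f = Generates (lookup f) × (∀ j → Kills (extend f) j (D j))

  solution? : ∀ {n} (D : Fin (suc n) → Fin (suc n) → ℕ) f → Dec (Solution D f)
  solution? D f = generates? (lookup f) ×-dec Fin.all? (λ j → kills? (extend f) j (D j))

  functions : ∀ n → List (Vec X n)
  functions n = elements (vecs (fins size) n)

  #solutions : ∀ {n} → (Fin (suc n) → Fin (suc n) → ℕ) → ℕ
  #solutions {n} D = length (filter (solution? D) (functions n))

-- Squared translation differences and one step of the random walk.

module Walk (F : OrderedRing) (a : ℕ) .{{_ : NonZero a}} (G : TorsionGroup a) where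
  open OrderedRingProperties F
  open TorsionGroupProperties a G

  𝔾 : List X
  𝔾 = allFin size

  residues : List (Fin a)
  residues = allFin a

  private
    ts = residues

    2# : C
    2# = fromℕ# 2

    0≤2 : 0# ≤ 2#
    0≤2 = 0≤fromℕ 2

  1/ₙ : ∀ n .{{_ : NonZero n}} → C
  1/ₙ n = recip (ℕ.pred n)

  n*1/ₙ : ∀ n .{{_ : NonZero n}} → fromℕ# n * 1/ₙ n ≡ 1#
  n*1/ₙ n = trans (cong (λ k → fromℕ# k * 1/ₙ n) (sym (ℕ.suc-pred n))) (suc*recip (ℕ.pred n))

  length-residues : length ts ≡ a
  length-residues = List.length-tabulate id

  record IsLaw (q : Fin a → C) : Set where
    field
      nonNeg : ∀ t → 0# ≤ q t
      mass-1 : ∑ residues q ≡ 1#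

  -- The bound 1 - 1/(E + 1) is on the mass of each residue class modulo p.
  Balanced : ℕ → (Fin a → C) → Set
  Balanced E q = ∀ {p} → Prime p → p ∣ a → ∀ u →
    ∑ residues (λ t → [ does (p ∣? (toℕ t ℕ.+ u)) ] * q t) + recip E ≤ 1#

  sq : C → C
  sq x = x * x

  ‖_‖² : (X → C) → C
  ‖ h ‖² = ∑ 𝔾 (λ x → sq (h x))

  D : (X → C) → X → C
  D h s = ∑ 𝔾 (λ x → sq (h x - h (x ⊝ s)))

  step : (Fin a → C) → X → (X → C) → X → C
  step q v h x = ∑ residues (λ t → q t * h (x ⊝ toℕ t · v))

  ∑-shift : ∀ s (f : X → C) → ∑ 𝔾 (λ x → f (x ⊝ s)) ≡ ∑ 𝔾 f
  ∑-shift s = ∑-reindex (fins size) (_⊝ s) (_⊕ s) (λ x → ⊝-⊕-cancel x s) (λ x → ⊕-⊝ x s)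

  0≤D : ∀ h s → 0# ≤ D h s
  0≤D h s = ∑-nonNeg 𝔾 (λ x → 0≤x² _)

  D-0̂ : ∀ h → D h 0̂ ≡ 0#
  D-0̂ h = trans (∑-cong 𝔾 λ x → trans (cong (λ y → sq (h x - h y)) (⊝-0 x))
    (solve 1 (λ y → (y :- y) :* (y :- y) := con (+ 0)) refl (h x))) (∑-0 𝔾)

  D-⊖ : ∀ h s → D h (⊖ s) ≡ D h s
  D-⊖ h s = trans (sym (∑-shift s _)) (∑-cong 𝔾 λ x → trans
    (cong (λ y → sq (h (x ⊝ s) - h y)) (trans (cong (x ⊝ s ⊕_) (⊖-⊖ s)) (⊝-⊕-cancel x s)))
    (solve 2 (λ y z → (z :- y) :* (z :- y) := (y :- z) :* (y :- z)) refl (h x) (h (x ⊝ s))))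

  sq-+ : ∀ x y → sq (x + y) ≤ 2# * (sq x + sq y)
  sq-+ x y = 0≤y-x⇒x≤y (subst (0# ≤_)
    (solve 2 (λ x y → (x :- y) :* (x :- y) := con (+ 2) :* (x :* x :+ y :* y) :- (x :+ y) :* (x :+ y)) refl x y)
    (0≤x² (x - y)))

  -- The translation by `s ⊕ t` is split at x - s, and (p + q)² ≤ 2 (p² + q²) takes the place of the
  -- triangle inequality for the norm.
  D-⊕ : ∀ h s t → D h (s ⊕ t) ≤ 2# * (D h s + D h t)
  D-⊕ h s t = begin
    D h (s ⊕ t)
      ≡⟨ ∑-cong 𝔾 (λ x → trans (cong (λ y → sq (h x - h y)) (⊝-⊕ x s t))
           (solve 3 (λ p q r → (p :- r) :* (p :- r) := ((p :- q) :+ (q :- r)) :* ((p :- q) :+ (q :- r))) refl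
             (h x) (h (x ⊝ s)) (h ((x ⊝ s) ⊝ t)))) ⟩
    ∑ 𝔾 (λ x → sq ((h x - h (x ⊝ s)) + (h (x ⊝ s) - h ((x ⊝ s) ⊝ t))))
      ≤⟨ ∑-mono 𝔾 (λ x → sq-+ _ _) ⟩
    ∑ 𝔾 (λ x → 2# * (sq (h x - h (x ⊝ s)) + sq (h (x ⊝ s) - h ((x ⊝ s) ⊝ t))))
      ≡⟨ ∑-*ˡ 𝔾 2# _ ⟨
    2# * ∑ 𝔾 (λ x → sq (h x - h (x ⊝ s)) + sq (h (x ⊝ s) - h ((x ⊝ s) ⊝ t)))
      ≡⟨ cong (2# *_) (∑-+ 𝔾 _ _) ⟩
    2# * (D h s + ∑ 𝔾 (λ x → sq (h (x ⊝ s) - h ((x ⊝ s) ⊝ t))))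
      ≡⟨ cong (λ z → 2# * (D h s + z)) (∑-shift s (λ x → sq (h x - h (x ⊝ t)))) ⟩
    2# * (D h s + D h t) ∎
    where open ≤-Reasoning

  D-⊝ : ∀ h s t → D h (s ⊝ t) ≤ 2# * (D h s + D h t)
  D-⊝ h s t = subst (λ z → D h (s ⊝ t) ≤ 2# * (D h s + z)) (D-⊖ h t) (D-⊕ h s (⊖ t))

  D-·-^ : ∀ h k s → D h (k · s) ≤ fromℕ# (4 ℕ.^ k) * D h s
  D-·-^ h zero    s = subst (_≤ fromℕ# 1 * D h s) (sym (D-0̂ h)) (*-nonNeg (0≤fromℕ 1) (0≤D h s))
  D-·-^ h (suc k) s = begin
    D h (s ⊕ k · s)
      ≤⟨ D-⊕ h s (k · s) ⟩
    2# * (D h s + D h (k · s))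
      ≤⟨ *-monoˡ 0≤2 (+-mono-≤ (≤-trans (≤-reflexive (sym (*-identityˡ _))) (*-monoʳ (0≤D h s) 1≤4^k)) (D-·-^ h k s)) ⟩
    2# * (c * D h s + c * D h s)
      ≡⟨ solve 2 (λ c d → con (+ 2) :* (c :* d :+ c :* d) := (con (+ 4) :* c) :* d) refl c (D h s) ⟩
    (fromℕ# 4 * c) * D h s
      ≡⟨ cong (_* D h s) (fromℕ#-* 4 (4 ℕ.^ k)) ⟨
    fromℕ# (4 ℕ.^ suc k) * D h s ∎
    where
    open ≤-Reasoning
    c = fromℕ# (4 ℕ.^ k)
    1≤4^k : 1# ≤ c
    1≤4^k = subst (_≤ c) fromℤ-1 (fromℕ-mono (ℕ.m^n>0 4 k))

  -- Reducing k modulo a first makes the constant independent of k.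
  D-· : ∀ h k s → D h (k · s) ≤ fromℕ# (4 ℕ.^ a) * D h s
  D-· h k s = begin
    D h (k · s)                          ≡⟨ cong (D h) (·-% k s) ⟨
    D h ((k ℕ/.% a) · s)                 ≤⟨ D-·-^ h (k ℕ/.% a) s ⟩
    fromℕ# (4 ℕ.^ (k ℕ/.% a)) * D h s    ≤⟨ *-monoʳ (0≤D h s) (fromℕ-mono (ℕ.^-monoʳ-≤ 4 (ℕ.<⇒≤ (ℕ/.m%n<n k a)))) ⟩
    fromℕ# (4 ℕ.^ a) * D h s             ∎
    where open ≤-Reasoning

  D-·-⊝-· : ∀ h i j s t → D h (i · s ⊝ j · t) ≤ fromℕ# (2 ℕ.* 4 ℕ.^ a) * (D h s + D h t)
  D-·-⊝-· h i j s t = begin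
    D h (i · s ⊝ j · t)                    ≤⟨ D-⊝ h (i · s) (j · t) ⟩
    2# * (D h (i · s) + D h (j · t))       ≤⟨ *-monoˡ 0≤2 (+-mono-≤ (D-· h i s) (D-· h j t)) ⟩
    2# * (c * D h s + c * D h t)           ≡⟨ solve 3 (λ c d e → con (+ 2) :* (c :* d :+ c :* e) := (con (+ 2) :* c) :* (d :+ e)) refl c (D h s) (D h t) ⟩
    (2# * c) * (D h s + D h t)             ≡⟨ cong (_* (D h s + D h t)) (fromℕ#-* 2 (4 ℕ.^ a)) ⟨
    fromℕ# (2 ℕ.* 4 ℕ.^ a) * (D h s + D h t) ∎
    where
    open ≤-Reasoning
    c = fromℕ# (4 ℕ.^ a)

  -- growth l bounds D on combinations of l generators, relative to its values on the generators.
  growth : ℕ → ℕ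
  growth zero    = 0
  growth (suc l) = 2 ℕ.* 4 ℕ.^ a ℕ.* (1 ℕ.+ growth l)

  growth-mono : ∀ {l l′} → l ℕ.≤ l′ → growth l ℕ.≤ growth l′
  growth-mono ℕ.z≤n     = ℕ.z≤n
  growth-mono (ℕ.s≤s p) = ℕ.*-monoʳ-≤ (2 ℕ.* 4 ℕ.^ a) (ℕ.s≤s (growth-mono p))

  private
    grow : ∀ {x B d l} → x ≤ fromℕ# (2 ℕ.* 4 ℕ.^ a) * (d + fromℕ# (growth l) * B) → d ≤ B → x ≤ fromℕ# (growth (suc l)) * B
    grow {x} {B} {d} {l} x≤ d≤B = begin
      x                              ≤⟨ x≤ ⟩
      c * (d + fromℕ# (growth l) * B) ≤⟨ *-monoˡ (0≤fromℕ (2 ℕ.* 4 ℕ.^ a)) (+-monoˡ _ d≤B) ⟩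
      c * (B + fromℕ# (growth l) * B) ≡⟨ solve 3 (λ c b g → c :* (b :+ g :* b) := (c :* (con (+ 1) :+ g)) :* b) refl c B (fromℕ# (growth l)) ⟩
      (c * (1# + fromℕ# (growth l))) * B ≡⟨ cong (λ z → (c * z) * B) (fromℕ#-suc (growth l)) ⟨
      (c * fromℕ# (1 ℕ.+ growth l)) * B ≡⟨ cong (_* B) (fromℕ#-* (2 ℕ.* 4 ℕ.^ a) (1 ℕ.+ growth l)) ⟨
      fromℕ# (growth (suc l)) * B ∎
      where
      open ≤-Reasoning
      c = fromℕ# (2 ℕ.* 4 ℕ.^ a)

  -- Each entry of the list costs one Bézout combination of two multiples, and the a at the end of
  -- the gcd costs nothing because `a · x` is `0̂`.
  D-gcds : ∀ h x {B} us → All (λ u → D h (u · x) ≤ B) us → D h (gcds a us · x) ≤ fromℕ# (growth (length us)) * B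
  D-gcds h x {B} []       []      = ≤-reflexive (trans (cong (D h) (torsion x))
    (trans (D-0̂ h) (sym (trans (cong (_* B) fromℤ-0) (zeroˡ B)))))
  D-gcds h x {B} (u ∷ us) (p ∷ ps) with gcd-· u (gcds a us) x
  ... | i , j , inj₁ eq = grow {l = length us} (≤-trans (≤-reflexive (cong (D h) eq))
        (≤-trans (D-·-⊝-· h i j _ _) (*-monoˡ (0≤fromℕ (2 ℕ.* 4 ℕ.^ a)) (+-monoʳ _ (D-gcds h x us ps))))) p
  ... | i , j , inj₂ eq = grow {l = length us} (≤-trans (≤-reflexive (cong (D h) eq))
        (≤-trans (D-·-⊝-· h j i _ _) (*-monoˡ (0≤fromℕ (2 ℕ.* 4 ℕ.^ a))
          (≤-trans (≤-reflexive (+-comm _ _)) (+-monoʳ _ (D-gcds h x us ps)))))) p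

  D-span : ∀ h {B} vs → (∀ {v} → v ∈ vs → D h v ≤ B) → ∀ {x} → span vs x → D h x ≤ fromℕ# (growth (length vs)) * B
  D-span h {B} []       _ refl     = ≤-reflexive (trans (D-0̂ h) (sym (trans (cong (_* B) fromℤ-0) (zeroˡ B))))
  D-span h {B} (v ∷ vs) p {x} (c , x∈) = grow {l = length vs} (begin
    -- Written as x = 1 · (x - c v) - c · (- v), so that the bound for a difference of two multiples
    -- applies.
    D h x
      ≡⟨ cong (D h) (trans (sym (⊝-⊕-cancel x (toℕ c · v))) (trans (cong₂ _⊕_ (sym (⊕-identityʳ _)) (sym (⊖-⊖ _)))
           (cong (λ z → 1 · (x ⊝ toℕ c · v) ⊕ ⊖ z) (sym (·-⊖ (toℕ c) v))))) ⟩
    D h (1 · (x ⊝ toℕ c · v) ⊝ toℕ c · (⊖ v))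
      ≤⟨ D-·-⊝-· h 1 (toℕ c) _ _ ⟩
    κ * (D h (x ⊝ toℕ c · v) + D h (⊖ v))
      ≡⟨ cong (κ *_) (trans (+-comm _ _) (cong (_+ D h (x ⊝ toℕ c · v)) (D-⊖ h v))) ⟩
    κ * (D h v + D h (x ⊝ toℕ c · v))
      ≤⟨ *-monoˡ (0≤fromℕ (2 ℕ.* 4 ℕ.^ a)) (+-monoʳ _ (D-span h vs (p ∘ there) x∈)) ⟩
    κ * (D h v + fromℕ# (growth (length vs)) * B) ∎) (p (here refl))
    where
    open ≤-Reasoning
    κ = fromℕ# (2 ℕ.* 4 ℕ.^ a)

  ∑∑-* : ∀ {A B : Set} (xs : List A) (ys : List B) (f : A → C) (g : B → C) →
         ∑ xs (λ x → ∑ ys (λ y → f x * g y)) ≡ ∑ xs f * ∑ ys g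
  ∑∑-* xs ys f g = trans (∑-cong xs (λ x → sym (∑-*ˡ ys (f x) g))) (sym (∑-*ʳ xs (∑ ys g) f))

  -- The mean of D g (t′ v - t v) over independent t and t′ with law q.
  spread : (Fin a → C) → X → (X → C) → C
  spread q v g = ∑ ts (λ t → ∑ ts (λ t′ → (q t * q t′) * D g (toℕ t′ · v ⊝ toℕ t · v)))

  module _ {q : Fin a → C} (law : IsLaw q) where
    open IsLaw law

    variance : ∀ (y : Fin a → C) →
      2# * sq (∑ ts (λ t → q t * y t)) + ∑ ts (λ t → ∑ ts (λ t′ → (q t * q t′) * sq (y t - y t′)))
        ≡ 2# * ∑ ts (λ t → q t * sq (y t))
    variance y = begin
      2# * (m₁ * m₁) + ∑ ts (λ t → ∑ ts (λ t′ → (q t * q t′) * sq (y t - y t′)))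
        ≡⟨ cong (λ z → 2# * z + V) (∑∑-* ts ts _ _) ⟨
      2# * ∑ ts (λ t → ∑ ts (λ t′ → (q t * y t) * (q t′ * y t′))) + V
        ≡⟨ cong (_+ V) (trans (∑-*ˡ ts 2# _) (∑-cong ts λ t → ∑-*ˡ ts 2# _)) ⟩
      ∑ ts (λ t → ∑ ts (λ t′ → 2# * ((q t * y t) * (q t′ * y t′)))) + V
        ≡⟨ trans (∑-cong ts λ t → ∑-+ ts _ _) (∑-+ ts _ _) ⟨
      ∑ ts (λ t → ∑ ts (λ t′ → 2# * ((q t * y t) * (q t′ * y t′)) + (q t * q t′) * sq (y t - y t′)))
        ≡⟨ ∑-cong ts (λ t → ∑-cong ts λ t′ → solve 4 (λ q y q′ y′ →
             con (+ 2) :* ((q :* y) :* (q′ :* y′)) :+ (q :* q′) :* ((y :- y′) :* (y :- y′))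
               := (q :* (y :* y)) :* q′ :+ q :* (q′ :* (y′ :* y′))) refl (q t) (y t) (q t′) (y t′)) ⟩
      ∑ ts (λ t → ∑ ts (λ t′ → (q t * sq (y t)) * q t′ + q t * (q t′ * sq (y t′))))
        ≡⟨ trans (∑-cong ts λ t → ∑-+ ts _ _) (∑-+ ts _ _) ⟩
      ∑ ts (λ t → ∑ ts (λ t′ → (q t * sq (y t)) * q t′)) + ∑ ts (λ t → ∑ ts (λ t′ → q t * (q t′ * sq (y t′))))
        ≡⟨ cong₂ _+_ (∑∑-* ts ts _ _) (∑∑-* ts ts _ _) ⟩
      m₂ * ∑ ts q + ∑ ts q * m₂
        ≡⟨ cong (λ z → m₂ * z + z * m₂) mass-1 ⟩
      m₂ * 1# + 1# * m₂
        ≡⟨ solve 1 (λ m → m :* con (+ 1) :+ con (+ 1) :* m := con (+ 2) :* m) refl m₂ ⟩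
      2# * m₂ ∎
      where
      open ≡.≡-Reasoning
      m₁ = ∑ ts (λ t → q t * y t)
      m₂ = ∑ ts (λ t → q t * sq (y t))
      V  = ∑ ts (λ t → ∑ ts (λ t′ → (q t * q t′) * sq (y t - y t′)))

    -- `variance` at each point, summed over the group, where translation invariance turns every
    -- shifted square sum into `‖ g ‖²`. The spread is thus exactly twice the squared norm lost in
    -- the step, and any lower bound on it is a contraction.
    energy : ∀ v g → 2# * ‖ step q v g ‖² + spread q v g ≡ 2# * ‖ g ‖²
    energy v g = begin
      2# * ‖ step q v g ‖² + spread q v g
        ≡⟨ cong₂ _+_ (∑-*ˡ 𝔾 2# _) (sym spread≡) ⟩
      ∑ 𝔾 (λ x → 2# * sq (step q v g x)) + ∑ 𝔾 (λ x → ∑ ts (λ t → ∑ ts (λ t′ → (q t * q t′) * sq (y x t - y x t′))))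
        ≡⟨ ∑-+ 𝔾 _ _ ⟨
      ∑ 𝔾 (λ x → 2# * sq (step q v g x) + ∑ ts (λ t → ∑ ts (λ t′ → (q t * q t′) * sq (y x t - y x t′))))
        ≡⟨ ∑-cong 𝔾 (λ x → variance (y x)) ⟩
      ∑ 𝔾 (λ x → 2# * ∑ ts (λ t → q t * sq (y x t)))
        ≡⟨ ∑-*ˡ 𝔾 2# _ ⟨
      2# * ∑ 𝔾 (λ x → ∑ ts (λ t → q t * sq (y x t)))
        ≡⟨ cong (2# *_) (∑-swap 𝔾 ts _) ⟩
      2# * ∑ ts (λ t → ∑ 𝔾 (λ x → q t * sq (y x t)))
        ≡⟨ cong (2# *_) (∑-cong ts (λ t → trans (sym (∑-*ˡ 𝔾 (q t) _)) (cong (q t *_) (∑-shift (toℕ t · v) (sq ∘ g))))) ⟩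
      2# * ∑ ts (λ t → q t * ‖ g ‖²)
        ≡⟨ cong (2# *_) (trans (sym (∑-*ʳ ts _ q)) (trans (cong (_* ‖ g ‖²) mass-1) (*-identityˡ _))) ⟩
      2# * ‖ g ‖² ∎
      where
      open ≡.≡-Reasoning
      y : X → Fin a → C
      y x t = g (x ⊝ toℕ t · v)
      spread≡ : ∑ 𝔾 (λ x → ∑ ts (λ t → ∑ ts (λ t′ → (q t * q t′) * sq (y x t - y x t′)))) ≡ spread q v g
      spread≡ = trans (∑-swap 𝔾 ts _) (∑-cong ts λ t → trans (∑-swap 𝔾 ts _) (∑-cong ts λ t′ →
        trans (sym (∑-*ˡ 𝔾 (q t * q t′) _)) (cong ((q t * q t′) *_)
          (trans (∑-cong 𝔾 λ x → cong (λ z → sq (y x t - g z)) (sym (⊝-⊝-⊝ x (toℕ t′ · v) (toℕ t · v))))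
            (∑-shift (toℕ t · v) (λ x → sq (g x - g (x ⊝ (toℕ t′ · v ⊝ toℕ t · v)))))))))

    0≤spread : ∀ v g → 0# ≤ spread q v g
    0≤spread v g = ∑-nonNeg ts λ t → ∑-nonNeg ts λ t′ → *-nonNeg (*-nonNeg (nonNeg t) (nonNeg t′)) (0≤D g _)

    -- A step is a convolution, so it commutes with translation.
    step-difference : ∀ v h s x → step q v h x - step q v h (x ⊝ s) ≡ step q v (λ y → h y - h (y ⊝ s)) x
    step-difference v h s x = begin
      step q v h x - step q v h (x ⊝ s)
        ≡⟨ solve 2 (λ p r → p :- r := p :+ (:- con (+ 1)) :* r) refl _ _ ⟩
      step q v h x + (- 1#) * step q v h (x ⊝ s)
        ≡⟨ cong (_+_ (step q v h x)) (∑-*ˡ ts (- 1#) _) ⟩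
      step q v h x + ∑ ts (λ t → (- 1#) * (q t * h ((x ⊝ s) ⊝ toℕ t · v)))
        ≡⟨ ∑-+ ts _ _ ⟨
      ∑ ts (λ t → q t * h (x ⊝ toℕ t · v) + (- 1#) * (q t * h ((x ⊝ s) ⊝ toℕ t · v)))
        ≡⟨ ∑-cong ts (λ t → trans (cong (λ z → q t * h (x ⊝ toℕ t · v) + (- 1#) * (q t * h z)) (⊝-comm x s (toℕ t · v)))
             (solve 3 (λ q p r → q :* p :+ (:- con (+ 1)) :* (q :* r) := q :* (p :- r)) refl (q t) _ _)) ⟩
      step q v (λ y → h y - h (y ⊝ s)) x ∎
      where open ≡.≡-Reasoning

    D-step : ∀ v h s → D (step q v h) s ≡ ‖ step q v (λ y → h y - h (y ⊝ s)) ‖²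
    D-step v h s = ∑-cong 𝔾 λ x → cong sq (step-difference v h s x)

    ‖step‖≤ : ∀ v g → ‖ step q v g ‖² ≤ ‖ g ‖²
    ‖step‖≤ v g = *-cancelˡ-≤ 2# (suc≰0 1) (subst (2# * ‖ step q v g ‖² ≤_) (energy v g) (x≤x+y (0≤spread v g)))

    D-step-≤ : ∀ v h s → D (step q v h) s ≤ D h s
    D-step-≤ v h s = subst (_≤ D h s) (sym (D-step v h s)) (‖step‖≤ v _)

-- Contraction by a balanced summand.

module Contraction (F : OrderedRing) (a : ℕ) .{{_ : NonZero a}} (G : TorsionGroup a) (E : ℕ) where
  open OrderedRingProperties F
  open TorsionGroupProperties a G
  open Walk F a G

  private
    ts = residues

    2# : C
    2# = fromℕ# 2

    instance
      a+a≢0 : NonZero (a ℕ.+ a)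
      a+a≢0 = ℕ.>-nonZero (ℕ.<-≤-trans (ℕ.>-nonZero⁻¹ a) (ℕ.m≤m+n a a))

    -- Chosen as 1/(2a) so that a terms of size at most κ c add up to at most c/2.
    κ : C
    κ = 1/ₙ (a ℕ.+ a)

    0≤κ : 0# ≤ κ
    0≤κ = 0≤recip _

    ε₀ : C
    ε₀ = recip E

    0≤κε₀ : 0# ≤ κ * ε₀
    0≤κε₀ = *-nonNeg 0≤κ (0≤recip E)

  recip≰0 : ∀ k → ¬ recip k ≤ 0#
  recip≰0 k h = 1≰0 (subst₂ _≤_ (suc*recip k) (zeroʳ _) (*-monoˡ (0≤fromℕ (suc k)) h))

  x+x≤x⇒x≤0 : ∀ {x} → x + x ≤ x → x ≤ 0#
  x+x≤x⇒x≤0 {x} h = subst₂ _≤_ (solve 1 (λ x → (x :+ x) :+ :- x := x) refl x) (-‿inverseʳ x) (+-monoˡ (- x) h)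

  ∑≤½ : ∀ {c} (f : Fin a → C) → (∀ t → f t ≤ κ * c) → ∑ ts f + ∑ ts f ≤ c
  ∑≤½ {c} f h = begin
    ∑ ts f + ∑ ts f
      ≤⟨ +-mono-≤ ∑f≤ ∑f≤ ⟩
    fromℕ# a * (κ * c) + fromℕ# a * (κ * c)
      ≡⟨ solve 3 (λ n k c → n :* (k :* c) :+ n :* (k :* c) := ((n :+ n) :* k) :* c) refl (fromℕ# a) κ c ⟩
    ((fromℕ# a + fromℕ# a) * κ) * c
      ≡⟨ cong (λ z → (z * κ) * c) (fromℕ#-+ a a) ⟨
    (fromℕ# (a ℕ.+ a) * κ) * c
      ≡⟨ trans (cong (_* c) (n*1/ₙ (a ℕ.+ a))) (*-identityˡ c) ⟩
    c ∎
    where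
    open ≤-Reasoning
    ∑f≤ : ∑ ts f ≤ fromℕ# a * (κ * c)
    ∑f≤ = ≤-trans (∑-mono ts h) (≤-reflexive
      (trans (∑-const ts (κ * c)) (cong (λ l → fromℕ# l * (κ * c)) length-residues)))

  uniform : Fin a → C
  uniform _ = 1/ₙ a

  uniform-law : IsLaw uniform
  uniform-law = record
    { nonNeg = λ _ → 0≤recip _
    ; mass-1 = trans (∑-const ts (1/ₙ a)) (trans (cong (λ l → fromℕ# l * 1/ₙ a) length-residues) (n*1/ₙ a))
    }

  allFin-suc : ∀ n → allFin (suc n) ≡ zero ∷ map suc (allFin n)
  allFin-suc n = cong (zero ∷_) (sym (List.map-tabulate id suc))

  telescope : ∀ n (φ : ℕ → C) → ∑ (allFin n) (λ t → φ (toℕ t) - φ (suc (toℕ t))) ≡ φ 0 - φ n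
  telescope zero    φ = sym (-‿inverseʳ (φ 0))
  telescope (suc n) φ = trans (cong (λ xs → ∑ xs ψ) (allFin-suc n))
    (trans (cong (_+_ (ψ zero)) (trans (∑-map suc (allFin n) ψ) (telescope n (φ ∘ suc))))
      (solve 3 (λ p q r → (p :- q) :+ (q :- r) := p :- r) refl (φ 0) (φ 1) (φ (suc n))))
    where
    ψ : Fin (suc n) → C
    ψ t = φ (toℕ t) - φ (suc (toℕ t))

  -- The sum along x, x - v, x - 2v, ... telescopes and closes up, since a v = `0̂`.
  uniform-kills : ∀ v (h : X → C) x → step uniform v (λ y → h y - h (y ⊝ v)) x ≡ 0#
  uniform-kills v h x = begin
    ∑ ts (λ t → 1/ₙ a * (h (x ⊝ toℕ t · v) - h ((x ⊝ toℕ t · v) ⊝ v)))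
      ≡⟨ ∑-cong ts (λ t → cong (λ y → 1/ₙ a * (h (x ⊝ toℕ t · v) - h y))
           (trans (sym (⊝-⊕ x (toℕ t · v) v)) (cong (x ⊝_) (⊕-comm (toℕ t · v) v)))) ⟩
    ∑ ts (λ t → 1/ₙ a * (φ (toℕ t) - φ (suc (toℕ t))))
      ≡⟨ ∑-*ˡ ts (1/ₙ a) _ ⟨
    1/ₙ a * ∑ ts (λ t → φ (toℕ t) - φ (suc (toℕ t)))
      ≡⟨ cong (1/ₙ a *_) (telescope a φ) ⟩
    1/ₙ a * (φ 0 - φ a)
      ≡⟨ cong (λ y → 1/ₙ a * (φ 0 - h (x ⊝ y))) (torsion v) ⟩
    1/ₙ a * (φ 0 - φ 0)
      ≡⟨ solve 2 (λ p q → p :* (q :- q) := con (+ 0)) refl (1/ₙ a) (φ 0) ⟩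
    0# ∎
    where
    open ≡.≡-Reasoning
    φ : ℕ → C
    φ k = h (x ⊝ k · v)

  ∑∑-law : ∀ {q} → IsLaw q → ∀ B → ∑ ts (λ t → ∑ ts (λ t′ → (q t * q t′) * B)) ≡ B
  ∑∑-law {q} law B = trans (∑-cong ts λ t → ∑-cong ts λ t′ → *-assoc _ _ _)
    (trans (∑∑-* ts ts q (λ t′ → q t′ * B)) (trans (cong₂ _*_ mass-1 (trans (sym (∑-*ʳ ts B q)) (trans (cong (_* B) mass-1) (*-identityˡ B)))) (*-identityˡ B)))
    where open IsLaw law

  -- The energy identity for the uniform law, whose step kills g.
  poincaré : ∀ v (h : X → C) → let g = λ y → h y - h (y ⊝ v) in ‖ g ‖² ≤ fromℕ# (2 ℕ.* 4 ℕ.^ a) * D g v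
  poincaré v h = *-cancelˡ-≤ 2# (suc≰0 1) (begin
    2# * ‖ g ‖²
      ≡⟨ energy uniform-law v g ⟨
    2# * ‖ step uniform v g ‖² + spread uniform v g
      ≡⟨ cong (λ z → 2# * z + spread uniform v g) (trans (∑-cong 𝔾 λ x → trans (cong sq (uniform-kills v h x)) (zeroˡ 0#)) (∑-0 𝔾)) ⟩
    2# * 0# + spread uniform v g
      ≡⟨ trans (cong (_+ spread uniform v g) (zeroʳ 2#)) (+-identityˡ _) ⟩
    spread uniform v g
      ≤⟨ ∑-mono ts (λ t → ∑-mono ts λ t′ → *-monoˡ (*-nonNeg (0≤recip _) (0≤recip _)) (D-·-⊝-· g (toℕ t′) (toℕ t) v v)) ⟩
    ∑ ts (λ t → ∑ ts (λ t′ → (uniform t * uniform t′) * (c * (D g v + D g v))))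
      ≡⟨ ∑∑-law uniform-law _ ⟩
    c * (D g v + D g v)
      ≡⟨ solve 2 (λ c d → c :* (d :+ d) := con (+ 2) :* (c :* d)) refl c (D g v) ⟩
    2# * (c * D g v) ∎)
    where
    open ≤-Reasoning
    c = fromℕ# (2 ℕ.* 4 ℕ.^ a)
    g : X → C
    g y = h y - h (y ⊝ v)

  -- The reciprocal of κ · κ ε₀, the least weight used in `spread-gap`, times the cost of reaching
  -- gcd 1 from a and at most a offsets.
  gapConst : ℕ
  gapConst = growth a ℕ.* ((a ℕ.+ a) ℕ.* (a ℕ.+ a) ℕ.* suc E)

  module _ {q : Fin a → C} (law : IsLaw q) (balanced : Balanced E q) where
    open IsLaw law

    -- Otherwise all a masses are at most 1/(2a), and their sum 1 is at most 1/2.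
    exists-likely : ∃[ t ] κ ≤ q t
    exists-likely with Fin.any? (λ t → κ ≤? q t)
    ... | yes found = found
    ... | no  none  = contradiction (x+x≤x⇒x≤0 (subst (λ z → z + z ≤ 1#) mass-1
        (∑≤½ q (λ t → [ (λ κ≤ → contradiction (t , κ≤) none) , (λ ≤κ → subst (q t ≤_) (sym (*-identityʳ κ)) ≤κ) ]′ (≤-total κ (q t))))))
        1≰0

    private
      t⋆ = proj₁ exists-likely

      likely? : ∀ t → Dec (κ * ε₀ ≤ q t)
      likely? t = κ * ε₀ ≤? q t

      likely : List (Fin a)
      likely = filter likely? ts

    private
      ∤-mass : ∀ {p} → All (p ∣_) (map (offset t⋆) likely) → ∀ t → [ not (does (p ∣? offset t⋆ t)) ] * q t ≤ κ * ε₀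
      ∤-mass {p} p∣ t with likely? t
      ... | yes t-likely = subst (_≤ κ * ε₀) (sym (trans (cong (λ b → [ not b ] * q t)
              (dec-true (p ∣? offset t⋆ t) (All.lookup p∣ (∈.∈-map⁺ (offset t⋆) (∈.∈-filter⁺ likely? (∈.∈-allFin t) t-likely)))))
              (zeroˡ (q t)))) 0≤κε₀
      ... | no unlikely = ≤-trans
              (≤-trans (*-monoʳ (nonNeg t) ([]≤1 _)) (≤-reflexive (*-identityˡ (q t))))
              ([ (λ h → contradiction h unlikely) , id ]′ (≤-total (κ * ε₀) (q t)))

      []-not : ∀ b x → [ b ] * x + [ not b ] * x ≡ x
      []-not true  x = solve 1 (λ x → con (+ 1) :* x :+ con (+ 0) :* x := x) refl x
      []-not false x = solve 1 (λ x → con (+ 0) :* x :+ con (+ 1) :* x := x) refl x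

    -- A prime dividing a and every likely offset puts all likely residues into the class of t⋆.
    -- Only unlikely residues remain outside, with mass at most ε₀/2, but balance leaves at least ε₀
    -- there. The shift `a ℕ.∸ toℕ t⋆` makes the class in `balanced` the one tested by `offset t⋆`.
    likely-gcd : gcds a (map (offset t⋆) likely) ≡ 1
    likely-gcd with gcds a (map (offset t⋆) likely) ℕ.≟ 1
    ... | yes g≡1 = g≡1
    ... | no  g≢1 = contradiction (≤-trans ε₀≤S (x+x≤x⇒x≤0 (≤-trans (∑≤½ _ (∤-mass p∣us)) ε₀≤S))) (recip≰0 E)
      where
      found = common-prime a (map (offset t⋆) likely) g≢1
      p = proj₁ found
      p∣us = proj₂ (proj₂ (proj₂ found))
      S₊ = ∑ ts (λ t → [ does (p ∣? offset t⋆ t) ] * q t)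
      S₋ = ∑ ts (λ t → [ not (does (p ∣? offset t⋆ t)) ] * q t)
      S≡ : S₊ + S₋ ≡ 1#
      S≡ = trans (sym (∑-+ ts _ _)) (trans (∑-cong ts λ t → []-not (does (p ∣? offset t⋆ t)) (q t)) mass-1)
      ε₀≤S : ε₀ ≤ S₋
      ε₀≤S = subst₂ _≤_ (solve 2 (λ s e → (s :+ e) :- s := e) refl S₊ ε₀) (solve 2 (λ s r → (s :+ r) :- s := r) refl S₊ S₋)
        (+-monoˡ (- S₊) (subst (S₊ + ε₀ ≤_) (sym S≡) (balanced (proj₁ (proj₂ found)) (proj₁ (proj₂ (proj₂ found))) (a ℕ.∸ toℕ t⋆))))

    -- Since the gcd is 1, v is a Bézout combination of the multiples `offset t⋆ t · v` with t
    -- likely. D at each of these is one term of the spread, of weight `q t⋆ * q t`, which is at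
    -- least κ · κ ε₀.
    spread-gap : ∀ v g → D g v ≤ fromℕ# gapConst * spread q v g
    spread-gap v g = begin
      D g v
        ≡⟨ cong (D g) (trans (sym (⊕-identityʳ v)) (cong (_· v) (sym likely-gcd))) ⟩
      D g (gcds a us · v)
        ≤⟨ D-gcds g v us (All.map⁺ (All.map (λ {t} h → subst (λ y → D g y ≤ B) (sym (offset-· t⋆ t v)) (bound t h)) (All.all-filter likely? ts))) ⟩
      fromℕ# (growth (length us)) * B
        ≤⟨ *-monoʳ 0≤B (fromℕ-mono (growth-mono (ℕ.≤-trans (ℕ.≤-reflexive (List.length-map (offset t⋆) likely))
             (ℕ.≤-trans (List.length-filter likely? ts) (ℕ.≤-reflexive length-residues))))) ⟩
      fromℕ# (growth a) * B
        ≡⟨ *-assoc _ _ _ ⟨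
      (fromℕ# (growth a) * c) * W
        ≡⟨ cong (_* W) (fromℕ#-* (growth a) _) ⟨
      fromℕ# gapConst * W ∎
      where
      open ≤-Reasoning
      us = map (offset t⋆) likely
      W = spread q v g
      c = fromℕ# ((a ℕ.+ a) ℕ.* (a ℕ.+ a) ℕ.* suc E)
      B = c * W
      0≤B : 0# ≤ B
      0≤B = *-nonNeg (0≤fromℕ _) (0≤spread law v g)
      nn : ∀ t t′ → 0# ≤ (q t * q t′) * D g (toℕ t′ · v ⊝ toℕ t · v)
      nn t t′ = *-nonNeg (*-nonNeg (nonNeg t) (nonNeg t′)) (0≤D g _)
      cκκε₀ : c * (κ * (κ * ε₀)) ≡ 1#
      cκκε₀ = trans (cong (_* (κ * (κ * ε₀))) (trans (fromℕ#-* _ (suc E)) (cong (_* fromℕ# (suc E)) (fromℕ#-* (a ℕ.+ a) (a ℕ.+ a)))))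
        (trans (solve 4 (λ n e k f → ((n :* n) :* e) :* (k :* (k :* f)) := (n :* k) :* ((n :* k) :* (e :* f))) refl
                  (fromℕ# (a ℕ.+ a)) (fromℕ# (suc E)) κ ε₀)
          (trans (cong₂ (λ x y → x * (x * y)) (n*1/ₙ (a ℕ.+ a)) (suc*recip E))
            (solve 0 (con (+ 1) :* (con (+ 1) :* con (+ 1)) := con (+ 1)) refl)))
      bound : ∀ t → κ * ε₀ ≤ q t → D g (toℕ t · v ⊝ toℕ t⋆ · v) ≤ B
      bound t h = begin
        d
          ≡⟨ trans (cong (_* d) cκκε₀) (*-identityˡ d) ⟨
        (c * (κ * (κ * ε₀))) * d
          ≡⟨ *-assoc _ _ _ ⟩
        c * ((κ * (κ * ε₀)) * d)
          ≤⟨ *-monoˡ (0≤fromℕ _) (*-monoʳ (0≤D g _) (*-mono 0≤κ (≤-trans 0≤κε₀ h) (proj₂ exists-likely) h)) ⟩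
        c * ((q t⋆ * q t) * d)
          ≤⟨ *-monoˡ (0≤fromℕ _) (≤-trans
               (term≤∑ {f = λ t′ → (q t⋆ * q t′) * D g (toℕ t′ · v ⊝ toℕ t⋆ · v)} (nn t⋆) (∈.∈-allFin t))
               (term≤∑ {f = λ t₁ → ∑ ts (λ t′ → (q t₁ * q t′) * D g (toℕ t′ · v ⊝ toℕ t₁ · v))} (λ t₁ → ∑-nonNeg ts (nn t₁)) (∈.∈-allFin t⋆))) ⟩
        c * W ∎
        where d = D g (toℕ t · v ⊝ toℕ t⋆ · v)

  -- Twice the product of the constants in `poincaré` and `spread-gap`. The extra successor makes it
  -- at least 1, which gives ρ ≥ 1/2.
  rateConst : ℕ
  rateConst = suc (2 ℕ.* (2 ℕ.* 4 ℕ.^ a ℕ.* gapConst))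

  ρ : C
  ρ = rate rateConst

  -- `energy` for the difference g of h and its translate by v, whose squared norm is `D h v`: by
  -- `poincaré` and `spread-gap`, the spread of g is a fixed fraction of that norm.
  D-step-balanced : ∀ {q} → IsLaw q → Balanced E q → ∀ v (h : X → C) → D (step q v h) v ≤ ρ * D h v
  D-step-balanced {q} law balanced v h = *-cancelˡ-≤ 2# (suc≰0 1) (begin
    2# * D (step q v h) v
      ≡⟨ cong (2# *_) (D-step law v h v) ⟩
    2# * ‖ step q v g ‖²
      ≡⟨ solve 2 (λ t w → con (+ 2) :* t := (con (+ 2) :* t :+ w) :- w) refl _ W ⟩
    (2# * ‖ step q v g ‖² + W) - W
      ≡⟨ cong (_- W) (energy law v g) ⟩
    2# * ‖ g ‖² - W
      ≤⟨ 0≤y-x⇒x≤y (subst (0# ≤_) (solve 3 (λ n r w → w :- r :* (con (+ 2) :* n)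
           := con (+ 2) :* ((con (+ 1) :- r) :* n) :- (con (+ 2) :* n :- w)) refl ‖ g ‖² r W) (0≤y-x r2N≤W)) ⟩
    2# * (ρ * ‖ g ‖²) ∎)
    where
    open ≤-Reasoning
    g : X → C
    g y = h y - h (y ⊝ v)
    W = spread q v g
    r = recip rateConst
    M = 2 ℕ.* 4 ℕ.^ a ℕ.* gapConst
    r2N≤W : r * (2# * ‖ g ‖²) ≤ W
    r2N≤W = begin
      r * (2# * ‖ g ‖²)
        ≤⟨ *-monoˡ (0≤recip _) (*-monoˡ (0≤fromℕ 2) (≤-trans (poincaré v h) (*-monoˡ (0≤fromℕ _) (spread-gap law balanced v g)))) ⟩
      r * (2# * (fromℕ# (2 ℕ.* 4 ℕ.^ a) * (fromℕ# gapConst * W)))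
        ≡⟨ cong (λ z → r * (2# * z)) (trans (sym (*-assoc _ _ _)) (cong (_* W) (sym (fromℕ#-* (2 ℕ.* 4 ℕ.^ a) gapConst)))) ⟩
      r * (2# * (fromℕ# M * W))
        ≡⟨ cong (r *_) (trans (sym (*-assoc _ _ _)) (cong (_* W) (sym (fromℕ#-* 2 M)))) ⟩
      r * (fromℕ# (2 ℕ.* M) * W)
        ≤⟨ *-monoˡ (0≤recip _) (*-monoʳ (0≤spread law v g) (fromℕ-mono (ℕ.m≤n+m (2 ℕ.* M) 2))) ⟩
      r * (fromℕ# (suc rateConst) * W)
        ≡⟨ trans (sym (*-assoc _ _ _)) (trans (cong (_* W) (recip*suc rateConst)) (*-identityˡ W)) ⟩
      W ∎

-- The law of the sum attached to one vertex.

module Column (F : OrderedRing) (a : ℕ) .{{_ : NonZero a}} (G : TorsionGroup a) (E : ℕ) where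
  open OrderedRingProperties F
  open TorsionGroupProperties a G
  open Walk F a G
  open Contraction F a G E

  private
    ts = residues

    ε₀ : C
    ε₀ = recip E

  -- The law of Σᵢ tᵢ vᵢ, where tᵢ has law q i.
  μ : ∀ {n} → (Fin n → Fin a → C) → (Fin n → X) → X → C
  μ {zero}  q v x = [ does (x Fin.≟ 0̂) ]
  μ {suc n} q v   = step (q zero) (v zero) (μ (q ∘ suc) (v ∘ suc))

  count : ∀ {n} → (Fin n → X) → X → ℕ
  count {zero}  f s = 0
  count {suc n} f s = (if does (s Fin.≟ f zero) then 1 else 0) ℕ.+ count (f ∘ suc) s

  0≤μ : ∀ {n} (q : Fin n → Fin a → C) v → (∀ i → IsLaw (q i)) → ∀ x → 0# ≤ μ q v x
  0≤μ {zero}  q v law x = 0≤[] _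
  0≤μ {suc n} q v law x = ∑-nonNeg ts λ t → *-nonNeg (IsLaw.nonNeg (law zero) t) (0≤μ _ _ (law ∘ suc) _)

  ∑-step : ∀ {q} → IsLaw q → ∀ v h → ∑ 𝔾 (step q v h) ≡ ∑ 𝔾 h
  ∑-step {q} law v h = begin
    ∑ 𝔾 (λ x → ∑ ts (λ t → q t * h (x ⊝ toℕ t · v)))
      ≡⟨ ∑-swap 𝔾 ts _ ⟩
    ∑ ts (λ t → ∑ 𝔾 (λ x → q t * h (x ⊝ toℕ t · v)))
      ≡⟨ ∑-cong ts (λ t → trans (sym (∑-*ˡ 𝔾 (q t) _)) (cong (q t *_) (∑-shift (toℕ t · v) h))) ⟩
    ∑ ts (λ t → q t * ∑ 𝔾 h)
      ≡⟨ trans (sym (∑-*ʳ ts (∑ 𝔾 h) q)) (trans (cong (_* ∑ 𝔾 h) (IsLaw.mass-1 law)) (*-identityˡ _)) ⟩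
    ∑ 𝔾 h ∎
    where open ≡.≡-Reasoning

  ∑μ≡1 : ∀ {n} (q : Fin n → Fin a → C) v → (∀ i → IsLaw (q i)) → ∑ 𝔾 (μ q v) ≡ 1#
  ∑μ≡1 {zero}  q v law = ∑-δ₁ (fins size) 0̂
  ∑μ≡1 {suc n} q v law = trans (∑-step (law zero) (v zero) _) (∑μ≡1 (q ∘ suc) (v ∘ suc) (law ∘ suc))

  μ≤1 : ∀ {n} (q : Fin n → Fin a → C) v → (∀ i → IsLaw (q i)) → ∀ x → μ q v x ≤ 1#
  μ≤1 q v law x = subst (μ q v x ≤_) (∑μ≡1 q v law) (term≤∑ (0≤μ q v law) (∈.∈-allFin x))

  D≤4‖‖² : ∀ h s → D h s ≤ fromℕ# 4 * ‖ h ‖²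
  D≤4‖‖² h s = begin
    D h s
      ≤⟨ ∑-mono 𝔾 (λ x → sq-+ (h x) (- h (x ⊝ s))) ⟩
    ∑ 𝔾 (λ x → fromℕ# 2 * (sq (h x) + sq (- h (x ⊝ s))))
      ≡⟨ trans (sym (∑-*ˡ 𝔾 _ _)) (cong (fromℕ# 2 *_) (∑-+ 𝔾 _ _)) ⟩
    fromℕ# 2 * (‖ h ‖² + ∑ 𝔾 (λ x → sq (- h (x ⊝ s))))
      ≡⟨ cong (λ z → fromℕ# 2 * (‖ h ‖² + z)) (trans (∑-shift s (λ x → sq (- h x)))
           (∑-cong 𝔾 λ x → solve 1 (λ y → (:- y) :* (:- y) := y :* y) refl (h x))) ⟩
    fromℕ# 2 * (‖ h ‖² + ‖ h ‖²)
      ≡⟨ solve 1 (λ n → con (+ 2) :* (n :+ n) := con (+ 4) :* n) refl ‖ h ‖² ⟩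
    fromℕ# 4 * ‖ h ‖² ∎
    where open ≤-Reasoning

  0≤ρ : 0# ≤ ρ
  0≤ρ = 0≤rate rateConst

  ρ≤1 : ρ ≤ 1#
  ρ≤1 = rate≤1 rateConst

  -- Every index with `f i ≡ s` steps in the direction `c ⊝ s` and multiplies D there by ρ; no other
  -- index increases it, and the initial point mass has D at most 4. For s = c the direction is
  -- `0̂`, where D vanishes. Balance is asked only where `f i ≢ c`, which leaves out the diagonal
  -- entry of the column.
  D-decay : ∀ {n} (q : Fin n → Fin a → C) (f : Fin n → X) c s → (∀ i → IsLaw (q i)) →
            (∀ i → f i ≢ c → Balanced E (q i)) → D (μ q (λ i → c ⊝ f i)) (c ⊝ s) ≤ fromℕ# 4 * ρ ^ count f s
  D-decay q f c s law balanced with s Fin.≟ c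
  ... | yes refl = subst (_≤ _) (sym (trans (cong (D _) (⊕-inverseʳ s)) (D-0̂ _)))
                     (*-nonNeg (0≤fromℕ 4) (0≤^ 0≤ρ (count f s)))
  ... | no  s≢c  = go q f law balanced
    where
    go : ∀ {n} (q : Fin n → Fin a → C) (f : Fin n → X) → (∀ i → IsLaw (q i)) →
         (∀ i → f i ≢ c → Balanced E (q i)) → D (μ q (λ i → c ⊝ f i)) (c ⊝ s) ≤ fromℕ# 4 * ρ ^ count f s
    go {zero} q f law balanced = ≤-trans (D≤4‖‖² δ (c ⊝ s)) (≤-reflexive (cong (fromℕ# 4 *_)
      (trans (∑-δ (fins size) 0̂ δ) (cong [_] (dec-true (0̂ Fin.≟ 0̂) refl)))))
      where
      δ : X → C
      δ x = [ does (x Fin.≟ 0̂) ]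
    go {suc n} q f law balanced with s Fin.≟ f zero
    ... | yes refl = ≤-trans (D-step-balanced (law zero) (balanced zero s≢c) (c ⊝ f zero) _)
      (≤-trans (*-monoˡ 0≤ρ (go (q ∘ suc) (f ∘ suc) (law ∘ suc) (balanced ∘ suc)))
        (≤-reflexive (solve 3 (λ r k p → r :* (k :* p) := k :* (r :* p)) refl ρ (fromℕ# 4) _)))
    ... | no _ = ≤-trans (D-step-≤ (law zero) (c ⊝ f zero) _ (c ⊝ s)) (go (q ∘ suc) (f ∘ suc) (law ∘ suc) (balanced ∘ suc))

  -- Elements outside S contribute `0̂`, so the length is always `size` and the constant
  -- `growth size` serves for every S.
  gens : (X → Bool) → X → List X
  gens S c = map (λ s → if S s then c ⊝ s else 0̂) 𝔾

  ∈-gens : ∀ S c {s} → S s ≡ true → c ⊝ s ∈ gens S c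
  ∈-gens S c {s} s∈S = subst (_∈ gens S c) (cong (λ b → if b then c ⊝ s else 0̂) s∈S)
    (∈.∈-map⁺ (λ s → if S s then c ⊝ s else 0̂) (∈.∈-allFin s))

  gens-⊆ : ∀ S c {H : X → Set} → H 0̂ → (∀ {s} → S s ≡ true → H (c ⊝ s)) → ∀ {v} → v ∈ gens S c → H v
  gens-⊆ S c {H} 0∈ ⊆H v∈ with ∈.∈-map⁻ (λ s → if S s then c ⊝ s else 0̂) v∈
  ... | s , _ , refl with S s in eq
  ...   | true  = ⊆H eq
  ...   | false = 0∈

  -- 4k repetitions make the error τ below of order ρ ^ (2 k): one factor ρ ^ k will absorb the number of columns.
  Popular : ∀ {n} → ℕ → (Fin n → X) → (X → Bool) → Set
  Popular k f S = ∀ s → S s ≡ true → 4 ℕ.* k ℕ.≤ count f s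

  errorConst : ℕ
  errorConst = growth size ℕ.* 4

  τ : ℕ → C
  τ k = fromℕ# errorConst * ρ ^ (2 ℕ.* k)

  0≤τ : ∀ k → 0# ≤ τ k
  0≤τ k = *-nonNeg (0≤fromℕ _) (0≤^ 0≤ρ (2 ℕ.* k))

  -- Squaring `errorConst` only enlarges the constant, so τ can be defined without the square root
  -- of one; the exponent 4k is even for the same purpose.
  growth≤τ² : ∀ k → fromℕ# (growth size) * (fromℕ# 4 * ρ ^ (4 ℕ.* k)) ≤ sq (τ k)
  growth≤τ² k = begin
    fromℕ# (growth size) * (fromℕ# 4 * ρ ^ (4 ℕ.* k))
      ≡⟨ trans (sym (*-assoc _ _ _)) (cong (_* ρ ^ (4 ℕ.* k)) (sym (fromℕ#-* (growth size) 4))) ⟩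
    fromℕ# errorConst * ρ ^ (4 ℕ.* k)
      ≤⟨ *-monoʳ (0≤^ 0≤ρ (4 ℕ.* k)) (fromℕ-mono (n≤n*n errorConst)) ⟩
    fromℕ# (errorConst ℕ.* errorConst) * ρ ^ (4 ℕ.* k)
      ≡⟨ cong₂ _*_ (fromℕ#-* errorConst errorConst) (trans (cong (ρ ^_) (4k k)) (^-homo-* ρ (2 ℕ.* k) (2 ℕ.* k))) ⟩
    (fromℕ# errorConst * fromℕ# errorConst) * (ρ ^ (2 ℕ.* k) * ρ ^ (2 ℕ.* k))
      ≡⟨ solve 2 (λ e r → (e :* e) :* (r :* r) := (e :* r) :* (e :* r)) refl (fromℕ# errorConst) (ρ ^ (2 ℕ.* k)) ⟩
    sq (τ k) ∎
    where
    open ≤-Reasoning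
    n≤n*n : ∀ n → n ℕ.≤ n ℕ.* n
    n≤n*n zero    = ℕ.z≤n
    n≤n*n (suc n) = ℕ.m≤m*n (suc n) (suc n)
    4k : ∀ k → 4 ℕ.* k ≡ 2 ℕ.* k ℕ.+ 2 ℕ.* k
    4k = solveℕ-∀

  module _ {n} (q : Fin n → Fin a → C) (f : Fin n → X) (c : X) (law : ∀ i → IsLaw (q i))
           (balanced : ∀ i → f i ≢ c → Balanced E (q i)) k (S : X → Bool) (popular : Popular k f S) where

    private
      ν : X → C
      ν = μ q (λ i → c ⊝ f i)

      H : X → Set
      H = span (gens S c)

      sub : IsSubgroup H
      sub = span-isSubgroup (gens S c)

    D≤ : ∀ {x} → H x → D ν x ≤ sq (τ k)
    D≤ {x} x∈ = ≤-trans (D-span ν (gens S c) (gens-⊆ S c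
        (subst (_≤ _) (sym (D-0̂ ν)) (*-nonNeg (0≤fromℕ 4) (0≤^ 0≤ρ (4 ℕ.* k))))
        (λ {s} s∈S → ≤-trans (D-decay q f c s law balanced) (*-monoˡ (0≤fromℕ 4) (^-antitone 0≤ρ ρ≤1 (popular s s∈S)))))
      x∈)
      (subst (λ l → fromℕ# (growth l) * _ ≤ _) (sym (trans (List.length-map (λ s → if S s then c ⊝ s else 0̂) 𝔾) (List.length-tabulate {n = size} id))) (growth≤τ² k))

    -- This is the single term y = x of the sum defining D.
    sq-difference≤ : ∀ {x} → H x → sq (ν x - ν 0̂) ≤ sq (τ k)
    sq-difference≤ {x} x∈ = ≤-trans (≤-reflexive (cong (λ y → sq (ν x - ν y)) (sym (⊕-inverseʳ x))))
      (≤-trans (term≤∑ {f = λ y → sq (ν y - ν (y ⊝ x))} (λ y → 0≤x² _) (∈.∈-allFin x)) (D≤ x∈))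

    ν≤ν0+τ : ∀ {x} → H x → ν x ≤ ν 0̂ + τ k
    ν≤ν0+τ {x} x∈ = subst (_≤ ν 0̂ + τ k) (solve 2 (λ x z → z :+ (x :- z) := x) refl (ν x) (ν 0̂))
      (+-monoʳ (ν 0̂) (x²≤y²⇒x≤y (0≤τ k) (sq-difference≤ x∈)))

    ν0≤ν+τ : ∀ {x} → H x → ν 0̂ ≤ ν x + τ k
    ν0≤ν+τ {x} x∈ = subst (_≤ ν x + τ k) (solve 2 (λ x z → z :+ (x :- z) := x) refl (ν 0̂) (ν x))
      (+-monoʳ (ν x) (x²≤y²⇒x≤y (0≤τ k) (subst (_≤ sq (τ k))
        (solve 2 (λ x z → (x :- z) :* (x :- z) := (z :- x) :* (z :- x)) refl (ν x) (ν 0̂)) (sq-difference≤ x∈))))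

    private
      ∑-const-𝔾 : ∀ z → ∑ 𝔾 (λ _ → z) ≡ fromℕ# size * z
      ∑-const-𝔾 z = trans (∑-const 𝔾 z) (cong (λ l → fromℕ# l * z) (List.length-tabulate id))

    module _ (spans : ∀ x → H x) where

      size*ν0≤ : fromℕ# size * ν 0̂ ≤ 1# + fromℕ# size * τ k
      size*ν0≤ = subst₂ _≤_ (∑-const-𝔾 (ν 0̂))
        (trans (∑-+ 𝔾 _ _) (cong₂ _+_ (∑μ≡1 q _ law) (∑-const-𝔾 (τ k))))
        (∑-mono 𝔾 (λ x → ν0≤ν+τ (spans x)))

      ≤size*ν0 : 1# ≤ fromℕ# size * ν 0̂ + fromℕ# size * τ k
      ≤size*ν0 = subst₂ _≤_ (∑μ≡1 q _ law) (trans (∑-+ 𝔾 _ _) (cong₂ _+_ (∑-const-𝔾 (ν 0̂)) (∑-const-𝔾 (τ k))))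
        (∑-mono 𝔾 (λ x → ν≤ν0+τ (spans x)))

  module Escape {H : X → Set} (sub : IsSubgroup H) (H? : Decidable H) where
    open IsSubgroup sub

    mass-on : (X → C) → X → C
    mass-on h y = ∑ 𝔾 (λ x → [ does (H? (x ⊝ y)) ] * h x)

    -- If t₀ is one residue with z + t₀ v in H, all others differ from it by an offset u with u v in
    -- H. If these offsets and a had gcd 1, v itself would lie in H; so they share a prime with a,
    -- and the residues in question lie in a single class modulo that prime.
    coset-mass : ∀ {q} → IsLaw q → Balanced E q → ∀ {v} → ¬ H v → ∀ z →
                 ∑ ts (λ t → [ does (H? (z ⊕ toℕ t · v)) ] * q t) + ε₀ ≤ 1#
    coset-mass {q} law balanced {v} v∉H z with Fin.any? (λ t → H? (z ⊕ toℕ t · v))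
    ... | no  none = subst (λ s → s + ε₀ ≤ 1#) (sym (trans (∑-cong ts λ t →
            trans (cong (λ b → [ b ] * q t) (dec-false (H? (z ⊕ toℕ t · v)) (λ h → none (t , h)))) (zeroˡ (q t))) (∑-0 ts)))
            (subst (_≤ 1#) (sym (+-identityˡ ε₀)) (recip≤1 E))
    ... | yes (t₀ , t₀∈) = ≤-trans (+-monoˡ ε₀ (∑-mono ts λ t → *-monoʳ (IsLaw.nonNeg law t) (mono t)))
                             (balanced (proj₁ (proj₂ found)) (proj₁ (proj₂ (proj₂ found))) (a ℕ.∸ toℕ t₀))
      where
      inH? = λ t → H? (z ⊕ toℕ t · v)
      us = map (offset t₀) (filter inH? ts)
      us∈ : All (λ u → H (u · v)) us
      us∈ = All.map⁺ (All.map (λ {t} t∈ → subst H (sym (trans (offset-· t₀ t v) (sym (cancel (toℕ t · v) (toℕ t₀ · v))))) (⊝∈ t∈ t₀∈)) (All.all-filter inH? ts))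
        where
        cancel : ∀ x y → (z ⊕ x) ⊝ (z ⊕ y) ≡ x ⊝ y
        cancel x y = trans (⊝-⊕ (z ⊕ x) z y) (cong (_⊝ y) (trans (cong (_⊝ z) (⊕-comm z x)) (⊕-⊝ x z)))
      found = common-prime a us (λ g≡1 → v∉H (subst H (trans (cong (_· v) g≡1) (⊕-identityʳ v)) (gcds∈ us us∈)))
      p = proj₁ found
      mono : ∀ t → [ does (inH? t) ] ≤ [ does (p ∣? offset t₀ t) ]
      mono t with inH? t
      ... | no  _  = 0≤[] _
      ... | yes t∈ = ≤-reflexive (cong [_] (sym (dec-true (p ∣? offset t₀ t)
                       (All.lookup (proj₂ (proj₂ (proj₂ found))) (∈.∈-map⁺ (offset t₀) (∈.∈-filter⁺ inH? (∈.∈-allFin t) t∈))))))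

    mass-on-step : ∀ q v h y → mass-on (step q v h) y ≡ ∑ 𝔾 (λ x → h x * ∑ ts (λ t → [ does (H? ((x ⊝ y) ⊕ toℕ t · v)) ] * q t))
    mass-on-step q v h y = begin
      ∑ 𝔾 (λ x → [ does (H? (x ⊝ y)) ] * ∑ ts (λ t → q t * h (x ⊝ toℕ t · v)))
        ≡⟨ trans (∑-cong 𝔾 λ x → ∑-*ˡ ts _ _) (∑-swap 𝔾 ts _) ⟩
      ∑ ts (λ t → ∑ 𝔾 (λ x → [ does (H? (x ⊝ y)) ] * (q t * h (x ⊝ toℕ t · v))))
        ≡⟨ ∑-cong ts (λ t → trans
             (∑-cong 𝔾 λ x → cong (λ z → [ does (H? (z ⊝ y)) ] * (q t * h (x ⊝ toℕ t · v))) (sym (⊝-⊕-cancel x (toℕ t · v))))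
             (∑-shift (toℕ t · v) (λ x → [ does (H? ((x ⊕ toℕ t · v) ⊝ y)) ] * (q t * h x)))) ⟩
      ∑ ts (λ t → ∑ 𝔾 (λ x → [ does (H? ((x ⊕ toℕ t · v) ⊝ y)) ] * (q t * h x)))
        ≡⟨ ∑-swap ts 𝔾 _ ⟩
      ∑ 𝔾 (λ x → ∑ ts (λ t → [ does (H? ((x ⊕ toℕ t · v) ⊝ y)) ] * (q t * h x)))
        ≡⟨ ∑-cong 𝔾 (λ x → trans (∑-cong ts λ t → trans
             (cong (λ z → [ does (H? z) ] * (q t * h x)) (slide x (toℕ t · v)))
             (solve 3 (λ i q h → i :* (q :* h) := h :* (i :* q)) refl _ (q t) (h x)))
             (sym (∑-*ˡ ts (h x) _))) ⟩
      ∑ 𝔾 (λ x → h x * ∑ ts (λ t → [ does (H? ((x ⊝ y) ⊕ toℕ t · v)) ] * q t)) ∎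
      where
      open ≡.≡-Reasoning
      slide : ∀ x w → (x ⊕ w) ⊝ y ≡ (x ⊝ y) ⊕ w
      slide x w = trans (⊕-assoc x w (⊖ y)) (trans (cong (x ⊕_) (⊕-comm w (⊖ y))) (sym (⊕-assoc x (⊖ y) w)))

    mass-on-step-average : ∀ q v h y → mass-on (step q v h) y ≡ ∑ ts (λ t → q t * mass-on h (y ⊝ toℕ t · v))
    mass-on-step-average q v h y = begin
      mass-on (step q v h) y
        ≡⟨ mass-on-step q v h y ⟩
      ∑ 𝔾 (λ x → h x * ∑ ts (λ t → [ does (H? ((x ⊝ y) ⊕ toℕ t · v)) ] * q t))
        ≡⟨ trans (∑-cong 𝔾 λ x → ∑-*ˡ ts _ _) (∑-swap 𝔾 ts _) ⟩
      ∑ ts (λ t → ∑ 𝔾 (λ x → h x * ([ does (H? ((x ⊝ y) ⊕ toℕ t · v)) ] * q t)))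
        ≡⟨ ∑-cong ts (λ t → trans (∑-cong 𝔾 λ x → trans
             (solve 3 (λ h i q → h :* (i :* q) := q :* (i :* h)) refl (h x) _ (q t))
             (cong (λ z → q t * ([ does (H? z) ] * h x)) (slide x (toℕ t · v)))) (sym (∑-*ˡ 𝔾 (q t) _))) ⟩
      ∑ ts (λ t → q t * mass-on h (y ⊝ toℕ t · v)) ∎
      where
      open ≡.≡-Reasoning
      slide : ∀ x w → (x ⊝ y) ⊕ w ≡ x ⊝ (y ⊝ w)
      slide x w = trans (⊕-assoc x (⊖ y) w) (cong (x ⊕_) (trans (⊕-comm (⊖ y) w) (sym (⊖-⊝ y w))))

    -- Given the other summands, the i-th one leads into the coset of y with probability at most 1 -
    -- ε₀. The steps in front of it only average over cosets, so the claim is made for every y.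
    escape : ∀ {n} (q : Fin n → Fin a → C) v → (∀ i → IsLaw (q i)) → ∀ i → ¬ H (v i) → Balanced E (q i) →
             ∀ y → mass-on (μ q v) y ≤ 1# - ε₀
    escape {suc n} q v law zero v∉H balanced y = begin
      mass-on (step (q zero) (v zero) h) y
        ≡⟨ mass-on-step (q zero) (v zero) h y ⟩
      ∑ 𝔾 (λ x → h x * ∑ ts (λ t → [ does (H? ((x ⊝ y) ⊕ toℕ t · v zero)) ] * q zero t))
        ≤⟨ ∑-mono 𝔾 (λ x → *-monoˡ (0≤μ (q ∘ suc) (v ∘ suc) (law ∘ suc) x)
             (subst (_≤ 1# - ε₀) (solve 2 (λ s e → (s :+ e) :- e := s) refl _ ε₀) (+-monoˡ (- ε₀) (coset-mass (law zero) balanced v∉H (x ⊝ y))))) ⟩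
      ∑ 𝔾 (λ x → h x * (1# - ε₀))
        ≡⟨ trans (sym (∑-*ʳ 𝔾 _ h)) (trans (cong (_* (1# - ε₀)) (∑μ≡1 (q ∘ suc) (v ∘ suc) (law ∘ suc))) (*-identityˡ _)) ⟩
      1# - ε₀ ∎
      where
      open ≤-Reasoning
      h = μ (q ∘ suc) (v ∘ suc)
    escape {suc n} q v law (suc i) v∉H balanced y = begin
      mass-on (step (q zero) (v zero) h) y
        ≡⟨ mass-on-step-average (q zero) (v zero) h y ⟩
      ∑ ts (λ t → q zero t * mass-on h (y ⊝ toℕ t · v zero))
        ≤⟨ ∑-mono ts (λ t → *-monoˡ (IsLaw.nonNeg (law zero) t) (escape (q ∘ suc) (v ∘ suc) (law ∘ suc) i v∉H balanced _)) ⟩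
      ∑ ts (λ t → q zero t * (1# - ε₀))
        ≡⟨ trans (sym (∑-*ʳ ts _ (q zero))) (trans (cong (_* (1# - ε₀)) (IsLaw.mass-1 (law zero))) (*-identityˡ _)) ⟩
      1# - ε₀ ∎
      where
      open ≤-Reasoning
      h = μ (q ∘ suc) (v ∘ suc)

  card : (X → Bool) → C
  card S = ∑ 𝔾 (λ s → [ S s ])

  -- For s in S, `c ⊝ s` lies in the span H, so its probability is that of `0̂` up to τ. These are
  -- `card S` different points of H, and by `escape` the whole of H has mass at most 1 - ε₀.
  card*μ0≤ : ∀ {n} (q : Fin n → Fin a → C) (f : Fin n → X) (c : X) → (∀ i → IsLaw (q i)) →
             (∀ i → f i ≢ c → Balanced E (q i)) → ∀ k (S : X → Bool) → Popular k f S →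
             ∀ i → ¬ span (gens S c) (c ⊝ f i) →
             card S * μ q (λ i → c ⊝ f i) 0̂ ≤ (1# - ε₀) + fromℕ# size * τ k
  card*μ0≤ q f c law balanced k S popular i fi∉H = begin
    card S * ν 0̂
      ≡⟨ ∑-*ʳ 𝔾 (ν 0̂) _ ⟩
    ∑ 𝔾 (λ s → [ S s ] * ν 0̂)
      ≤⟨ ∑-mono 𝔾 bound ⟩
    ∑ 𝔾 (λ s → [ S s ] * ν (c ⊝ s) + τ k)
      ≡⟨ trans (∑-+ 𝔾 _ _) (cong₂ _+_
           (trans (∑-cong 𝔾 λ s → cong (λ z → [ S z ] * ν (c ⊝ s)) (sym (⊝-⊝ c s)))
             (∑-reindex (fins size) (c ⊝_) (c ⊝_) (⊝-⊝ c) (⊝-⊝ c) (λ x → [ S (c ⊝ x) ] * ν x)))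
           (trans (∑-const 𝔾 (τ k)) (cong (λ l → fromℕ# l * τ k) (List.length-tabulate id)))) ⟩
    ∑ 𝔾 (λ x → [ S (c ⊝ x) ] * ν x) + fromℕ# size * τ k
      ≤⟨ +-monoˡ _ (∑-mono 𝔾 λ x → *-monoʳ (0≤μ q _ law x) (mono x)) ⟩
    mass-on ν 0̂ + fromℕ# size * τ k
      ≤⟨ +-monoˡ _ (escape q _ law i fi∉H (balanced i fi≢c) 0̂) ⟩
    (1# - ε₀) + fromℕ# size * τ k ∎
    where
    open ≤-Reasoning
    sub = span-isSubgroup (gens S c)
    H? = span? (gens S c)
    open Escape sub H?
    ν : X → C
    ν = μ q (λ i → c ⊝ f i)
    fi≢c : f i ≢ c
    fi≢c refl = fi∉H (subst (span (gens S c)) (sym (⊕-inverseʳ c)) (IsSubgroup.0∈ sub))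
    bound : ∀ s → [ S s ] * ν 0̂ ≤ [ S s ] * ν (c ⊝ s) + τ k
    bound s with S s in eq
    ... | true  = subst₂ _≤_ (sym (*-identityˡ _)) (cong (_+ τ k) (sym (*-identityˡ _)))
                    (ν0≤ν+τ q f c law balanced k S popular (span-∈ (∈-gens S c eq)))
    ... | false = subst₂ _≤_ (sym (zeroˡ _)) (sym (trans (cong (_+ τ k) (zeroˡ _)) (+-identityˡ _))) (0≤τ k)
    mono : ∀ x → [ S (c ⊝ x) ] ≤ [ does (H? (x ⊝ 0̂)) ]
    mono x with S (c ⊝ x) in eq
    ... | false = 0≤[] _
    ... | true  = ≤-reflexive (cong [_] (sym (dec-true (H? (x ⊝ 0̂))
                    (subst (span (gens S c)) (trans (⊝-⊝ c x) (sym (⊝-0 x))) (span-∈ (∈-gens S c eq))))))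

-- Popular values, and an envelope for the functions whose popular set is bad.

module Estimate (F : OrderedRing) (a : ℕ) .{{_ : NonZero a}} (G : TorsionGroup a) (E : ℕ) where
  open OrderedRingProperties F
  open TorsionGroupProperties a G
  open Walk F a G
  open Contraction F a G E
  open Column F a G E

  private
    module ∑ℕ = Sums ℕ.+-*-commutativeSemiring

  instance
    size≢0 : NonZero size
    size≢0 = Fin.nonZeroIndex 0̂

  -- All base points c are required because the condition at j is based at c = f j, which may be an
  -- unpopular value.
  Good : (X → Bool) → Set
  Good S = ∀ c x → span (gens S c) x

  good? : ∀ S → Dec (Good S)
  good? S = Fin.all? λ c → Fin.all? (span? (gens S c))

  -- A vector rather than a predicate, so that the possible popular sets can be enumerated and
  -- summed over.
  popular : ∀ {n} → ℕ → (Fin n → X) → Vec Bool size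
  popular k f = Vec.tabulate λ s → does (4 ℕ.* k ℕ.≤? count f s)

  popular-Popular : ∀ {n} k (f : Fin n → X) → Popular k f (lookup (popular k f))
  popular-Popular k f s s∈ = does⇒ (4 ℕ.* k ℕ.≤? count f s)
    (trans (sym (Vec.lookup∘tabulate (λ s → does (4 ℕ.* k ℕ.≤? count f s)) s)) s∈)

  unpopular-count : ∀ {n} k (f : Fin n → X) s → lookup (popular k f) s ≡ false → count f s ℕ.≤ 4 ℕ.* k
  unpopular-count k f s s∉ = ℕ.<⇒≤ (ℕ.≰⇒> (does⇒¬ (4 ℕ.* k ℕ.≤? count f s)
    (trans (sym (Vec.lookup∘tabulate (λ s → does (4 ℕ.* k ℕ.≤? count f s)) s)) s∉)))

  count>0 : ∀ {n} (f : Fin n → X) s → 1 ℕ.≤ count f s → ∃[ i ] f i ≡ s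
  count>0 {suc n} f s h with s Fin.≟ f zero
  ... | yes s≡ = zero , sym s≡
  ... | no  _  = let (i , eq) = count>0 (f ∘ suc) s h in suc i , eq

  #unpopular : ∀ {n} → (X → Bool) → (Fin n → X) → ℕ
  #unpopular {zero}  S f = 0
  #unpopular {suc n} S f = (if S (f zero) then 0 else 1) ℕ.+ #unpopular S (f ∘ suc)

  #unpopular≡ : ∀ {n} S (f : Fin n → X) → #unpopular S f ≡ ∑ℕ.∑ 𝔾 (λ s → if S s then 0 else count f s)
  #unpopular≡ {zero}  S f = sym (trans (∑ℕ.∑-cong 𝔾 (λ s → Bool.if-eta (S s))) (∑ℕ.∑-0 𝔾))
  #unpopular≡ {suc n} S f = sym (begin
    ∑ℕ.∑ 𝔾 (λ s → if S s then 0 else (δ s ℕ.+ count (f ∘ suc) s))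
      ≡⟨ ∑ℕ.∑-cong 𝔾 (λ s → split (S s) (does (s Fin.≟ f zero)) (count (f ∘ suc) s)) ⟩
    ∑ℕ.∑ 𝔾 (λ s → ∑ℕ.[ does (s Fin.≟ f zero) ] ℕ.* (if S s then 0 else 1) ℕ.+ (if S s then 0 else count (f ∘ suc) s))
      ≡⟨ ∑ℕ.∑-+ 𝔾 _ _ ⟩
    ∑ℕ.∑ 𝔾 (λ s → ∑ℕ.[ does (s Fin.≟ f zero) ] ℕ.* (if S s then 0 else 1)) ℕ.+ ∑ℕ.∑ 𝔾 (λ s → if S s then 0 else count (f ∘ suc) s)
      ≡⟨ cong₂ ℕ._+_ (∑ℕ.∑-δ (fins size) (f zero) (λ s → if S s then 0 else 1)) (sym (#unpopular≡ S (f ∘ suc))) ⟩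
    #unpopular S f ∎)
    where
    open ≡.≡-Reasoning
    δ : X → ℕ
    δ s = if does (s Fin.≟ f zero) then 1 else 0
    split : ∀ b d c → (if b then 0 else ((if d then 1 else 0) ℕ.+ c)) ≡ ∑ℕ.[ d ] ℕ.* (if b then 0 else 1) ℕ.+ (if b then 0 else c)
    split true  true  c = refl
    split true  false c = refl
    split false true  c = refl
    split false false c = refl

  #unpopular≤ : ∀ {n} k (f : Fin n → X) → #unpopular (lookup (popular k f)) f ℕ.≤ size ℕ.* (4 ℕ.* k)
  #unpopular≤ k f = ℕ.≤-trans (ℕ.≤-reflexive (#unpopular≡ (lookup (popular k f)) f))
    (ℕ.≤-trans (bounded 𝔾) (ℕ.≤-reflexive (cong (ℕ._* (4 ℕ.* k)) (List.length-tabulate {n = size} id))))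
    where
    bounded : ∀ xs → ∑ℕ.∑ xs (λ s → if lookup (popular k f) s then 0 else count f s) ℕ.≤ length xs ℕ.* (4 ℕ.* k)
    bounded []       = ℕ.z≤n
    bounded (s ∷ xs) = ℕ.+-mono-≤ term (bounded xs)
      where
      term : (if lookup (popular k f) s then 0 else count f s) ℕ.≤ 4 ℕ.* k
      term with lookup (popular k f) s in eq
      ... | true  = ℕ.z≤n
      ... | false = unpopular-count k f s eq

  length-vecs : ∀ {A} (En : Enumeration A) n → length (elements (vecs En n)) ≡ length (elements En) ℕ.^ n
  length-vecs En zero    = refl
  length-vecs {A} En (suc n) = trans (go (elements En)) (cong (length (elements En) ℕ.*_) (length-vecs En n))
    where
    go : ∀ xs → length (cartesianProductWith Vec._∷_ xs (elements (vecs En n))) ≡ length xs ℕ.* length (elements (vecs En n))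
    go []       = refl
    go (x ∷ xs) = trans (List.length-++ (map (x Vec.∷_) (elements (vecs En n)))) (cong₂ ℕ._+_ (List.length-map _ (elements (vecs En n))) (go xs))

  #true : (X → Bool) → List X → ℕ
  #true S []       = 0
  #true S (x ∷ xs) = (if S x then 1 else 0) ℕ.+ #true S xs

  ∑-[]≡#true : ∀ S xs → ∑ xs (λ s → [ S s ]) ≡ fromℕ# (#true S xs)
  ∑-[]≡#true S []       = sym fromℤ-0
  ∑-[]≡#true S (x ∷ xs) with S x
  ... | true  = trans (cong (_+_ 1#) (∑-[]≡#true S xs)) (sym (fromℕ#-suc _))
  ... | false = trans (+-identityˡ _) (∑-[]≡#true S xs)

  -- Equal to 1 for empty S; hence `card*1/card≤1` is only an inequality, while equality takes a
  -- member of S.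
  1/card : (X → Bool) → C
  1/card S = recip (ℕ.pred (#true S 𝔾))

  private
    n*1/n≤1 : ∀ n → fromℕ# n * recip (ℕ.pred n) ≤ 1#
    n*1/n≤1 zero    = subst (_≤ 1#) (sym (trans (cong (_* recip 0) fromℤ-0) (zeroˡ _))) 0≤1
    n*1/n≤1 (suc n) = ≤-reflexive (suc*recip n)

  card*1/card≤1 : ∀ S → card S * 1/card S ≤ 1#
  card*1/card≤1 S = subst (λ z → z * 1/card S ≤ 1#) (sym (∑-[]≡#true S 𝔾)) (n*1/n≤1 (#true S 𝔾))

  card*1/card : ∀ S {s} → S s ≡ true → card S * 1/card S ≡ 1#
  card*1/card S {s} s∈ = trans (cong (_* 1/card S) (∑-[]≡#true S 𝔾)) (n*1/ₙ (#true S 𝔾) {{ℕ.>-nonZero (pos (∈.∈-allFin s))}})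
    where
    pos : ∀ {xs} → s ∈ xs → 0 ℕ.< #true S xs
    pos {_ ∷ xs} (here refl) = subst (λ b → 0 ℕ.< (if b then 1 else 0) ℕ.+ #true S xs) (sym s∈) (ℕ.s≤s ℕ.z≤n)
    pos (there s∈xs) = ℕ.<-≤-trans (pos s∈xs) (ℕ.m≤n+m _ _)

  unscale-card : ∀ S {s x y} → S s ≡ true → card S * x ≤ y → x ≤ y * 1/card S
  unscale-card S {s} {x} {y} s∈ h = subst (_≤ y * 1/card S)
    (trans (solve 3 (λ c x i → (c :* x) :* i := (c :* i) :* x) refl (card S) x (1/card S))
      (trans (cong (_* x) (card*1/card S s∈)) (*-identityˡ x)))
    (*-monoʳ (0≤recip _) h)

  1/size : C
  1/size = 1/ₙ size

  module Weights (θ : C) (0≤θ : 0# ≤ θ) (Y : ℕ) .{{_ : NonZero Y}} where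

    -- For bad S, `cap S (f j)` bounds the probability of the condition at j. The caps of all values
    -- sum to too much for a union over f; lowering the unpopular ones to 1/Y brings the sum down to
    -- about θ.
    cap weight : (X → Bool) → X → C
    cap    S g = if S g then θ * 1/card S else 1#
    weight S g = if S g then θ * 1/card S else 1/ₙ Y

    0≤weight : ∀ S g → 0# ≤ weight S g
    0≤weight S g with S g
    ... | true  = *-nonNeg 0≤θ (0≤recip _)
    ... | false = 0≤recip _

    -- An unpopular vertex has cap 1 = Y · 1/Y and so accounts for one factor Y.
    ∏-cap : ∀ {n} S (f : Fin n → X) → ∏ (λ j → cap S (f j)) ≡ fromℕ# Y ^ #unpopular S f * ∏ (λ j → weight S (f j))
    ∏-cap {zero}  S f = sym (*-identityˡ 1#)
    ∏-cap {suc n} S f with S (f zero)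
    ... | true  = trans (cong (_ *_) (∏-cap S (f ∘ suc)))
                    (solve 3 (λ w y p → w :* (y :* p) := y :* (w :* p)) refl _ (fromℕ# Y ^ #unpopular S (f ∘ suc)) _)
    ... | false = trans (cong (1# *_) (∏-cap S (f ∘ suc))) (trans (cong (_* (fromℕ# Y ^ #unpopular S (f ∘ suc) * ∏ (λ j → weight S (f (suc j))))) (sym (n*1/ₙ Y)))
                    (solve 4 (λ w i y p → (w :* i) :* (y :* p) := (w :* y) :* (i :* p)) refl (fromℕ# Y) (1/ₙ Y) (fromℕ# Y ^ #unpopular S (f ∘ suc)) _))

    ∑-weight : ∀ S → ∑ 𝔾 (weight S) ≤ θ + fromℕ# size * 1/ₙ Y
    ∑-weight S = begin
      ∑ 𝔾 (weight S)
        ≤⟨ ∑-mono 𝔾 bound ⟩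
      ∑ 𝔾 (λ g → [ S g ] * (θ * 1/card S) + 1/ₙ Y)
        ≡⟨ trans (∑-+ 𝔾 _ _) (cong₂ _+_ (sym (∑-*ʳ 𝔾 _ _)) (trans (∑-const 𝔾 _) (cong (λ l → fromℕ# l * 1/ₙ Y) (List.length-tabulate {n = size} id)))) ⟩
      card S * (θ * 1/card S) + fromℕ# size * 1/ₙ Y
        ≤⟨ +-monoˡ _ (subst₂ _≤_ (solve 3 (λ c t i → t :* (c :* i) := c :* (t :* i)) refl (card S) θ (1/card S)) (*-identityʳ θ)
             (*-monoˡ 0≤θ (card*1/card≤1 S))) ⟩
      θ + fromℕ# size * 1/ₙ Y ∎
      where
      open ≤-Reasoning
      bound : ∀ g → weight S g ≤ [ S g ] * (θ * 1/card S) + 1/ₙ Y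
      bound g with S g
      ... | true  = ≤-trans (≤-reflexive (sym (*-identityˡ _))) (x≤x+y (0≤recip _))
      ... | false = ≤-reflexive (sym (trans (cong (_+ 1/ₙ Y) (zeroˡ _)) (+-identityˡ _)))

    -- Bounds the contribution of every f whose popular set is S.
    envelope : ∀ {n} → ℕ → Vec Bool size → (Fin n → X) → C
    envelope k S f = fromℕ# Y ^ (size ℕ.* (4 ℕ.* k)) * ∏ (λ j → weight (lookup S) (f j))

    0≤envelope : ∀ {n} k S (f : Fin n → X) → 0# ≤ envelope k S f
    0≤envelope k S f = *-nonNeg (0≤^ (0≤fromℕ Y) (size ℕ.* (4 ℕ.* k))) (∏-nonNeg λ j → 0≤weight (lookup S) (f j))

    ∏-cap≤envelope : ∀ {n} k (f : Fin n → X) → ∏ (λ j → cap (lookup (popular k f)) (f j)) ≤ envelope k (popular k f) f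
    ∏-cap≤envelope k f = ≤-trans (≤-reflexive (∏-cap S f))
      (*-monoʳ (∏-nonNeg λ j → 0≤weight S (f j)) (^-monotone 1≤Y (#unpopular≤ k f)))
      where
      S = lookup (popular k f)
      1≤Y : 1# ≤ fromℕ# Y
      1≤Y = subst (λ y → 1# ≤ fromℕ# y) (ℕ.suc-pred Y) (1≤suc (ℕ.pred Y))

    subsets : List (Vec Bool size)
    subsets = elements (vecs bools size)

    -- Summing over every S removes the dependence of the popular set on f, so that the sum over f
    -- factors vertex by vertex; the cost is the constant factor `2 ℕ.^ size`.
    totalEnvelope : ∀ {n} → ℕ → (Fin n → X) → C
    totalEnvelope k f = ∑ subsets (λ S → envelope k S f)

    0≤totalEnvelope : ∀ {n} k (f : Fin n → X) → 0# ≤ totalEnvelope k f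
    0≤totalEnvelope k f = ∑-nonNeg subsets λ S → 0≤envelope k S f

    envelope≤total : ∀ {n} k S (f : Fin n → X) → envelope k S f ≤ totalEnvelope k f
    envelope≤total k S f = term≤∑ {f = λ S → envelope k S f} (λ S → 0≤envelope k S f) (Enumeration.complete (vecs bools size) S)

    ∑-totalEnvelope : ∀ n k → ∑ (elements (vecs (fins size) n)) (λ f → totalEnvelope k (lookup f))
      ≤ fromℕ# (2 ℕ.^ size) * (fromℕ# Y ^ (size ℕ.* (4 ℕ.* k)) * (θ + fromℕ# size * 1/ₙ Y) ^ n)
    ∑-totalEnvelope n k = begin
      ∑ fs (λ f → totalEnvelope k (lookup f))
        ≡⟨ ∑-swap fs subsets _ ⟩
      ∑ subsets (λ S → ∑ fs (λ f → envelope k S (lookup f)))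
        ≤⟨ ∑-mono subsets (λ S → ≤-trans (≤-reflexive (sym (∑-*ˡ fs _ _)))
             (*-monoˡ (0≤^ (0≤fromℕ Y) (size ℕ.* (4 ℕ.* k)))
               (≤-trans (≤-reflexive (trans (∑-∏ (fins size) {n} (λ _ → weight (lookup S))) (∏-const n _)))
                 (^-mono (∑-nonNeg 𝔾 (0≤weight (lookup S))) (∑-weight (lookup S)) n)))) ⟩
      ∑ subsets (λ _ → B)
        ≡⟨ trans (∑-const subsets B) (cong (λ l → fromℕ# l * B) (length-vecs bools size)) ⟩
      fromℕ# (2 ℕ.^ size) * B ∎
      where
      open ≤-Reasoning
      fs = elements (vecs (fins size) n)
      B = fromℕ# Y ^ (size ℕ.* (4 ℕ.* k)) * (θ + fromℕ# size * 1/ₙ Y) ^ n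

  all-true⇒good : ∀ S → (∀ s → S s ≡ true) → Good S
  all-true⇒good S all c x = subst (span (gens S c)) (⊝-⊝ c x) (span-∈ (∈-gens S c (all (c ⊝ x))))

  -- A bad S misses some value. This serves to put 1/size below θ / `card S`, so that the main term
  -- of a bad f also stays under the envelope.
  bad⇒card : ∀ S → ¬ Good S → card S * 1/size ≤ 1# - 1/size
  bad⇒card S bad with Fin.any? (λ s → S s Bool.≟ false)
  ... | no  none = contradiction (all-true⇒good S λ s → Bool.¬-not (λ eq → none (s , eq))) bad
  ... | yes (s₀ , s₀∉) = begin
    card S * 1/size
      ≡⟨ solve 2 (λ c i → c :* i := (c :+ con (+ 1)) :* i :- i) refl (card S) 1/size ⟩
    (card S + 1#) * 1/size - 1/size
      ≤⟨ +-monoˡ _ (*-monoʳ (0≤recip _) card+1≤) ⟩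
    fromℕ# size * 1/size - 1/size
      ≡⟨ cong (_- 1/size) (n*1/ₙ size) ⟩
    1# - 1/size ∎
    where
    open ≤-Reasoning
    pointwise : ∀ s → [ S s ] + [ does (s Fin.≟ s₀) ] ≤ 1#
    pointwise s with s Fin.≟ s₀
    ... | yes refl = subst (λ b → [ b ] + 1# ≤ 1#) (sym s₀∉) (≤-reflexive (+-identityˡ 1#))
    ... | no  _    = subst (_≤ 1#) (sym (+-identityʳ _)) ([]≤1 (S s))
    card+1≤ : card S + 1# ≤ fromℕ# size
    card+1≤ = subst₂ _≤_ (trans (∑-+ 𝔾 _ _) (cong (_+_ (card S)) (∑-δ₁ (fins size) s₀)))
      (trans (∑-const 𝔾 1#) (trans (*-identityʳ _) (cong fromℕ# (List.length-tabulate {n = size} id))))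
      (∑-mono 𝔾 pointwise)

  -- With `suc k` the threshold is positive, so popular values are attained and lie in the span of
  -- f; the differences based at `0̂` already span the group.
  good⇒generates : ∀ {n} k (f : Vec X n) → Good (lookup (popular (suc k) (extend f))) → Generates (lookup f)
  good⇒generates k f good x = span-least sub (gens-⊆ S 0̂ (IsSubgroup.0∈ sub) ⊆H) (good 0̂ x)
    where
    S = lookup (popular (suc k) (extend f))
    sub = span-isSubgroup (tabulate (lookup f))
    values : ∀ i → span (tabulate (lookup f)) (extend f i)
    values zero    = IsSubgroup.0∈ sub
    values (suc i) = span-∈ (∈.∈-tabulate⁺ i)
    ⊆H : ∀ {s} → S s ≡ true → span (tabulate (lookup f)) (0̂ ⊝ s)
    ⊆H {s} s∈ = let (i , fi≡s) = count>0 (extend f) s (ℕ.≤-trans (ℕ.s≤s ℕ.z≤n) (popular-Popular (suc k) (extend f) s s∈))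
      in IsSubgroup.⊝∈ sub (IsSubgroup.0∈ sub) (subst (span _) fi≡s (values i))

  -- If every c - f i were in H, the base vertex with value `0̂` would give c in H, hence all values
  -- of f in H, and H would be the whole group. For any other base point c′, c - s = (c′ - s) - (c′
  -- - c) with c in S, so the differences based at c′ would span as well and S would be good.
  bad⇒escapes : ∀ {n} S (f : Vec X n) → ¬ Good S → Generates (lookup f) → ∀ {c} → S c ≡ true →
                ∃[ i ] ¬ span (gens S c) (c ⊝ extend f i)
  bad⇒escapes S f bad generates {c} c∈ with Fin.any? (λ i → ¬? (span? (gens S c) (c ⊝ extend f i)))
  ... | yes found = found
  ... | no  none  = contradiction good bad
    where
    H = span (gens S c)
    sub = span-isSubgroup (gens S c)
    open IsSubgroup sub
    inside : ∀ i → H (c ⊝ extend f i)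
    inside i with span? (gens S c) (c ⊝ extend f i)
    ... | yes h = h
    ... | no  h = contradiction (i , h) none
    c∈H : H c
    c∈H = subst H (⊝-0 c) (inside zero)
    f⊆H : ∀ {v} → v ∈ tabulate (lookup f) → H v
    f⊆H v∈ with ∈.∈-tabulate⁻ v∈
    ... | i , refl = subst H (⊝-⊝ c _) (⊝∈ c∈H (inside (suc i)))
    good : Good S
    good c′ x = span-least sub′ (gens-⊆ S c (IsSubgroup.0∈ sub′) ⊆H′) (span-least sub f⊆H (generates x))
      where
      sub′ = span-isSubgroup (gens S c′)
      ⊆H′ : ∀ {s} → S s ≡ true → span (gens S c′) (c ⊝ s)
      ⊆H′ {s} s∈ = subst (span (gens S c′)) (difference s)
        (IsSubgroup.⊝∈ sub′ (span-∈ (∈-gens S c′ s∈)) (span-∈ (∈-gens S c′ c∈)))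
        where
        difference : ∀ s → (c′ ⊝ s) ⊝ (c′ ⊝ c) ≡ c ⊝ s
        difference s = trans (cong ((c′ ⊝ s) ⊕_) (⊖-⊝ c′ c)) (trans (⊕-comm _ _)
          (trans (⊕-assoc c (⊖ c′) (c′ ⊝ s)) (cong (c ⊕_)
            (trans (sym (⊕-assoc (⊖ c′) c′ (⊖ s))) (trans (cong (_⊝ s) (⊕-inverseˡ c′)) (⊕-identityˡ _))))))

-- The expected number of solutions for rational laws.

module Uniformity (F : OrderedRing) (a : ℕ) .{{_ : NonZero a}} (G : TorsionGroup a) (E : ℕ) where
  open OrderedRingProperties F
  open TorsionGroupProperties a G
  open Walk F a G
  open Contraction F a G E
  open Column F a G E
  open Estimate F a G E

  private
    ε₀ : C
    ε₀ = recip E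

    2# : C
    2# = fromℕ# 2

  Laws : ℕ → Set
  Laws n = Fin n → Fin n → Fin a → C

  -- Balance is asked off the diagonal only: the diagonal laws come from the constant residue
  -- recorded for loops.
  record IsBalancedSystem {n} (q : Laws n) : Set where
    field
      law      : ∀ j i → IsLaw (q j i)
      balanced : ∀ j i → j ≢ i → Balanced E (q j i)

  columnProb : ∀ {n} → Laws n → (Fin n → X) → Fin n → C
  columnProb q f j = μ (q j) (λ i → f j ⊝ f i) 0̂

  -- The probability that f is a `Solution`: the condition at j involves only the edges leaving j,
  -- so the conditions are independent.
  summand : ∀ {n} → Laws (suc n) → Vec X n → C
  summand q f = [ does (generates? (lookup f)) ] * ∏ (columnProb q (extend f))

  moment : ∀ {n} → Laws (suc n) → C
  moment {n} q = ∑ (functions n) (summand q)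

  length-functions : ∀ n → length (functions n) ≡ size ℕ.^ n
  length-functions n = trans (length-vecs (fins size) n) (cong (ℕ._^ n) (List.length-tabulate {n = size} id))

  infix 4 _≈_within_
  _≈_within_ : C → C → C → Set
  x ≈ y within d = x ≤ y + d × y ≤ x + d

  within-mono : ∀ {x y d d′} → d ≤ d′ → x ≈ y within d → x ≈ y within d′
  within-mono d≤ (p , q) = ≤-trans p (+-monoʳ _ d≤) , ≤-trans q (+-monoʳ _ d≤)

  ∏-scale : ∀ n c d → ∏ {n} (λ _ → c * d) ≡ c ^ n * d ^ n
  ∏-scale n c d = trans (∏-* {n} (λ _ → c) (λ _ → d)) (cong₂ _*_ (∏-const n c) (∏-const n d))

  size^*1/size^ : ∀ n → fromℕ# (size ℕ.^ n) * 1/size ^ n ≡ 1#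
  size^*1/size^ n = trans (cong (_* 1/size ^ n) (fromℕ#-^ size n))
    (trans (sym (^-distrib-* (fromℕ# size) 1/size n)) (trans (cong (_^ n) (n*1/ₙ size)) (1^ n)))
    where
    1^ : ∀ n → 1# ^ n ≡ 1#
    1^ zero    = refl
    1^ (suc n) = trans (*-identityˡ _) (1^ n)

  1/size-unscale : ∀ {x y} → fromℕ# size * x ≤ y → x ≤ 1/size * y
  1/size-unscale {x} {y} h = subst (_≤ 1/size * y)
    (trans (sym (*-assoc _ _ _)) (trans (cong (_* x) (trans (*-comm _ _) (n*1/ₙ size))) (*-identityˡ x)))
    (*-monoˡ (0≤recip _) h)

  1/size-scale : ∀ {x y} → x ≤ fromℕ# size * y → 1/size * x ≤ y
  1/size-scale {x} {y} h = subst (1/size * x ≤_)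
    (trans (sym (*-assoc _ _ _)) (trans (cong (_* y) (trans (*-comm _ _) (n*1/ₙ size))) (*-identityˡ y)))
    (*-monoˡ (0≤recip _) h)

  module _ {n} {q : Laws (suc n)} (system : IsBalancedSystem q) where
    open IsBalancedSystem system

    module _ (f : Fin (suc n) → X) where

      balanced-at : ∀ j i → f i ≢ f j → Balanced E (q j i)
      balanced-at j i fi≢fj = balanced j i (λ { refl → fi≢fj refl })

      0≤columnProb : ∀ j → 0# ≤ columnProb q f j
      0≤columnProb j = 0≤μ (q j) (λ i → f j ⊝ f i) (law j) 0̂

      columnProb≤1 : ∀ j → columnProb q f j ≤ 1#
      columnProb≤1 j = μ≤1 (q j) (λ i → f j ⊝ f i) (law j) 0̂

    0≤summand : ∀ f → 0# ≤ summand q f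
    0≤summand f = *-nonNeg (0≤[] _) (∏-nonNeg (0≤columnProb (extend f)))

    summand≤1 : ∀ f → summand q f ≤ 1#
    summand≤1 f = subst (summand q f ≤_) (*-identityˡ 1#)
      (*-mono (0≤[] _) 0≤1 ([]≤1 _) (≤-trans (∏-mono (0≤columnProb (extend f)) (columnProb≤1 (extend f))) (≤-reflexive (∏-1 (suc n)))))

    moment≤ : moment q ≤ fromℕ# (size ℕ.^ n)
    moment≤ = ≤-trans (∑-mono (functions n) summand≤1) (≤-reflexive
      (trans (∑-const (functions n) 1#) (trans (*-identityʳ _) (cong fromℕ# (length-functions n)))))

    0≤moment : 0# ≤ moment q
    0≤moment = ∑-nonNeg (functions n) 0≤summand

    module _ (k : ℕ) (θ : C) (0≤θ : 0# ≤ θ) (Y : ℕ) .{{_ : NonZero Y}}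
             (σ≤ : (1# - ε₀) + fromℕ# size * τ (suc k) ≤ θ)
             (1-1/size≤θ : 1# - 1/size ≤ θ)
             (nσ≤ : 2# * (fromℕ# (suc n) * (fromℕ# size * τ (suc k))) ≤ 1#) where
      open Weights θ 0≤θ Y

      private
        σ e u : C
        σ = fromℕ# size * τ (suc k)
        e = 2# * (fromℕ# (suc n) * σ)
        u = 1/size ^ suc n

        0≤σ : 0# ≤ σ
        0≤σ = *-nonNeg (0≤fromℕ size) (0≤τ (suc k))

        0≤u : 0# ≤ u
        0≤u = 0≤^ (0≤recip _) (suc n)

        nσ≤e : fromℕ# (suc n) * σ ≤ e
        nσ≤e = subst (fromℕ# (suc n) * σ ≤_) (solve 1 (λ x → x :+ x := con (+ 2) :* x) refl _)
          (x≤x+y (*-nonNeg (0≤fromℕ (suc n)) 0≤σ))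

        0≤e : 0# ≤ e
        0≤e = *-nonNeg (0≤fromℕ 2) (*-nonNeg (0≤fromℕ (suc n)) 0≤σ)

        σ≤1 : σ ≤ 1#
        σ≤1 = ≤-trans (subst (_≤ fromℕ# (suc n) * σ) (*-identityˡ σ) (*-monoʳ 0≤σ (1≤suc n))) (≤-trans nσ≤e nσ≤)

      module _ (f : Vec X n) where

        private
          g : Fin (suc n) → X
          g = extend f

          S : X → Bool
          S = lookup (popular (suc k) g)

          S-popular : Popular (suc k) g S
          S-popular = popular-Popular (suc k) g

          P : Fin (suc n) → C
          P = columnProb q g

        -- Popular differences span from every base point, so each column probability is between (1
        -- - σ)/size and (1 + σ)/size; e = 2 (n + 1) σ covers the product of the n + 1 columns.
        good-bound : Good S → summand q f ≈ u within u * e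
        good-bound good = upper , lower
          where
          summand≡ : summand q f ≡ ∏ P
          summand≡ = trans (cong (λ b → [ b ] * ∏ P) (dec-true (generates? (lookup f)) (good⇒generates k f good))) (*-identityˡ _)
          upper : summand q f ≤ u + u * e
          upper = begin
            summand q f                          ≡⟨ summand≡ ⟩
            ∏ P                                  ≤⟨ ∏-mono (0≤columnProb g) (λ j → 1/size-unscale
              (size*ν0≤ (q j) g (g j) (law j) (balanced-at g j) (suc k) S S-popular (good (g j)))) ⟩
            ∏ {suc n} (λ _ → 1/size * (1# + σ))  ≡⟨ ∏-scale (suc n) 1/size (1# + σ) ⟩
            u * (1# + σ) ^ suc n                 ≤⟨ *-monoˡ 0≤u ([1+σ]^≤ 0≤σ (suc n) nσ≤) ⟩
            u * (1# + e)                         ≡⟨ solve 2 (λ u e → u :* (con (+ 1) :+ e) := u :+ u :* e) refl u e ⟩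
            u + u * e                            ∎
            where open ≤-Reasoning
          lower : u ≤ summand q f + u * e
          lower = begin
            u
              ≡⟨ solve 2 (λ u x → u := u :* (con (+ 1) :- x) :+ u :* x) refl u (fromℕ# (suc n) * σ) ⟩
            u * (1# - fromℕ# (suc n) * σ) + u * (fromℕ# (suc n) * σ)
              ≤⟨ +-mono-≤ (*-monoˡ 0≤u (≤[1-σ]^ 0≤σ σ≤1 (suc n))) (*-monoˡ 0≤u nσ≤e) ⟩
            u * (1# - σ) ^ suc n + u * e
              ≡⟨ cong (_+ u * e) (∏-scale (suc n) 1/size (1# - σ)) ⟨
            ∏ {suc n} (λ _ → 1/size * (1# - σ)) + u * e
              ≤⟨ +-monoˡ _ (∏-mono (λ _ → *-nonNeg (0≤recip _) (0≤y-x σ≤1)) (λ j → 1/size-scale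
                   (subst (1# - σ ≤_) (solve 2 (λ x s → (x :+ s) :- s := x) refl _ σ) (+-monoˡ (- σ)
                     (≤size*ν0 (q j) g (g j) (law j) (balanced-at g j) (suc k) S S-popular (good (g j))))))) ⟩
            ∏ P + u * e
              ≡⟨ cong (_+ u * e) summand≡ ⟨
            summand q f + u * e ∎
            where open ≤-Reasoning

        -- Both sides are nonnegative and at most the envelope, so they differ by at most the
        -- envelope. For the summand this uses `card*μ0≤` at popular vertices, for u the bound
        -- `bad⇒card`.
        bad-bound : ¬ Good S → summand q f ≈ u within totalEnvelope (suc k) g
        bad-bound bad = ≤-trans summand≤ (x≤y+x 0≤u) , ≤-trans u≤ (x≤y+x (0≤summand f))
          where
          ∏cap≤ : ∏ (λ j → cap S (g j)) ≤ totalEnvelope (suc k) g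
          ∏cap≤ = ≤-trans (∏-cap≤envelope (suc k) g) (envelope≤total (suc k) (popular (suc k) g) g)
          P≤ : Generates (lookup f) → ∀ j → P j ≤ cap S (g j)
          P≤ gen j with S (g j) in eq
          ... | false = columnProb≤1 g j
          ... | true  = let (i , i∉) = bad⇒escapes S f bad gen eq in unscale-card S eq
            (≤-trans (card*μ0≤ (q j) g (g j) (law j) (balanced-at g j) (suc k) S S-popular i i∉) σ≤)
          summand≤ : summand q f ≤ totalEnvelope (suc k) g
          summand≤ = by-cases (generates? (lookup f))
            where
            by-cases : (gen? : Dec (Generates (lookup f))) → [ does gen? ] * ∏ P ≤ totalEnvelope (suc k) g
            by-cases (no  _)   = subst (_≤ totalEnvelope (suc k) g) (sym (zeroˡ _)) (0≤totalEnvelope (suc k) g)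
            by-cases (yes gen) = subst (_≤ totalEnvelope (suc k) g) (sym (*-identityˡ _))
              (≤-trans (∏-mono (0≤columnProb g) (P≤ gen)) ∏cap≤)
          1/size≤cap : ∀ j → 1/size ≤ cap S (g j)
          1/size≤cap j with S (g j) in eq
          ... | false = recip≤1 _
          ... | true  = unscale-card S eq (≤-trans (bad⇒card S bad) 1-1/size≤θ)
          u≤ : u ≤ totalEnvelope (suc k) g
          u≤ = ≤-trans (≤-reflexive (sym (∏-const (suc n) 1/size))) (≤-trans (∏-mono {suc n} (λ _ → 0≤recip _) 1/size≤cap) ∏cap≤)

        summand-bound : summand q f ≈ u within u * e + totalEnvelope (suc k) g
        summand-bound with good? S
        ... | yes good = within-mono (x≤x+y (0≤totalEnvelope (suc k) g)) (good-bound good)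
        ... | no  bad  = within-mono (x≤y+x (*-nonNeg 0≤u 0≤e)) (bad-bound bad)

      private
        T : C
        T = ∑ (functions n) (λ f → totalEnvelope (suc k) (extend f))

        R : C
        R = fromℕ# (2 ℕ.^ size) * (fromℕ# Y ^ (size ℕ.* (4 ℕ.* suc k)) * (θ + fromℕ# size * 1/ₙ Y) ^ suc n)

        T≤R : T ≤ R
        -- Functions normalised to `0̂` at the base vertex are the part g₀ = `0̂` of all functions
        -- on n + 1 vertices.
        T≤R = ≤-trans (≤-trans (term≤∑ {f = λ g₀ → ∑ (functions n) (λ f → totalEnvelope (suc k) (lookup (g₀ ∷ f)))}
            (λ g₀ → ∑-nonNeg (functions n) λ f → 0≤totalEnvelope (suc k) (lookup (g₀ ∷ f))) (∈.∈-allFin 0̂))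
          (≤-reflexive (sym (∑-cartesianProductWith Vec._∷_ 𝔾 (functions n) (λ g → totalEnvelope (suc k) (lookup g))))))
          (∑-totalEnvelope (suc n) (suc k))

        ∑-const-functions : ∀ c → ∑ (functions n) (λ _ → u * c) ≡ 1/size * c
        ∑-const-functions c = trans (∑-const (functions n) (u * c)) (trans (cong (λ l → fromℕ# l * (u * c)) (length-functions n))
          (trans (solve 4 (λ m i v c → m :* ((i :* v) :* c) := (m :* v) :* (i :* c)) refl (fromℕ# (size ℕ.^ n)) 1/size (1/size ^ n) c)
            (trans (cong (_* (1/size * c)) (size^*1/size^ n)) (*-identityˡ _))))

        ∑u : ∑ (functions n) (λ _ → u) ≡ 1/size
        ∑u = trans (∑-cong (functions n) (λ _ → sym (*-identityʳ u))) (trans (∑-const-functions 1#) (*-identityʳ _))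

        ∑error≤ : ∑ (functions n) (λ f → u * e + totalEnvelope (suc k) (extend f)) ≤ e + R
        ∑error≤ = ≤-trans (≤-reflexive (trans (∑-+ (functions n) _ _) (cong (_+ T) (∑-const-functions e))))
          (+-mono-≤ (≤-trans (*-monoʳ 0≤e (recip≤1 _)) (≤-reflexive (*-identityˡ e))) T≤R)

      -- There are `size ^ n` normalised functions but n + 1 conditions, so the main terms u add up
      -- to 1/size.
      moment-bound : moment q ≈ 1/size within e + R
      moment-bound = within-mono ∑error≤
        ( subst (moment q ≤_) (trans (∑-+ (functions n) _ _) (cong (_+ Δ) ∑u)) (∑-mono (functions n) (λ f → proj₁ (summand-bound f)))
        , subst₂ _≤_ ∑u (∑-+ (functions n) _ _) (∑-mono (functions n) (λ f → proj₂ (summand-bound f))) )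
        where Δ = ∑ (functions n) (λ f → u * e + totalEnvelope (suc k) (extend f))

-- Choice of the constants, and exponential decay.

module MomentBound (F : OrderedRing) (a : ℕ) .{{_ : NonZero a}} (G : TorsionGroup a) (E : ℕ) where
  open OrderedRingProperties F
  open TorsionGroupProperties a G
  open Walk F a G
  open Contraction F a G E
  open Column F a G E
  open Estimate F a G E
  open Uniformity F a G E

  private
    ε₀ : C
    ε₀ = recip E

    -- θ = 1 - 1/(2 (E + 1) size)
    Nθ : ℕ
    Nθ = ℕ.pred ((2 ℕ.* suc E) ℕ.* size)

    suc-Nθ : suc Nθ ≡ (2 ℕ.* suc E) ℕ.* size
    suc-Nθ = ℕ.suc-pred ((2 ℕ.* suc E) ℕ.* size) {{ℕ.m*n≢0 (2 ℕ.* suc E) size}}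

    θ : C
    θ = rate Nθ

    -- chosen so that size / Y is half of 1 - θ
    Y : ℕ
    Y = (2 ℕ.* suc Nθ) ℕ.* size

    instance
      Y≢0 : NonZero Y
      Y≢0 = ℕ.m*n≢0 (2 ℕ.* suc Nθ) size

    -- `rate Nθ′` is halfway between θ and 1, which is also θ + size/Y.
    Nθ′ : ℕ
    Nθ′ = Nθ ℕ.+ suc (Nθ ℕ.+ 0)

    -- Twice the factor Y^(4 size) lost per unit of k. `blockLength` is a number of columns over
    -- which `rate Nθ′` makes up for this loss and leaves 1/2.
    Z : ℕ
    Z = 2 ℕ.* Y ℕ.^ (size ℕ.* 4)

    instance
      Z≢0 : NonZero Z
      Z≢0 = ℕ.m*n≢0 2 (Y ℕ.^ (size ℕ.* 4)) {{_}} {{ℕ.m^n≢0 Y (size ℕ.* 4)}}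

  blockLength : ℕ
  blockLength = suc Nθ′ ℕ.* Z

  instance
    blockLength≢0 : NonZero blockLength
    blockLength≢0 = ℕ.m*n≢0 (suc Nθ′) Z

  private
    B = blockLength

  private
    1-1/size≤θ : 1# - 1/size ≤ θ
    1-1/size≤θ = negate-≤ (recip-antitone (ℕ.pred-mono-≤ (ℕ.m≤n*m size (2 ℕ.* suc E))))

    E′ : ℕ
    E′ = E ℕ.+ suc (E ℕ.+ 0)

    -- `recip E′` is ε₀/2: one half of ε₀ is spent on σ, the other keeps the total below θ.
    θ-room : ∀ {σ} → σ ≤ recip E′ → (1# - ε₀) + σ ≤ θ
    θ-room {σ} σ≤ = begin
      (1# - ε₀) + σ
        ≤⟨ +-monoʳ _ σ≤ ⟩
      (1# - ε₀) + recip E′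
        ≡⟨ cong (λ z → (1# - z) + recip E′) (recip-double E) ⟨
      (1# - (recip E′ + recip E′)) + recip E′
        ≡⟨ solve 1 (λ r → (con (+ 1) :- (r :+ r)) :+ r := con (+ 1) :- r) refl (recip E′) ⟩
      1# - recip E′
        ≤⟨ negate-≤ (recip-antitone (ℕ.≤-pred (subst (suc E′ ℕ.≤_) (sym suc-Nθ) (ℕ.m≤m*n (2 ℕ.* suc E) size)))) ⟩
      θ ∎
      where open ≤-Reasoning

    θ+size/Y : θ + fromℕ# size * 1/ₙ Y ≡ rate Nθ′
    θ+size/Y = begin
      (1# - recip Nθ) + fromℕ# size * 1/ₙ Y
        ≡⟨ cong₂ (λ x y → (1# - x) + y) (sym (recip-double Nθ)) size/Y ⟩
      (1# - (recip Nθ′ + recip Nθ′)) + recip Nθ′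
        ≡⟨ solve 1 (λ r → (con (+ 1) :- (r :+ r)) :+ r := con (+ 1) :- r) refl (recip Nθ′) ⟩
      rate Nθ′ ∎
      where
      open ≡.≡-Reasoning
      size/Y : fromℕ# size * 1/ₙ Y ≡ recip Nθ′
      size/Y = begin
        fromℕ# size * 1/ₙ Y
          ≡⟨ trans (cong (_* (fromℕ# size * 1/ₙ Y)) (recip*suc Nθ′)) (*-identityˡ _) ⟨
        (recip Nθ′ * fromℕ# (suc Nθ′)) * (fromℕ# size * 1/ₙ Y)
          ≡⟨ solve 4 (λ r n s y → (r :* n) :* (s :* y) := r :* ((n :* s) :* y)) refl (recip Nθ′) (fromℕ# (suc Nθ′)) (fromℕ# size) (1/ₙ Y) ⟩
        recip Nθ′ * ((fromℕ# (suc Nθ′) * fromℕ# size) * 1/ₙ Y)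
          ≡⟨ cong (λ z → recip Nθ′ * (z * 1/ₙ Y)) (fromℕ#-* (suc Nθ′) size) ⟨
        recip Nθ′ * (fromℕ# Y * 1/ₙ Y)
          ≡⟨ trans (cong (recip Nθ′ *_) (n*1/ₙ Y)) (*-identityʳ _) ⟩
        recip Nθ′ ∎

  -- Lets ρ absorb the factor 1/2 gained per block, so that a single rate governs all error terms.
  ½≤ρ : recip 1 ≤ ρ
  ½≤ρ = begin
    recip 1                          ≡⟨ solve 1 (λ r → r := (r :+ r) :- r) refl (recip 1) ⟩
    (recip 1 + recip 1) - recip 1    ≡⟨ cong (_- recip 1) (trans (recip-double 0) recip0≡1) ⟩
    1# - recip 1                     ≤⟨ negate-≤ (recip-antitone (ℕ.s≤s ℕ.z≤n)) ⟩
    ρ                                ∎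
    where
    open ≤-Reasoning
    recip0≡1 : recip 0 ≡ 1#
    recip0≡1 = trans (sym (*-identityˡ _)) (trans (cong (_* recip 0) (sym fromℤ-1)) (suc*recip 0))

  private
    block-small : fromℕ# (Y ℕ.^ (size ℕ.* 4)) * rate Nθ′ ^ B ≤ recip 1
    block-small = ≤-trans (recip-unscale 1 (subst (_≤ 1#)
      (trans (cong (_* rate Nθ′ ^ B) (fromℕ#-* 2 (Y ℕ.^ (size ℕ.* 4)))) (*-assoc _ _ _))
      (rate^-small Nθ′ Z B (ℕ.n≤1+n B)))) (≤-reflexive (*-identityʳ _))

    envelope-small : ∀ n k → k ℕ.* B ℕ.≤ n →
      fromℕ# Y ^ (size ℕ.* (4 ℕ.* k)) * (θ + fromℕ# size * 1/ₙ Y) ^ n ≤ ρ ^ k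
    envelope-small n k kB≤n = begin
      fromℕ# Y ^ (size ℕ.* (4 ℕ.* k)) * (θ + fromℕ# size * 1/ₙ Y) ^ n
        ≡⟨ cong₂ (λ x y → fromℕ# Y ^ x * y ^ n) (sym (ℕ.*-assoc size 4 k)) θ+size/Y ⟩
      fromℕ# Y ^ (size ℕ.* 4 ℕ.* k) * rate Nθ′ ^ n
        ≤⟨ *-monoˡ (0≤^ (0≤fromℕ Y) (size ℕ.* 4 ℕ.* k))
             (^-antitone (0≤rate Nθ′) (rate≤1 Nθ′) (subst (ℕ._≤ n) (ℕ.*-comm k B) kB≤n)) ⟩
      fromℕ# Y ^ (size ℕ.* 4 ℕ.* k) * rate Nθ′ ^ (B ℕ.* k)
        ≡⟨ cong₂ _*_ (trans (cong (_^ k) (fromℕ#-^ Y (size ℕ.* 4))) (^-assocʳ (fromℕ# Y) (size ℕ.* 4) k)) (^-assocʳ (rate Nθ′) B k) ⟨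
      fromℕ# (Y ℕ.^ (size ℕ.* 4)) ^ k * (rate Nθ′ ^ B) ^ k
        ≡⟨ ^-distrib-* (fromℕ# (Y ℕ.^ (size ℕ.* 4))) (rate Nθ′ ^ B) k ⟨
      (fromℕ# (Y ℕ.^ (size ℕ.* 4)) * rate Nθ′ ^ B) ^ k
        ≤⟨ ^-mono (*-nonNeg (0≤fromℕ _) (0≤^ (0≤rate Nθ′) B)) (≤-trans block-small ½≤ρ) k ⟩
      ρ ^ k ∎
      where open ≤-Reasoning

    sC : ℕ
    sC = size ℕ.* errorConst

    σ≡ : ∀ k → fromℕ# size * τ k ≡ fromℕ# sC * ρ ^ (2 ℕ.* k)
    σ≡ k = trans (sym (*-assoc _ _ _)) (cong (_* ρ ^ (2 ℕ.* k)) (sym (fromℕ#-* size errorConst)))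

    eC : ℕ
    eC = 2 ℕ.* (B ℕ.* (sC ℕ.* suc rateConst))

    -- The factor n ≤ B (k + 1) is absorbed by one of the two factors ρ ^ k in τ k.
    e-small : ∀ n k → n ℕ.≤ B ℕ.* suc k → fromℕ# 2 * (fromℕ# n * (fromℕ# size * τ k)) ≤ fromℕ# eC * ρ ^ k
    e-small n k n≤ = begin
      fromℕ# 2 * (fromℕ# n * (fromℕ# size * τ k))
        ≤⟨ *-monoˡ (0≤fromℕ 2) (*-monoʳ (*-nonNeg (0≤fromℕ size) (0≤τ k)) (≤-trans (fromℕ-mono n≤) (≤-reflexive (fromℕ#-* B (suc k))))) ⟩
      fromℕ# 2 * ((fromℕ# B * fromℕ# (suc k)) * (fromℕ# size * τ k))
        ≡⟨ cong (λ z → fromℕ# 2 * ((fromℕ# B * fromℕ# (suc k)) * z)) (trans (σ≡ k) (cong (fromℕ# sC *_)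
             (trans (cong (ρ ^_) (cong (k ℕ.+_) (ℕ.+-identityʳ k))) (^-homo-* ρ k k)))) ⟩
      fromℕ# 2 * ((fromℕ# B * fromℕ# (suc k)) * (fromℕ# sC * (ρ ^ k * ρ ^ k)))
        ≡⟨ solve 4 (λ b n s r → con (+ 2) :* ((b :* n) :* (s :* (r :* r))) := (con (+ 2) :* (b :* s)) :* ((n :* r) :* r)) refl
             (fromℕ# B) (fromℕ# (suc k)) (fromℕ# sC) (ρ ^ k) ⟩
      (fromℕ# 2 * (fromℕ# B * fromℕ# sC)) * ((fromℕ# (suc k) * ρ ^ k) * ρ ^ k)
        ≤⟨ *-monoˡ (*-nonNeg (0≤fromℕ 2) (*-nonNeg (0≤fromℕ B) (0≤fromℕ sC))) (*-monoʳ (0≤^ 0≤ρ k) (suc*rate^≤ rateConst k)) ⟩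
      (fromℕ# 2 * (fromℕ# B * fromℕ# sC)) * (fromℕ# (suc rateConst) * ρ ^ k)
        ≡⟨ solve 4 (λ b s c r → (con (+ 2) :* (b :* s)) :* (c :* r) := (con (+ 2) :* (b :* (s :* c))) :* r) refl
             (fromℕ# B) (fromℕ# sC) (fromℕ# (suc rateConst)) (ρ ^ k) ⟩
      (fromℕ# 2 * (fromℕ# B * (fromℕ# sC * fromℕ# (suc rateConst)))) * ρ ^ k
        ≡⟨ cong (_* ρ ^ k) (trans (fromℕ#-* 2 _) (cong (fromℕ# 2 *_) (trans (fromℕ#-* B _) (cong (fromℕ# B *_) (fromℕ#-* sC (suc rateConst)))))) ⟨
      fromℕ# eC * ρ ^ k ∎
      where open ≤-Reasoning

    -- From here on, `rate^-small` yields both smallness conditions of `moment-bound`: e ≤ 1 from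
    -- the summand `eC`, and σ ≤ ε₀/2 from the other.
    k₁ : ℕ
    k₁ = suc rateConst ℕ.* (eC ℕ.+ suc E′ ℕ.* sC)

    e≤1 : ∀ n k → n ℕ.≤ B ℕ.* suc k → k₁ ℕ.≤ k → fromℕ# 2 * (fromℕ# n * (fromℕ# size * τ k)) ≤ 1#
    e≤1 n k n≤ k₁≤k = ≤-trans (e-small n k n≤) (rate^-small rateConst eC k
      (ℕ.≤-trans (ℕ.*-monoʳ-≤ (suc rateConst) (ℕ.m≤m+n eC _)) (ℕ.≤-trans k₁≤k (ℕ.n≤1+n k))))

    σ≤recip : ∀ k → k₁ ℕ.≤ k → fromℕ# size * τ k ≤ recip E′
    σ≤recip k k₁≤k = ≤-trans (recip-unscale E′ (begin
      fromℕ# (suc E′) * (fromℕ# size * τ k)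
        ≡⟨ trans (cong (fromℕ# (suc E′) *_) (σ≡ k)) (sym (*-assoc _ _ _)) ⟩
      (fromℕ# (suc E′) * fromℕ# sC) * ρ ^ (2 ℕ.* k)
        ≤⟨ *-monoˡ (*-nonNeg (0≤fromℕ (suc E′)) (0≤fromℕ sC)) (^-antitone 0≤ρ ρ≤1 (ℕ.m≤m+n k _)) ⟩
      (fromℕ# (suc E′) * fromℕ# sC) * ρ ^ k
        ≡⟨ cong (_* ρ ^ k) (fromℕ#-* (suc E′) sC) ⟨
      fromℕ# (suc E′ ℕ.* sC) * ρ ^ k
        ≤⟨ rate^-small rateConst _ k (ℕ.≤-trans (ℕ.*-monoʳ-≤ (suc rateConst) (ℕ.m≤n+m _ eC)) (ℕ.≤-trans k₁≤k (ℕ.n≤1+n k))) ⟩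
      1# ∎)) (≤-reflexive (*-identityʳ _))
      where open ≤-Reasoning

    large : ℕ
    large = eC ℕ.+ 2 ℕ.^ size

    -- Covers k ≤ k₁: the trivial bound size^n is then at most size^(B (k₁ + 1)), and the power of 2
    -- makes up for ρ^k, which is at least 2^-(k₁ + 1).
    small : ℕ
    small = size ℕ.^ (B ℕ.* suc k₁) ℕ.* 2 ℕ.^ suc k₁

  boundConst : ℕ
  boundConst = large ℕ.+ small

  private
    large-case : ∀ {n} {q : Laws (suc n)} → IsBalancedSystem q → ∀ k → suc n ℕ.≤ B ℕ.* suc (suc k) → suc k ℕ.* B ℕ.≤ suc n →
                 k₁ ℕ.≤ suc k → moment q ≈ 1/size within fromℕ# large * ρ ^ suc k
    large-case {n} system k n≤ ≤n k₁≤ = within-mono (begin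
      _ ≤⟨ +-mono-≤ (e-small (suc n) (suc k) n≤) (*-monoˡ (0≤fromℕ (2 ℕ.^ size)) (envelope-small (suc n) (suc k) ≤n)) ⟩
      fromℕ# eC * ρ ^ suc k + fromℕ# (2 ℕ.^ size) * ρ ^ suc k
        ≡⟨ trans (sym (distribʳ _ _ _)) (cong (_* ρ ^ suc k) (sym (fromℕ#-+ eC (2 ℕ.^ size)))) ⟩
      fromℕ# large * ρ ^ suc k ∎)
      (moment-bound system k θ (0≤rate Nθ) Y (θ-room (σ≤recip (suc k) k₁≤)) 1-1/size≤θ (e≤1 (suc n) (suc k) n≤ k₁≤))
      where open ≤-Reasoning

    small-case : ∀ {n} {q : Laws (suc n)} → IsBalancedSystem q → ∀ k → suc n ℕ.≤ B ℕ.* suc k →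
                 k ℕ.≤ k₁ → moment q ≈ 1/size within fromℕ# small * ρ ^ k
    small-case {n} {q} system k n≤ k≤ = within-mono d≤
      ( ≤-trans (moment≤ system) (≤-trans (fromℕ-mono (ℕ.^-monoʳ-≤ size n≤′)) (x≤y+x (0≤recip _)))
      , ≤-trans (recip≤1 _) (≤-trans 1≤d (x≤y+x (0≤moment system))) )
      where
      open ≤-Reasoning
      d : ℕ
      d = size ℕ.^ (B ℕ.* suc k₁)
      n≤′ : n ℕ.≤ B ℕ.* suc k₁
      n≤′ = ℕ.≤-trans (ℕ.n≤1+n n) (ℕ.≤-trans n≤ (ℕ.*-monoʳ-≤ B (ℕ.s≤s k≤)))
      1≤d : 1# ≤ fromℕ# d
      1≤d = subst (_≤ fromℕ# d) fromℤ-1 (fromℕ-mono (ℕ.m^n>0 size (B ℕ.* suc k₁)))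
      2^½^ : fromℕ# 2 ^ suc k₁ * recip 1 ^ suc k₁ ≡ 1#
      2^½^ = trans (sym (^-distrib-* (fromℕ# 2) (recip 1) (suc k₁)))
        (trans (cong (_^ suc k₁) (suc*recip 1)) (trans (sym (∏-const (suc k₁) 1#)) (∏-1 (suc k₁))))
      d≤ : fromℕ# d ≤ fromℕ# small * ρ ^ k
      d≤ = begin
        fromℕ# d
          ≡⟨ trans (cong (fromℕ# d *_) 2^½^) (*-identityʳ _) ⟨
        fromℕ# d * (fromℕ# 2 ^ suc k₁ * recip 1 ^ suc k₁)
          ≡⟨ trans (sym (*-assoc _ _ _)) (cong (_* recip 1 ^ suc k₁) (trans (cong (fromℕ# d *_) (sym (fromℕ#-^ 2 (suc k₁)))) (sym (fromℕ#-* d (2 ℕ.^ suc k₁))))) ⟩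
        fromℕ# small * recip 1 ^ suc k₁
          ≤⟨ *-monoˡ (0≤fromℕ small) (≤-trans (^-mono (0≤recip 1) ½≤ρ (suc k₁)) (^-antitone 0≤ρ ρ≤1 (ℕ.≤-trans k≤ (ℕ.n≤1+n k₁)))) ⟩
        fromℕ# small * ρ ^ k ∎

  n≤B[1+n/B] : ∀ n → n ℕ.≤ B ℕ.* suc (n ℕ/./ B)
  n≤B[1+n/B] n = ℕ.≤-trans (ℕ.≤-reflexive (ℕ/.m≡m%n+[m/n]*n n B))
    (ℕ.≤-trans (ℕ.+-monoˡ-≤ _ (ℕ.<⇒≤ (ℕ/.m%n<n n B))) (ℕ.≤-reflexive (ℕ.*-comm (suc (n ℕ/./ B)) B)))

  moment-uniform : ∀ {n} {q : Laws (suc n)} → IsBalancedSystem q →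
                   moment q ≈ 1/size within fromℕ# boundConst * ρ ^ (suc n ℕ/./ B)
  moment-uniform {n} {q} system = go (suc n ℕ/./ B)
    (n≤B[1+n/B] (suc n))
    (ℕ/.m/n*n≤m (suc n) B)
    where
    scale : ∀ {c} k → c ℕ.≤ boundConst → fromℕ# c * ρ ^ k ≤ fromℕ# boundConst * ρ ^ k
    scale k c≤ = *-monoʳ (0≤^ 0≤ρ k) (fromℕ-mono c≤)
    go : ∀ k → suc n ℕ.≤ B ℕ.* suc k → k ℕ.* B ℕ.≤ suc n → moment q ≈ 1/size within fromℕ# boundConst * ρ ^ k
    -- Without a full block the popularity threshold would be 0, so the trivial bound is used.
    go zero n≤ ≤n = within-mono (scale 0 (ℕ.m≤n+m small large)) (small-case system 0 n≤ ℕ.z≤n)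
    go (suc k) n≤ ≤n with ℕ.≤-total k₁ (suc k)
    ... | inj₁ k₁≤ = within-mono (scale (suc k) (ℕ.m≤m+n large small)) (large-case system k n≤ ≤n k₁≤)
    ... | inj₂ ≤k₁ = within-mono (scale (suc k) (ℕ.m≤n+m small large)) (small-case system (suc k) n≤ ≤k₁)

  -- Since ρ ≤ (1 - 1/(decayConst + 1)) ^ B, decay in n / B is decay in n.
  decayConst : ℕ
  decayConst = ℕ.pred (suc rateConst ℕ.* B)

  private
    suc-decayConst : suc decayConst ≡ suc rateConst ℕ.* B
    suc-decayConst = ℕ.suc-pred (suc rateConst ℕ.* B) {{ℕ.m*n≢0 (suc rateConst) B}}

    B*recip : fromℕ# B * recip decayConst ≡ recip rateConst
    B*recip = begin
      fromℕ# B * recip decayConst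
        ≡⟨ trans (cong (_* (fromℕ# B * recip decayConst)) (recip*suc rateConst)) (*-identityˡ _) ⟨
      (recip rateConst * fromℕ# (suc rateConst)) * (fromℕ# B * recip decayConst)
        ≡⟨ solve 4 (λ r n b d → (r :* n) :* (b :* d) := r :* ((n :* b) :* d)) refl (recip rateConst) (fromℕ# (suc rateConst)) (fromℕ# B) (recip decayConst) ⟩
      recip rateConst * ((fromℕ# (suc rateConst) * fromℕ# B) * recip decayConst)
        ≡⟨ cong (λ z → recip rateConst * (z * recip decayConst)) (trans (cong fromℕ# suc-decayConst) (fromℕ#-* (suc rateConst) B)) ⟨
      recip rateConst * (fromℕ# (suc decayConst) * recip decayConst)
        ≡⟨ trans (cong (recip rateConst *_) (suc*recip decayConst)) (*-identityʳ _) ⟩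
      recip rateConst ∎
      where open ≡.≡-Reasoning

    ρ≤r^B : ρ ≤ rate decayConst ^ B
    ρ≤r^B = subst (λ z → 1# - z ≤ rate decayConst ^ B) B*recip (≤[1-σ]^ (0≤recip decayConst) (recip≤1 decayConst) B)

  -- Only B (k + 1), not B k, is sure to reach the number of vertices. One more factor ρ is
  -- therefore introduced, at the price of a factor 2 because ρ ≥ 1/2.
  moment-decay : ∀ {n} {q : Laws (suc n)} → IsBalancedSystem q →
                 moment q ≈ 1/size within fromℕ# (suc (2 ℕ.* boundConst)) * rate decayConst ^ suc n
  moment-decay {n} system = within-mono (begin
    fromℕ# boundConst * ρ ^ k
      ≡⟨ trans (cong (_* (fromℕ# boundConst * ρ ^ k)) (suc*recip 1)) (*-identityˡ _) ⟨
    (fromℕ# 2 * recip 1) * (fromℕ# boundConst * ρ ^ k)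
      ≡⟨ solve 4 (λ t h b p → (t :* h) :* (b :* p) := (t :* b) :* (h :* p)) refl (fromℕ# 2) (recip 1) (fromℕ# boundConst) (ρ ^ k) ⟩
    (fromℕ# 2 * fromℕ# boundConst) * (recip 1 * ρ ^ k)
      ≤⟨ *-monoˡ (*-nonNeg (0≤fromℕ 2) (0≤fromℕ boundConst)) (*-monoʳ (0≤^ 0≤ρ k) ½≤ρ) ⟩
    (fromℕ# 2 * fromℕ# boundConst) * ρ ^ suc k
      ≤⟨ *-monoˡ (*-nonNeg (0≤fromℕ 2) (0≤fromℕ boundConst)) (≤-trans (^-mono 0≤ρ ρ≤r^B (suc k)) (≤-reflexive (^-assocʳ r B (suc k)))) ⟩
    (fromℕ# 2 * fromℕ# boundConst) * r ^ (B ℕ.* suc k)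
      ≤⟨ *-mono (*-nonNeg (0≤fromℕ 2) (0≤fromℕ boundConst)) (0≤^ (0≤rate decayConst) (suc n))
           (subst (_≤ fromℕ# (suc (2 ℕ.* boundConst))) (fromℕ#-* 2 boundConst) (fromℕ-mono (ℕ.n≤1+n _)))
           (^-antitone (0≤rate decayConst) (rate≤1 decayConst) (n≤B[1+n/B] (suc n))) ⟩
    fromℕ# (suc (2 ℕ.* boundConst)) * r ^ suc n ∎)
    (moment-uniform system)
    where
    open ≤-Reasoning
    k = suc n ℕ/./ B
    r = rate decayConst

-- The moment as a polynomial in the laws.

module Expansion (F : OrderedRing) (a : ℕ) .{{_ : NonZero a}} (G : TorsionGroup a) (E : ℕ) where
  open OrderedRingProperties F
  open TorsionGroupProperties a G
  open Walk F a G
  open Column F a G E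
  open Uniformity F a G E

  ∏-[] : ∀ {n} {P : Fin n → Set} (P? : ∀ i → Dec (P i)) (all? : Dec (∀ i → P i)) → ∏ (λ i → [ does (P? i) ]) ≡ [ does all? ]
  ∏-[] {n} P? (yes all) = trans (∏-cong λ i → cong [_] (dec-true (P? i) (all i))) (∏-1 n)
  ∏-[] {n} {P} P? (no ¬all) = vanish (λ i → [ does (P? i) ]) i (cong [_] (dec-false (P? i) ¬p))
    where
    counterexample : ∃[ i ] ¬ P i
    counterexample = Fin.¬∀⟶∃¬ n P P? ¬all
    i  = proj₁ counterexample
    ¬p = proj₂ counterexample
    vanish : ∀ {n} (f : Fin n → C) i → f i ≡ 0# → ∏ f ≡ 0#
    vanish f zero    eq = trans (cong (_* ∏ (f ∘ suc)) eq) (zeroˡ _)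
    vanish f (suc i) eq = trans (cong (f zero *_) (vanish (f ∘ suc) i eq)) (zeroʳ _)

  [×] : ∀ {P Q : Set} (P? : Dec P) (Q? : Dec Q) → [ does P? ] * [ does Q? ] ≡ [ does (P? ×-dec Q?) ]
  [×] (yes _) Q? = *-identityˡ _
  [×] (no  _) Q? = zeroˡ _

  rows : ∀ n → List (Vec (Fin a) n)
  rows n = elements (vecs (fins a) n)

  μ-expand : ∀ {n} (q : Fin n → Fin a → C) v x →
    μ q v x ≡ ∑ (rows n) (λ d → [ does (x Fin.≟ combination (toℕ ∘ lookup d) v) ] * ∏ (λ i → q i (lookup d i)))
  μ-expand {zero}  q v x = sym (trans (+-identityʳ _) (*-identityʳ _))
  μ-expand {suc n} q v x = begin
    ∑ residues (λ t → q zero t * μ (q ∘ suc) (v ∘ suc) (x ⊝ toℕ t · v zero))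
      ≡⟨ ∑-cong residues (λ t → trans (cong (q zero t *_) (μ-expand (q ∘ suc) (v ∘ suc) (x ⊝ toℕ t · v zero))) (trans (∑-*ˡ (rows n) _ _)
           (∑-cong (rows n) λ d → trans
             (solve 3 (λ q i p → q :* (i :* p) := i :* (q :* p)) refl (q zero t) _ _)
             (cong (λ b → [ b ] * (q zero t * ∏ (λ i → q (suc i) (lookup d i)))) (move (toℕ t · v zero) (combination (toℕ ∘ lookup d) (v ∘ suc))))))) ⟩
    ∑ residues (λ t → ∑ (rows n) (λ d → [ does (x Fin.≟ combination (toℕ ∘ lookup (t ∷ d)) v) ] * ∏ (λ i → q i (lookup (t ∷ d) i))))
      ≡⟨ ∑-cartesianProductWith Vec._∷_ residues (rows n) _ ⟨
    ∑ (rows (suc n)) (λ d → [ does (x Fin.≟ combination (toℕ ∘ lookup d) v) ] * ∏ (λ i → q i (lookup d i))) ∎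
    where
    open ≡.≡-Reasoning
    move : ∀ w y → does (x ⊝ w Fin.≟ y) ≡ does (x Fin.≟ w ⊕ y)
    move w y with x Fin.≟ w ⊕ y
    ... | yes x≡ = dec-true (x ⊝ w Fin.≟ y) (trans (cong (_⊝ w) (trans x≡ (⊕-comm w y))) (⊕-⊝ y w))
    ... | no  x≢ = dec-false (x ⊝ w Fin.≟ y) (λ eq → x≢ (trans (sym (⊝-⊕-cancel x w)) (trans (cong (_⊕ w) eq) (⊕-comm y w))))

  Matrix : ℕ → Set
  Matrix n = Vec (Vec (Fin a) n) n

  entry : ∀ {n} → Matrix n → Fin n → Fin n → Fin a
  entry D j i = lookup (lookup D j) i

  matrices : ∀ n → Enumeration (Matrix n)
  matrices n = vecs (vecs (fins a) n) n

  weightOf : ∀ {n} → Laws n → Matrix n → C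
  weightOf q D = ∏ (λ j → ∏ (λ i → q j i (entry D j i)))

  ∑-[]≡length-filter : ∀ {A : Set} {P : A → Set} (P? : Decidable P) xs → ∑ xs (λ x → [ does (P? x) ]) ≡ fromℕ# (length (filter P? xs))
  ∑-[]≡length-filter P? []       = sym fromℤ-0
  ∑-[]≡length-filter P? (x ∷ xs) with P? x
  ... | yes _ = trans (cong (_+_ 1#) (∑-[]≡length-filter P? xs)) (sym (fromℕ#-suc _))
  ... | no  _ = trans (+-identityˡ _) (∑-[]≡length-filter P? xs)

  -- The link to probability: the right side, read with real laws, is the expectation of the number
  -- of solutions of the random residue matrix.
  moment-expand : ∀ {n} (q : Laws (suc n)) →
    moment q ≡ ∑ (elements (matrices (suc n))) (λ D → fromℕ# (#solutions (λ j i → toℕ (entry D j i))) * weightOf q D)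
  moment-expand {n} q = begin
    ∑ fs (λ f → [ gen f ] * ∏ (columnProb q (extend f)))
      ≡⟨ ∑-cong fs (λ f → cong ([ gen f ] *_) (trans (∏-cong λ j → trans (μ-expand (q j) (λ i → extend f j ⊝ extend f i) 0̂)
           (∑-cong (rows (suc n)) λ d → cong (λ b → [ b ] * ∏ (λ i → q j i (lookup d i))) (does-sym 0̂ (combination (toℕ ∘ lookup d) (λ i → extend f j ⊝ extend f i)))))
           (sym (∑-∏ (vecs (fins a) (suc n)) {suc n} (λ j d → [ kill f j d ] * ∏ (λ i → q j i (lookup d i))))))) ⟩
    ∑ fs (λ f → [ gen f ] * ∑ Ds (λ D → ∏ (λ j → [ kill f j (lookup D j) ] * ∏ (λ i → q j i (entry D j i)))))
      ≡⟨ ∑-cong fs (λ f → trans (∑-*ˡ Ds _ _) (∑-cong Ds λ D → trans (cong ([ gen f ] *_) (∏-* {suc n} (λ j → [ kill f j (lookup D j) ]) (λ j → ∏ (λ i → q j i (entry D j i)))))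
           (trans (sym (*-assoc _ _ _)) (cong (_* weightOf q D) (trans (cong ([ gen f ] *_) (∏-[] (λ j → kills? (extend f) j (λ i → toℕ (entry D j i))) (Fin.all? (λ j → kills? (extend f) j (λ i → toℕ (entry D j i))))))
             ([×] (generates? (lookup f)) (Fin.all? (λ j → kills? (extend f) j (λ i → toℕ (entry D j i)))))))))) ⟩
    ∑ fs (λ f → ∑ Ds (λ D → [ does (solution? (λ j i → toℕ (entry D j i)) f) ] * weightOf q D))
      ≡⟨ ∑-swap fs Ds _ ⟩
    ∑ Ds (λ D → ∑ fs (λ f → [ does (solution? (λ j i → toℕ (entry D j i)) f) ] * weightOf q D))
      ≡⟨ ∑-cong Ds (λ D → trans (sym (∑-*ʳ fs _ _)) (cong (_* weightOf q D) (∑-[]≡length-filter (solution? (λ j i → toℕ (entry D j i))) fs))) ⟩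
    ∑ Ds (λ D → fromℕ# (#solutions (λ j i → toℕ (entry D j i))) * weightOf q D) ∎
    where
    open ≡.≡-Reasoning
    fs = functions n
    Ds = elements (matrices (suc n))
    gen : Vec X n → Bool
    gen f = does (generates? (lookup f))
    kill : Vec X n → Fin (suc n) → Vec (Fin a) (suc n) → Bool
    kill f j d = does (kills? (extend f) j (toℕ ∘ lookup d))
    does-sym : ∀ (x y : X) → does (x Fin.≟ y) ≡ does (y Fin.≟ x)
    does-sym x y with y Fin.≟ x
    ... | yes eq = dec-true (x Fin.≟ y) (sym eq)
    ... | no  ne = dec-false (x Fin.≟ y) (ne ∘ sym)

-- Surjections from the sandpile group as solutions.

lookup-injective : ∀ {A : Set} {xs : List A} → Unique xs → ∀ i j → Data.List.Base.lookup xs i ≡ Data.List.Base.lookup xs j → i ≡ j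
lookup-injective (_ ∷ _)    zero    zero    _  = refl
lookup-injective (x∉ ∷ _)   zero    (suc j) eq = contradiction eq (All.lookup x∉ (∈.∈-lookup j))
lookup-injective (x∉ ∷ _)   (suc i) zero    eq = contradiction (sym eq) (All.lookup x∉ (∈.∈-lookup i))
lookup-injective (_ ∷ uniq) (suc i) (suc j) eq = cong suc (lookup-injective uniq i j eq)

module _ {c ℓ} (S : Setoid c ℓ) {A : Set} (E : Enumeration A) {P : A → Set} (P? : Decidable P) where
  open Setoid S using (Carrier; _≈_)

  -- `decode (encode s)` is compared with s for every proof of `P (encode s)`, since the proof
  -- recovered from the filtered list may differ from the one supplied for s.
  cardinality : (encode : Carrier → A) → (∀ s → P (encode s)) → (∀ {s t} → s ≈ t → encode s ≡ encode t) →
                (decode : ∀ x → P x → Carrier) → (∀ x p → encode (decode x p) ≡ x) → (∀ s p → decode (encode s) p ≈ s) →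
                HasCardinality S (length (filter P? (elements E)))
  cardinality encode encode-P encode-cong decode encode-decode decode-encode = record
    { to        = index
    ; from      = element
    ; to-cong   = λ {s} {t} s≈t → injective (index s) (index t)
                    (trans (lookup-index s) (trans (encode-cong s≈t) (sym (lookup-index t))))
    ; from-cong = λ { refl → Setoid.refl S }
    ; inverse   = (λ {i} {s} s≈ → injective (index s) i (trans (lookup-index s) (trans (encode-cong s≈) (encode-decode _ _))))
                , (λ {s} {i} i≡ → element-of i s (trans (cong (Data.List.Base.lookup xs) i≡) (lookup-index s)))
    }
    where
    xs = filter P? (elements E)
    injective = lookup-injective (Unique.filter⁺ P? (Enumeration.unique E))
    member : ∀ s → encode s ∈ xs
    member s = ∈.∈-filter⁺ P? (Enumeration.complete E (encode s)) (encode-P s)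
    index : Carrier → Fin (length xs)
    index s = Any.index (member s)
    lookup-index : ∀ s → Data.List.Base.lookup xs (index s) ≡ encode s
    lookup-index s = sym (Any.lookup-index (member s))
    satisfies : ∀ i → P (Data.List.Base.lookup xs i)
    satisfies i = proj₂ (∈.∈-filter⁻ P? {xs = elements E} (∈.∈-lookup {xs = xs} i))
    element : Fin (length xs) → Carrier
    element i = decode (Data.List.Base.lookup xs i) (satisfies i)
    element-of : ∀ i s → Data.List.Base.lookup xs i ≡ encode s → element i ≈ s
    element-of i s eq = decode-≡ (satisfies i) eq
      where
      decode-≡ : ∀ {x} (p : P x) → x ≡ encode s → decode x p ≈ s
      decode-≡ p refl = decode-encode s p

module KroneckerSum (M : CommutativeMonoid 0ℓ 0ℓ) where
  open CommutativeMonoid M renaming (refl to ≈-refl; trans to ≈-trans)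
  open CMSum M using (sum; sum-replicate-zero)

  kronecker : ∀ {n} → Fin n → Fin n → Carrier → Carrier
  kronecker i j y = if does (i Fin.≟ j) then y else ε

  sum-kronecker : ∀ {n} (j : Fin n) y → sum (λ i → kronecker i j y) ≈ y
  sum-kronecker {suc n} zero    y = ≈-trans (∙-congˡ (sum-replicate-zero n)) (identityʳ y)
  sum-kronecker {suc n} (suc j) y = ≈-trans (identityˡ _) (sum-kronecker j y)

module IntegerAction (a : ℕ) .{{_ : NonZero a}} (G : TorsionGroup a) where
  open TorsionGroupProperties a G
  module Σˣ = CMSum (AbelianGroup.commutativeMonoid abelianGroup)
  private
    module Gr = GroupProperties (AbelianGroup.group abelianGroup)
    module AG = AbelianGroupProperties abelianGroup

  infixr 8 _⋆_
  _⋆_ : ℤ → X → X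
  (+ n)    ⋆ x = n · x
  -[1+ n ] ⋆ x = ⊖ (suc n · x)

  ⋆-ℤ⊖ : ∀ m n x → (m ℤ.⊖ n) ⋆ x ≡ m · x ⊝ n · x
  ⋆-ℤ⊖ m       zero    x = sym (⊝-0 (m · x))
  ⋆-ℤ⊖ zero    (suc n) x = sym (⊕-identityˡ _)
  ⋆-ℤ⊖ (suc m) (suc n) x = trans (cong (_⋆ x) (ℤ.[1+m]⊖[1+n]≡m⊖n m n)) (trans (⋆-ℤ⊖ m n x)
    (sym (trans (cong₂ _⊝_ (⊕-comm x (m · x)) (⊕-comm x (n · x))) (add-both (m · x) (n · x) x))))
    where
    add-both : ∀ p q x → (p ⊕ x) ⊝ (q ⊕ x) ≡ p ⊝ q
    add-both p q x = trans (⊝-⊕ (p ⊕ x) q x) (trans (⊝-comm (p ⊕ x) q x) (cong (_⊝ q) (⊕-⊝ p x)))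

  ⋆-+ : ∀ i j x → (i ℤ.+ j) ⋆ x ≡ i ⋆ x ⊕ j ⋆ x
  ⋆-+ (+ m)    (+ n)    x = ·-+ m n x
  ⋆-+ (+ m)    -[1+ n ] x = ⋆-ℤ⊖ m (suc n) x
  ⋆-+ -[1+ m ] (+ n)    x = trans (⋆-ℤ⊖ n (suc m) x) (⊕-comm _ _)
  ⋆-+ -[1+ m ] -[1+ n ] x = trans (cong ⊖_ (trans (cong (_· x) (cong suc (sym (ℕ.+-suc m n)))) (·-+ (suc m) (suc n) x)))
    (sym (AG.⁻¹-∙-comm (suc m · x) (suc n · x)))

  ⋆-neg : ∀ i x → (ℤ.- i) ⋆ x ≡ ⊖ (i ⋆ x)
  ⋆-neg (+ zero)  x = sym Gr.ε⁻¹≈ε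
  ⋆-neg (+ suc n) x = refl
  ⋆-neg -[1+ n ]  x = sym (⊖-⊖ _)

  ⋆-0̂ : ∀ i → i ⋆ 0̂ ≡ 0̂
  ⋆-0̂ (+ n)    = ·-0̂ n
  ⋆-0̂ -[1+ n ] = trans (cong ⊖_ (·-0̂ (suc n))) Gr.ε⁻¹≈ε

  ⋆-⊕ : ∀ i x y → i ⋆ (x ⊕ y) ≡ i ⋆ x ⊕ i ⋆ y
  ⋆-⊕ (+ n)    x y = ·-⊕ n x y
  ⋆-⊕ -[1+ n ] x y = trans (cong ⊖_ (·-⊕ (suc n) x y)) (sym (AG.⁻¹-∙-comm _ _))

  ·-⋆ : ∀ m j x → (+ m ℤ.* j) ⋆ x ≡ m · j ⋆ x
  ·-⋆ zero    j x = cong (_⋆ x) (ℤ.*-zeroˡ j)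
  ·-⋆ (suc m) j x = trans (cong (_⋆ x) (ℤ.suc-* (+ m) j)) (trans (⋆-+ j (+ m ℤ.* j) x) (cong (j ⋆ x ⊕_) (·-⋆ m j x)))

  ⋆-* : ∀ i j x → (i ℤ.* j) ⋆ x ≡ i ⋆ j ⋆ x
  ⋆-* (+ m)    j x = ·-⋆ m j x
  ⋆-* -[1+ m ] j x = trans (cong (_⋆ x) (sym (ℤ.neg-distribˡ-* (+ suc m) j)))
    (trans (⋆-neg (+ suc m ℤ.* j) x) (cong ⊖_ (·-⋆ (suc m) j x)))

  ⋆-sum : ∀ {n} (c : Fin n → ℤ) x → Σℤ.sum c ⋆ x ≡ Σˣ.sum (λ i → c i ⋆ x)
  ⋆-sum {zero}  c x = refl
  ⋆-sum {suc n} c x = trans (⋆-+ (c zero) _ x) (cong (c zero ⋆ x ⊕_) (⋆-sum (c ∘ suc) x))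

  ⋆-Σ : ∀ {n} i (v : Fin n → X) → i ⋆ Σˣ.sum v ≡ Σˣ.sum (λ k → i ⋆ v k)
  ⋆-Σ {zero}  i v = ⋆-0̂ i
  ⋆-Σ {suc n} i v = trans (⋆-⊕ i (v zero) _) (cong (i ⋆ v zero ⊕_) (⋆-Σ i (v ∘ suc)))

  ⊖-Σ : ∀ {n} (v : Fin n → X) → ⊖ Σˣ.sum v ≡ Σˣ.sum (λ k → ⊖ v k)
  ⊖-Σ {zero}  v = Gr.ε⁻¹≈ε
  ⊖-Σ {suc n} v = trans (sym (AG.⁻¹-∙-comm _ _)) (cong (⊖ v zero ⊕_) (⊖-Σ (v ∘ suc)))

  ·-Σ : ∀ {n} (d : Fin n → ℕ) x → Σℕ.sum d · x ≡ Σˣ.sum (λ i → d i · x)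
  ·-Σ {zero}  d x = refl
  ·-Σ {suc n} d x = trans (·-+ (d zero) _ x) (cong (d zero · x ⊕_) (·-Σ (d ∘ suc) x))

  combination≡Σ : ∀ {n} (d : Fin n → ℕ) v → combination d v ≡ Σˣ.sum (λ i → d i · v i)
  combination≡Σ {zero}  d v = refl
  combination≡Σ {suc n} d v = cong (d zero · v zero ⊕_) (combination≡Σ (d ∘ suc) (v ∘ suc))

  evaluate : ∀ {n} → (Fin n → X) → (Fin n → ℤ) → X
  evaluate f u = Σˣ.sum (λ i → u i ⋆ f i)

  evaluate-cong : ∀ {n} (f : Fin n → X) {u v} → (∀ i → u i ≡ v i) → evaluate f u ≡ evaluate f v
  evaluate-cong f h = Σˣ.sum-cong-≗ (λ i → cong (_⋆ f i) (h i))

  evaluate-+ : ∀ {n} (f : Fin n → X) u v → evaluate f (λ i → u i ℤ.+ v i) ≡ evaluate f u ⊕ evaluate f v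
  evaluate-+ f u v = trans (Σˣ.sum-cong-≗ (λ i → ⋆-+ (u i) (v i) (f i))) (Σˣ.∑-distrib-+ (λ i → u i ⋆ f i) (λ i → v i ⋆ f i))

  evaluate-neg : ∀ {n} (f : Fin n → X) u → evaluate f (λ i → ℤ.- u i) ≡ ⊖ evaluate f u
  evaluate-neg f u = trans (Σˣ.sum-cong-≗ (λ i → ⋆-neg (u i) (f i))) (sym (⊖-Σ (λ i → u i ⋆ f i)))

  evaluate-0 : ∀ {n} (f : Fin n → X) → evaluate f (λ _ → ℤ.0ℤ) ≡ 0̂
  evaluate-0 {n} f = Σˣ.sum-replicate-zero n

  evaluate-mulVec : ∀ {n} (f : Fin n → X) L w → evaluate f (mulVec L w) ≡ Σˣ.sum (λ j → w j ⋆ evaluate f (λ i → L i j))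
  evaluate-mulVec f L w = begin
    Σˣ.sum (λ i → Σℤ.sum (λ j → L i j ℤ.* w j) ⋆ f i)
      ≡⟨ Σˣ.sum-cong-≗ (λ i → trans (⋆-sum (λ j → L i j ℤ.* w j) (f i))
           (Σˣ.sum-cong-≗ λ j → trans (cong (_⋆ f i) (ℤ.*-comm (L i j) (w j))) (⋆-* (w j) (L i j) (f i)))) ⟩
    Σˣ.sum (λ i → Σˣ.sum (λ j → w j ⋆ L i j ⋆ f i))
      ≡⟨ Σˣ.∑-comm (λ i j → w j ⋆ L i j ⋆ f i) ⟩
    Σˣ.sum (λ j → Σˣ.sum (λ i → w j ⋆ L i j ⋆ f i))
      ≡⟨ Σˣ.sum-cong-≗ (λ j → sym (⋆-Σ (w j) (λ i → L i j ⋆ f i))) ⟩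
    Σˣ.sum (λ j → w j ⋆ evaluate f (λ i → L i j)) ∎
    where open ≡.≡-Reasoning

  -- The outdegree on the diagonal is distributed over the edges leaving j, each of which
  -- contributes f j - f i. A loop contributes `0̂`, in accordance with its cancellation in L.
  laplacian-column : ∀ {n} (Γ : Digraph n) (f : Fin n → X) j →
    evaluate f (λ i → laplacian Γ i j) ≡ combination (deg Γ j) (λ i → f j ⊝ f i)
  laplacian-column Γ f j = begin
    Σˣ.sum (λ i → laplacian Γ i j ⋆ f i)
      ≡⟨ Σˣ.sum-cong-≗ term ⟩
    Σˣ.sum (λ i → K.kronecker i j (outdeg Γ j · f j) ⊝ deg Γ j i · f i)
      ≡⟨ Σˣ.∑-distrib-+ (λ i → K.kronecker i j (outdeg Γ j · f j)) (λ i → ⊖ (deg Γ j i · f i)) ⟩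
    Σˣ.sum (λ i → K.kronecker i j (outdeg Γ j · f j)) ⊕ Σˣ.sum (λ i → ⊖ (deg Γ j i · f i))
      ≡⟨ cong (_⊕ Σˣ.sum (λ i → ⊖ (deg Γ j i · f i))) (trans (K.sum-kronecker j _) (·-Σ (deg Γ j) (f j))) ⟩
    Σˣ.sum (λ i → deg Γ j i · f j) ⊕ Σˣ.sum (λ i → ⊖ (deg Γ j i · f i))
      ≡⟨ Σˣ.∑-distrib-+ (λ i → deg Γ j i · f j) (λ i → ⊖ (deg Γ j i · f i)) ⟨
    Σˣ.sum (λ i → deg Γ j i · f j ⊝ deg Γ j i · f i)
      ≡⟨ Σˣ.sum-cong-≗ (λ i → sym (·-⊝ (deg Γ j i) (f j) (f i))) ⟩
    Σˣ.sum (λ i → deg Γ j i · (f j ⊝ f i))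
      ≡⟨ combination≡Σ (deg Γ j) (λ i → f j ⊝ f i) ⟨
    combination (deg Γ j) (λ i → f j ⊝ f i) ∎
    where
    open ≡.≡-Reasoning
    module K = KroneckerSum (AbelianGroup.commutativeMonoid abelianGroup)
    term : ∀ i → laplacian Γ i j ⋆ f i ≡ K.kronecker i j (outdeg Γ j · f j) ⊝ deg Γ j i · f i
    term i with i Fin.≟ j
    ... | yes refl = trans (cong (_⋆ f i) (ℤ.m-n≡m⊖n (outdeg Γ i) (deg Γ i i))) (⋆-ℤ⊖ (outdeg Γ i) (deg Γ i i) (f i))
    ... | no  _    = trans (⋆-neg (+ deg Γ j i) (f i)) (sym (⊕-identityˡ _))

  combination-cong : ∀ {n} {d d′ : Fin n → ℕ} {v : Fin n → X} → (∀ i → d i · v i ≡ d′ i · v i) → combination d v ≡ combination d′ v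
  combination-cong {zero}  h = refl
  combination-cong {suc n} h = cong₂ _⊕_ (h zero) (combination-cong (h ∘ suc))

module Transport {g ℓ} (𝒢 : FiniteAbelianGroup g ℓ) where
  module 𝒜 = AbelianGroup (group 𝒢)
  open Inverse (FiniteAbelianGroup.enumeration 𝒢) public using (to; from; to-cong; strictlyInverseˡ; strictlyInverseʳ)
  private
    module Gr = GroupProperties 𝒜.group

  infixl 6 _⊕_
  _⊕_ : Op₂ (Fin (order 𝒢))
  x ⊕ y = to (from x 𝒜.∙ from y)

  neg : Op₁ (Fin (order 𝒢))
  neg x = to (from x 𝒜.⁻¹)

  from-injective : ∀ {x y} → from x 𝒜.≈ from y → x ≡ y
  from-injective {x} {y} h = trans (sym (strictlyInverseˡ x)) (trans (to-cong h) (strictlyInverseˡ y))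

  from-⊕ : ∀ x y → from (x ⊕ y) 𝒜.≈ from x 𝒜.∙ from y
  from-⊕ x y = strictlyInverseʳ _

  from-0 : from (to 𝒜.ε) 𝒜.≈ 𝒜.ε
  from-0 = strictlyInverseʳ _

  from-neg : ∀ x → from (neg x) 𝒜.≈ from x 𝒜.⁻¹
  from-neg x = strictlyInverseʳ _

  to-∙ : ∀ x y → to (x 𝒜.∙ y) ≡ to x ⊕ to y
  to-∙ x y = to-cong (𝒜.∙-cong (𝒜.sym (strictlyInverseʳ x)) (𝒜.sym (strictlyInverseʳ y)))

  to-⁻¹ : ∀ x → to (x 𝒜.⁻¹) ≡ neg (to x)
  to-⁻¹ x = to-cong (𝒜.⁻¹-cong (𝒜.sym (strictlyInverseʳ x)))

  isAbelianGroup : IsAbelianGroup _≡_ _⊕_ (to 𝒜.ε) neg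
  isAbelianGroup = record
    { isGroup = record
      { isMonoid = record
        { isSemigroup = record
          { isMagma = record { isEquivalence = ≡.isEquivalence ; ∙-cong = cong₂ _⊕_ }
          ; assoc = λ x y z → from-injective (begin
              from ((x ⊕ y) ⊕ z)               ≈⟨ 𝒜.trans (from-⊕ _ z) (𝒜.∙-congʳ (from-⊕ x y)) ⟩
              (from x 𝒜.∙ from y) 𝒜.∙ from z   ≈⟨ 𝒜.assoc _ _ _ ⟩
              from x 𝒜.∙ (from y 𝒜.∙ from z)   ≈⟨ 𝒜.trans (from-⊕ x _) (𝒜.∙-congˡ (from-⊕ y z)) ⟨
              from (x ⊕ (y ⊕ z))               ∎)
          }
        ; identity = (λ x → from-injective (𝒜.trans (from-⊕ _ x) (𝒜.trans (𝒜.∙-congʳ from-0) (𝒜.identityˡ _))))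
                   , (λ x → from-injective (𝒜.trans (from-⊕ x _) (𝒜.trans (𝒜.∙-congˡ from-0) (𝒜.identityʳ _))))
        }
      ; inverse = (λ x → from-injective (𝒜.trans (from-⊕ _ x) (𝒜.trans (𝒜.∙-congʳ (from-neg x)) (𝒜.trans (𝒜.inverseˡ _) (𝒜.sym from-0)))))
                , (λ x → from-injective (𝒜.trans (from-⊕ x _) (𝒜.trans (𝒜.∙-congˡ (from-neg x)) (𝒜.trans (𝒜.inverseʳ _) (𝒜.sym from-0)))))
      ; ⁻¹-cong = cong neg
      }
    ; comm = λ x y → to-cong (𝒜.comm _ _)
    }
    where open SetoidReasoning 𝒜.setoid

  transported : AbelianGroup 0ℓ 0ℓ
  transported = record { isAbelianGroup = isAbelianGroup }

  private
    module M  = CMMult 𝒜.commutativeMonoid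
    module M′ = CMMult (AbelianGroup.commutativeMonoid transported)

  from-× : ∀ k x → from (k M′.× x) 𝒜.≈ k M.× from x
  from-× zero    x = from-0
  from-× (suc k) x = 𝒜.trans (from-⊕ x _) (𝒜.∙-congˡ (from-× k x))

  torsionGroup : ∀ {a e} → IsExponent (group 𝒢) e → e ∣ a → TorsionGroup a
  torsionGroup {a} {e} (_ , kills , _) e∣a = record
    { size           = order 𝒢
    ; _⊕_            = _⊕_
    ; 0̂              = to 𝒜.ε
    ; ⊖_             = neg
    ; isAbelianGroup = isAbelianGroup
    ; torsion        = λ x → from-injective (𝒜.trans (from-× a x) (𝒜.trans (a-kills e∣a (from x)) (𝒜.sym from-0)))
    }
    where
    a-kills : ∀ {a} → e ∣ a → ∀ x → a M.× x 𝒜.≈ 𝒜.ε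
    a-kills (divides q refl) x = 𝒜.trans (𝒜.sym (M.×-assocˡ x q e)) (𝒜.trans (M.×-congʳ q (kills x)) (q×ε q))
      where
      q×ε : ∀ q → q M.× 𝒜.ε 𝒜.≈ 𝒜.ε
      q×ε zero    = 𝒜.refl
      q×ε (suc q) = 𝒜.trans (𝒜.identityˡ _) (q×ε q)

module _ {n} (Γ : Digraph n) where
  private
    module S = AbelianGroup (sandpileGroup Γ)

  ≗⇒≈ : ∀ {u v : ℤ₀^ n} → (∀ i → vec u i ≡ vec v i) → u S.≈ v
  ≗⇒≈ h = (λ _ → ℤ.0ℤ) , λ i → trans (ℤ.i≡j⇒i-j≡0 (h i)) (sym (mulVec-0 (laplacian Γ) i))

  infixr 8 _⊛_
  _⊛_ : ℤ → ℤ₀^ n → ℤ₀^ n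
  z ⊛ u = mkℤ₀ (λ i → z ℤ.* vec u i) (trans (sym (sum-*ˡ z (vec u))) (trans (cong (z ℤ.*_) (sum≡0 u)) (ℤ.*-zeroʳ z)))
    where
    sum-*ˡ : ∀ {n} z (u : Fin n → ℤ) → z ℤ.* Σℤ.sum u ≡ Σℤ.sum (λ i → z ℤ.* u i)
    sum-*ˡ {zero}  z u = ℤ.*-zeroʳ z
    sum-*ˡ {suc n} z u = trans (ℤ.*-distribˡ-+ z (u zero) _) (cong (ℤ._+_ (z ℤ.* u zero)) (sum-*ˡ z (u ∘ suc)))

  linear : ∀ {r} → (Fin r → ℤ) → (Fin r → ℤ₀^ n) → ℤ₀^ n
  linear {zero}  c b = S.ε
  linear {suc r} c b = c zero ⊛ b zero S.∙ linear (c ∘ suc) (b ∘ suc)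

  vec-linear : ∀ {r} (c : Fin r → ℤ) (b : Fin r → ℤ₀^ n) k → vec (linear c b) k ≡ Σℤ.sum (λ i → c i ℤ.* vec (b i) k)
  vec-linear {zero}  c b k = refl
  vec-linear {suc r} c b k = cong (ℤ._+_ (c zero ℤ.* vec (b zero) k)) (vec-linear (c ∘ suc) (b ∘ suc) k)

module Kℤ = KroneckerSum ℤ.+-0-commutativeMonoid

-- e_{i+1} - e_0
basis : ∀ {n} → Fin n → ℤ₀^ (suc n)
basis {n} i = mkℤ₀ entries (cong (ℤ._+_ ℤ.-1ℤ) (Kℤ.sum-kronecker i ℤ.1ℤ))
  where
  entries : Fin (suc n) → ℤ
  entries zero    = ℤ.-1ℤ
  entries (suc k) = Kℤ.kronecker k i ℤ.1ℤ

column : ∀ {n} → Digraph n → Fin n → ℤ₀^ n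
column {n} Γ j = mkℤ₀ (λ i → laplacian Γ i j) (begin
  Σℤ.sum (λ i → laplacian Γ i j)
    ≡⟨ Σℤ.sum-cong-≗ term ⟩
  Σℤ.sum (λ i → Kℤ.kronecker i j (+ outdeg Γ j) ℤ.+ ℤ.- (+ deg Γ j i))
    ≡⟨ Σℤ.∑-distrib-+ (λ i → Kℤ.kronecker i j (+ outdeg Γ j)) (λ i → ℤ.- (+ deg Γ j i)) ⟩
  Σℤ.sum (λ i → Kℤ.kronecker i j (+ outdeg Γ j)) ℤ.+ Σℤ.sum (λ i → ℤ.- (+ deg Γ j i))
    ≡⟨ cong₂ ℤ._+_ (Kℤ.sum-kronecker j (+ outdeg Γ j)) (trans (sum-neg (λ i → + deg Γ j i)) (cong ℤ.-_ (sym (pos-sum (deg Γ j))))) ⟩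
  + outdeg Γ j ℤ.+ ℤ.- (+ outdeg Γ j)
    ≡⟨ ℤ.+-inverseʳ (+ outdeg Γ j) ⟩
  ℤ.0ℤ ∎)
  where
  open ≡.≡-Reasoning
  term : ∀ i → laplacian Γ i j ≡ Kℤ.kronecker i j (+ outdeg Γ j) ℤ.+ ℤ.- (+ deg Γ j i)
  term i with i Fin.≟ j
  ... | yes refl = refl
  ... | no  _    = sym (ℤ.+-identityˡ _)
  pos-sum : ∀ {n} (d : Fin n → ℕ) → + Σℕ.sum d ≡ Σℤ.sum (λ i → + d i)
  pos-sum {zero}  d = refl
  pos-sum {suc n} d = trans (ℤ.pos-+ (d zero) _) (cong (ℤ._+_ (+ d zero)) (pos-sum (d ∘ suc)))

-- Column j is L applied to the j-th unit vector.
column≈0 : ∀ {n} (Γ : Digraph n) j → let open AbelianGroup (sandpileGroup Γ) in column Γ j ≈ ε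
column≈0 Γ j = (λ k → Kℤ.kronecker k j ℤ.1ℤ) , λ i → trans (ℤ.+-identityʳ _) (sym (trans
  (Σℤ.sum-cong-≗ (λ k → mask i k)) (Kℤ.sum-kronecker j (laplacian Γ i j))))
  where
  mask : ∀ i k → laplacian Γ i k ℤ.* Kℤ.kronecker k j ℤ.1ℤ ≡ Kℤ.kronecker k j (laplacian Γ i j)
  mask i k with k Fin.≟ j
  ... | yes refl = ℤ.*-identityʳ _
  ... | no  _    = ℤ.*-zeroʳ (laplacian Γ i k)

module Sandpile {g ℓ} (𝒢 : FiniteAbelianGroup g ℓ) (a : ℕ) .{{_ : NonZero a}} (e : ℕ)
                (exponent : IsExponent (group 𝒢) e) (e∣a : e ∣ a) where
  open Transport 𝒢 using (module 𝒜; to; from; to-cong; strictlyInverseˡ; strictlyInverseʳ; from-⊕; from-0; from-neg; from-injective; to-∙; to-⁻¹)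

  G : TorsionGroup a
  G = Transport.torsionGroup 𝒢 exponent e∣a

  open TorsionGroupProperties a G
  open IntegerAction a G

  module _ {n} (Γ : Digraph n) (φ : SurjectiveHom (sandpileGroup Γ) (group 𝒢)) where
    private
      module S = AbelianGroup (sandpileGroup Γ)
    open SurjectiveHom φ
    open GroupMorphisms.IsGroupHomomorphism isGroupHomomorphism using (⟦⟧-cong; homo; ε-homo; ⁻¹-homo)

    value : ℤ₀^ n → X
    value u = to (⟦ u ⟧)

    value-cong : ∀ {u v} → u S.≈ v → value u ≡ value v
    value-cong h = to-cong (⟦⟧-cong h)

    value-∙ : ∀ u v → value (u S.∙ v) ≡ value u ⊕ value v
    value-∙ u v = trans (to-cong (homo u v)) (to-∙ _ _)

    value-ε : value S.ε ≡ 0̂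
    value-ε = to-cong ε-homo

    value-⁻¹ : ∀ u → value (u S.⁻¹) ≡ ⊖ value u
    value-⁻¹ u = trans (to-cong (⁻¹-homo u)) (to-⁻¹ _)

    value-·⊛ : ∀ k u → value (_⊛_ Γ (+ k) u) ≡ k · value u
    value-·⊛ zero    u = trans (value-cong {_⊛_ Γ (+ 0) u} {S.ε} (≗⇒≈ Γ {_⊛_ Γ (+ 0) u} {S.ε} λ i → ℤ.*-zeroˡ (vec u i))) value-ε
    value-·⊛ (suc k) u = trans (value-cong {_⊛_ Γ (+ suc k) u} {u S.∙ _⊛_ Γ (+ k) u} (≗⇒≈ Γ {_⊛_ Γ (+ suc k) u} {u S.∙ _⊛_ Γ (+ k) u} λ i → ℤ.suc-* (+ k) (vec u i)))
      (trans (value-∙ u _) (cong (value u ⊕_) (value-·⊛ k u)))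

    value-⊛ : ∀ z u → value (_⊛_ Γ z u) ≡ z ⋆ value u
    value-⊛ (+ k)    u = value-·⊛ k u
    value-⊛ -[1+ k ] u = trans (value-cong {_⊛_ Γ -[1+ k ] u} {(_⊛_ Γ (+ suc k) u) S.⁻¹} (≗⇒≈ Γ {_⊛_ Γ -[1+ k ] u} {(_⊛_ Γ (+ suc k) u) S.⁻¹} λ i → sym (ℤ.neg-distribˡ-* (+ suc k) (vec u i))))
      (trans (value-⁻¹ (_⊛_ Γ (+ suc k) u)) (cong ⊖_ (value-·⊛ (suc k) u)))

    value-linear : ∀ {r} (c : Fin r → ℤ) b → value (linear Γ c b) ≡ Σˣ.sum (λ i → c i ⋆ value (b i))
    value-linear {zero}  c b = value-ε
    value-linear {suc r} c b = trans (value-∙ (_⊛_ Γ (c zero) (b zero)) _) (cong₂ _⊕_ (value-⊛ (c zero) (b zero)) (value-linear (c ∘ suc) (b ∘ suc)))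

  module _ {n} (Γ : Digraph (suc n)) where
    private
      module S = AbelianGroup (sandpileGroup Γ)
      Hom = SurjectiveHom (sandpileGroup Γ) (group 𝒢)

    encode : Hom → Vec X n
    encode φ = Vec.tabulate (λ i → value Γ φ (basis i))

    basis-expansion : ∀ u → linear Γ (vec u ∘ suc) basis S.≈ u
    basis-expansion u = ≗⇒≈ Γ {linear Γ (vec u ∘ suc) basis} {u} λ k → trans (vec-linear Γ (vec u ∘ suc) basis k) (at k)
      where
      open ≡.≡-Reasoning
      at : ∀ k → Σℤ.sum (λ i → vec u (suc i) ℤ.* vec (basis i) k) ≡ vec u k
      at zero = begin
        Σℤ.sum (λ i → vec u (suc i) ℤ.* ℤ.-1ℤ)
          ≡⟨ Σℤ.sum-cong-≗ (λ i → trans (ℤ.*-comm (vec u (suc i)) ℤ.-1ℤ) (ℤ.-1*i≡-i (vec u (suc i)))) ⟩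
        Σℤ.sum (λ i → ℤ.- vec u (suc i))
          ≡⟨ sum-neg (vec u ∘ suc) ⟩
        ℤ.- Σℤ.sum (vec u ∘ suc)
          ≡⟨ GroupProperties.inverseˡ-unique (AbelianGroup.group ℤ.+-0-abelianGroup) (vec u zero) _ (sum≡0 u) ⟨
        vec u zero ∎
      at (suc k) = trans (Σℤ.sum-cong-≗ mask) (Kℤ.sum-kronecker k (vec u (suc k)))
        where
        mask : ∀ i → vec u (suc i) ℤ.* Kℤ.kronecker k i ℤ.1ℤ ≡ Kℤ.kronecker i k (vec u (suc k))
        mask i with i Fin.≟ k | k Fin.≟ i
        ... | yes refl | yes _  = ℤ.*-identityʳ _
        ... | yes refl | no k≢k = contradiction refl k≢k
        ... | no i≢k | yes k≡i = contradiction (sym k≡i) i≢k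
        ... | no _ | no _ = ℤ.*-zeroʳ (vec u (suc i))

    -- The vectors e_(i+1) - e_0 generate the vectors of sum 0, so a homomorphism is determined by
    -- their images; giving the base vertex the value `0̂` turns it into an evaluation on all
    -- coordinates.
    value≡evaluate : ∀ φ u → value Γ φ u ≡ evaluate (extend (encode φ)) (vec u)
    value≡evaluate φ u = begin
      value Γ φ u
        ≡⟨ value-cong Γ φ {linear Γ (vec u ∘ suc) basis} {u} (basis-expansion u) ⟨
      value Γ φ (linear Γ (vec u ∘ suc) basis)
        ≡⟨ value-linear Γ φ (vec u ∘ suc) basis ⟩
      Σˣ.sum (λ i → vec u (suc i) ⋆ value Γ φ (basis i))
        ≡⟨ Σˣ.sum-cong-≗ (λ i → cong (vec u (suc i) ⋆_) (sym (Vec.lookup∘tabulate _ i))) ⟩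
      Σˣ.sum (λ i → vec u (suc i) ⋆ lookup (encode φ) i)
        ≡⟨ trans (cong (_⊕ Σˣ.sum (λ i → vec u (suc i) ⋆ lookup (encode φ) i)) (⋆-0̂ (vec u zero))) (⊕-identityˡ _) ⟨
      evaluate (extend (encode φ)) (vec u) ∎
      where open ≡.≡-Reasoning

    -- Surjectivity puts every x into the span of the values, and the conditions hold because the
    -- columns of L vanish in the sandpile group.
    encode-solution : ∀ φ → Solution (deg Γ) (encode φ)
    encode-solution φ = generates , kills
      where
      f = encode φ
      sub = span-isSubgroup (tabulate (lookup f))
      open IsSubgroup sub
      ⋆∈ : ∀ z {x} → span (tabulate (lookup f)) x → span (tabulate (lookup f)) (z ⋆ x)
      ⋆∈ (+ k)    x∈ = ·∈ k x∈
      ⋆∈ -[1+ k ] x∈ = ⊖∈ (·∈ (suc k) x∈)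
      Σ∈ : ∀ {r} (v : Fin r → X) → (∀ i → span (tabulate (lookup f)) (v i)) → span (tabulate (lookup f)) (Σˣ.sum v)
      Σ∈ {zero}  v h = 0∈
      Σ∈ {suc r} v h = ⊕∈ (h zero) (Σ∈ (v ∘ suc) (h ∘ suc))
      generates : Generates (lookup f)
      generates x = let (u , h) = SurjectiveHom.surjective φ (from x) in
        subst (span (tabulate (lookup f))) (trans (sym (value≡evaluate φ u)) (trans (to-cong (h {u} (S.refl {u}))) (strictlyInverseˡ x)))
          (Σ∈ (λ i → vec u i ⋆ extend f i) λ { zero → ⋆∈ (vec u zero) 0∈ ; (suc i) → ⋆∈ (vec u (suc i)) (span-∈ (∈.∈-tabulate⁺ i)) })
      kills : ∀ j → Kills (extend f) j (deg Γ j)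
      kills j = trans (sym (laplacian-column Γ (extend f) j)) (trans (sym (value≡evaluate φ (column Γ j)))
        (trans (value-cong Γ φ {column Γ j} {S.ε} (column≈0 Γ j)) (value-ε Γ φ)))

    evaluate-basis : ∀ (f : Vec X n) i → evaluate (extend f) (vec (basis i)) ≡ lookup f i
    evaluate-basis f i = trans (cong₂ _⊕_ (⋆-0̂ ℤ.-1ℤ) (trans (Σˣ.sum-cong-≗ mask) (Kˣ.sum-kronecker i (lookup f i)))) (⊕-identityˡ _)
      where
      module Kˣ = KroneckerSum (AbelianGroup.commutativeMonoid abelianGroup)
      mask : ∀ k → Kℤ.kronecker k i ℤ.1ℤ ⋆ lookup f k ≡ Kˣ.kronecker k i (lookup f i)
      mask k with k Fin.≟ i
      ... | yes refl = ⊕-identityʳ _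
      ... | no  _    = refl

    -- Evaluation is well defined because L w evaluates to a combination of killed columns. It is
    -- onto because its image is a subgroup containing the values of f, which generate.
    decode : ∀ f → Solution (deg Γ) f → Hom
    decode f (generates , kills) = record
      { ⟦_⟧ = λ u → from (ev u)
      ; isGroupHomomorphism = record
        { isMonoidHomomorphism = record
          { isMagmaHomomorphism = record
            { isRelHomomorphism = record { cong = λ {u} {v} h → 𝒜.reflexive (cong from (ev-cong {u} {v} h)) }
            ; homo = λ u v → 𝒜.trans (𝒜.reflexive (cong from (evaluate-+ F (vec u) (vec v)))) (from-⊕ (ev u) (ev v))
            }
          ; ε-homo = 𝒜.trans (𝒜.reflexive (cong from (evaluate-0 F))) from-0
          }
        ; ⁻¹-homo = λ u → 𝒜.trans (𝒜.reflexive (cong from (evaluate-neg F (vec u)))) (from-neg (ev u))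
        }
      ; surjective = λ y → let (u , eq) = image (to y) in
          u , λ {v} h → 𝒜.trans (𝒜.reflexive (cong from (trans (ev-cong {v} {u} h) eq))) (strictlyInverseʳ y)
      }
      where
      F = extend f
      ev : ℤ₀^ (suc n) → X
      ev u = evaluate F (vec u)
      ev-cong : ∀ {u v} → u S.≈ v → ev u ≡ ev v
      ev-cong {u} {v} (w , h) = ⊝≡0⇒≡ (begin
        ev u ⊝ ev v
          ≡⟨ trans (evaluate-+ F (vec u) (λ i → ℤ.- vec v i)) (cong (ev u ⊕_) (evaluate-neg F (vec v))) ⟨
        evaluate F (λ i → vec u i ℤ.- vec v i)
          ≡⟨ evaluate-cong F h ⟩
        evaluate F (mulVec (laplacian Γ) w)
          ≡⟨ evaluate-mulVec F (laplacian Γ) w ⟩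
        Σˣ.sum (λ j → w j ⋆ evaluate F (λ i → laplacian Γ i j))
          ≡⟨ Σˣ.sum-cong-≗ (λ j → trans (cong (w j ⋆_) (trans (laplacian-column Γ F j) (kills j))) (⋆-0̂ (w j))) ⟩
        Σˣ.sum {suc n} (λ _ → 0̂)
          ≡⟨ Σˣ.sum-replicate-zero (suc n) ⟩
        0̂ ∎)
        where open ≡.≡-Reasoning
      Image : X → Set
      Image x = ∃[ u ] ev u ≡ x
      image-sub : IsSubgroup Image
      image-sub = record
        { 0∈ = S.ε , evaluate-0 F
        ; ⊕∈ = λ { (u , refl) (v , refl) → u S.∙ v , evaluate-+ F (vec u) (vec v) }
        ; ⊖∈ = λ { (u , refl) → u S.⁻¹ , evaluate-neg F (vec u) }
        }
      image : ∀ x → Image x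
      image x = span-least image-sub (λ v∈ → let (i , eq) = ∈.∈-tabulate⁻ v∈ in basis i , trans (evaluate-basis f i) (sym eq)) (generates x)

    #Sur : HasCardinality (Sur (sandpileGroup Γ) (group 𝒢)) (#solutions (deg Γ))
    #Sur = cardinality (Sur (sandpileGroup Γ) (group 𝒢)) (vecs (fins size) n) (solution? (deg Γ))
      encode encode-solution
      (λ φ≈ψ → Vec.tabulate-cong (λ i → to-cong (φ≈ψ (basis i))))
      decode
      (λ f p → trans (Vec.tabulate-cong (λ i → trans (strictlyInverseˡ _) (evaluate-basis f i))) (Vec.tabulate∘lookup f))
      (λ φ p u → 𝒜.trans (𝒜.reflexive (cong from (sym (value≡evaluate φ u)))) (strictlyInverseʳ _))

  -- Without vertices there is no base vertex to normalise at. The sandpile group is trivial, so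
  -- there is one surjection if the target is trivial and none otherwise.
  #Sur-empty : (Γ : Digraph 0) → HasCardinality (Sur (sandpileGroup Γ) (group 𝒢))
    (length (filter (λ f → generates? (lookup f)) (functions 0)))
  #Sur-empty Γ = cardinality (Sur (sandpileGroup Γ) (group 𝒢)) (vecs (fins size) 0) (λ f → generates? (lookup f))
    (λ _ → []) trivial (λ _ → refl) zero-hom (λ { [] _ → refl })
    (λ φ _ u → 𝒜.trans (𝒜.sym (GroupMorphisms.IsGroupHomomorphism.ε-homo (SurjectiveHom.isGroupHomomorphism φ)))
      (GroupMorphisms.IsGroupHomomorphism.⟦⟧-cong (SurjectiveHom.isGroupHomomorphism φ) {S.ε} {u} (≗⇒≈ Γ {S.ε} {u} (λ ()))))
    where
    module S = AbelianGroup (sandpileGroup Γ)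
    trivial : SurjectiveHom (sandpileGroup Γ) (group 𝒢) → Generates {0} (lookup [])
    trivial φ x = let (u , h) = SurjectiveHom.surjective φ (from x) in
      trans (sym (strictlyInverseˡ x)) (trans (to-cong (𝒜.sym (h {u} (S.refl {u}))))
        (trans (value-cong Γ φ {u} {S.ε} (≗⇒≈ Γ {u} {S.ε} (λ ()))) (value-ε Γ φ)))
    zero-hom : ∀ f → Generates {0} (lookup f) → SurjectiveHom (sandpileGroup Γ) (group 𝒢)
    zero-hom [] generates = record
      { ⟦_⟧ = λ _ → 𝒜.ε
      ; isGroupHomomorphism = record
        { isMonoidHomomorphism = record
          { isMagmaHomomorphism = record
            { isRelHomomorphism = record { cong = λ _ → 𝒜.refl }
            ; homo = λ _ _ → 𝒜.sym (𝒜.identityˡ 𝒜.ε)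
            }
          ; ε-homo = 𝒜.refl
          }
        ; ⁻¹-homo = λ _ → 𝒜.sym (GroupProperties.ε⁻¹≈ε 𝒜.group)
        }
      ; surjective = λ y → S.ε , λ _ → 𝒜.trans (𝒜.sym from-0) (𝒜.trans (𝒜.reflexive (cong from (sym (generates (to y))))) (strictlyInverseʳ y))
      }

-- The rationals as an ordered ring; limits and series of reals.

fromℤℚ : ℤ → ℚ
fromℤℚ i = i ℚ./ 1

private
  toℚᵘ-fromℤℚ : ∀ i → ℚ.toℚᵘ (fromℤℚ i) ℚᵘ.≃ ℚᵘ.mkℚᵘ i 0
  toℚᵘ-fromℤℚ i = ℚ.toℚᵘ-fromℚᵘ (ℚᵘ.mkℚᵘ i 0)

fromℤℚ-+ : ∀ i j → fromℤℚ (i ℤ.+ j) ≡ fromℤℚ i ℚ.+ fromℤℚ j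
fromℤℚ-+ i j = ℚ.toℚᵘ-injective (ℚᵘ.≃-trans (toℚᵘ-fromℤℚ (i ℤ.+ j))
  (ℚᵘ.≃-trans (ℚᵘ.*≡* (cong (ℤ._* + 1) (cong₂ ℤ._+_ (sym (ℤ.*-identityʳ i)) (sym (ℤ.*-identityʳ j)))))
    (ℚᵘ.≃-sym (ℚᵘ.≃-trans (ℚ.toℚᵘ-homo-+ (fromℤℚ i) (fromℤℚ j)) (ℚᵘ.+-cong (toℚᵘ-fromℤℚ i) (toℚᵘ-fromℤℚ j))))))

fromℤℚ-* : ∀ i j → fromℤℚ (i ℤ.* j) ≡ fromℤℚ i ℚ.* fromℤℚ j
fromℤℚ-* i j = ℚ.toℚᵘ-injective (ℚᵘ.≃-trans (toℚᵘ-fromℤℚ (i ℤ.* j))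
  (ℚᵘ.≃-sym (ℚᵘ.≃-trans (ℚ.toℚᵘ-homo-* (fromℤℚ i) (fromℤℚ j)) (ℚᵘ.*-cong (toℚᵘ-fromℤℚ i) (toℚᵘ-fromℤℚ j)))))

fromℤℚ-neg : ∀ i → fromℤℚ (ℤ.- i) ≡ ℚ.- fromℤℚ i
fromℤℚ-neg i = ℚ.toℚᵘ-injective (ℚᵘ.≃-trans (toℚᵘ-fromℤℚ (ℤ.- i))
  (ℚᵘ.≃-sym (ℚᵘ.≃-trans (ℚ.toℚᵘ-homo‿- (fromℤℚ i)) (ℚᵘ.-‿cong (toℚᵘ-fromℤℚ i)))))

ℚ-orderedRing : OrderedRing
ℚ-orderedRing = record
  { Carrier           = ℚ
  ; _+_               = ℚ._+_
  ; _*_               = ℚ._*_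
  ; -_                = ℚ.-_
  ; 0#                = 0ℚ
  ; 1#                = 1ℚ
  ; isCommutativeRing = ℚ.+-*-isCommutativeRing
  ; _≤_               = ℚ._≤_
  ; isDecTotalOrder   = ℚ.≤-isDecTotalOrder
  ; +-mono-≤          = ℚ.+-mono-≤
  ; *-nonNeg          = λ {p} {q} p≥0 q≥0 → ℚ.nonNegative⁻¹ (p ℚ.* q)
                          {{ℚ.nonNeg*nonNeg⇒nonNeg p {{ℚ.nonNegative p≥0}} q {{ℚ.nonNegative q≥0}}}}
  ; *-cancelˡ-≤       = λ r r≰0 → ℚ.*-cancelˡ-≤-pos r {{ℚ.positive (ℚ.≰⇒> r≰0)}}
  ; 0≤1               = ℚ.nonNegative⁻¹ 1ℚ
  ; 1≰0               = λ { (ℚ.*≤* (ℤ.+≤+ ())) }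
  ; fromℤ             = fromℤℚ
  ; fromℤ-+           = fromℤℚ-+
  ; fromℤ-*           = fromℤℚ-*
  ; fromℤ-neg         = fromℤℚ-neg
  ; fromℤ-0           = refl
  ; fromℤ-1           = refl
  ; recip             = 1/suc
  ; suc*recip         = λ k → ExpSummable.fromℕℚ-inv (suc k)
  }

module Q = OrderedRingProperties ℚ-orderedRing

Eventually : (ℕ → Set) → Set
Eventually P = ∃[ N ] (∀ n → N ℕ.≤ n → P n)

eventually-map : ∀ {P R : ℕ → Set} → (∀ {n} → P n → R n) → Eventually P → Eventually R
eventually-map f (N , h) = N , λ n N≤n → f (h n N≤n)

eventually-zip : ∀ {P R T : ℕ → Set} → (∀ {n} → P n → R n → T n) → Eventually P → Eventually R → Eventually T
eventually-zip f (M , p) (N , r) = M ℕ.⊔ N , λ n h → f (p n (ℕ.m⊔n≤o⇒m≤o M N h)) (r n (ℕ.m⊔n≤o⇒n≤o M N h))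

always : ∀ {P : ℕ → Set} → (∀ n → P n) → Eventually P
always h = 0 , λ n _ → h n

eventually-all : ∀ {A : Set} {P : A → ℕ → Set} (xs : List A) → (∀ x → Eventually (P x)) → Eventually (λ n → ∀ {x} → x ∈ xs → P x n)
eventually-all []       h = always λ _ ()
eventually-all (x ∷ xs) h = eventually-zip (λ { p ps (here refl) → p ; p ps (there x∈) → ps x∈ }) (h x) (eventually-all xs h)

eventually-enum : ∀ {A : Set} (E : Enumeration A) {P : A → ℕ → Set} → (∀ x → Eventually (P x)) → Eventually (λ n → ∀ x → P x n)
eventually-enum E h = eventually-map (λ ps x → ps (Enumeration.complete E x)) (eventually-all (elements E) h)

-- Unlike _≈ᴿ_, a record, so that its endpoints can be inferred.
infix 4 _≋_
record _≋_ (x y : ℝ) : Set where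
  constructor ≋-intro
  field
    close : ∀ ε → 0ℚ ℚ.< ε → Eventually (λ n → ℚ.∣ seq x n ℚ.- seq y n ∣ ℚ.≤ ε)

open _≋_

private
  p≤q+r⇒p-q≤r : ∀ {p q r} → p ℚ.≤ q ℚ.+ r → p ℚ.- q ℚ.≤ r
  p≤q+r⇒p-q≤r {p} {q} {r} h = subst (p ℚ.- q ℚ.≤_) (QS.solve 2 (λ q r → (q QS.:+ r) QS.:- q QS.:= r) refl q r) (ℚ.+-monoˡ-≤ (ℚ.- q) h)

  p-q≤r⇒p≤q+r : ∀ {p q r} → p ℚ.- q ℚ.≤ r → p ℚ.≤ q ℚ.+ r
  p-q≤r⇒p≤q+r {p} {q} {r} h = subst (ℚ._≤ q ℚ.+ r) (QS.solve 2 (λ p q → q QS.:+ (p QS.:- q) QS.:= p) refl p q) (ℚ.+-monoʳ-≤ q h)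

  -[p-q] : ∀ p q → ℚ.- (p ℚ.- q) ≡ q ℚ.- p
  -[p-q] = QS.solve 2 (λ p q → QS.:- (p QS.:- q) QS.:= q QS.:- p) refl

≈ᴿ⇒≋ : ∀ {x y} → x ≈ᴿ y → x ≋ y
≈ᴿ⇒≋ {x} {y} (x≤y , y≤x) = ≋-intro λ ε ε>0 → eventually-zip
  (λ {n} p q → ∣p∣≤ (p≤q+r⇒p-q≤r p) (subst (ℚ._≤ ε) (sym (-[p-q] (seq x n) (seq y n))) (p≤q+r⇒p-q≤r q)))
  (x≤y ε ε>0) (y≤x ε ε>0)

≋⇒≤ᴿ : ∀ {x y} → x ≋ y → x ≤ᴿ y
≋⇒≤ᴿ x≋y ε ε>0 = eventually-map (λ h → p-q≤r⇒p≤q+r (ℚ.≤-trans (p≤∣p∣ _) h)) (close x≋y ε ε>0)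

≗⇒≋ : ∀ {x y} → (∀ n → seq x n ≡ seq y n) → x ≋ y
≗⇒≋ {x} {y} h = ≋-intro λ ε ε>0 → always λ n → ℚ.≤-trans
  (ℚ.≤-reflexive (cong ℚ.∣_∣ (trans (cong (ℚ._- seq y n) (h n)) (ℚ.+-inverseʳ (seq y n))))) (ℚ.<⇒≤ ε>0)

≋-refl : ∀ {x} → x ≋ x
≋-refl = ≗⇒≋ λ _ → refl

≋-sym : ∀ {x y} → x ≋ y → y ≋ x
≋-sym {x} {y} h = ≋-intro λ ε ε>0 → eventually-map (λ {n} → subst (ℚ._≤ ε) (∣-∣-flip (seq x n) (seq y n))) (close h ε ε>0)

≋-trans : ∀ {x y z} → x ≋ y → y ≋ z → x ≋ z
≋-trans {x} {y} {z} p q = ≋-intro λ ε ε>0 → eventually-zip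
  (λ {n} a b → ℚ.≤-trans (triangle (seq x n) (seq y n) (seq z n)) (+-mono-half ε a b))
  (close p (half ε) (half>0 ε>0)) (close q (half ε) (half>0 ε>0))

+ᴿ-cong : ∀ {x y u v} → x ≋ y → u ≋ v → x +ᴿ u ≋ y +ᴿ v
+ᴿ-cong {x} {y} {u} {v} p q = ≋-intro λ ε ε>0 → eventually-zip
  (λ {n} a b → ℚ.≤-trans (ℚ.≤-reflexive (cong ℚ.∣_∣ (QS.solve 4
      (λ a b c d → (a QS.:+ b) QS.:- (c QS.:+ d) QS.:= (a QS.:- c) QS.:+ (b QS.:- d)) refl (seq x n) (seq u n) (seq y n) (seq v n))))
    (ℚ.≤-trans (ℚ.∣p+q∣≤∣p∣+∣q∣ (seq x n ℚ.- seq y n) (seq u n ℚ.- seq v n)) (+-mono-half ε a b)))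
  (close p (half ε) (half>0 ε>0)) (close q (half ε) (half>0 ε>0))

*ᴿ-cong : ∀ {x y u v} → x ≋ y → u ≋ v → x *ᴿ u ≋ y *ᴿ v
*ᴿ-cong {x} {y} {u} {v} p q = ≋-intro λ ε ε>0 →
  let (A , A>0 , hA) = eventuallyBounded x
      (B , B>0 , hB) = eventuallyBounded v
      (δ , δ>0 , Aδ) = scaled (half>0 ε>0) A A>0
      (η , η>0 , Bη) = scaled (half>0 ε>0) B B>0
  in eventually-zip (λ {n} (a , a′) (b , b′) → ℚ.≤-trans
       (ℚ.≤-trans (ℚ.≤-reflexive (cong ℚ.∣_∣ (QS.solve 4
           (λ x u y v → (x QS.:* u) QS.:- (y QS.:* v) QS.:= x QS.:* (u QS.:- v) QS.:+ v QS.:* (x QS.:- y)) refl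
             (seq x n) (seq u n) (seq y n) (seq v n))))
         (ℚ.∣p+q∣≤∣p∣+∣q∣ (seq x n ℚ.* (seq u n ℚ.- seq v n)) (seq v n ℚ.* (seq x n ℚ.- seq y n))))
       (+-mono-half ε
         (ℚ.≤-trans (*-mono-∣∣ A>0 a b) (ℚ.≤-reflexive Aδ))
         (ℚ.≤-trans (*-mono-∣∣ B>0 b′ a′) (ℚ.≤-reflexive Bη))))
     (eventually-zip _,_ hA (close p η η>0))
     (eventually-zip _,_ (close q δ δ>0) hB)

ℝ-commutativeSemiring : CommutativeSemiring 0ℓ 0ℓ
ℝ-commutativeSemiring = record
  { Carrier = ℝ
  ; _≈_     = _≋_
  ; _+_     = _+ᴿ_
  ; _*_     = _*ᴿ_
  ; 0#      = 0ᴿ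
  ; 1#      = 1ᴿ
  ; isCommutativeSemiring = record
    { isSemiring = record
      { isSemiringWithoutAnnihilatingZero = record
        { +-isCommutativeMonoid = record
          { isMonoid = record
            { isSemigroup = record
              { isMagma = record
                { isEquivalence = record { refl = ≋-refl ; sym = ≋-sym ; trans = ≋-trans }
                ; ∙-cong = +ᴿ-cong
                }
              ; assoc = λ x y z → ≗⇒≋ λ n → ℚ.+-assoc (seq x n) (seq y n) (seq z n)
              }
            ; identity = (λ x → ≗⇒≋ λ n → ℚ.+-identityˡ (seq x n)) , (λ x → ≗⇒≋ λ n → ℚ.+-identityʳ (seq x n))
            }
          ; comm = λ x y → ≗⇒≋ λ n → ℚ.+-comm (seq x n) (seq y n)
          }
        ; *-cong = *ᴿ-cong
        ; *-assoc = λ x y z → ≗⇒≋ λ n → ℚ.*-assoc (seq x n) (seq y n) (seq z n)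
        ; *-identity = (λ x → ≗⇒≋ λ n → ℚ.*-identityˡ (seq x n)) , (λ x → ≗⇒≋ λ n → ℚ.*-identityʳ (seq x n))
        ; distrib = (λ x y z → ≗⇒≋ λ n → ℚ.*-distribˡ-+ (seq x n) (seq y n) (seq z n))
                  , (λ x y z → ≗⇒≋ λ n → ℚ.*-distribʳ-+ (seq x n) (seq y n) (seq z n))
        }
      ; zero = (λ x → ≗⇒≋ λ n → ℚ.*-zeroˡ (seq x n)) , (λ x → ≗⇒≋ λ n → ℚ.*-zeroʳ (seq x n))
      }
    ; *-comm = λ x y → ≗⇒≋ λ n → ℚ.*-comm (seq x n) (seq y n)
    }
  }

module R = CommutativeSemiring ℝ-commutativeSemiring
module ∑ᴿ = Sums ℝ-commutativeSemiring
open ∑ᴿ using () renaming (∑ to ∑ᴿ; ∏ to ∏ᴿ)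

seq-∑ : ∀ {A : Set} (xs : List A) f k → seq (∑ᴿ xs f) k ≡ Q.∑ xs (λ x → seq (f x) k)
seq-∑ []       f k = refl
seq-∑ (x ∷ xs) f k = cong (seq (f x) k ℚ.+_) (seq-∑ xs f k)

seq-∏ : ∀ {n} (f : Fin n → ℝ) k → seq (∏ᴿ f) k ≡ Q.∏ (λ i → seq (f i) k)
seq-∏ {zero}  f k = refl
seq-∏ {suc n} f k = cong (seq (f zero) k ℚ.*_) (seq-∏ (f ∘ suc) k)

-- ConvergesTo with the inner real inequality unfolded; a record for the same reason as _≋_.
record Converges (x : ℕ → ℝ) (l : ℝ) : Set where
  constructor converges-intro
  field
    approach : ∀ ε → 0ℚ ℚ.< ε → Eventually (λ n → Eventually (λ i → ℚ.∣ seq (x n) i ℚ.- seq l i ∣ ℚ.≤ ε))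

open Converges

ConvergesTo⇒ : ∀ {x l} → ConvergesTo x l → Converges x l
ConvergesTo⇒ {x} {l} h = converges-intro λ ε ε>0 → eventually-map
  (λ {n} p → eventually-map (λ q → ℚ.≤-trans q (ℚ.≤-reflexive (half+half ε))) (p (half ε) (half>0 ε>0)))
  (h (half ε) (half>0 ε>0))

⇒ConvergesTo : ∀ {x l} → Converges x l → ConvergesTo x l
⇒ConvergesTo h ε ε>0 = eventually-map
  (λ p δ δ>0 → eventually-map (λ q → ℚ.≤-trans q (Q.x≤x+y (ℚ.<⇒≤ δ>0))) p) (approach h ε ε>0)

converges-unique : ∀ {x l l′} → Converges x l → Converges x l′ → l ≋ l′
converges-unique {x} {l} {l′} p q = ≋-intro λ ε ε>0 →
  let (M , hp) = approach p (half ε) (half>0 ε>0)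
      (N , hq) = approach q (half ε) (half>0 ε>0)
      n = M ℕ.⊔ N
  in eventually-zip (λ {i} a b → ℚ.≤-trans (triangle (seq l i) (seq (x n) i) (seq l′ i))
       (+-mono-half ε (subst (ℚ._≤ half ε) (∣-∣-flip (seq (x n) i) (seq l i)) a) b))
     (hp n (ℕ.m≤m⊔n M N)) (hq n (ℕ.m≤n⊔m M N))

converges-cong : ∀ {x y l l′} → (∀ n → x n ≋ y n) → l ≋ l′ → Converges x l → Converges y l′
converges-cong {x} {y} {l} {l′} p q h = converges-intro λ ε ε>0 →
  let ε′ = half (half ε)
      ε′>0 = half>0 (half>0 ε>0)
  in eventually-map (λ {n} hn →
     eventually-zip (λ {i} a (b , c) → ℚ.≤-trans (triangle (seq (y n) i) (seq (x n) i) (seq l′ i))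
       (+-mono-half ε a (ℚ.≤-trans (triangle (seq (x n) i) (seq l i) (seq l′ i)) (+-mono-half (half ε) b c))))
     (close (≋-sym (p n)) (half ε) (half>0 ε>0)) (eventually-zip _,_ hn (close q ε′ ε′>0)))
  (approach h ε′ ε′>0)

converges-+ : ∀ {x y l m} → Converges x l → Converges y m → Converges (λ n → x n +ᴿ y n) (l +ᴿ m)
converges-+ {x} {y} {l} {m} p q = converges-intro λ ε ε>0 → eventually-zip (λ {n} a b → eventually-zip (λ {i} c d →
    ℚ.≤-trans (ℚ.≤-reflexive (cong ℚ.∣_∣ (QS.solve 4
      (λ a b c d → (a QS.:+ b) QS.:- (c QS.:+ d) QS.:= (a QS.:- c) QS.:+ (b QS.:- d)) refl (seq (x n) i) (seq (y n) i) (seq l i) (seq m i))))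
    (ℚ.≤-trans (ℚ.∣p+q∣≤∣p∣+∣q∣ (seq (x n) i ℚ.- seq l i) (seq (y n) i ℚ.- seq m i)) (+-mono-half ε c d))) a b)
  (approach p (half ε) (half>0 ε>0)) (approach q (half ε) (half>0 ε>0))

converges-scale : ∀ {x l} c → Converges x l → Converges (λ n → fromℚ c *ᴿ x n) (fromℚ c *ᴿ l)
converges-scale {x} {l} c p = converges-intro λ ε ε>0 →
  let B   = ℚ.∣ c ∣ ℚ.+ 1ℚ
      B>0 = ℚ.nonNeg+pos⇒pos ℚ.∣ c ∣ {{ℚ.∣-∣-nonNeg c}} 1ℚ
      (δ , δ>0 , Bδ) = scaled ε>0 B B>0
  in eventually-map (λ {n} → eventually-map (λ {i} a → ℚ.≤-trans
       (ℚ.≤-reflexive (cong ℚ.∣_∣ (QS.solve 3 (λ c a b → (c QS.:* a) QS.:- (c QS.:* b) QS.:= c QS.:* (a QS.:- b)) refl c (seq (x n) i) (seq l i))))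
       (ℚ.≤-trans (*-mono-∣∣ {c} {seq (x n) i ℚ.- seq l i} B>0 (Q.x≤x+y Q.0≤1) a) (ℚ.≤-reflexive Bδ)))) (approach p δ δ>0)

-- x n and x i are compared at an index l late enough for their distance; by the choice of `index`,
-- each is within 1/(n + 1) or 1/(i + 1) of its own entry at l.
lim-converges : ∀ x (x-cauchy : IsCauchyᴿ x) → Converges x (lim x x-cauchy)
lim-converges x x-cauchy = converges-intro λ ε ε>0 →
  let η   = half (half ε)
      η>0 = half>0 (half>0 ε>0)
      (A , 1/≤η)  = 1/suc-archimedean η>0
      (B , x-close) = x-cauchy η η>0
  in A ℕ.⊔ B , λ n ≤n → A ℕ.⊔ B ℕ.⊔ D.index n , λ i ≤i →
    let A⊔B≤i = ℕ.m⊔n≤o⇒m≤o (A ℕ.⊔ B) (D.index n) ≤i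
        (L , hL) = x-close n i (ℕ.m⊔n≤o⇒n≤o A B ≤n) (ℕ.m⊔n≤o⇒n≤o A B A⊔B≤i) η η>0
        l = (D.index n ℕ.⊔ D.index i) ℕ.⊔ L
        n≤l = ℕ.≤-trans (ℕ.m≤m⊔n (D.index n) (D.index i)) (ℕ.m≤m⊔n (D.index n ℕ.⊔ D.index i) L)
        i≤l = ℕ.≤-trans (ℕ.m≤n⊔m (D.index n) (D.index i)) (ℕ.m≤m⊔n (D.index n ℕ.⊔ D.index i) L)
    in begin
      ℚ.∣ seq (x n) i ℚ.- D.diag i ∣
        ≤⟨ triangle (seq (x n) i) (seq (x n) l) (D.diag i) ⟩
      ℚ.∣ seq (x n) i ℚ.- seq (x n) l ∣ ℚ.+ ℚ.∣ seq (x n) l ℚ.- D.diag i ∣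
        ≤⟨ ℚ.+-monoʳ-≤ ℚ.∣ seq (x n) i ℚ.- seq (x n) l ∣ (triangle (seq (x n) l) (seq (x i) l) (D.diag i)) ⟩
      ℚ.∣ seq (x n) i ℚ.- seq (x n) l ∣ ℚ.+ (ℚ.∣ seq (x n) l ℚ.- seq (x i) l ∣ ℚ.+ ℚ.∣ seq (x i) l ℚ.- D.diag i ∣)
        ≤⟨ ℚ.+-mono-≤ (ℚ.≤-trans (D.index-close n i l (ℕ.m⊔n≤o⇒n≤o (A ℕ.⊔ B) (D.index n) ≤i) n≤l) (1/≤η n (ℕ.m⊔n≤o⇒m≤o A B ≤n)))
             (ℚ.+-mono-≤ (hL l (ℕ.m≤n⊔m (D.index n ℕ.⊔ D.index i) L))
               (ℚ.≤-trans (D.index-close i l (D.index i) i≤l ℕ.≤-refl) (1/≤η i (ℕ.m⊔n≤o⇒m≤o A B A⊔B≤i)))) ⟩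
      η ℚ.+ ((η ℚ.+ η) ℚ.+ η)
        ≡⟨ QS.solve 1 (λ e → let h = QS.con ½ QS.:* (QS.con ½ QS.:* e) in h QS.:+ ((h QS.:+ h) QS.:+ h) QS.:= e) refl ε ⟩
      ε ∎
  where
  open ℚ.≤-Reasoning
  module D = Diagonal x

Series : (ℕ → ℝ) → ℝ → Set
Series f = Converges (partialSum f)

series-cong : ∀ {f g l m} → (∀ k → f k ≋ g k) → l ≋ m → Series f l → Series g m
series-cong {f} {g} h = converges-cong partialSum-cong
  where
  partialSum-cong : ∀ n → partialSum f n ≋ partialSum g n
  partialSum-cong zero    = ≋-refl
  partialSum-cong (suc n) = +ᴿ-cong (partialSum-cong n) (h n)

series-0 : Series (λ _ → 0ᴿ) 0ᴿ
series-0 = converges-cong (λ n → ≋-sym (partialSum-0 n)) (≋-refl {0ᴿ}) (converges-intro λ ε ε>0 → always λ _ → always λ _ → ℚ.<⇒≤ ε>0)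
  where
  partialSum-0 : ∀ n → partialSum (λ _ → 0ᴿ) n ≋ 0ᴿ
  partialSum-0 zero    = ≋-refl
  partialSum-0 (suc n) = ≋-trans (+ᴿ-cong (partialSum-0 n) ≋-refl) (R.+-identityˡ 0ᴿ)

series-+ : ∀ {f g l m} → Series f l → Series g m → Series (λ k → f k +ᴿ g k) (l +ᴿ m)
series-+ {f} {g} {l} {m} p q = converges-cong (λ n → ≋-sym (partialSum-+ n)) (≋-refl {l +ᴿ m}) (converges-+ p q)
  where
  partialSum-+ : ∀ n → partialSum (λ k → f k +ᴿ g k) n ≋ partialSum f n +ᴿ partialSum g n
  partialSum-+ zero    = ≋-sym (R.+-identityˡ 0ᴿ)
  partialSum-+ (suc n) = ≋-trans (+ᴿ-cong (partialSum-+ n) ≋-refl) (∑ᴿ.+-interchange (partialSum f n) (partialSum g n) (f n) (g n))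

series-scale : ∀ {f l} c → Series f l → Series (λ k → fromℚ c *ᴿ f k) (fromℚ c *ᴿ l)
series-scale {f} {l} c p = converges-cong (λ n → ≋-sym (partialSum-scale n)) (≋-refl {fromℚ c *ᴿ l}) (converges-scale c p)
  where
  partialSum-scale : ∀ n → partialSum (λ k → fromℚ c *ᴿ f k) n ≋ fromℚ c *ᴿ partialSum f n
  partialSum-scale zero    = ≋-sym (R.zeroʳ (fromℚ c))
  partialSum-scale (suc n) = ≋-trans (+ᴿ-cong (partialSum-scale n) ≋-refl) (≋-sym (R.distribˡ (fromℚ c) (partialSum f n) (f n)))

series-∑ : ∀ {A : Set} (xs : List A) {f : A → ℕ → ℝ} {l} → (∀ x → Series (f x) (l x)) → Series (λ k → ∑ᴿ xs (λ x → f x k)) (∑ᴿ xs l)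
series-∑ []       h = series-0
series-∑ (x ∷ xs) h = series-+ (h x) (series-∑ xs h)

fromℚ-[] : ∀ b → fromℚ Q.[ b ] ≋ ∑ᴿ.[ b ]
fromℚ-[] true  = ≋-refl
fromℚ-[] false = ≋-refl

-- Events, finitely valued random variables and independence.

module Probability (P : ProbabilitySpace) where

  ℙ-series : ∀ A → Series (restrict P A) (ℙ P A)
  ℙ-series A = lim-converges (partialSum (restrict P A)) (restrict-summable P A)

  restrict≋ : ∀ A ω → restrict P A ω ≋ ∑ᴿ.[ A ω ] *ᴿ mass P ω
  restrict≋ A ω with A ω
  ... | true  = ≋-sym (R.*-identityˡ (mass P ω))
  ... | false = ≋-sym (R.zeroˡ (mass P ω))

  ℙ-cong : ∀ {A B} → (∀ ω → A ω ≡ B ω) → ℙ P A ≋ ℙ P B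
  ℙ-cong {A} {B} h = converges-unique (ℙ-series A)
    (series-cong (λ ω → ≗⇒≋ λ n → cong (λ b → seq (if b then mass P ω else 0ᴿ) n) (sym (h ω))) (≋-refl {ℙ P B}) (ℙ-series B))

  ℙ-∧ : ∀ b A → ℙ P (λ ω → b ∧ A ω) ≋ ∑ᴿ.[ b ] *ᴿ ℙ P A
  ℙ-∧ true  A = ≋-sym (R.*-identityˡ (ℙ P A))
  ℙ-∧ false A = ≋-trans (converges-unique (ℙ-series (λ _ → false)) series-0) (≋-sym (R.zeroˡ (ℙ P A)))

  0≤ℙ : ∀ A → 0ᴿ ≤ᴿ ℙ P A
  0≤ℙ A ε ε>0 =
    let (N , h) = approach (ℙ-series A) (half ε) (half>0 ε>0)
    in eventually-zip (λ {i} p q → begin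
         0ℚ
           ≤⟨ p ⟩
         seq (partialSum (restrict P A) N) i ℚ.+ half ε
           ≤⟨ ℚ.+-monoˡ-≤ (half ε) (ℚ.≤-trans (p≤q+∣p-q∣ (seq (partialSum (restrict P A) N) i) (seq (ℙ P A) i)) (ℚ.+-monoʳ-≤ (seq (ℙ P A) i) q)) ⟩
         (seq (ℙ P A) i ℚ.+ half ε) ℚ.+ half ε
           ≡⟨ trans (ℚ.+-assoc (seq (ℙ P A) i) (half ε) (half ε)) (cong (seq (ℙ P A) i ℚ.+_) (half+half ε)) ⟩
         seq (ℙ P A) i ℚ.+ ε ∎)
       (partialSum≥0 N (half ε) (half>0 ε>0)) (h N ℕ.≤-refl)
    where
    open ℚ.≤-Reasoning
    p≤q+∣p-q∣ : ∀ p q → p ℚ.≤ q ℚ.+ ℚ.∣ p ℚ.- q ∣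
    p≤q+∣p-q∣ p q = subst (ℚ._≤ q ℚ.+ ℚ.∣ p ℚ.- q ∣) (QS.solve 2 (λ p q → q QS.:+ (p QS.:- q) QS.:= p) refl p q) (ℚ.+-monoʳ-≤ q (p≤∣p∣ (p ℚ.- q)))
    restrict≥0 : ∀ ω → 0ᴿ ≤ᴿ restrict P A ω
    restrict≥0 ω with A ω
    ... | true  = mass≥0 P ω
    ... | false = ≋⇒≤ᴿ (≋-refl {0ᴿ})
    partialSum≥0 : ∀ n → 0ᴿ ≤ᴿ partialSum (restrict P A) n
    partialSum≥0 zero    = ≋⇒≤ᴿ (≋-refl {0ᴿ})
    partialSum≥0 (suc n) = +ᴿ-mono-≤ {0ᴿ} {partialSum (restrict P A) n} {0ᴿ} {restrict P A n} (partialSum≥0 n) (restrict≥0 n)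

  module _ {V : Set} (En : Enumeration V) (r : Ω → V) where
    open Enumeration En using (_≟_)

    pmf : V → ℝ
    pmf t = ℙ P (λ ω → does (t ≟ r ω))

    -- Outcome by outcome, h (r ω) is the finite sum of h t over the events r = t, so the series is
    -- a finite combination of the series of these probabilities.
    expectation : ∀ (h : V → ℚ) → Series (λ ω → fromℚ (h (r ω)) *ᴿ mass P ω) (∑ᴿ (elements En) (λ t → fromℚ (h t) *ᴿ pmf t))
    expectation h = series-cong collapse (≋-refl {∑ᴿ (elements En) (λ t → fromℚ (h t) *ᴿ pmf t)})
      (series-∑ (elements En) (λ t → series-scale (h t) (ℙ-series (λ ω → does (t ≟ r ω)))))
      where
      collapse : ∀ ω → ∑ᴿ (elements En) (λ t → fromℚ (h t) *ᴿ restrict P (λ ω → does (t ≟ r ω)) ω) ≋ fromℚ (h (r ω)) *ᴿ mass P ω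
      collapse ω = ≋-trans (∑ᴿ.∑-cong (elements En) (λ t → ≋-trans
          (*ᴿ-cong (≋-refl {fromℚ (h t)}) (restrict≋ (λ ω → does (t ≟ r ω)) ω))
          (≋-trans (≋-sym (R.*-assoc (fromℚ (h t)) ∑ᴿ.[ does (t ≟ r ω) ] (mass P ω)))
            (≋-trans (*ᴿ-cong (R.*-comm (fromℚ (h t)) ∑ᴿ.[ does (t ≟ r ω) ]) (≋-refl {mass P ω}))
              (R.*-assoc ∑ᴿ.[ does (t ≟ r ω) ] (fromℚ (h t)) (mass P ω))))))
        (∑ᴿ.∑-δ En (r ω) (λ t → fromℚ (h t) *ᴿ mass P ω))

    ℙ-∘ : ∀ (g : V → Bool) → ℙ P (g ∘ r) ≋ ∑ᴿ (elements En) (λ t → fromℚ Q.[ g t ] *ᴿ pmf t)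
    ℙ-∘ g = converges-unique (ℙ-series (g ∘ r)) (series-cong
      (λ ω → ≋-trans (*ᴿ-cong (fromℚ-[] (g (r ω))) (≋-refl {mass P ω})) (≋-sym (restrict≋ (g ∘ r) ω)))
      (≋-refl {∑ᴿ (elements En) (λ t → fromℚ Q.[ g t ] *ᴿ pmf t)}) (expectation (λ t → Q.[ g t ])))

    ∑pmf : ∑ᴿ (elements En) pmf ≋ 1ᴿ
    ∑pmf = ≋-trans (∑ᴿ.∑-cong (elements En) (λ t → ≋-sym (R.*-identityˡ (pmf t))))
      (converges-unique (series-cong (λ ω → R.*-identityˡ (mass P ω)) (≋-refl {∑ᴿ (elements En) (λ t → 1ᴿ *ᴿ pmf t)}) (expectation (λ _ → 1ℚ)))
        (ConvergesTo⇒ {partialSum (mass P)} {1ᴿ} (ProbabilitySpace.total P)))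

-- The shape of the product in `Independent`.
prodᴸ : ∀ {A : Set} → List A → (A → ℝ) → ℝ
prodᴸ xs g = foldr _*ᴿ_ 1ᴿ (map g xs)

prodᴸ-cong : ∀ {A : Set} (xs : List A) {f g : A → ℝ} → (∀ x → f x ≋ g x) → prodᴸ xs f ≋ prodᴸ xs g
prodᴸ-cong []       h = ≋-refl
prodᴸ-cong (x ∷ xs) h = *ᴿ-cong (h x) (prodᴸ-cong xs h)

prodᴸ-++ : ∀ {A : Set} (xs ys : List A) f → prodᴸ (xs ++ ys) f ≋ prodᴸ xs f *ᴿ prodᴸ ys f
prodᴸ-++ []       ys f = ≋-sym (R.*-identityˡ (prodᴸ ys f))
prodᴸ-++ (x ∷ xs) ys f = ≋-trans (*ᴿ-cong (≋-refl {f x}) (prodᴸ-++ xs ys f)) (≋-sym (R.*-assoc (f x) (prodᴸ xs f) (prodᴸ ys f)))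

prodᴸ-map : ∀ {A B : Set} (h : A → B) xs f → prodᴸ (map h xs) f ≡ prodᴸ xs (f ∘ h)
prodᴸ-map h xs f = cong (foldr _*ᴿ_ 1ᴿ) (sym (List.map-∘ xs))

prodᴸ-cartesianProduct : ∀ {A B : Set} (xs : List A) (ys : List B) f →
  prodᴸ (cartesianProduct xs ys) f ≋ prodᴸ xs (λ x → prodᴸ ys (λ y → f (x , y)))
prodᴸ-cartesianProduct []       ys f = ≋-refl
prodᴸ-cartesianProduct (x ∷ xs) ys f = ≋-trans (prodᴸ-++ (map (x ,_) ys) (cartesianProduct xs ys) f)
  (*ᴿ-cong (R.reflexive (prodᴸ-map (x ,_) ys f)) (prodᴸ-cartesianProduct xs ys f))

prodᴸ-allFin : ∀ n (f : Fin n → ℝ) → prodᴸ (allFin n) f ≋ ∏ᴿ f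
prodᴸ-allFin zero    f = ≋-refl
prodᴸ-allFin (suc n) f = *ᴿ-cong (≋-refl {f zero}) (≋-trans
  (R.reflexive (trans (cong (λ xs → prodᴸ xs f) (sym (List.map-tabulate {n = n} id suc))) (prodᴸ-map suc (allFin n) f)))
  (prodᴸ-allFin n (f ∘ suc)))

[]-∧ : ∀ b c → ∑ᴿ.[ b ∧ c ] ≋ ∑ᴿ.[ b ] *ᴿ ∑ᴿ.[ c ]
[]-∧ true  c = ≋-sym (R.*-identityˡ ∑ᴿ.[ c ])
[]-∧ false c = ≋-sym (R.zeroˡ ∑ᴿ.[ c ])

prodᴸ-[] : ∀ {A : Set} (d : A → Bool) xs → prodᴸ xs (λ x → ∑ᴿ.[ d x ]) ≋ ∑ᴿ.[ all d xs ]
prodᴸ-[] d []       = ≋-refl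
prodᴸ-[] d (x ∷ xs) = ≋-trans (*ᴿ-cong (≋-refl {∑ᴿ.[ d x ]}) (prodᴸ-[] d xs)) (≋-sym ([]-∧ (d x) (all d xs)))

module _ {A : Set} {P : A → Set} (P? : Decidable P) (d : A → Bool) where

  all-filter : (f f′ : A → Bool) → (∀ x → P x → f x ≡ d x ∧ f′ x) → (∀ x → ¬ P x → f x ≡ d x) →
               ∀ xs → all f xs ≡ all d xs ∧ all f′ (filter P? xs)
  all-filter f f′ on off []       = refl
  all-filter f f′ on off (x ∷ xs) with P? x
  ... | yes p = trans (cong₂ _∧_ (on x p) (all-filter f f′ on off xs)) (shuffle (d x) (f′ x) (all d xs) _)
    where
    shuffle : ∀ b c b′ c′ → (b ∧ c) ∧ (b′ ∧ c′) ≡ (b ∧ b′) ∧ (c ∧ c′)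
    shuffle true  true  b′    c′ = refl
    shuffle true  false true  c′ = refl
    shuffle true  false false c′ = refl
    shuffle false c     b′    c′ = refl
  ... | no ¬p = trans (cong₂ _∧_ (off x ¬p) (all-filter f f′ on off xs)) (sym (Bool.∧-assoc (d x) (all d xs) _))

  prodᴸ-filter : (g g′ : A → ℝ) → (∀ x → P x → g x ≋ ∑ᴿ.[ d x ] *ᴿ g′ x) → (∀ x → ¬ P x → g x ≋ ∑ᴿ.[ d x ]) →
                 ∀ xs → prodᴸ xs g ≋ prodᴸ xs (λ x → ∑ᴿ.[ d x ]) *ᴿ prodᴸ (filter P? xs) g′
  prodᴸ-filter g g′ on off []       = ≋-sym (R.*-identityˡ 1ᴿ)
  prodᴸ-filter g g′ on off (x ∷ xs) with P? x
  ... | yes p = ≋-trans (*ᴿ-cong (on x p) (prodᴸ-filter g g′ on off xs))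
                  (interchange ∑ᴿ.[ d x ] (g′ x) (prodᴸ xs (λ x → ∑ᴿ.[ d x ])) (prodᴸ (filter P? xs) g′))
    where
    interchange : ∀ a b c d → (a *ᴿ b) *ᴿ (c *ᴿ d) ≋ (a *ᴿ c) *ᴿ (b *ᴿ d)
    interchange a b c d = ≗⇒≋ λ n → QS.solve 4 (λ a b c d → (a QS.:* b) QS.:* (c QS.:* d) QS.:= (a QS.:* c) QS.:* (b QS.:* d)) refl
      (seq a n) (seq b n) (seq c n) (seq d n)
  ... | no ¬p = ≋-trans (*ᴿ-cong (off x ¬p) (prodᴸ-filter g g′ on off xs))
                  (≋-sym (R.*-assoc ∑ᴿ.[ d x ] (prodᴸ xs (λ x → ∑ᴿ.[ d x ])) (prodᴸ (filter P? xs) g′)))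

all-true : ∀ {A : Set} (f : A → Bool) xs → (∀ x → f x ≡ true) → all f xs ≡ true
all-true f []       h = refl
all-true f (x ∷ xs) h = cong₂ _∧_ (h x) (all-true f xs h)

all-true⁻ : ∀ {A : Set} (f : A → Bool) {xs} → all f xs ≡ true → ∀ {x} → x ∈ xs → f x ≡ true
all-true⁻ f {x ∷ xs} h (here refl) with f x
... | true = refl
all-true⁻ f {x ∷ xs} h (there x∈) with f x
... | true = all-true⁻ f h x∈

module Residues (a : ℕ) .{{_ : NonZero a}} (P : ProbabilitySpace) {n} (Γ : RandomDigraph n) where
  open Probability P

  residue : ℤ → Fin a
  residue z = Fin.fromℕ< (ℤ.n%ℕd<d z a)

  0ᵃ : Fin a
  0ᵃ = residue ℤ.0ℤ

  degrees : Enumeration (Vec (Vec (Fin a) n) n)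
  degrees = vecs (vecs (fins a) n) n

  -- Loops cancel in the Laplacian, so the diagonal is recorded as 0.
  residues : Ω → Vec (Vec (Fin a) n) n
  residues ω = Vec.tabulate λ j → Vec.tabulate λ i → if does (j Fin.≟ i) then 0ᵃ else residue (degree Γ (j , i) ω)

  entry-residues : ∀ ω j i → lookup (lookup (residues ω) j) i ≡ (if does (j Fin.≟ i) then 0ᵃ else residue (degree Γ (j , i) ω))
  entry-residues ω j i = trans (cong (λ row → lookup row i) (Vec.lookup∘tabulate _ j)) (Vec.lookup∘tabulate _ i)

  -- On the diagonal, the point mass of the constant recorded there.
  law : Fin n → Fin n → Fin a → ℝ
  law j i t = if does (j Fin.≟ i) then fromℚ Q.[ does (t Fin.≟ 0ᵃ) ] else pmf (fins a) (λ ω → residue (degree Γ (j , i) ω)) t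

  -- Equality with D is a deterministic test on the diagonal and a test of one degree at each other
  -- place. The first comes out of the probability as a factor 0 or 1; `Independent` splits the
  -- rest.
  pmf-residues : Independent P (offDiagonal n) (degree Γ) → ∀ D →
    pmf degrees residues D ≋ ∏ᴿ (λ j → ∏ᴿ (λ i → law j i (lookup (lookup D j) i)))
  pmf-residues independent D = begin
    pmf degrees residues D
      ≈⟨ ℙ-cong (λ ω → trans (does≡all ω) (all-filter off? diagonal (match ω) (λ x → test x (degree Γ x ω)) (match-off ω) (match-diagonal ω) pairs)) ⟩
    ℙ P (λ ω → all diagonal pairs ∧ all (λ x → test x (degree Γ x ω)) (offDiagonal n))
      ≈⟨ ℙ-∧ (all diagonal pairs) (λ ω → all (λ x → test x (degree Γ x ω)) (offDiagonal n)) ⟩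
    ∑ᴿ.[ all diagonal pairs ] *ᴿ ℙ P (λ ω → all (λ x → test x (degree Γ x ω)) (offDiagonal n))
      ≈⟨ *ᴿ-cong (≋-sym (prodᴸ-[] diagonal pairs)) (≈ᴿ⇒≋ (independent test)) ⟩
    prodᴸ pairs (λ x → ∑ᴿ.[ diagonal x ]) *ᴿ prodᴸ (offDiagonal n) (λ x → ℙ P (λ ω → test x (degree Γ x ω)))
      ≈⟨ prodᴸ-filter off? diagonal cell (λ x → ℙ P (λ ω → test x (degree Γ x ω))) cell-off cell-diagonal pairs ⟨
    prodᴸ pairs cell
      ≈⟨ prodᴸ-cartesianProduct (allFin n) (allFin n) cell ⟩
    prodᴸ (allFin n) (λ j → prodᴸ (allFin n) (λ i → law j i (lookup (lookup D j) i)))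
      ≈⟨ ≋-trans (prodᴸ-cong (allFin n) (λ j → prodᴸ-allFin n (λ i → cell (j , i)))) (prodᴸ-allFin n (λ j → ∏ᴿ (λ i → cell (j , i)))) ⟩
    ∏ᴿ (λ j → ∏ᴿ (λ i → law j i (lookup (lookup D j) i))) ∎
    where
    open SetoidReasoning R.setoid
    pairs : List (Fin n × Fin n)
    pairs = cartesianProduct (allFin n) (allFin n)
    off? : ∀ (x : Fin n × Fin n) → Dec (¬ (proj₁ x ≡ proj₂ x))
    off? (i , j) = ¬? (i Fin.≟ j)
    diagonal : Fin n × Fin n → Bool
    diagonal (j , i) = if does (j Fin.≟ i) then does (lookup (lookup D j) i Fin.≟ 0ᵃ) else true
    test : Fin n × Fin n → ℤ → Bool
    test (j , i) z = does (lookup (lookup D j) i Fin.≟ residue z)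
    match : Ω → Fin n × Fin n → Bool
    match ω (j , i) = does (lookup (lookup D j) i Fin.≟ (if does (j Fin.≟ i) then 0ᵃ else residue (degree Γ (j , i) ω)))
    cell : Fin n × Fin n → ℝ
    cell (j , i) = law j i (lookup (lookup D j) i)
    match-off : ∀ ω x → ¬ (proj₁ x ≡ proj₂ x) → match ω x ≡ diagonal x ∧ test x (degree Γ x ω)
    match-off ω x@(j , i) j≢i = trans (cong (λ t → does (lookup (lookup D j) i Fin.≟ t)) (if-no (j Fin.≟ i) j≢i))
      (cong (_∧ test x (degree Γ x ω)) (sym (if-no (j Fin.≟ i) j≢i)))
    match-diagonal : ∀ ω x → ¬ ¬ (proj₁ x ≡ proj₂ x) → match ω x ≡ diagonal x
    match-diagonal ω (j , i) ¬¬j≡i = trans (cong (λ t → does (lookup (lookup D j) i Fin.≟ t)) (if-yes (j Fin.≟ i) j≡i))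
      (sym (if-yes (j Fin.≟ i) j≡i))
      where j≡i = decidable-stable (j Fin.≟ i) ¬¬j≡i
    cell-off : ∀ x → ¬ (proj₁ x ≡ proj₂ x) → cell x ≋ ∑ᴿ.[ diagonal x ] *ᴿ ℙ P (λ ω → test x (degree Γ x ω))
    cell-off x@(j , i) j≢i = subst₂ (λ c b → c ≋ ∑ᴿ.[ b ] *ᴿ p)
      (sym (if-no (j Fin.≟ i) j≢i)) (sym (if-no (j Fin.≟ i) j≢i)) (≋-sym (R.*-identityˡ p))
      where p = ℙ P (λ ω → test x (degree Γ x ω))
    cell-diagonal : ∀ x → ¬ ¬ (proj₁ x ≡ proj₂ x) → cell x ≋ ∑ᴿ.[ diagonal x ]
    cell-diagonal (j , i) ¬¬j≡i = subst₂ (λ c b → c ≋ ∑ᴿ.[ b ]) (sym (if-yes (j Fin.≟ i) j≡i)) (sym (if-yes (j Fin.≟ i) j≡i))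
      (fromℚ-[] (does (lookup (lookup D j) i Fin.≟ 0ᵃ)))
      where j≡i = decidable-stable (j Fin.≟ i) ¬¬j≡i
    does≡all : ∀ ω → does (Enumeration._≟_ degrees D (residues ω)) ≡ all (match ω) pairs
    does≡all ω = by-cases (Enumeration._≟_ degrees D (residues ω))
      where
      by-cases : (D≟ : Dec (D ≡ residues ω)) → does D≟ ≡ all (match ω) pairs
      by-cases (yes eq) = sym (all-true (match ω) pairs (λ (j , i) → dec-true (lookup (lookup D j) i Fin.≟ _)
        (trans (cong (λ M → lookup (lookup M j) i) eq) (entry-residues ω j i))))
      by-cases (no neq) = sym (Bool.¬-not (λ all≡true → neq (matrix-ext λ j i →
        trans (does⇒ (lookup (lookup D j) i Fin.≟ _) (all-true⁻ (match ω) all≡true (∈.∈-cartesianProduct⁺ (∈.∈-allFin j) (∈.∈-allFin i))))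
          (sym (entry-residues ω j i)))))
        where
        ext : ∀ {A : Set} {k} {v w : Vec A k} → (∀ i → lookup v i ≡ lookup w i) → v ≡ w
        ext {v = v} {w} h = trans (sym (Vec.tabulate∘lookup v)) (trans (Vec.tabulate-cong h) (Vec.tabulate∘lookup w))
        matrix-ext : ∀ {v w : Vec (Vec (Fin a) n) n} → (∀ j i → lookup (lookup v j) i ≡ lookup (lookup w j) i) → v ≡ w
        matrix-ext h = ext λ j → ext (h j)

-- Partial sums of the exponential series.

module Exponential (F : OrderedRing) where
  open OrderedRingProperties F

  partial : (ℕ → C) → ℕ → C
  partial f zero    = 0#
  partial f (suc n) = partial f n + f n

  partial-cong : ∀ {f g} → (∀ k → f k ≡ g k) → ∀ n → partial f n ≡ partial g n
  partial-cong h zero    = refl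
  partial-cong h (suc n) = cong₂ _+_ (partial-cong h n) (h n)

  partial-head : ∀ f n → partial f (suc n) ≡ f 0 + partial (f ∘ suc) n
  partial-head f zero    = trans (+-identityˡ _) (sym (+-identityʳ _))
  partial-head f (suc n) = trans (cong (_+ f (suc n)) (partial-head f n)) (+-assoc _ _ _)

  partial-+ : ∀ f g n → partial (λ k → f k + g k) n ≡ partial f n + partial g n
  partial-+ f g zero    = sym (+-identityˡ 0#)
  partial-+ f g (suc n) = trans (cong (_+ (f n + g n)) (partial-+ f g n)) (+-interchange _ _ _ _)

  0≤partial : ∀ {f} → (∀ k → 0# ≤ f k) → ∀ n → 0# ≤ partial f n
  0≤partial h zero    = ≤-refl
  0≤partial h (suc n) = 0≤+ (0≤partial h n) (h n)

  partial-mono : ∀ {f} → (∀ k → 0# ≤ f k) → ∀ {m n} → m ℕ.≤ n → partial f m ≤ partial f n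
  partial-mono {f} h {m} {n} m≤n = subst (λ k → partial f m ≤ partial f k) (ℕ.m∸n+n≡m m≤n) (go (n ℕ.∸ m))
    where
    go : ∀ d → partial f m ≤ partial f (d ℕ.+ m)
    go zero    = ≤-refl
    go (suc d) = ≤-trans (go d) (x≤x+y (h (d ℕ.+ m)))

  -- The Cauchy product, by recursion on the first factor.
  conv : (ℕ → C) → (ℕ → C) → ℕ → C
  conv f g zero    = f 0 * g 0
  conv f g (suc k) = f 0 * g (suc k) + conv (f ∘ suc) g k

  conv-cong : ∀ {f f′ g g′} → (∀ k → f k ≡ f′ k) → (∀ k → g k ≡ g′ k) → ∀ k → conv f g k ≡ conv f′ g′ k
  conv-cong p q zero    = cong₂ _*_ (p 0) (q 0)
  conv-cong p q (suc k) = cong₂ _+_ (cong₂ _*_ (p 0) (q (suc k))) (conv-cong (p ∘ suc) q k)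

  conv-+ˡ : ∀ f f′ g k → conv (λ i → f i + f′ i) g k ≡ conv f g k + conv f′ g k
  conv-+ˡ f f′ g zero    = distribʳ _ _ _
  conv-+ˡ f f′ g (suc k) = trans (cong₂ _+_ (distribʳ _ _ _) (conv-+ˡ (f ∘ suc) (f′ ∘ suc) g k)) (+-interchange _ _ _ _)

  conv-+ʳ : ∀ f g g′ k → conv f (λ i → g i + g′ i) k ≡ conv f g k + conv f g′ k
  conv-+ʳ f g g′ zero    = distribˡ _ _ _
  conv-+ʳ f g g′ (suc k) = trans (cong₂ _+_ (distribˡ _ _ _) (conv-+ʳ (f ∘ suc) g g′ k)) (+-interchange _ _ _ _)

  conv-*ˡ : ∀ c f g k → conv (λ i → c * f i) g k ≡ c * conv f g k
  conv-*ˡ c f g zero    = *-assoc _ _ _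
  conv-*ˡ c f g (suc k) = trans (cong₂ _+_ (*-assoc _ _ _) (conv-*ˡ c (f ∘ suc) g k)) (sym (distribˡ _ _ _))

  conv-*ʳ : ∀ c f g k → conv f (λ i → c * g i) k ≡ c * conv f g k
  conv-*ʳ c f g zero    = solve 3 (λ c f g → f :* (c :* g) := c :* (f :* g)) refl c (f 0) (g 0)
  conv-*ʳ c f g (suc k) = trans (cong (_+_ (f 0 * (c * g (suc k)))) (conv-*ʳ c (f ∘ suc) g k))
    (solve 4 (λ c f g r → f :* (c :* g) :+ c :* r := c :* (f :* g :+ r)) refl c (f 0) (g (suc k)) (conv (f ∘ suc) g k))

  -- The formal derivative of the generating function.
  derivative : (ℕ → C) → ℕ → C
  derivative f k = fromℕ# (suc k) * f (suc k)

  leibniz : ∀ f g k → derivative (conv f g) k ≡ conv (derivative f) g k + conv f (derivative g) k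
  leibniz f g zero = trans (cong (_* (f 0 * g 1 + f 1 * g 0)) fromℤ-1)
    (trans (solve 4 (λ a b c d → con (+ 1) :* (a :* d :+ b :* c) := (con (+ 1) :* b) :* c :+ a :* (con (+ 1) :* d)) refl (f 0) (f 1) (g 0) (g 1))
      (sym (cong (λ o → (o * f 1) * g 0 + f 0 * (o * g 1)) fromℤ-1)))
  leibniz f g (suc k) = begin
    fromℕ# (2 ℕ.+ k) * (f 0 * g (2 ℕ.+ k) + r)
      ≡⟨ cong (_* (f 0 * g (2 ℕ.+ k) + r)) (fromℕ#-suc (suc k)) ⟩
    (1# + n) * (f 0 * g (2 ℕ.+ k) + r)
      ≡⟨ solve 4 (λ n a b r → (con (+ 1) :+ n) :* (a :* b :+ r) := (a :* ((con (+ 1) :+ n) :* b) :+ r) :+ n :* r) refl n (f 0) (g (2 ℕ.+ k)) r ⟩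
    (f 0 * ((1# + n) * g (2 ℕ.+ k)) + r) + n * r
      ≡⟨ cong₂ (λ x y → (f 0 * (x * g (2 ℕ.+ k)) + r) + y) (fromℕ#-suc (suc k)) (sym (leibniz (f ∘ suc) g k)) ⟨
    (f 0 * derivative g (suc k) + (f 1 * g (suc k) + conv (λ i → f (2 ℕ.+ i)) g k)) + (conv (derivative (f ∘ suc)) g k + conv (f ∘ suc) (derivative g) k)
      ≡⟨ solve 6 (λ a b c d e o → (a :+ (b :* c :+ d)) :+ (e :+ o) := (b :* c :+ (e :+ d)) :+ (a :+ o)) refl
           (f 0 * derivative g (suc k)) (f 1) (g (suc k)) (conv (λ i → f (2 ℕ.+ i)) g k) (conv (derivative (f ∘ suc)) g k) (conv (f ∘ suc) (derivative g) k) ⟩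
    (f 1 * g (suc k) + (conv (derivative (f ∘ suc)) g k + conv (λ i → f (2 ℕ.+ i)) g k)) + conv f (derivative g) (suc k)
      ≡⟨ cong₂ (λ x y → (x * g (suc k) + y) + conv f (derivative g) (suc k))
           (trans (cong (_* f 1) fromℤ-1) (*-identityˡ (f 1)))
           (trans (conv-cong (λ i → trans (cong (_* f (2 ℕ.+ i)) (fromℕ#-suc (suc i)))
               (solve 2 (λ n x → (con (+ 1) :+ n) :* x := n :* x :+ x) refl (fromℕ# (suc i)) (f (2 ℕ.+ i)))) (λ _ → refl) k)
             (conv-+ˡ (derivative (f ∘ suc)) (λ i → f (2 ℕ.+ i)) g k)) ⟨
    conv (derivative f) g (suc k) + conv f (derivative g) (suc k) ∎
    where
    open ≡.≡-Reasoning
    n = fromℕ# (suc k)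
    r = conv (f ∘ suc) g (suc k)

  partial-conv : ∀ f g n → partial (conv f g) (suc n) ≡ f 0 * partial g (suc n) + partial (conv (f ∘ suc) g) n
  partial-conv f g zero    = solve 2 (λ f g → con (+ 0) :+ f :* g := f :* (con (+ 0) :+ g) :+ con (+ 0)) refl (f 0) (g 0)
  partial-conv f g (suc n) = trans (cong (_+ conv f g (suc n)) (partial-conv f g n))
    (solve 5 (λ f p q g r → (f :* p :+ q) :+ (f :* g :+ r) := f :* (p :+ g) :+ (q :+ r)) refl
      (f 0) (partial g (suc n)) (partial (conv (f ∘ suc) g) n) (g (suc n)) (conv (f ∘ suc) g n))

  module _ {g : ℕ → C} (0≤g : ∀ k → 0# ≤ g k) where

    -- The triangle i + j < n lies in the square i, j < n.
    partial-conv≤ : ∀ f → (∀ k → 0# ≤ f k) → ∀ n → partial (conv f g) n ≤ partial f n * partial g n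
    partial-conv≤ f 0≤f zero    = ≤-reflexive (sym (zeroˡ _))
    partial-conv≤ f 0≤f (suc n) = begin
      partial (conv f g) (suc n)
        ≡⟨ partial-conv f g n ⟩
      f 0 * partial g (suc n) + partial (conv (f ∘ suc) g) n
        ≤⟨ +-monoʳ _ (≤-trans (partial-conv≤ (f ∘ suc) (0≤f ∘ suc) n)
             (*-monoˡ (0≤partial (0≤f ∘ suc) n) (partial-mono 0≤g (ℕ.n≤1+n n)))) ⟩
      f 0 * partial g (suc n) + partial (f ∘ suc) n * partial g (suc n)
        ≡⟨ trans (sym (distribʳ _ _ _)) (cong (_* partial g (suc n)) (sym (partial-head f n))) ⟩
      partial f (suc n) * partial g (suc n) ∎
      where open ≤-Reasoning

    -- The rectangle i < m, j < n lies in the triangle i + j < m + n.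
    ≤partial-conv : ∀ f → (∀ k → 0# ≤ f k) → ∀ m n → partial f m * partial g n ≤ partial (conv f g) (m ℕ.+ n)
    ≤partial-conv f 0≤f zero    n = subst (_≤ partial (conv f g) n) (sym (zeroˡ _)) (0≤partial (0≤conv f 0≤f) n)
      where
      0≤conv : ∀ f → (∀ k → 0# ≤ f k) → ∀ k → 0# ≤ conv f g k
      0≤conv f 0≤f zero    = *-nonNeg (0≤f 0) (0≤g 0)
      0≤conv f 0≤f (suc k) = 0≤+ (*-nonNeg (0≤f 0) (0≤g (suc k))) (0≤conv (f ∘ suc) (0≤f ∘ suc) k)
    ≤partial-conv f 0≤f (suc m) n = begin
      partial f (suc m) * partial g n
        ≡⟨ trans (cong (_* partial g n) (partial-head f m)) (distribʳ _ _ _) ⟩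
      f 0 * partial g n + partial (f ∘ suc) m * partial g n
        ≤⟨ +-mono-≤ (*-monoˡ (0≤f 0) (partial-mono 0≤g (ℕ.m≤n+m n (suc m)))) (≤partial-conv (f ∘ suc) (0≤f ∘ suc) m n) ⟩
      f 0 * partial g (suc (m ℕ.+ n)) + partial (conv (f ∘ suc) g) (m ℕ.+ n)
        ≡⟨ partial-conv f g (m ℕ.+ n) ⟨
      partial (conv f g) (suc m ℕ.+ n) ∎
      where open ≤-Reasoning

  1/! : ℕ → C
  1/! zero    = 1#
  1/! (suc k) = recip k * 1/! k

  0≤1/! : ∀ k → 0# ≤ 1/! k
  0≤1/! zero    = 0≤1
  0≤1/! (suc k) = *-nonNeg (0≤recip k) (0≤1/! k)

  term : C → ℕ → C
  term x k = x ^ k * 1/! k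

  0≤term : ∀ {x} → 0# ≤ x → ∀ k → 0# ≤ term x k
  0≤term p k = *-nonNeg (0≤^ p k) (0≤1/! k)

  derivative-term : ∀ x k → derivative (term x) k ≡ x * term x k
  derivative-term x k = trans (solve 5 (λ n x p i f → n :* ((x :* p) :* (i :* f)) := (n :* i) :* (x :* (p :* f))) refl
    (fromℕ# (suc k)) x (x ^ k) (recip k) (1/! k)) (trans (cong (_* (x * term x k)) (suc*recip k)) (*-identityˡ _))

  -- By `leibniz`, the Cauchy product satisfies the same first-order recursion as the left side: its
  -- formal derivative is x + y times itself. This is the binomial theorem without binomial
  -- coefficients.
  term-+ : ∀ x y k → term (x + y) k ≡ conv (term x) (term y) k
  term-+ x y zero    = solve 0 (con (+ 1) :* con (+ 1) := (con (+ 1) :* con (+ 1)) :* (con (+ 1) :* con (+ 1))) refl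
  term-+ x y (suc k) = unscale (begin
    fromℕ# (suc k) * term (x + y) (suc k)
      ≡⟨ derivative-term (x + y) k ⟩
    (x + y) * term (x + y) k
      ≡⟨ trans (cong ((x + y) *_) (term-+ x y k)) (distribʳ _ _ _) ⟩
    x * conv (term x) (term y) k + y * conv (term x) (term y) k
      ≡⟨ cong₂ _+_ (conv-*ˡ x (term x) (term y) k) (conv-*ʳ y (term x) (term y) k) ⟨
    conv (λ i → x * term x i) (term y) k + conv (term x) (λ i → y * term y i) k
      ≡⟨ cong₂ _+_ (conv-cong (derivative-term x) (λ _ → refl) k) (conv-cong (λ _ → refl) (derivative-term y) k) ⟨
    conv (derivative (term x)) (term y) k + conv (term x) (derivative (term y)) k
      ≡⟨ leibniz (term x) (term y) k ⟨
    fromℕ# (suc k) * conv (term x) (term y) (suc k) ∎)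
    where
    open ≡.≡-Reasoning
    cancel : ∀ z → recip k * (fromℕ# (suc k) * z) ≡ z
    cancel z = trans (sym (*-assoc _ _ _)) (trans (cong (_* z) (recip*suc k)) (*-identityˡ z))
    unscale : ∀ {u v} → fromℕ# (suc k) * u ≡ fromℕ# (suc k) * v → u ≡ v
    unscale {u} {v} h = trans (sym (cancel u)) (trans (cong (recip k *_) h) (cancel v))

  expSum : C → ℕ → C
  expSum x = partial (term x)

  expSum-+≤ : ∀ {x y} → 0# ≤ x → 0# ≤ y → ∀ n → expSum (x + y) n ≤ expSum x n * expSum y n
  expSum-+≤ {x} {y} p q n = ≤-trans (≤-reflexive (partial-cong (term-+ x y) n)) (partial-conv≤ (0≤term q) (term x) (0≤term p) n)

  expSum²≤ : ∀ {x} → 0# ≤ x → ∀ n → expSum x n * expSum x n ≤ expSum (x + x) (n ℕ.+ n)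
  expSum²≤ {x} p n = ≤-trans (≤partial-conv (0≤term p) (term x) (0≤term p) n n) (≤-reflexive (sym (partial-cong (term-+ x x) (n ℕ.+ n))))

  0≤x^+[-x]^ : ∀ {x} → 0# ≤ x → ∀ k → (0# ≤ (- x) ^ k + x ^ k) × (0# ≤ x ^ k - (- x) ^ k)
  0≤x^+[-x]^ {x} p zero    = 0≤+ 0≤1 0≤1 , ≤-reflexive (sym (-‿inverseʳ 1#))
  0≤x^+[-x]^ {x} p (suc k) = let (q , r) = 0≤x^+[-x]^ p k in
      subst (0# ≤_) (solve 3 (λ x a b → x :* (b :- a) := (:- x) :* a :+ x :* b) refl x ((- x) ^ k) (x ^ k)) (*-nonNeg p r)
    , subst (0# ≤_) (solve 3 (λ x a b → x :* (a :+ b) := x :* b :- (:- x) :* a) refl x ((- x) ^ k) (x ^ k)) (*-nonNeg p q)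

  expSum-0 : ∀ n → expSum 0# (suc n) ≡ 1#
  expSum-0 zero    = solve 0 (con (+ 0) :+ con (+ 1) :* con (+ 1) := con (+ 1)) refl
  expSum-0 (suc n) = trans (cong₂ _+_ (expSum-0 n) (trans (cong (_* 1/! (suc n)) (zeroˡ _)) (zeroˡ _))) (+-identityʳ 1#)

  -- The defect of the Cauchy product is linear in the second factor, and |term (- x)| ≤ term x.
  expSum-inverse : ∀ {x} → 0# ≤ x → ∀ n →
    1# - (expSum (x + x) (suc n ℕ.+ suc n) - expSum (x + x) (suc n)) ≤ expSum (- x) (suc n) * expSum x (suc n)
  expSum-inverse {x} p n = 0≤y-x⇒x≤y (subst (0# ≤_)
    (trans (cong₂ (λ c d → ((b * (a + b) - (c + d)) + (e - b * b))) (trans (sym (partial-cong (term-+ x (- x)) N)) (trans (cong (λ z → expSum z N) (-‿inverseʳ x)) (expSum-0 n))) (sym (partial-cong (term-+ x x) N)))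
      (solve 4 (λ a b e d → (b :* (a :+ b) :- (con (+ 1) :+ d)) :+ (e :- b :* b) := a :* b :- (con (+ 1) :- (e :- d))) refl a b e (expSum (x + x) N)))
    (0≤+ (0≤y-x defect) (0≤y-x (expSum²≤ p N))))
    where
    N = suc n
    a = expSum (- x) N
    b = expSum x N
    e = expSum (x + x) (N ℕ.+ N)
    g : ℕ → C
    g k = term (- x) k + term x k
    0≤g : ∀ k → 0# ≤ g k
    0≤g k = subst (0# ≤_) (distribʳ (1/! k) ((- x) ^ k) (x ^ k)) (*-nonNeg (proj₁ (0≤x^+[-x]^ p k)) (0≤1/! k))
    defect : partial (conv (term x) (term (- x))) N + partial (conv (term x) (term x)) N ≤ b * (a + b)
    defect = subst₂ _≤_
      (trans (partial-cong (conv-+ʳ (term x) (term (- x)) (term x)) N) (partial-+ (conv (term x) (term (- x))) (conv (term x) (term x)) N))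
      (cong (b *_) (partial-+ (term (- x)) (term x) N))
      (partial-conv≤ 0≤g (term x) (0≤term p) N)

  expSum-·≤ : ∀ {c} → 0# ≤ c → ∀ k n → expSum (fromℕ# k * c) (suc n) ≤ expSum c (suc n) ^ k
  expSum-·≤ {c} p zero    n = ≤-reflexive (trans (cong (λ z → expSum z (suc n)) (trans (cong (_* c) fromℤ-0) (zeroˡ c))) (expSum-0 n))
  expSum-·≤ {c} p (suc k) n = begin
    expSum (fromℕ# (suc k) * c) (suc n)
      ≡⟨ cong (λ z → expSum z (suc n)) (trans (cong (_* c) (fromℕ#-suc k)) (solve 2 (λ k c → (con (+ 1) :+ k) :* c := c :+ k :* c) refl (fromℕ# k) c)) ⟩
    expSum (c + fromℕ# k * c) (suc n)
      ≤⟨ expSum-+≤ p (*-nonNeg (0≤fromℕ k) p) (suc n) ⟩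
    expSum c (suc n) * expSum (fromℕ# k * c) (suc n)
      ≤⟨ *-monoˡ (0≤partial (0≤term p) (suc n)) (expSum-·≤ p k n) ⟩
    expSum c (suc n) ^ suc k ∎
    where open ≤-Reasoning

  -- As (j + 1)! ≥ 2^j and c ≤ 1, the term of degree j + 1 is at most c/2^j. The induction carries
  -- the unspent geometric tail `(c + c) * h ^ n` along.
  expSum≤1+2c : ∀ {c} → 0# ≤ c → c ≤ 1# → ∀ n → expSum c (suc n) ≤ 1# + (c + c)
  expSum≤1+2c {c} p c≤1 n = ≤-trans (x≤x+y (*-nonNeg (0≤+ p p) (0≤^ (0≤recip 1) n))) (go n)
    where
    open ≤-Reasoning
    h = recip 1
    1/!≤ : ∀ n → 1/! (suc n) ≤ h ^ n
    1/!≤ zero    = subst (_≤ 1#) (sym (*-identityʳ _)) (recip≤1 0)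
    1/!≤ (suc n) = *-mono (0≤recip (suc n)) (0≤^ (0≤recip 1) n) (recip≤½ n) (1/!≤ n)
      where
      recip≤½ : ∀ n → recip (suc n) ≤ h
      recip≤½ n = subst (recip (suc n) ≤_) (*-identityʳ h) (recip-unscale 1 (subst (fromℕ# 2 * recip (suc n) ≤_)
        (suc*recip (suc n)) (*-monoʳ (0≤recip (suc n)) (fromℕ-mono (ℕ.s≤s (ℕ.s≤s ℕ.z≤n))))))
    go : ∀ n → expSum c (suc n) + (c + c) * h ^ n ≤ 1# + (c + c)
    go zero    = ≤-reflexive (solve 1 (λ c → (con (+ 0) :+ con (+ 1) :* con (+ 1)) :+ (c :+ c) :* con (+ 1) := con (+ 1) :+ (c :+ c)) refl c)
    go (suc n) = begin
      (expSum c (suc n) + (c * c ^ n) * 1/! (suc n)) + (c + c) * (h * h ^ n)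
        ≤⟨ +-monoˡ _ (+-monoʳ _ (*-mono (*-nonNeg p (0≤^ p n)) (0≤^ (0≤recip 1) n)
             (subst (c * c ^ n ≤_) (*-identityʳ c) (*-monoˡ p (^≤1 p c≤1 n))) (1/!≤ n))) ⟩
      (expSum c (suc n) + c * h ^ n) + (c + c) * (h * h ^ n)
        ≡⟨ solve 4 (λ s c h r → (s :+ c :* r) :+ (c :+ c) :* (h :* r) := s :+ c :* (r :+ (con (+ 2) :* h) :* r)) refl (expSum c (suc n)) c h (h ^ n) ⟩
      expSum c (suc n) + c * (h ^ n + (fromℕ# 2 * h) * h ^ n)
        ≡⟨ cong (λ o → expSum c (suc n) + c * (h ^ n + o * h ^ n)) (suc*recip 1) ⟩
      expSum c (suc n) + c * (h ^ n + 1# * h ^ n)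
        ≡⟨ solve 3 (λ s c r → s :+ c :* (r :+ con (+ 1) :* r) := s :+ (c :+ c) :* r) refl (expSum c (suc n)) c (h ^ n) ⟩
      expSum c (suc n) + (c + c) * h ^ n
        ≤⟨ go n ⟩
      1# + (c + c) ∎

  -- With s⁺ and s⁻ the sums at y and -y, r^k s⁺ ≤ ((1 + 2c) r)^k ≤ 1 and s⁻ s⁺ ≥ 1 - δ, so r^k (1 -
  -- δ) ≤ r^k s⁺ s⁻ ≤ s⁻. The last step takes s⁻ ≥ 0, which follows from δ < 1.
  expSum-lower : ∀ {c r δ} k n → 0# ≤ c → c ≤ 1# → 0# ≤ r → (1# + (c + c)) * r ≤ 1# → ¬ 1# ≤ δ →
    let y = fromℕ# k * c in expSum (y + y) (suc n ℕ.+ suc n) - expSum (y + y) (suc n) ≤ δ →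
    r ^ k ≤ expSum (- y) (suc n) + δ
  expSum-lower {c} {r} {δ} k n 0≤c c≤1 0≤r cr≤1 1≰δ tail≤δ = begin
    r ^ k
      ≡⟨ solve 2 (λ t d → t := t :* (con (+ 1) :- d) :+ t :* d) refl (r ^ k) δ ⟩
    r ^ k * (1# - δ) + r ^ k * δ
      ≤⟨ +-mono-≤ (≤-trans (*-monoˡ (0≤^ 0≤r k) 1-δ≤) scaled≤) (subst (r ^ k * δ ≤_) (*-identityˡ δ) (*-monoʳ 0≤δ (^≤1 0≤r r≤1 k))) ⟩
    s⁻ + δ ∎
    where
    open ≤-Reasoning
    y = fromℕ# k * c
    0≤y : 0# ≤ y
    0≤y = *-nonNeg (0≤fromℕ k) 0≤c
    s⁻ = expSum (- y) (suc n)
    s⁺ = expSum y (suc n)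
    0≤δ : 0# ≤ δ
    0≤δ = ≤-trans (0≤y-x (partial-mono (0≤term (0≤+ 0≤y 0≤y)) (ℕ.m≤m+n (suc n) (suc n)))) tail≤δ
    r≤1 : r ≤ 1#
    r≤1 = ≤-trans (subst (_≤ (1# + (c + c)) * r) (*-identityˡ r) (*-monoʳ 0≤r (x≤x+y (0≤+ 0≤c 0≤c)))) cr≤1
    1-δ≤ : 1# - δ ≤ s⁻ * s⁺
    1-δ≤ = ≤-trans (0≤y-x⇒x≤y (subst (0# ≤_) (solve 2 (λ d t → d :- t := (con (+ 1) :- t) :- (con (+ 1) :- d)) refl δ _) (0≤y-x tail≤δ))) (expSum-inverse 0≤y n)
    rs⁺≤1 : r ^ k * s⁺ ≤ 1#
    rs⁺≤1 = begin
      r ^ k * s⁺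
        ≤⟨ *-monoˡ (0≤^ 0≤r k) (≤-trans (expSum-·≤ 0≤c k n) (^-mono (0≤partial (0≤term 0≤c) (suc n)) (expSum≤1+2c 0≤c c≤1 n) k)) ⟩
      r ^ k * (1# + (c + c)) ^ k
        ≡⟨ trans (*-comm _ _) (sym (^-distrib-* (1# + (c + c)) r k)) ⟩
      ((1# + (c + c)) * r) ^ k
        ≤⟨ ^≤1 (*-nonNeg (0≤+ 0≤1 (0≤+ 0≤c 0≤c)) 0≤r) cr≤1 k ⟩
      1# ∎
    0≤s⁻ : 0# ≤ s⁻
    0≤s⁻ with ≤-total 0# s⁻
    ... | inj₁ h = h
    ... | inj₂ h = contradiction (≤-trans (≤-reflexive (solve 1 (λ d → con (+ 1) := (con (+ 1) :- d) :+ d) refl δ))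
      (≤-trans (+-monoˡ δ (≤-trans 1-δ≤ (≤-trans (*-monoʳ (0≤partial (0≤term 0≤y) (suc n)) h) (≤-reflexive (zeroˡ s⁺))))) (≤-reflexive (+-identityˡ δ)))) 1≰δ
    scaled≤ : r ^ k * (s⁻ * s⁺) ≤ s⁻
    scaled≤ = subst₂ _≤_ (solve 3 (λ t a b → a :* (t :* b) := t :* (a :* b)) refl (r ^ k) s⁻ s⁺) (*-identityʳ s⁻) (*-monoˡ 0≤s⁻ rs⁺≤1)

-- Rational laws approximating a real law.

realise : ∀ (s : ℕ → ℚ) x → (∀ ε → 0ℚ ℚ.< ε → Eventually (λ n → ℚ.∣ s n ℚ.- seq x n ∣ ℚ.≤ ε)) → ℝ
realise s x h = mkℝ s λ ε ε>0 →
  let ε′ = half (half ε)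
      ε′>0 = half>0 (half>0 ε>0)
      (M , hs) = h ε′ ε′>0
      (N , hx) = cauchy x (half ε) (half>0 ε>0)
  in M ℕ.⊔ N , λ m n ≤m ≤n → begin
    ℚ.∣ s m ℚ.- s n ∣
      ≤⟨ triangle (s m) (seq x m) (s n) ⟩
    ℚ.∣ s m ℚ.- seq x m ∣ ℚ.+ ℚ.∣ seq x m ℚ.- s n ∣
      ≤⟨ ℚ.+-monoʳ-≤ ℚ.∣ s m ℚ.- seq x m ∣ (triangle (seq x m) (seq x n) (s n)) ⟩
    ℚ.∣ s m ℚ.- seq x m ∣ ℚ.+ (ℚ.∣ seq x m ℚ.- seq x n ∣ ℚ.+ ℚ.∣ seq x n ℚ.- s n ∣)
      ≤⟨ ℚ.+-mono-≤ (hs m (ℕ.m⊔n≤o⇒m≤o M N ≤m)) (ℚ.+-mono-≤ (hx m n (ℕ.m⊔n≤o⇒n≤o M N ≤m) (ℕ.m⊔n≤o⇒n≤o M N ≤n))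
           (subst (ℚ._≤ ε′) (∣-∣-flip (s n) (seq x n)) (hs n (ℕ.m⊔n≤o⇒m≤o M N ≤n)))) ⟩
    ε′ ℚ.+ (half ε ℚ.+ ε′)
      ≡⟨ QS.solve 1 (λ e → let f = QS.con ½ QS.:* e in QS.con ½ QS.:* f QS.:+ (f QS.:+ QS.con ½ QS.:* f) QS.:= e) refl ε ⟩
    ε ∎
  where open ℚ.≤-Reasoning

realise≋ : ∀ s x h → realise s x h ≋ x
realise≋ s x h = ≋-intro h

-- Rational laws converging to a given real law: truncate at 0 and renormalise.
module LawApproximation (a : ℕ) .{{_ : NonZero a}} (G : TorsionGroup a) where
  open Walk ℚ-orderedRing a G using (IsLaw; Balanced)

  private
    ts = allFin a

    0ᵃ : Fin a
    0ᵃ = Fin.fromℕ< (ℕ.>-nonZero⁻¹ a)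

  renormalise : (y : Fin a → ℚ) → Dec (Q.∑ ts y ℚ.≤ 0ℚ) → Fin a → ℚ
  renormalise y (yes _)   t = Q.[ does (t Fin.≟ 0ᵃ) ]
  renormalise y (no  T≰0) t = y t ℚ.* (ℚ.1/ Q.∑ ts y) {{ℚ.pos⇒nonZero (Q.∑ ts y) {{ℚ.positive (ℚ.≰⇒> T≰0)}}}}

  renormalise-law : ∀ y T≤? → (∀ t → 0ℚ ℚ.≤ y t) → IsLaw (renormalise y T≤?)
  renormalise-law y (yes _) 0≤y = record { nonNeg = λ t → Q.0≤[] _ ; mass-1 = Q.∑-δ₁ (fins a) 0ᵃ }
  renormalise-law y (no T≰0) 0≤y = record
    { nonNeg = λ t → Q.*-nonNeg (0≤y t) (ℚ.<⇒≤ (ℚ.positive⁻¹ i {{ℚ.1/pos⇒pos (Q.∑ ts y) {{T>0}}}}))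
    ; mass-1 = trans (sym (Q.∑-*ʳ ts i y)) (ℚ.*-inverseʳ (Q.∑ ts y) {{nz}})
    }
    where
    T>0 = ℚ.positive (ℚ.≰⇒> T≰0)
    nz  = ℚ.pos⇒nonZero (Q.∑ ts y) {{T>0}}
    i   = (ℚ.1/ Q.∑ ts y) {{nz}}

  -- With T the total and q = y/T, q - y = q (1 - T), and a mass q is at most 1.
  renormalise-close : ∀ y T≤? → (∀ t → 0ℚ ℚ.≤ y t) → ¬ Q.∑ ts y ℚ.≤ 0ℚ → ∀ t →
                      ℚ.∣ renormalise y T≤? t ℚ.- y t ∣ ℚ.≤ ℚ.∣ Q.∑ ts y ℚ.- 1ℚ ∣
  renormalise-close y (yes T≤0) 0≤y T≰0 t = contradiction T≤0 T≰0
  renormalise-close y T≤?@(no T≰0′) 0≤y T≰0 t = begin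
    ℚ.∣ q ℚ.- y t ∣
      ≡⟨ cong ℚ.∣_∣ (trans (cong (λ z → q ℚ.- z) (sym (trans (ℚ.*-assoc (y t) i T) (trans (cong (y t ℚ.*_) (ℚ.*-inverseˡ T {{nz}})) (ℚ.*-identityʳ (y t))))))
           (QS.solve 2 (λ q T → q QS.:- q QS.:* T QS.:= q QS.:* (QS.con 1ℚ QS.:- T)) refl q T)) ⟩
    ℚ.∣ q ℚ.* (1ℚ ℚ.- T) ∣
      ≡⟨ ℚ.∣p*q∣≡∣p∣*∣q∣ q (1ℚ ℚ.- T) ⟩
    ℚ.∣ q ∣ ℚ.* ℚ.∣ 1ℚ ℚ.- T ∣
      ≤⟨ Q.*-monoʳ (ℚ.0≤∣p∣ (1ℚ ℚ.- T)) (subst (ℚ._≤ 1ℚ) (sym (ℚ.0≤p⇒∣p∣≡p (nonNeg t)))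
           (subst (q ℚ.≤_) mass-1 (Q.term≤∑ {f = renormalise y T≤?} nonNeg (∈.∈-allFin t)))) ⟩
    1ℚ ℚ.* ℚ.∣ 1ℚ ℚ.- T ∣
      ≡⟨ trans (ℚ.*-identityˡ ℚ.∣ 1ℚ ℚ.- T ∣) (∣-∣-flip 1ℚ T) ⟩
    ℚ.∣ T ℚ.- 1ℚ ∣ ∎
    where
    open ℚ.≤-Reasoning
    T  = Q.∑ ts y
    nz = ℚ.pos⇒nonZero T {{ℚ.positive (ℚ.≰⇒> T≰0′)}}
    i  = (ℚ.1/ T) {{nz}}
    q  = y t ℚ.* i
    open IsLaw (renormalise-law y T≤? 0≤y)

  module _ (p : Fin a → ℝ) (0≤p : ∀ t → 0ᴿ ≤ᴿ p t) (∑p≋1 : ∑ᴿ ts p ≋ 1ᴿ) where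

    private
      y : ℕ → Fin a → ℚ
      y k t = 0ℚ ℚ.⊔ seq (p t) k

      0≤y : ∀ k t → 0ℚ ℚ.≤ y k t
      0≤y k t = ℚ.p≤p⊔q 0ℚ (seq (p t) k)

      y-close : ∀ t ε → 0ℚ ℚ.< ε → Eventually (λ k → ℚ.∣ y k t ℚ.- seq (p t) k ∣ ℚ.≤ ε)
      y-close t ε ε>0 = eventually-map (λ {k} → bound (seq (p t) k)) (0≤p t ε ε>0)
        where
        bound : ∀ x → 0ℚ ℚ.≤ x ℚ.+ ε → ℚ.∣ (0ℚ ℚ.⊔ x) ℚ.- x ∣ ℚ.≤ ε
        bound x 0≤x+ε with ℚ.≤-total 0ℚ x
        ... | inj₁ 0≤x = subst (ℚ._≤ ε) (sym (cong ℚ.∣_∣ (trans (cong (ℚ._- x) (ℚ.p≤q⇒p⊔q≡q 0≤x)) (ℚ.+-inverseʳ x)))) (ℚ.<⇒≤ ε>0)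
        ... | inj₂ x≤0 = subst (λ z → ℚ.∣ z ℚ.- x ∣ ℚ.≤ ε) (sym (ℚ.p≥q⇒p⊔q≡p x≤0)) (∣p∣≤
                (subst₂ ℚ._≤_ (QS.solve 1 (λ x → (QS.con 0ℚ) QS.:- x QS.:= QS.con 0ℚ QS.:+ QS.:- x) refl x)
                  (QS.solve 2 (λ x e → (x QS.:+ e) QS.:+ QS.:- x QS.:= e) refl x ε) (ℚ.+-monoˡ-≤ (ℚ.- x) 0≤x+ε))
                (ℚ.≤-trans (ℚ.≤-reflexive (QS.solve 1 (λ x → QS.:- (QS.con 0ℚ QS.:- x) QS.:= x) refl x)) (ℚ.≤-trans x≤0 (ℚ.<⇒≤ ε>0))))

      yᴿ : Fin a → ℝ
      yᴿ t = realise (λ k → y k t) (p t) (y-close t)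

      T : ℕ → ℚ
      T k = Q.∑ ts (y k)

      T-close : ∀ ε → 0ℚ ℚ.< ε → Eventually (λ k → ℚ.∣ T k ℚ.- 1ℚ ∣ ℚ.≤ ε)
      T-close ε ε>0 = eventually-map (λ {k} → subst (λ z → ℚ.∣ z ℚ.- 1ℚ ∣ ℚ.≤ ε) (seq-∑ ts yᴿ k))
        (close ∑y≋1 ε ε>0)
        where
        ∑y≋1 : ∑ᴿ ts yᴿ ≋ 1ᴿ
        ∑y≋1 = ≋-trans (∑ᴿ.∑-cong {f = yᴿ} {g = p} ts (λ t → realise≋ (λ k → y k t) (p t) (y-close t))) ∑p≋1

      T≰0 : ∀ T → ℚ.∣ T ℚ.- 1ℚ ∣ ℚ.≤ ½ → ¬ T ℚ.≤ 0ℚ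
      T≰0 T h T≤0 = 1≰½ (begin
        1ℚ                    ≤⟨ Q.x≤x+y (Q.0≤y-x T≤0) ⟩
        1ℚ ℚ.+ (0ℚ ℚ.- T)     ≡⟨ QS.solve 1 (λ T → QS.con 1ℚ QS.:+ (QS.con 0ℚ QS.:- T) QS.:= QS.con 1ℚ QS.:- T) refl T ⟩
        1ℚ ℚ.- T              ≤⟨ p≤∣p∣ (1ℚ ℚ.- T) ⟩
        ℚ.∣ 1ℚ ℚ.- T ∣        ≡⟨ ∣-∣-flip 1ℚ T ⟩
        ℚ.∣ T ℚ.- 1ℚ ∣        ≤⟨ h ⟩
        ½                     ∎)
        where
        open ℚ.≤-Reasoning
        1≰½ : ¬ 1ℚ ℚ.≤ ½
        1≰½ (ℚ.*≤* (ℤ.+≤+ (ℕ.s≤s ())))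

      q : ℕ → Fin a → ℚ
      q k = renormalise (y k) (T k ℚ.≤? 0ℚ)

      q-close : ∀ t ε → 0ℚ ℚ.< ε → Eventually (λ k → ℚ.∣ q k t ℚ.- seq (p t) k ∣ ℚ.≤ ε)
      q-close t ε ε>0 = eventually-zip (λ {k} (small , T≤) y≤ → ℚ.≤-trans (triangle (q k t) (y k t) (seq (p t) k))
          (+-mono-half ε (ℚ.≤-trans (renormalise-close (y k) (T k ℚ.≤? 0ℚ) (0≤y k) (T≰0 (T k) small) t) T≤) y≤))
        (eventually-zip _,_ (T-close ½ (ℚ.positive⁻¹ ½)) (T-close (half ε) (half>0 ε>0)))
        (y-close t (half ε) (half>0 ε>0))

    -- The same real number as `p t` with another representative. Real sums and products act
    -- termwise on `seq`, so with these representatives every index of a real expression in the laws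
    -- is that expression for an exact rational law.
    approximateLaw : Fin a → ℝ
    approximateLaw t = realise (λ k → q k t) (p t) (q-close t)

    approximateLaw≋ : ∀ t → approximateLaw t ≋ p t
    approximateLaw≋ t = realise≋ (λ k → q k t) (p t) (q-close t)

    approximateLaw-law : ∀ k → IsLaw (λ t → seq (approximateLaw t) k)
    approximateLaw-law k = renormalise-law (y k) (T k ℚ.≤? 0ℚ) (0≤y k)

    -- Of the two copies of 1/(E + 1) below ε, one absorbs the approximation error and the other is
    -- the balance that remains. A common index exists because r divides a and u matters only modulo
    -- a, leaving finitely many cases.
    approximateLaw-balanced : ∀ ε E → Eventually (λ k → 1/suc E ℚ.+ 1/suc E ℚ.≤ seq ε k) →
      (∀ {r} → Prime r → r ∣ a → ∀ u → ∑ᴿ ts (λ t → fromℚ Q.[ does (r ∣? (toℕ t ℕ.+ u)) ] *ᴿ p t) ≤ᴿ 1ᴿ -ᴿ ε) →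
      Eventually (λ k → Balanced E (λ t → seq (approximateLaw t) k))
    approximateLaw-balanced ε E E≤ε bounded = eventually-map assemble
      (eventually-enum (fins (suc a)) λ r → eventually-enum (fins a) λ u → eventual r u)
      where
      mass-of : ℕ → ℕ → ℕ → ℚ
      mass-of r u k = Q.∑ ts (λ t → Q.[ does (r ∣? (toℕ t ℕ.+ u)) ] ℚ.* seq (approximateLaw t) k)
      Bound : ℕ → ℕ → ℕ → Set
      Bound r u k = Prime r → r ∣ a → mass-of r u k ℚ.+ 1/suc E ℚ.≤ 1ℚ
      eventual′ : ∀ {r} → Prime r → r ∣ a → ∀ u → Eventually (λ k → mass-of r u k ℚ.+ 1/suc E ℚ.≤ 1ℚ)
      eventual′ {r} r-prime r∣a u = eventually-zip (λ {k} E≤ h → begin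
          mass-of r u k ℚ.+ 1/suc E
            ≡⟨ cong (ℚ._+ 1/suc E) (seq-∑ ts (λ t → fromℚ Q.[ does (r ∣? (toℕ t ℕ.+ u)) ] *ᴿ approximateLaw t) k) ⟨
          seq S k ℚ.+ 1/suc E
            ≤⟨ ℚ.+-monoˡ-≤ (1/suc E) h ⟩
          ((1ℚ ℚ.- seq ε k) ℚ.+ 1/suc E) ℚ.+ 1/suc E
            ≤⟨ Q.0≤y-x⇒x≤y (subst (0ℚ ℚ.≤_) (QS.solve 2 (λ e r → e QS.:- (r QS.:+ r) QS.:= QS.con 1ℚ QS.:- (((QS.con 1ℚ QS.:- e) QS.:+ r) QS.:+ r)) refl (seq ε k) (1/suc E)) (Q.0≤y-x E≤)) ⟩
          1ℚ ∎) E≤ε (S≤ (1/suc E) (1/suc>0 E))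
        where
        open ℚ.≤-Reasoning
        S = ∑ᴿ ts (λ t → fromℚ Q.[ does (r ∣? (toℕ t ℕ.+ u)) ] *ᴿ approximateLaw t)
        S′ = ∑ᴿ ts (λ t → fromℚ Q.[ does (r ∣? (toℕ t ℕ.+ u)) ] *ᴿ p t)
        S≤ : S ≤ᴿ 1ᴿ -ᴿ ε
        S≤ = ≤ᴿ-trans {S} {S′} {1ᴿ -ᴿ ε} (≋⇒≤ᴿ {S} {S′} (∑ᴿ.∑-cong ts λ t → *ᴿ-cong (≋-refl {fromℚ Q.[ does (r ∣? (toℕ t ℕ.+ u)) ]}) (approximateLaw≋ t)))
               (bounded r-prime r∣a u)
      eventual : ∀ (r : Fin (suc a)) (u : Fin a) → Eventually (Bound (toℕ r) (toℕ u))
      eventual r u with prime? (toℕ r) | toℕ r ∣? a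
      ... | yes r-prime | yes r∣a = eventually-map (λ h _ _ → h) (eventual′ r-prime r∣a (toℕ u))
      ... | no ¬prime   | _       = always λ _ r-prime _ → contradiction r-prime ¬prime
      ... | yes _       | no r∤a  = always λ _ _ r∣a → contradiction r∣a r∤a
      assemble : ∀ {k} → (∀ (r : Fin (suc a)) (u : Fin a) → Bound (toℕ r) (toℕ u) k) → Balanced E (λ t → seq (approximateLaw t) k)
      assemble {k} h {r} r-prime r∣a u = subst (λ z → z ℚ.+ 1/suc E ℚ.≤ 1ℚ) (Q.∑-cong ts (λ t → cong (λ b → Q.[ b ] ℚ.* seq (approximateLaw t) k) (same t)))
        (subst₂ (λ r u → Bound r u k) (Fin.toℕ-fromℕ< r<) (Fin.toℕ-fromℕ< (ℕ/.m%n<n u a)) (h (Fin.fromℕ< r<) (Fin.fromℕ< (ℕ/.m%n<n u a))) r-prime r∣a)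
        where
        r< : r ℕ.< suc a
        r< = ℕ.s≤s (ℕ∣.∣⇒≤ r∣a)
        u≡ = ℕ/.m≡m%n+[m/n]*n u a
        r∣qa : r ∣ (u ℕ/./ a) ℕ.* a
        r∣qa = ℕ∣.∣n⇒∣m*n (u ℕ/./ a) r∣a
        regroup : ∀ t → toℕ t ℕ.+ u ≡ (u ℕ/./ a) ℕ.* a ℕ.+ (toℕ t ℕ.+ u ℕ/.% a)
        regroup t = trans (cong (toℕ t ℕ.+_) u≡) (trans (sym (ℕ.+-assoc (toℕ t) (u ℕ/.% a) _)) (ℕ.+-comm (toℕ t ℕ.+ u ℕ/.% a) _))
        same : ∀ t → does (r ∣? (toℕ t ℕ.+ u ℕ/.% a)) ≡ does (r ∣? (toℕ t ℕ.+ u))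
        same t = does-⇔ (mk⇔ (λ d → subst (r ∣_) (sym (regroup t)) (ℕ∣.∣m∣n⇒∣m+n r∣qa d)) (λ d → ℕ∣.∣m+n∣m⇒∣n (subst (r ∣_) (regroup t) d) r∣qa))
                   (r ∣? (toℕ t ℕ.+ u ℕ/.% a)) (r ∣? (toℕ t ℕ.+ u))

-- Prime numbers generate maximal ideals of the integers.

module PrimeIdeal {p : ℕ} (p-prime : Prime p) where
  open Ideal

  ideal : Ideal ℤ.+-*-commutativeRing
  ideal = record
    { Mem      = λ x → (+ p) ℤ∣.∣ x
    ; resp     = λ { refl x∈ → x∈ }
    ; 0∈       = ℤ∣.divides ℤ.0ℤ refl
    ; +-closed = ℤ∣.∣m∣n⇒∣m+n
    ; *-closed = λ r → ℤ∣.∣n⇒∣m*n r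
    }

  member? : Decidable (Mem ideal)
  member? x = (+ p) ℤ∣.∣? x

  -- An ideal containing p and some x outside the multiples of p contains 1, by Bézout for p and
  -- |x|.
  maximal : IsMaximal ideal
  maximal = (λ p∣1 → ¬prime[1] (subst Prime (ℕ∣.∣1⇒≡1 (ℤ∣.∣⇒∣ᵤ p∣1)) p-prime)) , contains
    where
    contains : ∀ J → Proper J → (∀ {x} → Mem ideal x → Mem J x) → ∀ {x} → Mem J x → Mem ideal x
    contains J proper ⊆J {x} x∈J with member? x
    ... | yes p∣x = p∣x
    ... | no  p∤x = contradiction 1∈J proper
      where
      coprime : gcd p ℤ.∣ x ∣ ≡ 1
      coprime with prime⇒irreducible p-prime (GCD.gcd[m,n]∣m p ℤ.∣ x ∣)
      ... | inj₁ ≡1 = ≡1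
      ... | inj₂ ≡p = contradiction (ℤ∣.∣ᵤ⇒∣ (subst (_∣ ℤ.∣ x ∣) ≡p (GCD.gcd[m,n]∣n p ℤ.∣ x ∣))) p∤x
      ∣x∣∈J : Mem J (+ ℤ.∣ x ∣)
      ∣x∣∈J with ℤ.+∣i∣≡i⊎+∣i∣≡-i x
      ... | inj₁ eq = subst (Mem J) (sym eq) x∈J
      ... | inj₂ eq = subst (Mem J) (trans (ℤ.-1*i≡-i x) (sym eq)) (*-closed J ℤ.-1ℤ x∈J)
      p∈J : Mem J (+ p)
      p∈J = ⊆J (ℤ∣.∣-refl)
      combine : ∀ {i j u w} → 1 ℕ.+ j ℕ.* w ≡ i ℕ.* u → Mem J (+ u) → Mem J (+ w) → Mem J ℤ.1ℤ
      combine {i} {j} {u} {w} eq u∈ w∈ = subst (Mem J) one (+-closed J (*-closed J (+ i) u∈) (*-closed J (ℤ.- + j) w∈))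
        where
        one : + i ℤ.* + u ℤ.+ (ℤ.- + j) ℤ.* + w ≡ ℤ.1ℤ
        one = trans (cong₂ ℤ._+_ (sym (ℤ.pos-* i u)) (trans (sym (ℤ.neg-distribˡ-* (+ j) (+ w))) (cong ℤ.-_ (sym (ℤ.pos-* j w)))))
          (trans (cong (λ z → + z ℤ.- + (j ℕ.* w)) (sym eq)) (trans (cong (ℤ._- + (j ℕ.* w)) (ℤ.pos-+ 1 (j ℕ.* w)))
            (trans (ℤ.+-assoc ℤ.1ℤ (+ (j ℕ.* w)) (ℤ.- + (j ℕ.* w))) (cong (ℤ._+_ ℤ.1ℤ) (ℤ.+-inverseʳ (+ (j ℕ.* w)))))))
      1∈J : Mem J ℤ.1ℤ
      1∈J with subst (λ d → GCD.Bézout.Identity d p ℤ.∣ x ∣) coprime (GCD.Bézout.identity (GCD.gcd-GCD p ℤ.∣ x ∣))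
      ... | GCD.Bézout.+- i j eq = combine {i} {j} eq p∈J ∣x∣∈J
      ... | GCD.Bézout.-+ i j eq = combine {j} {i} eq ∣x∣∈J p∈J

-- The real exponential at rational points.

module RealExponential where
  open Exponential ℚ-orderedRing

  1/!≡ : ∀ k → ((+ 1) ℚ./ (k !)) {{ℕ._!≢0 k}} ≡ 1/! k
  1/!≡ k = begin
    i                                  ≡⟨ trans (cong (ℚ._* i) (trans (ℚ.*-comm (1/! k) (Q.fromℕ# (k !))) (inverse k))) (ℚ.*-identityˡ i) ⟨
    (1/! k ℚ.* Q.fromℕ# (k !)) ℚ.* i   ≡⟨ ℚ.*-assoc (1/! k) (Q.fromℕ# (k !)) i ⟩
    1/! k ℚ.* (Q.fromℕ# (k !) ℚ.* i)   ≡⟨ cong (1/! k ℚ.*_) (ExpSummable.fromℕℚ-inv (k !) {{ℕ._!≢0 k}}) ⟩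
    1/! k ℚ.* 1ℚ                       ≡⟨ ℚ.*-identityʳ (1/! k) ⟩
    1/! k                              ∎
    where
    open ≡.≡-Reasoning
    i = ((+ 1) ℚ./ (k !)) {{ℕ._!≢0 k}}
    inverse : ∀ k → Q.fromℕ# (k !) ℚ.* 1/! k ≡ 1ℚ
    inverse zero    = refl
    inverse (suc k) = trans (cong (ℚ._* (1/suc k ℚ.* 1/! k)) (Q.fromℕ#-* (suc k) (k !)))
      (trans (QS.solve 4 (λ a b c d → (a QS.:* b) QS.:* (c QS.:* d) QS.:= (a QS.:* c) QS.:* (b QS.:* d)) refl (Q.fromℕ# (suc k)) (Q.fromℕ# (k !)) (1/suc k) (1/! k))
        (cong₂ ℚ._*_ (Q.suc*recip k) (inverse k)))

  module _ (x : ℝ) (v : ℚ) (x≡v : ∀ i → seq x i ≡ v) where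

    seq-pow : ∀ k i → seq (x ^ᴿ k) i ≡ v Q.^ k
    seq-pow zero    i = refl
    seq-pow (suc k) i = cong₂ ℚ._*_ (x≡v i) (seq-pow k i)

    seq-partialSum : ∀ n i → seq (partialSum (expTerm x) n) i ≡ expSum v n
    seq-partialSum zero    i = refl
    seq-partialSum (suc n) i = cong₂ ℚ._+_ (seq-partialSum n i) (cong₂ ℚ._*_ (seq-pow n i) (1/!≡ n))

    -- At a rational argument all entries of a partial sum coincide, so the index chosen by the
    -- diagonal limit does not matter.
    seq-exp : ∀ n → seq (exp x) n ≡ expSum v n
    seq-exp n = seq-partialSum n (Diagonal.index (partialSum (expTerm x)) n)

  -- The range from n to 2n is the one that remains in `expSum-inverse`.
  tail-small : ∀ v δ → 0ℚ ℚ.< δ → Eventually (λ n → expSum v (n ℕ.+ n) ℚ.- expSum v n ℚ.≤ δ)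
  tail-small v δ δ>0 =
    let (N , h) = ExpSummable.expTerm-summable (fromℚ v) (half δ) (half>0 δ>0)
    in N , λ n N≤n →
      let (i , hi) = h (n ℕ.+ n) n (ℕ.≤-trans N≤n (ℕ.m≤m+n n n)) N≤n (half δ) (half>0 δ>0)
      in ℚ.≤-trans (p≤∣p∣ (expSum v (n ℕ.+ n) ℚ.- expSum v n))
           (subst₂ ℚ._≤_ (cong₂ (λ a b → ℚ.∣ a ℚ.- b ∣) (seq-partialSum (fromℚ v) v (λ _ → refl) (n ℕ.+ n) i) (seq-partialSum (fromℚ v) v (λ _ → refl) n i))
             (half+half δ) (hi i ℕ.≤-refl))

  -- Half of 1/(M + 1): with c this number, `rate M` is 1 - 2c and (1 + 2c)(1 - 2c) ≤ 1, as
  -- `expSum-lower` asks.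
  decayRate : ℕ → ℚ
  decayRate M = 1/suc (M ℕ.+ suc (M ℕ.+ 0))

  exp-lower : ∀ M n η → 0ℚ ℚ.< η →
    Eventually (λ k → Q.rate M Q.^ n ℚ.≤ seq (exp (-ᴿ (fromℚ (decayRate M) *ᴿ fromℕ n))) k ℚ.+ η)
  exp-lower M n η η>0 =
    let (N , tail) = tail-small (y ℚ.+ y) δ δ>0
    in suc N , λ { (suc k) (ℕ.s≤s N≤k) → ℚ.≤-trans
         (expSum-lower {c} {Q.rate M} {δ} n k (Q.0≤recip (M ℕ.+ suc (M ℕ.+ 0))) (Q.recip≤1 (M ℕ.+ suc (M ℕ.+ 0))) (Q.0≤rate M) [1+2c]r≤1 1≰δ (tail (suc k) (ℕ.≤-trans N≤k (ℕ.n≤1+n k))))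
         (ℚ.+-mono-≤ (ℚ.≤-reflexive (sym (seq-exp x (ℚ.- y) (λ _ → cong ℚ.-_ (ℚ.*-comm c (Q.fromℕ# n))) (suc k)))) (ℚ.p⊓q≤q ½ η)) }
    where
    c = decayRate M
    y = Q.fromℕ# n ℚ.* c
    x = -ᴿ (fromℚ c *ᴿ fromℕ n)
    -- The minimum with 1/2 keeps δ below 1, which makes the alternating partial sum nonnegative.
    δ = ½ ℚ.⊓ η
    δ>0 : 0ℚ ℚ.< δ
    δ>0 with ℚ.⊓-sel ½ η
    ... | inj₁ eq = subst (0ℚ ℚ.<_) (sym eq) (ℚ.positive⁻¹ ½)
    ... | inj₂ eq = subst (0ℚ ℚ.<_) (sym eq) η>0
    1≰δ : ¬ 1ℚ ℚ.≤ δ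
    1≰δ h with ℚ.≤-trans h (ℚ.p⊓q≤p ½ η)
    ... | ℚ.*≤* (ℤ.+≤+ (ℕ.s≤s ()))
    c+c : c ℚ.+ c ≡ 1/suc M
    c+c = Q.recip-double M
    [1+2c]r≤1 : (1ℚ ℚ.+ (c ℚ.+ c)) ℚ.* Q.rate M ℚ.≤ 1ℚ
    [1+2c]r≤1 = subst (λ z → (1ℚ ℚ.+ z) ℚ.* Q.rate M ℚ.≤ 1ℚ) (sym c+c)
      (subst (ℚ._≤ 1ℚ) (QS.solve 1 (λ r → QS.con 1ℚ QS.:- r QS.:* r QS.:= (QS.con 1ℚ QS.:+ r) QS.:* (QS.con 1ℚ QS.:- r)) refl (1/suc M))
        (Q.x-y≤x (Q.0≤x² (1/suc M))))

-- From rational moments to the expectation.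

module Moments {g ℓ} (𝒢 : FiniteAbelianGroup g ℓ) (a : ℕ) .{{_ : NonZero a}} (e : ℕ)
               (exponent : IsExponent (group 𝒢) e) (e∣a : e ∣ a) (E : ℕ) where
  open Sandpile 𝒢 a e exponent e∣a using (G; #Sur; #Sur-empty)
  open TorsionGroupProperties a G using (size; generates?; combination; solution?; functions; #solutions; extend; _⊝_; ·-%; ·-0̂; ⊕-inverseʳ; _·_)
  open IntegerAction a G using (combination-cong)
  open Walk ℚ-orderedRing a G using (IsLaw; Balanced)
  open Estimate ℚ-orderedRing a G E using (1/size)
  open Uniformity ℚ-orderedRing a G E using (Laws; IsBalancedSystem; moment)
  open MomentBound ℚ-orderedRing a G E using (boundConst; decayConst; moment-decay)
  open Expansion ℚ-orderedRing a G E using (moment-expand; entry)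
  open LawApproximation a G
  open RealExponential

  -- The successor keeps K at least 1, which gives 0 < K and settles n = 0.
  K₀ : ℕ
  K₀ = suc (2 ℕ.* boundConst)

  K c : ℝ
  K = fromℚ (Q.fromℕ# K₀)
  c = fromℚ (decayRate decayConst)

  0<K : 0ᴿ <ᴿ K
  0<K = 1ℚ , ℚ.positive⁻¹ 1ℚ , always λ _ → subst (ℚ._≤ Q.fromℕ# K₀) (sym (ℚ.+-identityˡ 1ℚ)) (Q.1≤suc (2 ℕ.* boundConst))

  0<c : 0ᴿ <ᴿ c
  0<c = decayRate decayConst , 1/suc>0 (decayConst ℕ.+ suc (decayConst ℕ.+ 0)) , always λ _ → ℚ.≤-reflexive (ℚ.+-identityˡ (decayRate decayConst))

  1/∣G∣≡ : ((+ 1) ℚ./ order 𝒢) {{order≢0 𝒢}} ≡ 1/size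
  1/∣G∣≡ = lemma (order 𝒢) {{order≢0 𝒢}}
    where
    lemma : ∀ n .{{_ : NonZero n}} → (+ 1) ℚ./ n ≡ 1/suc (ℕ.pred n)
    lemma (suc n) = refl

  exponential-bound : ∀ n X → Eventually (λ k → ℚ.∣ seq X k ℚ.- 1/size ∣ ℚ.≤ Q.fromℕ# K₀ ℚ.* Q.rate decayConst Q.^ n) →
                      ∣ X -ᴿ 1/∣ 𝒢 ∣ ∣ᴿ ≤ᴿ K *ᴿ exp (-ᴿ (c *ᴿ fromℕ n))
  exponential-bound n X close ε ε>0 =
    let (η , η>0 , Kη) = scaled ε>0 K′ (ℚ.positive (ℚ.<-≤-trans (ℚ.positive⁻¹ 1ℚ) (Q.1≤suc (2 ℕ.* boundConst))))
    in eventually-zip (λ {k} p r → begin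
         ℚ.∣ seq X k ℚ.- ((+ 1) ℚ./ order 𝒢) {{order≢0 𝒢}} ∣
           ≡⟨ cong (λ z → ℚ.∣ seq X k ℚ.- z ∣) 1/∣G∣≡ ⟩
         ℚ.∣ seq X k ℚ.- 1/size ∣
           ≤⟨ p ⟩
         K′ ℚ.* Q.rate decayConst Q.^ n
           ≤⟨ Q.*-monoˡ (Q.0≤fromℕ K₀) r ⟩
         K′ ℚ.* (seq ex k ℚ.+ η)
           ≡⟨ trans (ℚ.*-distribˡ-+ K′ (seq ex k) η) (cong (K′ ℚ.* seq ex k ℚ.+_) Kη) ⟩
         K′ ℚ.* seq ex k ℚ.+ ε ∎) close (exp-lower decayConst n η η>0)
    where
    open ℚ.≤-Reasoning
    K′ = Q.fromℕ# K₀
    ex = exp (-ᴿ (c *ᴿ fromℕ n))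

  -- For n = 0 the number of surjections is a constant 0 or 1, so it differs from 1/|G| by at most 1
  -- ≤ K.
  empty-moment : ∀ (P : ProbabilitySpace) (Γ : RandomDigraph 0) →
    ∃[ #S ] (∀ ω → HasCardinality (Sur (sandpileGroup (Γ ω)) (group 𝒢)) (#S ω)) ×
      ∃[ X ] HasExpectation P #S X × ∣ X -ᴿ 1/∣ 𝒢 ∣ ∣ᴿ ≤ᴿ K *ᴿ exp (-ᴿ (c *ᴿ fromℕ 0))
  empty-moment P Γ = (λ _ → N) , (λ ω → #Sur-empty (Γ ω)) , fromℕ N
    , ⇒ConvergesTo (series-cong (λ ω → R.*-comm (fromℕ N) (mass P ω)) (R.*-identityʳ (fromℕ N))
        (series-scale (Q.fromℕ# N) (ConvergesTo⇒ {partialSum (mass P)} {1ᴿ} (ProbabilitySpace.total P))))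
    , exponential-bound 0 (fromℕ N) (always λ _ → ℚ.≤-trans (∣p∣≤
        (ℚ.≤-trans (Q.x-y≤x (Q.0≤recip (ℕ.pred size))) N≤1)
        (subst (ℚ._≤ 1ℚ) (QS.solve 2 (λ s n → s QS.:- n QS.:= QS.:- (n QS.:- s)) refl 1/size (Q.fromℕ# N))
          (ℚ.≤-trans (Q.x-y≤x (Q.0≤fromℕ N)) (Q.recip≤1 (ℕ.pred size)))))
        (subst (1ℚ ℚ.≤_) (sym (ℚ.*-identityʳ (Q.fromℕ# K₀))) (Q.1≤suc (2 ℕ.* boundConst))))
    where
    N = length (filter (λ f → generates? (lookup f)) (functions 0))
    N≤1 : Q.fromℕ# N ℚ.≤ 1ℚ
    N≤1 = Q.fromℕ-mono {N} {1} (List.length-filter (λ f → generates? (lookup f)) (functions 0))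

  module _ {n} (P : ProbabilitySpace) (ε : ℝ) (E≤ε : Eventually (λ k → 1/suc E ℚ.+ 1/suc E ℚ.≤ seq ε k))
           (Γ : RandomDigraph (suc n)) (balancedΓ : IsBalancedDigraph P ε Γ) where
    open Probability P
    open Residues a P Γ renaming (residues to residueMatrix)

    private
      ts = allFin a

    0≤law : ∀ j i t → 0ᴿ ≤ᴿ law j i t
    0≤law j i t = by-cases (does (j Fin.≟ i)) (fromℚ Q.[ does (t Fin.≟ 0ᵃ) ]) (pmf (fins a) (λ ω → residue (degree Γ (j , i) ω)) t)
      (pointwise⇒≤ᴿ {0ᴿ} {fromℚ Q.[ does (t Fin.≟ 0ᵃ) ]} (λ _ → Q.0≤[] (does (t Fin.≟ 0ᵃ))))
      (0≤ℙ (λ ω → does (t Fin.≟ residue (degree Γ (j , i) ω))))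
      where
      by-cases : ∀ b x y → 0ᴿ ≤ᴿ x → 0ᴿ ≤ᴿ y → 0ᴿ ≤ᴿ (if b then x else y)
      by-cases true  x y p _ = p
      by-cases false x y _ q = q

    ∑law : ∀ j i → ∑ᴿ ts (law j i) ≋ 1ᴿ
    ∑law j i = by-cases (does (j Fin.≟ i)) (λ t → fromℚ Q.[ does (t Fin.≟ 0ᵃ) ]) (pmf (fins a) (λ ω → residue (degree Γ (j , i) ω)))
      (≋-trans (∑ᴿ.∑-cong ts (λ t → fromℚ-[] (does (t Fin.≟ 0ᵃ)))) (∑ᴿ.∑-δ₁ (fins a) 0ᵃ))
      (∑pmf (fins a) (λ ω → residue (degree Γ (j , i) ω)))
      where
      by-cases : ∀ b (x y : Fin a → ℝ) → ∑ᴿ ts x ≋ 1ᴿ → ∑ᴿ ts y ≋ 1ᴿ → ∑ᴿ ts (λ t → if b then x t else y t) ≋ 1ᴿ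
      by-cases true  x y p _ = p
      by-cases false x y _ q = q

    -- The balance hypothesis for the ideal generated by r and the representative -u. Because r
    -- divides a, divisibility of degree + u by r can be read off the residue modulo a.
    law-balanced : ∀ j i → j ≢ i → ∀ {r} → Prime r → r ∣ a → ∀ u →
      ∑ᴿ ts (λ t → fromℚ Q.[ does (r ∣? (toℕ t ℕ.+ u)) ] *ᴿ law j i t) ≤ᴿ 1ᴿ -ᴿ ε
    law-balanced j i j≢i {r} r-prime r∣a u =
      ≤ᴿ-trans {S} {ℙ P hit} {1ᴿ -ᴿ ε} (≋⇒≤ᴿ {S} {ℙ P hit} S≋) (proj₂ balancedΓ j i j≢i ideal member? maximal (ℤ.- + u))
      where
      open PrimeIdeal r-prime
      res : Ω → Fin a
      res ω = residue (degree Γ (j , i) ω)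
      hit : Ω → Bool
      hit ω = does (member? (degree Γ (j , i) ω ℤ.- (ℤ.- + u)))
      divisible : Fin a → Bool
      divisible t = does (r ∣? (toℕ t ℕ.+ u))
      S S′ : ℝ
      S  = ∑ᴿ ts (λ t → fromℚ Q.[ divisible t ] *ᴿ law j i t)
      S′ = ∑ᴿ ts (λ t → fromℚ Q.[ divisible t ] *ᴿ pmf (fins a) res t)
      same : ∀ ω → divisible (res ω) ≡ hit ω
      same ω = does-⇔ (mk⇔ forth back) (r ∣? (toℕ (res ω) ℕ.+ u)) (member? (degree Γ (j , i) ω ℤ.- (ℤ.- + u)))
        where
        d = deg (Γ ω) j i
        res≡ : toℕ (res ω) ≡ d ℕ/.% a
        res≡ = Fin.toℕ-fromℕ< _
        shift : + d ℤ.- (ℤ.- + u) ≡ + (d ℕ.+ u)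
        shift = cong (ℤ._+_ (+ d)) (ℤ.neg-involutive (+ u))
        d≡ : d ℕ.+ u ≡ (d ℕ/./ a) ℕ.* a ℕ.+ (toℕ (res ω) ℕ.+ u)
        d≡ = trans (cong (ℕ._+ u) (trans (ℕ/.m≡m%n+[m/n]*n d a) (ℕ.+-comm (d ℕ/.% a) _)))
          (trans (ℕ.+-assoc ((d ℕ/./ a) ℕ.* a) (d ℕ/.% a) u) (cong (λ t → (d ℕ/./ a) ℕ.* a ℕ.+ (t ℕ.+ u)) (sym res≡)))
        r∣qa : r ∣ (d ℕ/./ a) ℕ.* a
        r∣qa = ℕ∣.∣n⇒∣m*n (d ℕ/./ a) r∣a
        forth : r ∣ toℕ (res ω) ℕ.+ u → (+ r) ℤ∣.∣ (+ d ℤ.- (ℤ.- + u))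
        forth h = subst ((+ r) ℤ∣.∣_) (sym shift) (ℤ∣.∣ᵤ⇒∣ (subst (r ∣_) (sym d≡) (ℕ∣.∣m∣n⇒∣m+n r∣qa h)))
        back : (+ r) ℤ∣.∣ (+ d ℤ.- (ℤ.- + u)) → r ∣ toℕ (res ω) ℕ.+ u
        back h = ℕ∣.∣m+n∣m⇒∣n (subst (r ∣_) d≡ (ℤ∣.∣⇒∣ᵤ (subst ((+ r) ℤ∣.∣_) shift h))) r∣qa
      law-off : ∀ t → law j i t ≡ pmf (fins a) res t
      law-off t = if-no (j Fin.≟ i) j≢i
      ≋-reflexive : ∀ {x y} → x ≡ y → x ≋ y
      ≋-reflexive refl = ≋-refl
      S≋ : S ≋ ℙ P hit
      S≋ = ≋-trans {S} {S′} {ℙ P hit}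
        (∑ᴿ.∑-cong ts (λ t → *ᴿ-cong (≋-refl {fromℚ Q.[ divisible t ]}) (≋-reflexive (law-off t))))
        (≋-trans {S′} {ℙ P (divisible ∘ res)} {ℙ P hit} (≋-sym (ℙ-∘ (fins a) res divisible)) (ℙ-cong same))

    approximate : Fin (suc n) → Fin (suc n) → Fin a → ℝ
    approximate j i = approximateLaw (law j i) (0≤law j i) (∑law j i)

    lawsAt : ℕ → Laws (suc n)
    lawsAt k j i t = seq (approximate j i t) k

    system : Eventually (λ k → IsBalancedSystem (lawsAt k))
    system = eventually-map (λ {k} h → record
        { law      = λ j i → approximateLaw-law (law j i) (0≤law j i) (∑law j i) k
        ; balanced = λ j i → h j i
        })
      (eventually-enum (fins (suc n)) λ j → eventually-enum (fins (suc n)) λ i → off-diagonal j i)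
      where
      off-diagonal : ∀ j i → Eventually (λ k → j ≢ i → Balanced E (lawsAt k j i))
      off-diagonal j i = by-cases (j Fin.≟ i)
        where
        by-cases : Dec (j ≡ i) → Eventually (λ k → j ≢ i → Balanced E (lawsAt k j i))
        by-cases (yes j≡i) = always λ _ j≢i → contradiction j≡i j≢i
        by-cases (no  j≢i) = eventually-map (λ h _ → h)
          (approximateLaw-balanced (law j i) (0≤law j i) (∑law j i) ε E E≤ε (law-balanced j i j≢i))

    Ds : List (Vec (Vec (Fin a) (suc n)) (suc n))
    Ds = elements degrees

    #solutionsOf : Vec (Vec (Fin a) (suc n)) (suc n) → ℕ
    #solutionsOf D = #solutions (λ j i → toℕ (entry D j i))

    weightᴿ : (Fin (suc n) → Fin (suc n) → Fin a → ℝ) → Vec (Vec (Fin a) (suc n)) (suc n) → ℝ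
    weightᴿ p D = ∏ᴿ (λ j → ∏ᴿ (λ i → p j i (entry D j i)))

    #S : Ω → ℕ
    #S ω = #solutionsOf (residueMatrix ω)

    expected : ℝ
    expected = ∑ᴿ Ds (λ D → fromℚ (Q.fromℕ# (#solutionsOf D)) *ᴿ weightᴿ approximate D)

    -- This is where the exact rational laws pay off: each entry of the real expectation is itself a
    -- moment of rational laws, to which `moment-decay` applies.
    expected≡moment : ∀ k → seq expected k ≡ moment (lawsAt k)
    expected≡moment k = trans (seq-∑ Ds _ k) (trans
      (Q.∑-cong Ds λ D → cong (Q.fromℕ# (#solutionsOf D) ℚ.*_) (trans (seq-∏ (λ j → ∏ᴿ (λ i → approximate j i (entry D j i))) k) (Q.∏-cong λ j → seq-∏ (λ i → approximate j i (entry D j i)) k)))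
      (sym (moment-expand (lawsAt k))))

    expected-close : Eventually (λ k → ℚ.∣ seq expected k ℚ.- 1/size ∣ ℚ.≤ Q.fromℕ# K₀ ℚ.* Q.rate decayConst Q.^ suc n)
    expected-close = eventually-map (λ {k} sys → subst (λ m → ℚ.∣ m ℚ.- 1/size ∣ ℚ.≤ d) (sym (expected≡moment k))
        (within (moment (lawsAt k)) 1/size d (moment-decay sys))) system
      where
      d = Q.fromℕ# K₀ ℚ.* Q.rate decayConst Q.^ suc n
      within : ∀ x y d → x ℚ.≤ y ℚ.+ d × y ℚ.≤ x ℚ.+ d → ℚ.∣ x ℚ.- y ∣ ℚ.≤ d
      within x y d (p , q) = ∣p∣≤
        (subst (x ℚ.- y ℚ.≤_) (QS.solve 2 (λ y d → (y QS.:+ d) QS.:- y QS.:= d) refl y d) (ℚ.+-monoˡ-≤ (ℚ.- y) p))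
        (subst₂ ℚ._≤_ (QS.solve 2 (λ x y → y QS.:- x QS.:= QS.:- (x QS.:- y)) refl x y)
          (QS.solve 2 (λ x d → (x QS.:+ d) QS.:- x QS.:= d) refl x d) (ℚ.+-monoˡ-≤ (ℚ.- x) q))

    expected-hasExpectation : HasExpectation P #S expected
    expected-hasExpectation = ⇒ConvergesTo (series-cong
      (λ ω → R.*-comm (fromℕ (#S ω)) (mass P ω))
      (∑ᴿ.∑-cong Ds (λ D → *ᴿ-cong (≋-refl {fromℚ (Q.fromℕ# (#solutionsOf D))}) (≋-trans (pmf-residues (proj₁ balancedΓ) D)
        (∑ᴿ.∏-cong (λ j → ∑ᴿ.∏-cong (λ i → ≋-sym (approximateLaw≋ (law j i) (0≤law j i) (∑law j i) (entry D j i))))))))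
      (expectation degrees residueMatrix (λ D → Q.fromℕ# (#solutionsOf D))))

    -- Degrees may be reduced modulo a because a kills the group, and a loop may be given any
    -- multiplicity because it multiplies f j - f j.
    #S-cardinality : ∀ ω → HasCardinality (Sur (sandpileGroup (Γ ω)) (group 𝒢)) (#S ω)
    #S-cardinality ω = subst (HasCardinality (Sur (sandpileGroup (Γ ω)) (group 𝒢))) same (#Sur (Γ ω))
      where
      kills≡ : ∀ f j i → deg (Γ ω) j i · (f j ⊝ f i) ≡ toℕ (entry (residueMatrix ω) j i) · (f j ⊝ f i)
      kills≡ f j i = trans (by-cases (j Fin.≟ i)) (cong (λ t → toℕ t · (f j ⊝ f i)) (sym (entry-residues ω j i)))
        where
        by-cases : (d : Dec (j ≡ i)) → deg (Γ ω) j i · (f j ⊝ f i) ≡ toℕ (if does d then 0ᵃ else residue (degree Γ (j , i) ω)) · (f j ⊝ f i)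
        by-cases (yes refl) = trans (cong (deg (Γ ω) j j ·_) (⊕-inverseʳ (f j)))
          (trans (·-0̂ (deg (Γ ω) j j)) (sym (trans (cong (toℕ 0ᵃ ·_) (⊕-inverseʳ (f j))) (·-0̂ (toℕ 0ᵃ)))))
        by-cases (no _) = sym (trans (cong (_· (f j ⊝ f i)) (Fin.toℕ-fromℕ< (ℤ.n%ℕd<d (degree Γ (j , i) ω) a))) (·-% (deg (Γ ω) j i) (f j ⊝ f i)))
      M = λ j i → toℕ (entry (residueMatrix ω) j i)
      combination≡ : ∀ f j → combination (deg (Γ ω) j) (λ i → extend f j ⊝ extend f i) ≡ combination (M j) (λ i → extend f j ⊝ extend f i)
      combination≡ f j = combination-cong {d = deg (Γ ω) j} {d′ = M j} {v = λ i → extend f j ⊝ extend f i} (kills≡ (extend f) j)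
      same : #solutions (deg (Γ ω)) ≡ #S ω
      same = cong length (List.filter-≐ (solution? (deg (Γ ω))) (solution? M)
        ( (λ {f} (gen , kill) → gen , λ j → trans (sym (combination≡ f j)) (kill j))
        , (λ {f} (gen , kill) → gen , λ j → trans (combination≡ f j) (kill j)) )
        (functions n))

  moment-theorem : ∀ ε → Eventually (λ k → 1/suc E ℚ.+ 1/suc E ℚ.≤ seq ε k) →
    ∀ n (P : ProbabilitySpace) (Γ : RandomDigraph n) → IsBalancedDigraph P ε Γ →
    ∃[ #S ] (∀ ω → HasCardinality (Sur (sandpileGroup (Γ ω)) (group 𝒢)) (#S ω)) ×
      ∃[ X ] HasExpectation P #S X × ∣ X -ᴿ 1/∣ 𝒢 ∣ ∣ᴿ ≤ᴿ K *ᴿ exp (-ᴿ (c *ᴿ fromℕ n))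
  moment-theorem ε E≤ε zero    P Γ balancedΓ = empty-moment P Γ
  moment-theorem ε E≤ε (suc n) P Γ balancedΓ =
      #S P ε E≤ε Γ balancedΓ , #S-cardinality P ε E≤ε Γ balancedΓ
    , expected P ε E≤ε Γ balancedΓ , expected-hasExpectation P ε E≤ε Γ balancedΓ
    , exponential-bound (suc n) (expected P ε E≤ε Γ balancedΓ) (expected-close P ε E≤ε Γ balancedΓ)

mainTheorem7 : ∀ {g ℓ : Level} (ε : ℝ) → 0ᴿ <ᴿ ε →
    (a : ℕ) .{{_ : NonZero a}} →
    (G : FiniteAbelianGroup g ℓ) →
    (e : ℕ) → IsExponent (group G) e → e ∣ a →
    ∃[ K ] ∃[ c ] 0ᴿ <ᴿ K × 0ᴿ <ᴿ c ×
    (∀ (n : ℕ) (P : ProbabilitySpace) (Γ : RandomDigraph n) →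
    IsBalancedDigraph P ε Γ →
    ∃[ #Sur ]
    (∀ ω → HasCardinality (Sur (sandpileGroup (Γ ω)) (group G)) (#Sur ω)) ×
    ∃[ E ] HasExpectation P #Sur E ×
    ∣ E -ᴿ 1/∣ G ∣ ∣ᴿ ≤ᴿ K *ᴿ exp (-ᴿ (c *ᴿ fromℕ n)))
mainTheorem7 ε (ε₁ , ε₁>0 , N , ε₁≤ε) a G e exponent e∣a = K , c , 0<K , 0<c , moment-theorem ε E≤ε
  where
  -- Half of ε₁, since `approximateLaw-balanced` asks for 1/(E + 1) twice below ε.
  small = 1/suc-archimedean (half>0 ε₁>0)
  E = proj₁ small
  open Moments G a e exponent e∣a E
  E≤ε : Eventually (λ k → 1/suc E ℚ.+ 1/suc E ℚ.≤ seq ε k)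
  E≤ε = N , λ k N≤k → ℚ.≤-trans (+-mono-half ε₁ (proj₂ small E ℕ.≤-refl) (proj₂ small E ℕ.≤-refl))
    (subst (ℚ._≤ seq ε k) (ℚ.+-identityˡ ε₁) (ε₁≤ε k N≤k))
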